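{- Let $n\ge 5$ be an integer and let $g(n)$ denote the maximum girth of an almost self-centered graph of order $n$. Then $$ g(n)=\begin{cases} n-1 & \text{if } n \text{ is odd},\\ 4\lfloor n/6\rfloor & \text{if } n \text{ is even and } n\neq 10,\\ 5 & \text{if } n=10. \end{cases} $$ Furthermore, if $n\ge 12$ and $6$ divides $n$, then $g(n)$ is attained uniquely (up to isomorphism) by the graph obtained from the theta graph $\theta_{n/3,n/3,n/3}$ by attaching a pendant edge (a new vertex adjacent to exactly one existing vertex) at a vertex of degree three.
   Context: All graphs are finite and simple. For a connected graph $G$, the eccentricity $ecc(v)$ of a vertex $v$ is $\max_{u\in V(G)} d(v,u)$; the radius is the minimum eccentricity and the diameter the maximum eccentricity. A central vertex is one with eccentricity equal to the radius; a peripheral vertex is one with eccentricity equal to the diameter. A connected graph of order $n$ is almost self-centered if it has exactly $n-2$ central vertices. The girth of a graph containing a cycle is the length of a shortest cycle. The theta graph $\theta_{a,b,c}$ is the graph consisting of three internally vertex-disjoint paths of lengths $a,b,c$ sharing the same two endpoints. -}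

module Defs where

open import Data.Nat using (ℕ; zero; suc; _+_; _*_; _∸_; _≤_; _≡ᵇ_; _/_)
open import Data.Bool using (Bool; true; false; _∧_; _∨_; not)
open import Data.Bool.Properties using (∨-comm)
open import Data.Fin using (Fin; toℕ)
open import Data.Fin.Subset using (Subset; _∈_; ∣_∣)
open import Data.List using (List; []; _∷_; _++_; map; upTo; concat; zip; any; drop)
open import Data.Product using (Σ; ∃; _×_; _,_; proj₁)
open import Function.Bundles using (_↔_; Inverse)
open import Function.Definitions using (Injective)
open import Relation.Binary.PropositionalEquality using (_≡_; refl; cong; cong₂)
open import Relation.Nullary using (¬_)

record Graph (n : ℕ) : Set where
  field
    adj     : Fin n → Fin n → Bool
    adj-sym : ∀ u v → adj u v ≡ adj v u
    adj-irr : ∀ v → adj v v ≡ false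
open Graph public

Edge : ∀ {n} → Graph n → Fin n → Fin n → Set
Edge G u v = adj G u v ≡ true

data Walk {n} (G : Graph n) : Fin n → Fin n → ℕ → Set where
  nil  : ∀ {u} → Walk G u u 0
  cons : ∀ {u w v k} → Edge G u w → Walk G w v k → Walk G u v (suc k)

Connected : ∀ {n} → Graph n → Set
Connected G = ∀ u v → ∃ λ k → Walk G u v k

Dist : ∀ {n} → Graph n → Fin n → Fin n → ℕ → Set
Dist G u v d = Walk G u v d × (∀ k → Walk G u v k → d ≤ k)

IsEcc : ∀ {n} → Graph n → Fin n → ℕ → Set
IsEcc G v e = (∀ u d → Dist G v u d → d ≤ e) × (∃ λ u → Dist G v u e)

IsRadius : ∀ {n} → Graph n → ℕ → Set
IsRadius G r = (∃ λ v → IsEcc G v r) × (∀ v e → IsEcc G v e → r ≤ e)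

Central : ∀ {n} → Graph n → Fin n → Set
Central G v = ∃ λ r → IsRadius G r × IsEcc G v r

AlmostSelfCentered : ∀ {n} → Graph n → Set
AlmostSelfCentered {n} G =
  Connected G ×
  (Σ (Subset n) λ S → (∀ v → (v ∈ S → Central G v) × (Central G v → v ∈ S))
                     × ∣ S ∣ ≡ n ∸ 2)

HasCycle : ∀ {n} → Graph n → ℕ → Set
HasCycle {n} G k =
  3 ≤ k ×
  (Σ (Fin k → Fin n) λ f →
     Injective _≡_ _≡_ f ×
     (∀ i j → toℕ j ≡ suc (toℕ i) → Edge G (f i) (f j)) ×
     (∀ i j → toℕ i ≡ k ∸ 1 → toℕ j ≡ 0 → Edge G (f i) (f j)))

IsGirth : ∀ {n} → Graph n → ℕ → Set
IsGirth G g = HasCycle G g × (∀ k → HasCycle G k → g ≤ k)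

IsMaxASCGirth : ℕ → ℕ → Set
IsMaxASCGirth n g =
  (Σ (Graph n) λ G → AlmostSelfCentered G × IsGirth G g) ×
  (∀ (G : Graph n) → AlmostSelfCentered G → ∀ h → IsGirth G h → h ≤ g)

Isomorphic : ∀ {n} → Graph n → Graph n → Set
Isomorphic {n} G H =
  Σ (Fin n ↔ Fin n) λ φ →
    ∀ u v → adj G u v ≡ adj H (Inverse.to φ u) (Inverse.to φ v)

≡ᵇ-sym : ∀ a b → (a ≡ᵇ b) ≡ (b ≡ᵇ a)
≡ᵇ-sym zero zero = refl
≡ᵇ-sym zero (suc b) = refl
≡ᵇ-sym (suc a) zero = refl
≡ᵇ-sym (suc a) (suc b) = ≡ᵇ-sym a b

≡ᵇ-refl : ∀ a → (a ≡ᵇ a) ≡ true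
≡ᵇ-refl zero = refl
≡ᵇ-refl (suc a) = ≡ᵇ-refl a

matches : ℕ × ℕ → ℕ → ℕ → Bool
matches (a , b) x y = ((a ≡ᵇ x) ∧ (b ≡ᵇ y)) ∨ ((a ≡ᵇ y) ∧ (b ≡ᵇ x))

anyMatch : List (ℕ × ℕ) → ℕ → ℕ → Bool
anyMatch []       x y = false
anyMatch (e ∷ es) x y = matches e x y ∨ anyMatch es x y

anyMatch-sym : ∀ es x y → anyMatch es x y ≡ anyMatch es y x
anyMatch-sym []       x y = refl
anyMatch-sym ((a , b) ∷ es) x y =
  cong₂ _∨_ (∨-comm ((a ≡ᵇ x) ∧ (b ≡ᵇ y)) ((a ≡ᵇ y) ∧ (b ≡ᵇ x)))
            (anyMatch-sym es x y)

-- the simple graph on Fin n whose edges are the listed pairs of labels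
-- (loops and labels ≥ n are ignored)
fromEdges : (n : ℕ) → List (ℕ × ℕ) → Graph n
fromEdges n es = record
  { adj     = λ u v → not (toℕ u ≡ᵇ toℕ v) ∧ anyMatch es (toℕ u) (toℕ v)
  ; adj-sym = λ u v → cong₂ (λ p q → not p ∧ q)
                        (≡ᵇ-sym (toℕ u) (toℕ v)) (anyMatch-sym es (toℕ u) (toℕ v))
  ; adj-irr = λ v → cong (λ p → not p ∧ anyMatch es (toℕ v) (toℕ v)) (≡ᵇ-refl (toℕ v))
  }

pathEdges : List ℕ → List (ℕ × ℕ)
pathEdges []           = []
pathEdges (x ∷ [])     = []
pathEdges (x ∷ y ∷ xs) = (x , y) ∷ pathEdges (y ∷ xs)

-- θ_{m,m,m} with a pendant edge at a degree-3 vertex, on 3m vertices: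
--   0, 1            : the two branch vertices (degree 3 in the theta graph)
--   2 + j(m-1) + t  : t-th internal vertex (t < m-1) of the j-th path (j < 3)
--   3m - 1          : the pendant vertex, adjacent to 0
thetaPath : ℕ → ℕ → List ℕ
thetaPath m j = 0 ∷ (map (λ t → 2 + j * (m ∸ 1) + t) (upTo (m ∸ 1)) ++ (1 ∷ []))

thetaPendantEdges : ℕ → List (ℕ × ℕ)
thetaPendantEdges m =
  (0 , 3 * m ∸ 1) ∷ (pathEdges (thetaPath m 0) ++ pathEdges (thetaPath m 1)
                      ++ pathEdges (thetaPath m 2))

ThetaPendant : (n : ℕ) → Graph n
ThetaPendant n = fromEdges n (thetaPendantEdges (n / 3))

{-# OPTIONS --safe #-}

-- In an almost self-centered graph of radius r the two noncentral vertices u, v form the only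
-- pair at distance r + 1; in particular every leaf is u or v, and a leaf is never attached to a
-- vertex of degree two.  If n + 2 ≤ 2g, deleting the leaves therefore leaves a graph of minimum
-- degree two which is a cycle, or contains a theta graph formed by a shortest cycle and an ear
-- of it.  A further bridge of the theta graph would create a short cycle, unless 2g = n + 2 and
-- the graph is a subdivision of K₄ with equal opposite edges; for n = 8, 10, 16 those are
-- refuted by computing their distances.  So only cycles and theta graphs with at most two
-- pendant edges remain.  There the distances are explicit, and for even n the uniqueness of the
-- pair u, v excludes g > 4⌊n/6⌋ (g > 5 if n = 10); for n = 6k and g = 4k it leaves only
-- θ_{2k,2k,2k} with a pendant edge at a vertex of degree three.  The bounds are attained by an
-- even cycle with a pendant edge, by θ_{2k,2k,2k+2s} with a pendant edge at a branch vertex,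
-- and by a sporadic graph of order 10.

module Submission where

-- The hypothesis n + 2 ≤ 2g enters twice. At most g - 2 vertices lie off a shortest cycle, so a
-- non-backtracking path leaving it has no room to close a cycle of its own and must come back: this
-- is the ear. And a bridge of the theta graph yields four cycles of total length at most 2n + 4,
-- hence at most 4g; the equal opposite edges of K₄ are the equality case. With n ≤ 6k + 4, g > 4k
-- and g ≥ 5, the equality 2g = n + 2 leaves only g = 5, 6, 9. For n = 6k + 2s with k ≥ 1 and s ≤ 2,
-- every g > 4k satisfies n + 2 ≤ 2g exactly when s ≤ k. This fails only for k = 1, s = 2, and there
-- the girth 4k + 1 = 5 is attained: hence the exception n = 10. A leaf u is a strong constraint
-- because an inner vertex at distance at least r from its neighbour must be the other pole. On an
-- even cycle a vertex has one antipode, on an odd cycle two, so parity decides which theta graphs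
-- survive. An interior vertex of a strand of θ_{a,a,a} has an antipode on each of the other two
-- strands; this moves the pendant edge to a branch vertex.

open import Defs
open import Data.Nat using (ℕ; zero; suc; _+_; _*_; _∸_; _≤_; _<_; _/_; _%_; z≤n; s≤s; z<s; s<s; s≤s⁻¹; _≤ᵇ_; _<ᵇ_; _≡ᵇ_; _≤?_; _<?_)
open import Data.Nat.Properties using (≤-refl; ≤-reflexive; ≤-trans; ≤-antisym; ≤-total; <-irrefl; <-cmp; n<1+n; n≤1+n; ≮⇒≥; ≰⇒>; <⇒≤; <⇒≱; <⇒≢; ≤∧≢⇒<; ≤-<-trans; <-≤-trans; m≤m+n; m≤n+m; +-mono-≤; *-monoˡ-≤; *-monoʳ-≤; +-identityʳ; +-comm; +-assoc; +-suc; *-zeroʳ; *-identityʳ; ≤ᵇ⇒≤; ≤⇒≤ᵇ; <ᵇ⇒<; <⇒<ᵇ; ≡ᵇ⇒≡; suc-injective; +-cancelˡ-≡; m+n∸m≡n; m∸n≤m; m≤n+m∸n; m≤n+o⇒m∸n≤o; m∸[m∸n]≡n; n∸n≡0; m+[n∸m]≡n; module ≤-Reasoning)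
open import Data.Nat.Divisibility using (_∣_; divides)
open import Data.Nat.DivMod using (m≡m%n+[m/n]*n; m%n<n; [m+n]%n≡m%n; [m+kn]%n≡m%n; m<n⇒m%n≡m; m*n/n≡m)
open import Data.Nat.Tactic.RingSolver using (solve-∀)
open import Data.Bool as Bool using (Bool; true; false; T; _∧_; _∨_; not; if_then_else_)
open import Data.Bool.Properties using (T-∧; T-∨; T-≡)
open import Data.Fin as Fin using (Fin; zero; suc; toℕ; fromℕ<)
open import Data.Fin.Properties using (toℕ-injective; toℕ<n; toℕ-fromℕ<; any?; injective⇒≤)
open import Data.Fin.Subset as Subset using (Subset; ∣_∣; ⁅_⁆; _∪_)
import Data.Fin.Subset.Properties as Subset
open import Data.Vec as Vec using (Vec; []; _∷_)
open import Data.Vec.N-ary using (N-ary; _$ⁿ_; curryⁿ; ∀ⁿ)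
open import Data.List as List using (List; []; _∷_; length; applyUpTo; _++_)
open import Data.List.Properties using (++-identityʳ; ++-assoc; length-++; length-applyUpTo; applyUpTo-∷ʳ; map-upTo)
open import Data.List.Relation.Unary.All as All using (All)
import Data.List.Relation.Unary.All.Properties as All
open import Data.List.Relation.Unary.Any as Any using (Any; here; there)
import Data.List.Relation.Unary.Any.Properties as Any
open import Data.List.Relation.Unary.AllPairs as AllPairs using (AllPairs)
open import Data.List.Relation.Unary.Unique.Propositional using (Unique)
import Data.List.Relation.Unary.Unique.Propositional.Properties as Unique
open import Data.List.Membership.Propositional using (_∈_; _∉_)
open import Data.List.Membership.Propositional.Properties using (∈-++⁺ˡ; ∈-++⁺ʳ; ∈-++⁻; ∈-applyUpTo⁺; ∈-applyUpTo⁻; ∈-lookup)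
open import Data.Product using (∃; ∃₂; _×_; _,_; proj₁; proj₂)
open import Data.Sum using (_⊎_; inj₁; inj₂)
open import Data.Empty using (⊥; ⊥-elim)
open import Data.Unit using (tt)
open import Function using (_∘_; case_of_)
open import Function.Bundles using (Equivalence; mk↔ₛ′)
open import Relation.Binary using (tri<; tri≈; tri>)
open import Relation.Binary.PropositionalEquality using (_≡_; _≢_; refl; sym; trans; cong; cong₂; subst; subst₂)
open import Relation.Nullary using (¬_; Dec; yes; no; contradiction)
open import Relation.Nullary.Decidable using (_×-dec_; _⊎-dec_; ¬?; map′; decidable-stable)

-- Linear arithmetic over ℕ by Farkas certificates: a certificate lists multipliers for the
-- negated goal and for the hypotheses (two for each equation) whose weighted sum is absurd
-- coefficientwise.

data Expr (n : ℕ) : Set where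
  con  : ℕ → Expr n
  var  : Fin n → Expr n
  _:+_ : Expr n → Expr n → Expr n
  _:*_ : ℕ → Expr n → Expr n

infixl 6 _:+_
infixr 7 _:*_
infix  4 _:≤_ _:<_ _:≡_
infix  3 _⊢_

⟦_⟧ : ∀ {n} → Expr n → Vec ℕ n → ℕ
⟦ con c ⟧ ρ = c
⟦ var x ⟧ ρ = Vec.lookup ρ x
⟦ e :+ f ⟧ ρ = ⟦ e ⟧ ρ + ⟦ f ⟧ ρ
⟦ k :* e ⟧ ρ = k * ⟦ e ⟧ ρ

data Rel (n : ℕ) : Set where
  _:≤_ _:<_ _:≡_ : Expr n → Expr n → Rel n
  absurd : Rel n

data Problem (n : ℕ) : Set where
  _⊢_ : List (Rel n) → Rel n → Problem n

⟦_⟧ᴿ : ∀ {n} → Rel n → Vec ℕ n → Set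
⟦ e :≤ f ⟧ᴿ ρ = ⟦ e ⟧ ρ ≤ ⟦ f ⟧ ρ
⟦ e :< f ⟧ᴿ ρ = ⟦ e ⟧ ρ < ⟦ f ⟧ ρ
⟦ e :≡ f ⟧ᴿ ρ = ⟦ e ⟧ ρ ≡ ⟦ f ⟧ ρ
⟦ absurd ⟧ᴿ ρ = ⊥

⟦_⟧ᴾ : ∀ {n} → Problem n → Vec ℕ n → Set
⟦ [] ⊢ g ⟧ᴾ ρ = ⟦ g ⟧ᴿ ρ
⟦ (h ∷ hs) ⊢ g ⟧ᴾ ρ = ⟦ h ⟧ᴿ ρ → ⟦ hs ⊢ g ⟧ᴾ ρ

Ineq : ℕ → Set
Ineq n = Expr n × Expr n

Holds : ∀ {n} → Vec ℕ n → Ineq n → Set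
Holds ρ (e , f) = ⟦ e ⟧ ρ ≤ ⟦ f ⟧ ρ

toIneqs : ∀ {n} → Rel n → List (Ineq n)
toIneqs (e :≤ f) = (e , f) ∷ []
toIneqs (e :< f) = (con 1 :+ e , f) ∷ []
toIneqs (e :≡ f) = (e , f) ∷ (f , e) ∷ []
toIneqs absurd   = (con 1 , con 0) ∷ []

toIneqs-sound : ∀ {n} (h : Rel n) ρ → ⟦ h ⟧ᴿ ρ → All (Holds ρ) (toIneqs h)
toIneqs-sound (e :≤ f) ρ p = p All.∷ All.[]
toIneqs-sound (e :< f) ρ p = p All.∷ All.[]
toIneqs-sound (e :≡ f) ρ p = ≤-reflexive p All.∷ ≤-reflexive (sym p) All.∷ All.[]
toIneqs-sound absurd   ρ ()

dot : ∀ {n} → Vec ℕ n → Vec ℕ n → ℕ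
dot []       []       = 0
dot (a ∷ as) (x ∷ xs) = a * x + dot as xs

dot-0 : ∀ {n} (ρ : Vec ℕ n) → dot (Vec.replicate n 0) ρ ≡ 0
dot-0 []      = refl
dot-0 (_ ∷ ρ) = dot-0 ρ

dot-+ : ∀ {n} (u v ρ : Vec ℕ n) → dot (Vec.zipWith _+_ u v) ρ ≡ dot u ρ + dot v ρ
dot-+ [] [] [] = refl
dot-+ (a ∷ u) (b ∷ v) (x ∷ ρ) rewrite dot-+ u v ρ = lemma a b x (dot u ρ) (dot v ρ)
  where
  lemma : ∀ a b x p q → (a + b) * x + (p + q) ≡ (a * x + p) + (b * x + q)
  lemma = solve-∀

dot-* : ∀ {n} k (u ρ : Vec ℕ n) → dot (Vec.map (k *_) u) ρ ≡ k * dot u ρ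
dot-* k [] [] = sym (*-zeroʳ k)
dot-* k (a ∷ u) (x ∷ ρ) rewrite dot-* k u ρ = lemma k a x (dot u ρ)
  where
  lemma : ∀ k a x p → (k * a) * x + k * p ≡ k * (a * x + p)
  lemma = solve-∀

dot-mono : ∀ {n} (u v ρ : Vec ℕ n) → T (Vec.foldr _ _∧_ true (Vec.zipWith _≤ᵇ_ u v)) → dot u ρ ≤ dot v ρ
dot-mono [] [] [] _ = z≤n
dot-mono (a ∷ u) (b ∷ v) (x ∷ ρ) t =
  let t₁ , t₂ = Equivalence.to T-∧ t
  in +-mono-≤ (*-monoˡ-≤ x (≤ᵇ⇒≤ a b t₁)) (dot-mono u v ρ t₂)

unit : ∀ {n} → Fin n → Vec ℕ n
unit {suc n} zero    = 1 ∷ Vec.replicate n 0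
unit {suc n} (suc x) = 0 ∷ unit x

dot-unit : ∀ {n} (x : Fin n) ρ → dot (unit x) ρ ≡ Vec.lookup ρ x
dot-unit zero    (y ∷ ρ) rewrite dot-0 ρ | +-identityʳ y = +-identityʳ y
dot-unit (suc x) (y ∷ ρ) = dot-unit x ρ

-- The head is the constant term, which is why valuations appear below as `1 ∷ ρ`.
norm : ∀ {n} → Expr n → Vec ℕ (suc n)
norm {n} (con c) = c ∷ Vec.replicate n 0
norm (var x)  = 0 ∷ unit x
norm (e :+ f) = Vec.zipWith _+_ (norm e) (norm f)
norm (k :* e) = Vec.map (k *_) (norm e)

norm-sound : ∀ {n} (e : Expr n) ρ → dot (norm e) (1 ∷ ρ) ≡ ⟦ e ⟧ ρ
norm-sound (con c) ρ rewrite dot-0 ρ | +-identityʳ (c * 1) = *-identityʳ c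
norm-sound (var x) ρ = dot-unit x ρ
norm-sound (e :+ f) ρ = trans (dot-+ (norm e) (norm f) (1 ∷ ρ)) (cong₂ _+_ (norm-sound e ρ) (norm-sound f ρ))
norm-sound (k :* e) ρ = trans (dot-* k (norm e) (1 ∷ ρ)) (cong (k *_) (norm-sound e ρ))

combine : ∀ {n} → (Ineq n → Expr n) → List ℕ → List (Ineq n) → Vec ℕ (suc n)
combine {n} side (m ∷ ms) (h ∷ hs) = Vec.zipWith _+_ (Vec.map (m *_) (norm (side h))) (combine side ms hs)
combine {n} side _ _ = Vec.replicate (suc n) 0

combine-mono : ∀ {n} ms (hs : List (Ineq n)) ρ → All (Holds ρ) hs →
               dot (combine proj₁ ms hs) (1 ∷ ρ) ≤ dot (combine proj₂ ms hs) (1 ∷ ρ)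
combine-mono (m ∷ ms) (h@(e , f) ∷ hs) ρ (p All.∷ ps) = begin
  dot (combine proj₁ (m ∷ ms) (h ∷ hs)) (1 ∷ ρ) ≡⟨ expand proj₁ ⟩
  m * ⟦ e ⟧ ρ + dot (combine proj₁ ms hs) (1 ∷ ρ) ≤⟨ +-mono-≤ (*-monoʳ-≤ m p) (combine-mono ms hs ρ ps) ⟩
  m * ⟦ f ⟧ ρ + dot (combine proj₂ ms hs) (1 ∷ ρ) ≡⟨ expand proj₂ ⟨
  dot (combine proj₂ (m ∷ ms) (h ∷ hs)) (1 ∷ ρ) ∎
  where
  open ≤-Reasoning
  expand : ∀ side → dot (combine side (m ∷ ms) (h ∷ hs)) (1 ∷ ρ) ≡ m * ⟦ side h ⟧ ρ + dot (combine side ms hs) (1 ∷ ρ)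
  expand side = trans (dot-+ (Vec.map (m *_) (norm (side h))) (combine side ms hs) (1 ∷ ρ))
    (cong (_+ dot (combine side ms hs) (1 ∷ ρ))
      (trans (dot-* m (norm (side h)) (1 ∷ ρ)) (cong (m *_) (norm-sound (side h) ρ))))
combine-mono []       _  ρ _ = ≤-refl
combine-mono (_ ∷ _) [] ρ _ = ≤-refl

increment : ∀ {n} → Vec ℕ (suc n) → Vec ℕ (suc n)
increment (c ∷ cs) = suc c ∷ cs

-- Variables range over ℕ, so a coefficientwise comparison holds at every valuation. The increment
-- of the constant term makes the right-hand sum strictly smaller than the left-hand one, against
-- the weighted sum of the hypotheses.
refutes : ∀ {n} → List ℕ → List (Ineq n) → Bool
refutes ms hs = Vec.foldr _ _∧_ true (Vec.zipWith _≤ᵇ_ (increment (combine proj₂ ms hs)) (combine proj₁ ms hs))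

refute : ∀ {n} ms (hs : List (Ineq n)) ρ → T (refutes ms hs) → All (Holds ρ) hs → ⊥
refute ms hs ρ t ps = <-irrefl refl (begin-strict
  dot (combine proj₂ ms hs) (1 ∷ ρ)             <⟨ n<1+n _ ⟩
  suc (dot (combine proj₂ ms hs) (1 ∷ ρ))       ≡⟨ dot-increment (combine proj₂ ms hs) ⟨
  dot (increment (combine proj₂ ms hs)) (1 ∷ ρ) ≤⟨ dot-mono (increment (combine proj₂ ms hs)) (combine proj₁ ms hs) (1 ∷ ρ) t ⟩
  dot (combine proj₁ ms hs) (1 ∷ ρ)             ≤⟨ combine-mono ms hs ρ ps ⟩
  dot (combine proj₂ ms hs) (1 ∷ ρ)             ∎)
  where
  open ≤-Reasoning
  dot-increment : ∀ v → dot (increment v) (1 ∷ ρ) ≡ suc (dot v (1 ∷ ρ))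
  dot-increment (c ∷ cs) = refl

Certificate : Set
Certificate = List ℕ × List ℕ

-- Unless the goal is `absurd`, its negation is put in front of the hypotheses, so the first
-- multiplier of a certificate belongs to it. An equation is refuted in both directions, hence the
-- pair of lists.
valid : ∀ {n} → Certificate → List (Ineq n) → Rel n → Bool
valid (ms , _)   hs (e :≤ f) = refutes ms ((con 1 :+ f , e) ∷ hs)
valid (ms , _)   hs (e :< f) = refutes ms ((f , e) ∷ hs)
valid (ms , ms′) hs (e :≡ f) = refutes ms ((con 1 :+ f , e) ∷ hs) ∧ refutes ms′ ((con 1 :+ e , f) ∷ hs)
valid (ms , _)   hs absurd   = refutes ms hs

valid-sound : ∀ {n} c (hs : List (Ineq n)) g ρ → T (valid c hs g) → All (Holds ρ) hs → ⟦ g ⟧ᴿ ρ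
valid-sound (ms , _) hs (e :≤ f) ρ t ps = ≮⇒≥ λ lt → refute ms _ ρ t (lt All.∷ ps)
valid-sound (ms , _) hs (e :< f) ρ t ps = ≰⇒> λ le → refute ms _ ρ t (le All.∷ ps)
valid-sound (ms , ms′) hs (e :≡ f) ρ t ps =
  let t₁ , t₂ = Equivalence.to T-∧ t
  in ≤-antisym (≮⇒≥ λ lt → refute ms _ ρ t₁ (lt All.∷ ps)) (≮⇒≥ λ lt → refute ms′ _ ρ t₂ (lt All.∷ ps))
valid-sound (ms , _) hs absurd ρ t ps = refute ms hs ρ t ps

prove : ∀ {n} c (hs : List (Rel n)) g acc ρ → T (valid c (acc List.++ List.concatMap toIneqs hs) g) →
        All (Holds ρ) acc → ⟦ hs ⊢ g ⟧ᴾ ρ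
prove c [] g acc ρ t ps = valid-sound c acc g ρ (subst (λ xs → T (valid c xs g)) (++-identityʳ acc) t) ps
prove c (h ∷ hs) g acc ρ t ps p =
  prove c hs g (acc List.++ toIneqs h) ρ
    (subst (λ xs → T (valid c xs g)) (sym (++-assoc acc (toIneqs h) (List.concatMap toIneqs hs))) t)
    (All.++⁺ ps (toIneqs-sound h ρ p))

problemAt : ∀ n → N-ary n (Expr n) (Problem n) → Problem n
problemAt n f = f $ⁿ Vec.map var (Vec.allFin n)

certified : ∀ {n} → Problem n → Certificate → Bool
certified (hs ⊢ g) c = valid c (List.concatMap toIneqs hs) g

private
  curryⁿ-∀ : ∀ k {P : Vec ℕ k → Set} → (∀ ρ → P ρ) → ∀ⁿ k (curryⁿ {n = k} P)
  curryⁿ-∀ zero    p = p []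
  curryⁿ-∀ (suc k) p x = curryⁿ-∀ k (λ ρ → p (x ∷ ρ))

abstract
  -- Once the certificate evaluates to `true`, the type of the implicit argument is the unit type
  -- and eta fills it in. Abstraction keeps the checker out of the proof terms that use it.
  linear : ∀ n (f : N-ary n (Expr n) (Problem n)) (c : Certificate) → {T (certified (problemAt n f) c)} →
           ∀ⁿ n (curryⁿ {n = n} ⟦ problemAt n f ⟧ᴾ)
  linear n f c {t} = curryⁿ-∀ n (apply (problemAt n f) t)
    where
    apply : ∀ (P : Problem n) → T (certified P c) → ∀ ρ → ⟦ P ⟧ᴾ ρ
    apply (hs ⊢ g) t ρ = prove c hs g [] ρ t All.[]

-- Distances, eccentricities and poles

edge-sym : ∀ {n} (G : Graph n) {u v} → Edge G u v → Edge G v u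
edge-sym G {u} {v} e = trans (adj-sym G v u) e

edge-irr : ∀ {n} (G : Graph n) {v} → ¬ Edge G v v
edge-irr G {v} e with trans (sym e) (adj-irr G v)
... | ()

edge? : ∀ {n} (G : Graph n) u v → Dec (Edge G u v)
edge? G u v = adj G u v Bool.≟ true

walk-++ : ∀ {n} {G : Graph n} {u v w j k} → Walk G u v j → Walk G v w k → Walk G u w (j + k)
walk-++ nil        q = q
walk-++ (cons e p) q = cons e (walk-++ p q)

walk-reverse : ∀ {n} {G : Graph n} {u v k} → Walk G u v k → Walk G v u k
walk-reverse nil = nil
walk-reverse {G = G} {k = suc k} (cons e p) =
  subst (Walk G _ _) (+-comm k 1) (walk-++ (walk-reverse p) (cons (edge-sym G e) nil))

walk? : ∀ {n} (G : Graph n) k u v → Dec (Walk G u v k)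
walk? G zero u v with u Fin.≟ v
... | yes refl = yes nil
... | no u≢v   = no λ { nil → u≢v refl }
walk? G (suc k) u v =
  map′ (λ { (_ , e , p) → cons e p }) (λ { (cons e p) → _ , e , p })
    (any? λ w → edge? G u w ×-dec walk? G k w v)

least : ∀ {P : ℕ → Set} → (∀ k → Dec (P k)) → ∀ k → P k → ∃ λ d → P d × (∀ j → P j → d ≤ j)
least P? k p with P? 0
... | yes p₀ = 0 , p₀ , λ _ _ → z≤n
least P? zero    p | no ¬p₀ = contradiction p ¬p₀
least {P} P? (suc k) p | no ¬p₀ with least {P ∘ suc} (P? ∘ suc) k p
... | d , pd , min = suc d , pd , λ { zero p₀ → contradiction p₀ ¬p₀ ; (suc j) pj → s≤s (min j pj) }

argmax : ∀ {n} (f : Fin n → ℕ) → Fin n → ∃ λ i → ∀ j → f j ≤ f i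
argmax {suc zero} f _ = zero , λ { zero → ≤-refl }
argmax {suc (suc n)} f _ with argmax (f ∘ suc) zero
... | i , max with ≤-total (f zero) (f (suc i))
...   | inj₁ le = suc i , λ { zero → le ; (suc j) → max j }
...   | inj₂ ge = zero , λ { zero → ≤-refl ; (suc j) → ≤-trans (max j) ge }

avoid-two : ∀ {n} → 3 ≤ n → (u v : Fin n) → ∃ λ x → x ≢ u × x ≢ v
avoid-two {n} (s≤s (s≤s (s≤s z≤n))) u v with any? (λ x → ¬? (x Fin.≟ u) ×-dec ¬? (x Fin.≟ v))
... | yes found = found
... | no none = case (f zero , f (suc zero) , f (suc (suc zero))) of λ
  { (inj₁ refl , inj₁ () , _) ; (inj₁ refl , inj₂ refl , inj₁ ()) ; (inj₁ refl , inj₂ refl , inj₂ ())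
  ; (inj₂ refl , inj₂ () , _) ; (inj₂ refl , inj₁ refl , inj₁ ()) ; (inj₂ refl , inj₁ refl , inj₂ ()) }
  where
  f : ∀ x → x ≡ u ⊎ x ≡ v
  f x with x Fin.≟ u | x Fin.≟ v
  ... | yes x≡u | _       = inj₁ x≡u
  ... | no _    | yes x≡v = inj₂ x≡v
  ... | no x≢u  | no x≢v  = contradiction (x , x≢u , x≢v) none

one-outside : ∀ {n} (S : Subset n) → suc ∣ S ∣ ≡ n →
              ∃ λ u → u Subset.∉ S × (∀ x → x ≢ u → x Subset.∈ S)
one-outside (false ∷ S) eq with Subset.∣p∣≡n⇒p≡⊤ {p = S} (suc-injective eq)
... | refl = zero , (λ ()) , λ { zero x≢ → contradiction refl x≢ ; (suc x) _ → Vec.there Subset.∈⊤ }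
one-outside (true ∷ S) eq with one-outside S (suc-injective eq)
... | u , u∉ , rest = suc u , (λ { (Vec.there u∈) → u∉ u∈ })
    , λ { zero _ → Vec.here ; (suc x) x≢ → Vec.there (rest x (x≢ ∘ cong suc)) }

two-outside : ∀ {n} (S : Subset n) → suc (suc ∣ S ∣) ≡ n →
              ∃₂ λ u v → u Subset.∉ S × v Subset.∉ S × (∀ x → x ≢ u → x ≢ v → x Subset.∈ S)
two-outside (false ∷ S) eq with one-outside S (suc-injective eq)
... | v , v∉ , rest = zero , suc v , (λ ()) , (λ { (Vec.there v∈) → v∉ v∈ })
    , λ { zero x≢ _ → contradiction refl x≢ ; (suc x) _ x≢ → Vec.there (rest x (x≢ ∘ cong suc)) }
two-outside (true ∷ S) eq with two-outside S (suc-injective eq)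
... | u , v , u∉ , v∉ , rest = suc u , suc v , (λ { (Vec.there u∈) → u∉ u∈ }) , (λ { (Vec.there v∈) → v∉ v∈ })
    , λ { zero _ _ → Vec.here ; (suc x) x≢u x≢v → Vec.there (rest x (x≢u ∘ cong suc) (x≢v ∘ cong suc)) }

∣pair∣≡2 : ∀ {n} {u v : Fin n} → u ≢ v → ∣ ⁅ u ⁆ ∪ ⁅ v ⁆ ∣ ≡ 2
∣pair∣≡2 {u = zero}  {zero}  u≢v = contradiction refl u≢v
∣pair∣≡2 {u = zero}  {suc v} u≢v = cong suc (trans (cong ∣_∣ (Subset.∪-identityˡ ⁅ v ⁆)) (Subset.∣⁅x⁆∣≡1 v))
∣pair∣≡2 {u = suc u} {zero}  u≢v = cong suc (trans (cong ∣_∣ (Subset.∪-identityʳ ⁅ u ⁆)) (Subset.∣⁅x⁆∣≡1 u))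
∣pair∣≡2 {u = suc u} {suc v} u≢v = ∣pair∣≡2 {u = u} {v} (u≢v ∘ cong suc)

module Metric {n} (G : Graph n) (conn : Connected G) where

  abstract
    -- A search over decidable walk lengths, bounded by the length of a walk that connectedness
    -- supplies. It is abstract, so that later proofs rest on `dist-Dist` and never unfold the
    -- search.
    dist : Fin n → Fin n → ℕ
    dist u v = let k , p = conn u v in proj₁ (least (λ j → walk? G j u v) k p)

    dist-Dist : ∀ u v → Dist G u v (dist u v)
    dist-Dist u v = let k , p = conn u v in proj₂ (least (λ j → walk? G j u v) k p)

  dist-walk : ∀ u v → Walk G u v (dist u v)
  dist-walk u v = proj₁ (dist-Dist u v)

  dist-min : ∀ {u v k} → Walk G u v k → dist u v ≤ k
  dist-min {u} {v} {k} = proj₂ (dist-Dist u v) k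

  Dist-unique : ∀ {u v d} → Dist G u v d → d ≡ dist u v
  Dist-unique {u} {v} {d} (w , min) = ≤-antisym (min (dist u v) (dist-walk u v)) (dist-min w)

  dist-refl : ∀ u → dist u u ≡ 0
  dist-refl u = ≤-antisym (dist-min nil) z≤n

  dist-zero : ∀ {u v} → dist u v ≡ 0 → u ≡ v
  dist-zero {u} {v} eq with dist u v | dist-walk u v
  dist-zero refl | .0 | nil = refl

  dist-sym : ∀ u v → dist u v ≡ dist v u
  dist-sym u v = ≤-antisym (dist-min (walk-reverse (dist-walk v u))) (dist-min (walk-reverse (dist-walk u v)))

  dist-triangle : ∀ u v w → dist u w ≤ dist u v + dist v w
  dist-triangle u v w = dist-min (walk-++ (dist-walk u v) (dist-walk v w))

  dist-edge : ∀ {u v} → Edge G u v → dist u v ≤ 1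
  dist-edge e = dist-min (cons e nil)

  dist-suc : ∀ {u v w} → Edge G v w → dist u w ≤ suc (dist u v)
  dist-suc {u} {v} {w} e = ≤-trans (dist-triangle u v w)
    (subst (dist u v + dist v w ≤_) (+-comm (dist u v) 1) (+-mono-≤ ≤-refl (dist-edge e)))

  dist-pred : ∀ {u v d} → dist u v ≡ suc d → ∃ λ w → Edge G w v × dist u w ≡ d
  dist-pred {u} {v} {d} eq with walk-reverse (subst (Walk G u v) eq (dist-walk u v))
  ... | cons {w = w} e p = w , edge-sym G e
      , ≤-antisym (dist-min (walk-reverse p)) (s≤s⁻¹ (subst (_≤ suc (dist u w)) eq (dist-suc (edge-sym G e))))

  dist-along : ∀ (s : ℕ → Fin n) i k → (∀ t → i ≤ t → t < i + k → Edge G (s t) (s (suc t))) → dist (s i) (s (i + k)) ≤ k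
  dist-along s i zero _ rewrite +-identityʳ i = ≤-reflexive (dist-refl (s i))
  dist-along s i (suc k) e rewrite +-suc i k =
    ≤-trans (dist-suc (e (i + k) (m≤m+n i k) ≤-refl)) (s≤s (dist-along s i k λ t i≤t t< → e t i≤t (<-≤-trans t< (n≤1+n _))))

  -- In an almost self-centered graph of radius r the two noncentral vertices u, v form the
  -- only pair at distance r + 1.
  record Poles (u v : Fin n) (r : ℕ) : Set where
    field
      apart : dist u v ≡ suc r
      near  : ∀ x y → dist x y ≤ r ⊎ (x ≡ u × y ≡ v) ⊎ (x ≡ v × y ≡ u)
      far   : ∀ x → x ≢ u → x ≢ v → ∃ λ y → r ≤ dist x y

  IsEcc-exists : ∀ u → ∃ (IsEcc G u)
  IsEcc-exists u with argmax (dist u) u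
  ... | y , max = dist u y , (λ z d D → subst (_≤ dist u y) (sym (Dist-unique D)) (max z)) , y , dist-Dist u y

  module NonCentralPair (S : Subset n)
    (central : ∀ x → (x Subset.∈ S → Central G x) × (Central G x → x Subset.∈ S))
    {u v} (u∉ : u Subset.∉ S) (inS : ∀ x → x ≢ u → x ≢ v → x Subset.∈ S)
    {c} (c∈ : c Subset.∈ S) (c≢u : c ≢ u) {r} (radius : IsRadius G r) where

    ecc-in : ∀ {x} → x Subset.∈ S → IsEcc G x r
    ecc-in {x} x∈ = let r′ , ((w , ew) , min′) , e = proj₁ (central x) x∈ ; (w₀ , e₀) , min = radius in
      subst (IsEcc G x) (≤-antisym (min′ w₀ r e₀) (min w r′ ew)) e

    dist-in : ∀ {x} y → x Subset.∈ S → dist x y ≤ r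
    dist-in {x} y x∈ = proj₁ (ecc-in x∈) y (dist x y) (dist-Dist x y)

    far : ∀ x → x ≢ u → x ≢ v → ∃ λ y → r ≤ dist x y
    far x x≢u x≢v with proj₂ (ecc-in (inS x x≢u x≢v))
    ... | y , D = y , ≤-reflexive (Dist-unique D)

    -- Central vertices see everything within r, so a vertex at distance more than r from the
    -- noncentral `x` is noncentral too, and `y` is the only candidate.
    far-out : ∀ x y → x Subset.∉ S → (∀ z → z ≢ x → z ≢ y → z Subset.∈ S) → r < dist x y
    far-out x y x∉ rest with IsEcc-exists x
    ... | e , ecc@(max , z , D) with ≤∧≢⇒< (proj₂ radius x e ecc) (λ r≡e → x∉ (proj₂ (central x) (r , radius , subst (IsEcc G x) (sym r≡e) ecc)))
    ...   | r<e with z Fin.≟ x | z Fin.≟ y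
    ...     | yes refl | _ = contradiction (subst (r <_) (trans (Dist-unique D) (dist-refl x)) r<e) λ ()
    ...     | no _ | yes refl = subst (r <_) (Dist-unique D) r<e
    ...     | no z≢x | no z≢y = contradiction
      (subst (_≤ r) (trans (dist-sym z x) (sym (Dist-unique D))) (dist-in x (rest z z≢x z≢y))) (<⇒≱ r<e)

    r<uv : r < dist u v
    r<uv = far-out u v u∉ inS

    -- The vertex before `v` on a geodesic from `u` is central, which caps the distance at r + 1. If
    -- that vertex is `u` itself, then r = 0 and the central vertex `c` would coincide with `u`.
    apart : dist u v ≡ suc r
    apart with dist u v in eq | r<uv
    ... | suc d | s≤s r≤d with dist-pred eq
    ... | w , e , dw with w Fin.≟ u | w Fin.≟ v
    ...   | _ | yes refl = contradiction e (edge-irr G)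
    ...   | no w≢u | no w≢v = cong suc (≤-antisym (subst (_≤ r) (trans (dist-sym w u) dw) (dist-in u (inS w w≢u w≢v))) r≤d)
    ...   | yes refl | _ = contradiction
      (dist-zero (≤-antisym (≤-trans (dist-in u c∈) (≤-trans r≤d (≤-reflexive (trans (sym dw) (dist-refl u))))) z≤n)) c≢u

    near : ∀ x y → dist x y ≤ r ⊎ (x ≡ u × y ≡ v) ⊎ (x ≡ v × y ≡ u)
    near x y with x Fin.≟ u | x Fin.≟ v | y Fin.≟ u | y Fin.≟ v
    ... | no x≢u | no x≢v | _ | _ = inj₁ (dist-in y (inS x x≢u x≢v))
    ... | _ | _ | no y≢u | no y≢v = inj₁ (subst (_≤ r) (dist-sym y x) (dist-in x (inS y y≢u y≢v)))
    ... | yes refl | _ | yes refl | _ = inj₁ (subst (_≤ r) (sym (dist-refl x)) z≤n)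
    ... | _ | yes refl | _ | yes refl = inj₁ (subst (_≤ r) (sym (dist-refl x)) z≤n)
    ... | yes x≡u | _ | _ | yes y≡v = inj₂ (inj₁ (x≡u , y≡v))
    ... | _ | yes x≡v | yes y≡u | _ = inj₂ (inj₂ (x≡v , y≡u))

  AlmostSelfCentered⇒Poles : 3 ≤ n → AlmostSelfCentered G → ∃₂ λ u v → ∃ (Poles u v)
  AlmostSelfCentered⇒Poles n≥3 (_ , S , central , size)
    with two-outside S (trans (cong (2 +_) size) (m+[n∸m]≡n (≤-trans (n≤1+n 2) n≥3)))
  ... | u , v , u∉ , _ , inS with avoid-two n≥3 u v
  ...   | c , c≢u , c≢v with proj₁ (central c) (inS c c≢u c≢v)
  ...     | r , radius , _ = u , v , r , record { apart = apart ; near = near ; far = far }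
    where open NonCentralPair S central u∉ inS (inS c c≢u c≢v) c≢u radius

  Poles⇒AlmostSelfCentered : ∀ {u v r} → 3 ≤ n → Poles u v r → AlmostSelfCentered G
  Poles⇒AlmostSelfCentered {u} {v} {r} n≥3 P = conn , S , (λ x → ∈⇒central x , central⇒∈ x)
    , trans (Subset.∣∁p∣≡n∸∣p∣ (⁅ u ⁆ ∪ ⁅ v ⁆)) (cong (n ∸_) (∣pair∣≡2 u≢v))
    where
    open Poles P
    S = Subset.∁ (⁅ u ⁆ ∪ ⁅ v ⁆)
    u≢v : u ≢ v
    u≢v refl = contradiction (trans (sym apart) (dist-refl u)) λ ()

    ecc : ∀ {x} → x ≢ u → x ≢ v → IsEcc G x r
    ecc {x} x≢u x≢v = (λ y d D → subst (_≤ r) (sym (Dist-unique D)) (le y)) , y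
      , subst (Dist G x y) (≤-antisym (le y) r≤) (dist-Dist x y)
      where
      le : ∀ y → dist x y ≤ r
      le y with near x y
      ... | inj₁ xy≤r = xy≤r
      ... | inj₂ (inj₁ (x≡u , _)) = contradiction x≡u x≢u
      ... | inj₂ (inj₂ (x≡v , _)) = contradiction x≡v x≢v
      y = proj₁ (far x x≢u x≢v)
      r≤ = proj₂ (far x x≢u x≢v)

    lower : ∀ x e → IsEcc G x e → r ≤ e
    lower x e (max , _) with x Fin.≟ u | x Fin.≟ v
    ... | yes refl | _ = ≤-trans (n≤1+n r) (subst (_≤ e) apart (max v _ (dist-Dist u v)))
    ... | _ | yes refl = ≤-trans (n≤1+n r) (subst (_≤ e) (trans (dist-sym v u) apart) (max u _ (dist-Dist v u)))
    ... | no x≢u | no x≢v with far x x≢u x≢v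
    ...   | y , r≤ = ≤-trans r≤ (max y _ (dist-Dist x y))

    ∈⇒central : ∀ x → x Subset.∈ S → Central G x
    ∈⇒central x x∈ = r , ((x , ecc x≢u x≢v) , lower) , ecc x≢u x≢v
      where
      x∉ = Subset.x∈∁p⇒x∉p x∈
      x≢u : x ≢ u
      x≢u refl = x∉ (Subset.x∈p∪q⁺ (inj₁ (Subset.x∈⁅x⁆ x)))
      x≢v : x ≢ v
      x≢v refl = x∉ (Subset.x∈p∪q⁺ {p = ⁅ u ⁆} (inj₂ (Subset.x∈⁅x⁆ x)))

    not-central : ∀ x y → dist x y ≡ suc r → ¬ Central G x
    not-central x y eq (r′ , (_ , min′) , max , _) =
      let z , z≢u , z≢v = avoid-two n≥3 u v
      in <⇒≱ (subst (_≤ r′) eq (max y _ (dist-Dist x y))) (min′ z r (ecc z≢u z≢v))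

    central⇒∈ : ∀ x → Central G x → x Subset.∈ S
    central⇒∈ x cx = Subset.x∉p⇒x∈∁p λ x∈ → case Subset.x∈p∪q⁻ ⁅ u ⁆ ⁅ v ⁆ x∈ of λ
      { (inj₁ x∈u) → not-central u v apart (subst (Central G) (Subset.x∈⁅y⁆⇒x≡y u x∈u) cx)
      ; (inj₂ x∈v) → not-central v u (trans (dist-sym v u) apart) (subst (Central G) (Subset.x∈⁅y⁆⇒x≡y v x∈v) cx) }

-- Paths and cycles

lookup-injective : ∀ {A : Set} {xs : List A} → Unique xs → ∀ i j → List.lookup xs i ≡ List.lookup xs j → i ≡ j
lookup-injective (_ AllPairs.∷ _)  zero    zero    _  = refl
lookup-injective (x∉ AllPairs.∷ _) zero    (suc j) eq = contradiction eq (All.lookup x∉ (∈-lookup j))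
lookup-injective (x∉ AllPairs.∷ _) (suc i) zero    eq = contradiction (sym eq) (All.lookup x∉ (∈-lookup i))
lookup-injective (_ AllPairs.∷ u)  (suc i) (suc j) eq = cong suc (lookup-injective u i j eq)

Unique⇒length≤ : ∀ {n} {xs : List (Fin n)} → Unique xs → length xs ≤ n
Unique⇒length≤ u = injective⇒≤ (λ {i} {j} → lookup-injective u i j)

Unique⇒complete : ∀ {n} {xs : List (Fin n)} → Unique xs → n ≤ length xs → ∀ v → v ∈ xs
Unique⇒complete {xs = xs} u n≤ v with Any.any? (v Fin.≟_) xs
... | yes v∈ = v∈
... | no v∉ = contradiction (Unique⇒length≤ (All.¬Any⇒All¬ xs v∉ AllPairs.∷ u)) (<⇒≱ (s≤s n≤))

complete⇒length≥ : ∀ {n} {xs : List (Fin n)} → (∀ v → v ∈ xs) → n ≤ length xs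
complete⇒length≥ {xs = xs} all = injective⇒≤ {f = λ v → Any.index (all v)} λ {v} {w} eq →
  trans (Any.lookup-index (all v)) (trans (cong (List.lookup xs) eq) (sym (Any.lookup-index (all w))))

-- The step relation is arbitrary, so that side conditions such as avoiding an oriented edge or
-- staying on the strands are part of the relation.
data RWalk {A : Set} (R : A → A → Set) : A → A → ℕ → Set where
  nil  : ∀ {u} → RWalk R u u 0
  cons : ∀ {u w v k} → R u w → RWalk R w v k → RWalk R u v (suc k)

rwalk-++ : ∀ {A : Set} {R : A → A → Set} {u v w j k} → RWalk R u v j → RWalk R v w k → RWalk R u w (j + k)
rwalk-++ nil        q = q
rwalk-++ (cons e p) q = cons e (rwalk-++ p q)

rwalk-map : ∀ {A : Set} {R S : A → A → Set} → (∀ {x y} → R x y → S x y) → ∀ {u v k} → RWalk R u v k → RWalk S u v k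
rwalk-map f nil        = nil
rwalk-map f (cons e p) = cons (f e) (rwalk-map f p)

rwalk-reverse : ∀ {A : Set} {R S : A → A → Set} → (∀ {x y} → R x y → S y x) → ∀ {u v k} → RWalk R u v k → RWalk S v u k
rwalk-reverse f nil = nil
rwalk-reverse f {k = suc k} (cons e p) = subst (RWalk _ _ _) (+-comm k 1) (rwalk-++ (rwalk-reverse f p) (cons (f e) nil))

rwalk-along : ∀ {A : Set} {R : A → A → Set} (s : ℕ → A) i k →
              (∀ t → i ≤ t → t < i + k → R (s t) (s (suc t))) → RWalk R (s i) (s (i + k)) k
rwalk-along s i zero    e rewrite +-identityʳ i = nil
rwalk-along s i (suc k) e rewrite +-suc i k =
  cons (e i ≤-refl (s≤s (m≤m+n i k))) (rwalk-along s (suc i) k λ t i<t t< → e t (<⇒≤ i<t) t<)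

data Path {A : Set} (R : A → A → Set) : A → List A → A → Set where
  end  : ∀ {v} → Path R v [] v
  step : ∀ {u w v xs} → R u w → Path R w xs v → Path R u (w ∷ xs) v

module _ {n} {R : Fin n → Fin n → Set} where

  suffix : ∀ {u w v xs} → Path R w xs v → Unique (w ∷ xs) → u ∈ w ∷ xs →
           ∃ λ ys → Path R u ys v × Unique (u ∷ ys) × length ys ≤ length xs
  suffix p uq (here refl) = _ , p , uq , ≤-refl
  suffix (step _ p) (_ AllPairs.∷ uq) (there u∈) =
    let ys , q , uq′ , le = suffix p uq u∈ in ys , q , uq′ , ≤-trans le (n≤1+n _)

  -- Loop erasure: when the new head already occurs on the path, the path is cut back to that
  -- occurrence.
  simplify : ∀ {u v k} → RWalk R u v k → ∃ λ xs → Path R u xs v × Unique (u ∷ xs) × length xs ≤ k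
  simplify nil = [] , end , (All.[] AllPairs.∷ AllPairs.[]) , z≤n
  simplify {u} (cons {w = w} e p) with simplify p
  ... | xs , q , uq , le with Any.any? (u Fin.≟_) (w ∷ xs)
  ...   | no u∉ = w ∷ xs , step e q , (All.¬Any⇒All¬ _ u∉ AllPairs.∷ uq) , s≤s le
  ...   | yes u∈ = let ys , q′ , uq′ , le′ = suffix q uq u∈ in ys , q′ , uq′ , ≤-trans le′ (≤-trans le (n≤1+n _))

module _ {n} (G : Graph n) where

  close-path : ∀ {x y xs} → Path (Edge G) x xs y → Unique (x ∷ xs) → Edge G y x → 2 ≤ length xs →
               HasCycle G (suc (length xs))
  close-path {x} {y} {xs} p u e len = s≤s len , List.lookup (x ∷ xs) , (λ {i} {j} → lookup-injective u i j) , steps p , closing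
    where
    steps : ∀ {x xs} → Path (Edge G) x xs y → ∀ i j → toℕ j ≡ suc (toℕ i) →
            Edge G (List.lookup (x ∷ xs) i) (List.lookup (x ∷ xs) j)
    steps (step e p) zero    (suc zero)    eq = e
    steps (step e p) (suc i) (suc j)       eq = steps p i j (suc-injective eq)
    steps end        zero    zero          ()
    steps (step e p) zero    zero          ()
    steps (step e p) zero    (suc (suc j)) ()

    last : ∀ {x xs} → Path (Edge G) x xs y → ∀ i → toℕ i ≡ length xs → List.lookup (x ∷ xs) i ≡ y
    last end        zero    eq = refl
    last (step e p) (suc i) eq = last p i (suc-injective eq)

    closing : ∀ i j → toℕ i ≡ length xs → toℕ j ≡ 0 → Edge G (List.lookup (x ∷ xs) i) (List.lookup (x ∷ xs) j)
    closing i zero eq _ = subst (λ z → Edge G z x) (sym (last p i eq)) e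

  -- The walk may use the edge backwards, but never from x to y.
  edge+walk⇒cycle : ∀ {x y l} → Edge G x y → RWalk (λ a b → Edge G a b × ¬ (a ≡ x × b ≡ y)) x y l →
                    ∃ λ k → k ≤ suc l × HasCycle G k
  edge+walk⇒cycle {x} {y} e p with simplify p
  ... | [] , end , _ = contradiction e (edge-irr G)
  ... | _ ∷ [] , step (_ , ¬xy) end , _ = contradiction (refl , refl) ¬xy
  ... | z ∷ w ∷ xs , q , u , le = _ , s≤s le , close-path (forget q) u (edge-sym G e) (s≤s (s≤s z≤n))
    where
    forget : ∀ {a xs b} → Path (λ a b → Edge G a b × ¬ (a ≡ x × b ≡ y)) a xs b → Path (Edge G) a xs b
    forget end              = end
    forget (step (e , _) p) = step e (forget p)

  closed⇒cycle : ∀ (p : ℕ → Fin n) m → 2 ≤ m → (∀ i → i < m → Edge G (p i) (p (suc i))) → Edge G (p m) (p 0) →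
                 (∀ i j → i < j → j ≤ m → p i ≢ p j) → HasCycle G (suc m)
  closed⇒cycle p m 2≤m e e′ inj = s≤s 2≤m , p ∘ toℕ , (λ {i} {j} → injective i j)
    , (λ i j eq → subst (λ t → Edge G (p (toℕ i)) (p t)) (sym eq) (e (toℕ i) (s≤s⁻¹ (subst (_< suc m) eq (toℕ<n j)))))
    , (λ i j eq eq′ → subst₂ (λ s t → Edge G (p s) (p t)) (sym eq) (sym eq′) e′)
    where
    injective : ∀ (i j : Fin (suc m)) → p (toℕ i) ≡ p (toℕ j) → i ≡ j
    injective i j eq with <-cmp (toℕ i) (toℕ j)
    ... | tri< i<j _ _ = contradiction eq (inj _ _ i<j (s≤s⁻¹ (toℕ<n j)))
    ... | tri≈ _ i≡j _ = toℕ-injective i≡j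
    ... | tri> _ _ j<i = contradiction (sym eq) (inj _ _ j<i (s≤s⁻¹ (toℕ<n i)))

  -- A cycle unrolled to a sequence on ℕ: rotations become shifts of the index, and wrapping around
  -- is the equation `period`.
  record Periodic (g : ℕ) (c : ℕ → Fin n) : Set where
    field
      link     : ∀ i → Edge G (c i) (c (suc i))
      period   : ∀ i → c (g + i) ≡ c i
      distinct : ∀ i j → i < j → j < i + g → c i ≢ c j

  open Periodic

  rotate : ∀ {g c} k → Periodic g c → Periodic g (λ i → c (k + i))
  rotate {g} {c} k P = record
    { link = λ i → subst (λ t → Edge G (c (k + i)) (c t)) (sym (+-suc k i)) (link P (k + i))
    ; period = λ i → trans (cong c (lemma k g i)) (period P (k + i))
    ; distinct = λ i j i<j j< → distinct P (k + i) (k + j) ((linear 3 (λ k i j → (i :< j) ∷ [] ⊢ k :+ i :< k :+ j) ((1 ∷ 1 ∷ []) , [])) k i j i<j)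
        ((linear 4 (λ k i j g → (j :< i :+ g) ∷ [] ⊢ k :+ j :< k :+ i :+ g) ((1 ∷ 1 ∷ []) , [])) k i j g j<) }
    where
    lemma : ∀ k g i → k + (g + i) ≡ g + (k + i)
    lemma = solve-∀

  cycle⇒periodic : ∀ {g} → HasCycle G g → ∃ (Periodic g)
  cycle⇒periodic {suc g-1} (_ , f , inj , e , e′) = c , record { link = lk ; period = λ i → c-cong (g + i) i (per i) ; distinct = dst }
    where
    g = suc g-1
    pos : ℕ → Fin g
    pos i = fromℕ< (m%n<n i g)
    c : ℕ → Fin n
    c i = f (pos i)
    pos-cong : ∀ i j → i % g ≡ j % g → pos i ≡ pos j
    pos-cong i j eq = toℕ-injective (trans (toℕ-fromℕ< (m%n<n i g)) (trans eq (sym (toℕ-fromℕ< (m%n<n j g)))))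
    c-cong : ∀ i j → i % g ≡ j % g → c i ≡ c j
    c-cong i j eq = cong f (pos-cong i j eq)
    per : ∀ i → (g + i) % g ≡ i % g
    per i = trans (cong (_% g) (+-comm g i)) ([m+n]%n≡m%n i g)
    mod-< : ∀ q r → r < g → (q * g + r) % g ≡ r
    mod-< q r r<g = trans (cong (_% g) (+-comm (q * g) r)) (trans ([m+kn]%n≡m%n r q g) (m<n⇒m%n≡m r<g))
    shape : ∀ i → i ≡ i / g * g + i % g
    shape i = trans (m≡m%n+[m/n]*n i g) (+-comm (i % g) (i / g * g))
    next : ∀ i → suc (i % g) < g → suc i % g ≡ suc (i % g)
    next i lt = trans (cong (_% g) (trans (cong suc (shape i)) (sym (+-suc (i / g * g) (i % g))))) (mod-< (i / g) (suc (i % g)) lt)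
    wrap : ∀ i → suc (i % g) ≡ g → suc i % g ≡ 0
    wrap i eq = trans (cong (_% g) (trans (cong suc (shape i)) (trans (sym (+-suc (i / g * g) (i % g)))
      (trans (cong (i / g * g +_) eq) (lemma (i / g) g))))) (mod-< (suc (i / g)) 0 z<s)
      where
      lemma : ∀ q g → q * g + g ≡ g + q * g + 0
      lemma = solve-∀
    lk : ∀ i → Edge G (c i) (c (suc i))
    lk i with suc (i % g) <? g
    ... | yes lt = e (pos i) (pos (suc i)) (trans (toℕ-fromℕ< _) (trans (next i lt) (cong suc (sym (toℕ-fromℕ< (m%n<n i g))))))
    ... | no ≥ = let last = ≤-antisym (m%n<n i g) (≮⇒≥ ≥) in
      e′ (pos i) (pos (suc i)) (trans (toℕ-fromℕ< _) (suc-injective last)) (trans (toℕ-fromℕ< _) (wrap i last))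
    shift : ∀ r d q → r < g → 0 < d → d < g → (q * g + (r + d)) % g ≢ r
    shift r d q r<g 0<d d<g eq with r + d <? g
    ... | yes lt = (linear 2 (λ r d → (con 0 :< d) ∷ (r :+ d :≡ r) ∷ [] ⊢ absurd) ((1 ∷ 1 ∷ 0 ∷ []) , [])) r d 0<d (trans (sym (mod-< q (r + d) lt)) eq)
    ... | no ≥ = let s = (r + d) ∸ g ; g+s = m+[n∸m]≡n (≮⇒≥ ≥) in
      (linear 4 (λ r d g s → (g :+ s :≡ r :+ d) ∷ (s :≡ r) ∷ (d :< g) ∷ [] ⊢ absurd) ((1 ∷ 0 ∷ 0 ∷ 1 ∷ 1 ∷ []) , [])) r d g s g+s
        (trans (sym (trans (cong (_% g) (trans (cong (q * g +_) (sym g+s)) (lemma q g s)))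
          (mod-< (suc q) s ((linear 4 (λ r d g s → (g :+ s :≡ r :+ d) ∷ (r :< g) ∷ (d :< g) ∷ [] ⊢ s :< g) ((1 ∷ 1 ∷ 0 ∷ 1 ∷ 1 ∷ []) , [])) r d g s g+s r<g d<g)))) eq) d<g
      where
      lemma : ∀ q g s → q * g + (g + s) ≡ g + q * g + s
      lemma = solve-∀
    dst : ∀ i j → i < j → j < i + g → c i ≢ c j
    dst i j i<j j<i+g eq = shift (i % g) d (i / g) (m%n<n i g)
      ((linear 3 (λ i j d → (i :+ d :≡ j) ∷ (i :< j) ∷ [] ⊢ con 0 :< d) ((1 ∷ 0 ∷ 1 ∷ 1 ∷ []) , [])) i j d i+d i<j) ((linear 4 (λ i j d g → (i :+ d :≡ j) ∷ (j :< i :+ g) ∷ [] ⊢ d :< g) ((1 ∷ 1 ∷ 0 ∷ 1 ∷ []) , [])) i j d g i+d j<i+g)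
      (trans (cong (_% g) (trans (sym (+-assoc (i / g * g) (i % g) d)) (trans (cong (_+ d) (sym (shape i))) i+d)))
        (sym (trans (sym (toℕ-fromℕ< (m%n<n i g))) (trans (cong toℕ (inj eq)) (toℕ-fromℕ< (m%n<n j g))))))
      where
      d = j ∸ i
      i+d : i + d ≡ j
      i+d = m+[n∸m]≡n (<⇒≤ i<j)

-- Leaves and ears

extend : ∀ {A : Set} → (ℕ → A) → ℕ → A → ℕ → A
extend p t z i = if i ≤ᵇ t then p i else z

extend-old : ∀ {A : Set} (p : ℕ → A) {t} z {i} → i ≤ t → extend p t z i ≡ p i
extend-old p {t} z {i} i≤t with i ≤ᵇ t | ≤⇒≤ᵇ i≤t
... | true | _ = refl

extend-new : ∀ {A : Set} (p : ℕ → A) t z → extend p t z (suc t) ≡ z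
extend-new p t z with suc t ≤ᵇ t in eq
... | true  = contradiction (≤ᵇ⇒≤ (suc t) t (subst T (sym eq) tt)) (<-irrefl refl)
... | false = refl

Unique-window : ∀ {n} (p : ℕ → Fin n) k → (∀ i j → i < j → j < k → p i ≢ p j) → Unique (applyUpTo p k)
Unique-window p k inj = Unique.applyUpTo⁺₁ p k (λ {i} {j} → inj i j)

module _ {n} (G : Graph n) where

  -- Degree at least two. In a connected graph with a cycle the other vertices are exactly the
  -- leaves.
  Inner : Fin n → Set
  Inner x = ∃₂ λ a b → a ≢ b × Edge G x a × Edge G x b

  inner? : ∀ x → Dec (Inner x)
  inner? x = any? λ a → any? λ b → ¬? (a Fin.≟ b) ×-dec edge? G x a ×-dec edge? G x b

  leaf-unique : ∀ {x a b} → ¬ Inner x → Edge G x a → Edge G x b → a ≡ b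
  leaf-unique {a = a} {b} leaf xa xb with a Fin.≟ b
  ... | yes a≡b = a≡b
  ... | no a≢b  = contradiction (a , b , a≢b , xa , xb) leaf

  -- The count `fits` rests on the vertices of `S` being distinct, which is known where ears are
  -- built; it is stored for the counting argument on bridges.
  record Ear (S : List (Fin n)) : Set where
    field
      m       : ℕ
      p       : ℕ → Fin n
      start   : p 0 ∈ S
      finish  : p (suc m) ∈ S
      links   : ∀ i → i ≤ m → Edge G (p i) (p (suc i))
      outside : ∀ i → 0 < i → i ≤ m → p i ∉ S
      inj     : ∀ i j → i < j → j ≤ m → p i ≢ p j
      ends    : p 0 ≢ p (suc m)
      fits    : m + length S ≤ n

periodic-neighbours : ∀ {n} (G : Graph n) {g c} → Periodic G g c → 3 ≤ g → ∀ i →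
  c (suc i) ≢ c (i + (g ∸ 1)) × Edge G (c i) (c (suc i)) × Edge G (c i) (c (i + (g ∸ 1)))
periodic-neighbours G {g} {c} C 3≤g i = distinct (suc i) (i + (g ∸ 1)) ((linear 3 (λ i g h → (h :+ con 1 :≡ g) ∷ (con 3 :≤ g) ∷ [] ⊢ con 1 :+ i :< i :+ h) ((1 ∷ 0 ∷ 1 ∷ 1 ∷ []) , [])) i g _ g-1 3≤g)
      ((linear 3 (λ i g h → (h :+ con 1 :≡ g) ∷ [] ⊢ i :+ h :< con 1 :+ i :+ g) ((1 ∷ 1 ∷ 0 ∷ []) , [])) i g _ g-1)
  , link i
  , edge-sym G (subst (Edge G (c (i + (g ∸ 1)))) (trans (cong c (lemma i g _ g-1)) (period i)) (link (i + (g ∸ 1))))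
  where
  open Periodic C
  g-1 : (g ∸ 1) + 1 ≡ g
  g-1 = trans (+-comm (g ∸ 1) 1) (m+[n∸m]≡n (≤-trans (s≤s z≤n) 3≤g))
  lemma : ∀ i g h → h + 1 ≡ g → suc (i + h) ≡ g + i
  lemma i g h = (linear 3 (λ i g h → (h :+ con 1 :≡ g) ∷ [] ⊢ con 1 :+ (i :+ h) :≡ g :+ i) ((1 ∷ 1 ∷ 0 ∷ []) , (1 ∷ 0 ∷ 1 ∷ []))) i g h

module LeafMetric {n} (G : Graph n) (conn : Connected G) where

  open Metric G conn public

  leaf-dist : ∀ {x y} z → ¬ Inner G x → Edge G x y → z ≢ x → dist z x ≡ suc (dist z y)
  leaf-dist {x} {y} z leaf xy z≢x with dist z x in eq
  ... | zero = contradiction (dist-zero eq) z≢x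
  ... | suc d with dist-pred eq
  ...   | w , wx , zw with leaf-unique G leaf xy (edge-sym G wx)
  ...     | refl = cong suc (sym zw)

  dist≤1 : ∀ {x y} → dist x y ≤ 1 → x ≡ y ⊎ Edge G x y
  dist≤1 {x} {y} le with dist x y in eq
  ... | zero = inj₁ (dist-zero eq)
  ... | suc zero with dist-pred eq
  ...   | w , wy , xw with dist-zero xw
  ...     | refl = inj₂ wy
  dist≤1 (s≤s ()) | suc (suc d)

module Shape {n} (G : Graph n) (conn : Connected G) {g} (girth : ∀ k → HasCycle G k → g ≤ k) (4≤g : 4 ≤ g)
  {c} (C : Periodic G g c) where

  open LeafMetric G conn public
  open Periodic C

  detour : ∀ {x y l} → Edge G x y → RWalk (λ a b → Edge G a b × ¬ (a ≡ x × b ≡ y)) x y l → g ≤ suc l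
  detour e p = let k , k≤ , cyc = edge+walk⇒cycle G e p in ≤-trans (girth k cyc) k≤

  no-triangle : ∀ {a b d} → Edge G a b → Edge G b d → ¬ Edge G a d
  no-triangle {a} {b} {d} ab bd ad = contradiction (≤-trans 4≤g (detour ad
    (cons (ab , λ { (_ , refl) → edge-irr G bd }) (cons (bd , λ { (refl , _) → edge-irr G ab }) nil))))
    λ { (s≤s (s≤s (s≤s ()))) }

  cycle-neighbours : ∀ i → c (suc i) ≢ c (i + (g ∸ 1)) × Edge G (c i) (c (suc i)) × Edge G (c i) (c (i + (g ∸ 1)))
  cycle-neighbours = periodic-neighbours G C (≤-trans (n≤1+n 3) 4≤g)

  cycle-inner : ∀ i → Inner G (c i)
  cycle-inner i = c (suc i) , c (i + (g ∸ 1)) , cycle-neighbours i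

  distinct< : ∀ i j → i < j → j < 4 + i → c i ≢ c j
  distinct< i j i<j j< = distinct i j i<j ((linear 3 (λ i j g → (j :< con 4 :+ i) ∷ (con 4 :≤ g) ∷ [] ⊢ j :< i :+ g) ((1 ∷ 1 ∷ 1 ∷ []) , [])) i j g j< 4≤g)

  -- A vertex adjacent to two consecutive vertices of C would create a triangle.
  cycle-far : ∀ y → ∃ λ i → 2 ≤ dist y (c i)
  cycle-far y with 2 ≤? dist y (c 0) | 2 ≤? dist y (c 1) | 2 ≤? dist y (c 2) | 2 ≤? dist y (c 3)
  ... | yes p | _ | _ | _ = 0 , p
  ... | _ | yes p | _ | _ = 1 , p
  ... | _ | _ | yes p | _ = 2 , p
  ... | _ | _ | _ | yes p = 3 , p
  ... | no p₀ | no p₁ | no p₂ | no p₃ = ⊥-elim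
    (case near p₀ , near p₁ , near p₂ , near p₃ of λ
      { (inj₂ e₀ , inj₂ e₁ , _ , _) → no-triangle e₀ (link 0) e₁
      ; (_ , _ , inj₂ e₂ , inj₂ e₃) → no-triangle e₂ (link 2) e₃
      ; (inj₁ y≡ , _ , inj₁ y≡′ , _) → distinct< 0 2 z<s (s<s (s<s z<s)) (trans (sym y≡) y≡′)
      ; (inj₁ y≡ , _ , _ , inj₁ y≡′) → distinct< 0 3 z<s (s<s (s<s (s<s z<s))) (trans (sym y≡) y≡′)
      ; (_ , inj₁ y≡ , inj₁ y≡′ , _) → distinct< 1 2 (s<s z<s) (s<s (s<s z<s)) (trans (sym y≡) y≡′)
      ; (_ , inj₁ y≡ , _ , inj₁ y≡′) → distinct< 1 3 (s<s z<s) (s<s (s<s (s<s z<s))) (trans (sym y≡) y≡′) })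
    where
    near : ∀ {i} → ¬ 2 ≤ dist y (c i) → y ≡ c i ⊎ Edge G y (c i)
    near ¬2≤ = dist≤1 (s≤s⁻¹ (≰⇒> ¬2≤))

  -- A walk that enters a leaf has to return along the same edge, so excursions to leaves can be cut
  -- out. The first remaining vertex outside `S` is then inner and is entered directly from `S`.
  exit : ∀ {S x z k} → x ∈ S → Inner G z → z ∉ S → Walk G x z k →
         ∃₂ λ h w → h ∈ S × w ∉ S × Edge G h w × Inner G w
  exit x∈ _ z∉ nil = contradiction x∈ z∉
  exit {S} {x} x∈ iz z∉ (cons {w = w} e p) with Any.any? (w Fin.≟_) S | inner? G w
  ... | yes w∈ | _ = exit w∈ iz z∉ p
  ... | no w∉ | yes iw = x , w , x∈ , w∉ , e , iw
  ... | no w∉ | no ¬iw with p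
  ...   | nil = contradiction iz ¬iw
  ...   | cons e′ p′ with leaf-unique G ¬iw (edge-sym G e) e′
  ...     | refl = exit x∈ iz z∉ p′

  module _ (next : ∀ {z} y → Inner G z → ∃ λ w → Edge G z w × w ≢ y × Inner G w)
           (S : List (Fin n)) (uniqueS : Unique S) (large : suc n < g + length S) where

    -- The t + 1 vertices outside `S` number at most n - |S| < g - 1, so a cycle closed by the next
    -- step would have at most t + 2 < g vertices. The non-backtracking walk therefore never meets
    -- itself and, being bounded by n, has to meet `S` again.
    explore : ∀ fuel t (p : ℕ → Fin n) → suc n ≤ suc t + fuel → p 0 ∈ S →
              (∀ i → i ≤ t → Edge G (p i) (p (suc i))) → (∀ i → 0 < i → i ≤ suc t → p i ∉ S) →
              (∀ i j → i < j → j ≤ suc t → p i ≢ p j) → Inner G (p (suc t)) → ∃ λ (E : Ear G S) → 0 < Ear.m E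
    explore fuel t p fuel≥ start links outside inj inner = go fuel fuel≥
      where
      interior : List (Fin n)
      interior = applyUpTo (p ∘ suc) (suc t)

      fits : suc t + length S ≤ n
      fits = subst (_≤ n) (trans (length-++ interior) (cong (_+ length S) (length-applyUpTo (p ∘ suc) (suc t))))
        (Unique⇒length≤ (Unique.++⁺ (Unique-window (p ∘ suc) (suc t) λ i j i<j j< → inj _ _ (s≤s i<j) j<) uniqueS
          λ { (z∈ , z∈S) → let i , i< , z≡ = ∈-applyUpTo⁻ (p ∘ suc) z∈ in outside (suc i) z<s i< (subst (_∈ S) z≡ z∈S) }))

      short-cycle : ∀ {k} → k ≤ suc (suc t) → ¬ HasCycle G k
      short-cycle {k} k≤ cyc = (linear 5 (λ n g s t k → (con 1 :+ n :< g :+ s) ∷ (con 1 :+ t :+ s :≤ n) ∷ (k :≤ con 1 :+ (con 1 :+ t)) ∷ (g :≤ k) ∷ [] ⊢ absurd) ((1 ∷ 1 ∷ 1 ∷ 1 ∷ []) , []))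
        n g (length S) t k large fits k≤ (girth k cyc)

      module _ {w} (e : Edge G (p (suc t)) w) where
        p′ : ℕ → Fin n
        p′ = extend p (suc t) w
        old : ∀ {i} → i ≤ suc t → p′ i ≡ p i
        old = extend-old p w
        new : p′ (suc (suc t)) ≡ w
        new = extend-new p (suc t) w
        links′ : ∀ i → i ≤ suc t → Edge G (p′ i) (p′ (suc i))
        links′ i i≤ with i ≤? t
        ... | yes i≤t = subst₂ (Edge G) (sym (old i≤)) (sym (old (s≤s i≤t))) (links i i≤t)
        ... | no i≰t with ≤-antisym i≤ (≰⇒> i≰t)
        ...   | refl = subst₂ (Edge G) (sym (old ≤-refl)) (sym new) e
        outside′ : ∀ i → 0 < i → i ≤ suc t → p′ i ∉ S
        outside′ i 0<i i≤ = subst (_∉ S) (sym (old i≤)) (outside i 0<i i≤)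
        inj′ : ∀ i j → i < j → j ≤ suc t → p′ i ≢ p′ j
        inj′ i j i<j j≤ eq = inj i j i<j j≤ (trans (sym (old (≤-trans (<⇒≤ i<j) j≤))) (trans eq (old j≤)))

      go : ∀ fuel → suc n ≤ suc t + fuel → ∃ λ (E : Ear G S) → 0 < Ear.m E
      go zero enough = ⊥-elim ((linear 3 (λ n s t → (con 1 :+ n :≤ con 1 :+ t :+ con 0) ∷ (con 1 :+ t :+ s :≤ n) ∷ [] ⊢ absurd) ((1 ∷ 1 ∷ []) , [])) n (length S) t enough fits)
      go (suc fuel) enough with next (p t) inner
      ... | w , e , w≢ , iw with Any.any? (w Fin.≟_) S
      ...   | yes w∈ = record
        { m = suc t ; p = p′ e ; start = subst (_∈ S) (sym (old e z≤n)) start ; finish = subst (_∈ S) (sym (new e)) w∈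
        ; links = links′ e ; outside = outside′ e ; inj = inj′ e ; fits = fits
        ; ends = λ eq → ends (trans (sym (old e z≤n)) (trans eq (new e))) } , z<s
        where
        -- Coming back to the starting point would close a short cycle; for t = 0 it would be a step
        -- backwards, which `next` rules out.
        ends : p 0 ≢ w
        ends refl = case 1 ≤? t of λ
          { (yes 1≤t) → short-cycle ≤-refl (closed⇒cycle G p (suc t) (s≤s 1≤t) (λ i i< → links i (s≤s⁻¹ i<)) e inj)
          ; (no 1≰t) → w≢ (cong p (sym (≤-antisym (s≤s⁻¹ (≰⇒> 1≰t)) z≤n))) }
      ...   | no w∉S with Any.any? (w Fin.≟_) interior
      ...     | no w∉ = explore fuel (suc t) (p′ e) (subst (suc n ≤_) (cong suc (+-suc t fuel)) enough)
        (subst (_∈ S) (sym (old e z≤n)) start) (links′ e)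
        (λ i 0<i i≤ → case i ≤? suc t of λ
          { (yes i≤t) → outside′ e i 0<i i≤t
          ; (no i≰t) → subst (_∉ S) (sym (trans (cong (p′ e) (≤-antisym i≤ (≰⇒> i≰t))) (new e))) w∉S })
        (λ i j i<j j≤ → case j ≤? suc t of λ
          { (yes j≤t) → inj′ e i j i<j j≤t
          ; (no j≰t) eq → fresh i (s≤s⁻¹ (≤-trans i<j j≤)) (trans (sym (old e (s≤s⁻¹ (≤-trans i<j j≤))))
                            (trans eq (trans (cong (p′ e) (≤-antisym j≤ (≰⇒> j≰t))) (new e)))) })
        (subst (Inner G) (sym (new e)) iw)
        where
        fresh : ∀ i → i ≤ suc t → p i ≢ w
        fresh zero    _  eq = w∉S (subst (_∈ S) eq start)
        fresh (suc i) i≤ eq = w∉ (subst (_∈ interior) eq (∈-applyUpTo⁺ (p ∘ suc) i≤))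
      ...     | yes w∈ with ∈-applyUpTo⁻ (p ∘ suc) w∈
      ...       | j , j<suct , refl = ⊥-elim (short-cycle (s≤s (≤-trans k≤ (n≤1+n t)))
        (closed⇒cycle G (λ i → p (suc j + i)) k 2≤k
          (λ i i<k → subst (λ s → Edge G (p (suc j + i)) (p s)) (sym (+-suc (suc j) i))
            (links (suc j + i) ((linear 4 (λ j k t i → (j :+ k :≡ t) ∷ (i :< k) ∷ [] ⊢ con 1 :+ j :+ i :≤ t) ((1 ∷ 1 ∷ 0 ∷ 1 ∷ []) , [])) j k t i j+k i<k)))
          (subst₂ (Edge G) (cong p (cong suc (sym j+k))) (cong p (cong suc (sym (+-identityʳ j)))) e)
          (λ i i′ i<i′ i′≤k → inj (suc j + i) (suc j + i′) ((linear 3 (λ i i′ j → (i :< i′) ∷ [] ⊢ con 1 :+ j :+ i :< con 1 :+ j :+ i′) ((1 ∷ 1 ∷ []) , [])) i i′ j i<i′)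
            ((linear 4 (λ j k t i → (j :+ k :≡ t) ∷ (i :≤ k) ∷ [] ⊢ con 1 :+ j :+ i :≤ con 1 :+ t) ((1 ∷ 1 ∷ 0 ∷ 1 ∷ []) , [])) j k t i′ j+k i′≤k))))
        where
        k = t ∸ j
        j+k : j + k ≡ t
        j+k = m+[n∸m]≡n (s≤s⁻¹ j<suct)
        k≤ : k ≤ t
        k≤ = m∸n≤m t j
        2≤k : 2 ≤ k
        2≤k with k | j+k
        ... | zero        | eq = contradiction (subst (Edge G (p (suc t))) (cong (p ∘ suc) (trans (sym (+-identityʳ j)) eq)) e) (edge-irr G)
        ... | suc zero    | eq = contradiction (cong p (trans (+-comm 1 j) eq)) w≢
        ... | suc (suc k) | _  = s≤s (s≤s z≤n)

    find-ear : ∀ {x z} → x ∈ S → Inner G z → z ∉ S → ∃ λ (E : Ear G S) → 0 < Ear.m E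
    find-ear {x} {z} x∈ iz z∉ with exit x∈ iz z∉ (dist-walk x z)
    ... | h , w , h∈ , w∉ , e , iw = explore n 0 p ≤-refl h∈ (λ { zero _ → e }) outside inj iw
      where
      p : ℕ → Fin n
      p zero    = h
      p (suc _) = w
      outside : ∀ i → 0 < i → i ≤ 1 → p i ∉ S
      outside (suc i) _ _ = w∉
      inj : ∀ i j → i < j → j ≤ 1 → p i ≢ p j
      inj zero    (suc j)       _ _ eq = w∉ (subst (_∈ S) eq h∈)
      inj (suc i) (suc zero)    (s≤s ()) _
      inj (suc i) (suc (suc j)) _ (s≤s ())

module Leaves {n} (G : Graph n) (conn : Connected G) {g} (girth : ∀ k → HasCycle G k → g ≤ k) (4≤g : 4 ≤ g)
  {c} (C : Periodic G g c) where

  open Shape G conn girth 4≤g C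
  open Periodic C

  swap-poles : ∀ {u v r} → Poles u v r → Poles v u r
  swap-poles {u} {v} P = record
    { apart = trans (dist-sym v u) apart
    ; near = λ x y → case near x y of λ { (inj₁ le) → inj₁ le ; (inj₂ (inj₁ e)) → inj₂ (inj₂ e) ; (inj₂ (inj₂ e)) → inj₂ (inj₁ e) }
    ; far = λ x x≢v x≢u → far x x≢u x≢v }
    where open Poles P

  module _ {u v r} (P : Poles u v r) where
    open Poles P

    dist> : ∀ {x y} → r < dist x y → (x ≡ u × y ≡ v) ⊎ (x ≡ v × y ≡ u)
    dist> {x} {y} r< with near x y
    ... | inj₁ le = contradiction le (<⇒≱ r<)
    ... | inj₂ eq = eq

    far-from : ∀ x → ∃ λ y → r ≤ dist x y
    far-from x with x Fin.≟ u | x Fin.≟ v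
    ... | yes refl | _ = v , subst (r ≤_) (sym apart) (n≤1+n r)
    ... | _ | yes refl = u , subst (r ≤_) (sym (trans (dist-sym x u) apart)) (n≤1+n r)
    ... | no x≢u | no x≢v = far x x≢u x≢v

    -- Without triangles, vertices two apart on the cycle are at distance at least two. For r < 2
    -- the disjoint pairs `c 0`, `c 2` and `c 1`, `c 3` would both be the pair of poles.
    2≤r : 2 ≤ r
    2≤r = ≮⇒≥ λ r<2 → case far-pair r<2 0 , far-pair r<2 1 of λ
      { (inj₁ (p , _) , inj₁ (q , _)) → distinct< 0 1 z<s (s<s z<s) (trans p (sym q))
      ; (inj₁ (p , _) , inj₂ (_ , q)) → distinct< 0 3 z<s (s<s (s<s (s<s z<s))) (trans p (sym q))
      ; (inj₂ (p , _) , inj₁ (_ , q)) → distinct< 0 3 z<s (s<s (s<s (s<s z<s))) (trans p (sym q))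
      ; (inj₂ (p , _) , inj₂ (q , _)) → distinct< 0 1 z<s (s<s z<s) (trans p (sym q)) }
      where
      far-pair : r < 2 → ∀ i → (c i ≡ u × c (2 + i) ≡ v) ⊎ (c i ≡ v × c (2 + i) ≡ u)
      far-pair r<2 i with near (c i) (c (2 + i))
      ... | inj₂ eq = eq
      ... | inj₁ le with dist≤1 (≤-trans le (s≤s⁻¹ r<2))
      ...   | inj₁ eq = contradiction eq (distinct< i (2 + i) (s≤s (n≤1+n i)) (s≤s (s≤s (s≤s (n≤1+n i)))))
      ...   | inj₂ e = contradiction e (no-triangle (link i) (link (suc i)))

    -- A vertex at distance at least r from the neighbour of a leaf is at distance at least r + 1
    -- from the leaf; it is not the leaf itself because r ≥ 2.
    leaf⇒pole : ∀ {x} → ¬ Inner G x → x ≡ u ⊎ x ≡ v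
    leaf⇒pole {x} leaf with far-from x
    ... | z , r≤ with dist z x in eq
    ...   | zero = contradiction (subst (r ≤_) (trans (dist-sym x z) eq) r≤) (<⇒≱ (≤-trans (s≤s z≤n) 2≤r))
    ...   | suc d with dist-pred eq
    ...     | y , yx , _ with far-from y
    ...       | w , r≤′ with w Fin.≟ x
    ...         | yes refl = contradiction (≤-trans r≤′ (dist-edge yx)) (<⇒≱ 2≤r)
    ...         | no w≢x with dist> (subst (r <_) (sym (leaf-dist w leaf (edge-sym G yx) w≢x)) (s≤s (subst (r ≤_) (dist-sym y w) r≤′)))
    ...           | inj₁ (_ , x≡v) = inj₂ x≡v
    ...           | inj₂ (_ , x≡u) = inj₁ x≡u

    -- Otherwise the eccentricity would drop by two from the leaf u to y.
    no-pendant-path : ∀ {z y} → ¬ Inner G u → Edge G u z → Inner G z → (∀ w → Edge G z w → w ≡ y ⊎ w ≡ u) → ⊥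
    no-pendant-path {z} {y} leaf uz iz nbrs = case far-from y of λ (t , r≤) → case (t Fin.≟ u) , (t Fin.≟ z) of λ
      { (no t≢u , no t≢z) → conclude t t≢u t≢z r≤
      ; (_ , yes refl) → contradiction (≤-trans r≤ (dist-edge (edge-sym G zy))) (<⇒≱ 2≤r)
      -- Since `u` is within two steps of `y`, this case means r ≤ 2, and a cycle vertex at distance
      -- at least two from `y` serves instead of `u`.
      ; (yes refl , _) → let i , 2≤ = cycle-far y in
          conclude (c i) (λ eq → leaf (subst (Inner G) eq (cycle-inner i))) (off-cycle i)
            (≤-trans (≤-trans r≤ (dist-min (cons (edge-sym G zy) (cons (edge-sym G uz) nil)))) 2≤) }
      where
      z≢u : z ≢ u
      z≢u refl = edge-irr G uz

      zy : Edge G z y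
      zy = let a , b , a≢b , za , zb = iz in case nbrs a za , nbrs b zb of λ
        { (inj₁ refl , _) → za ; (_ , inj₁ refl) → zb ; (inj₂ p , inj₂ q) → contradiction (trans p (sym q)) a≢b }

      off-cycle : ∀ i → c i ≢ z
      off-cycle i refl with cycle-neighbours i
      ... | ends≢ , fore , back with nbrs _ fore | nbrs _ back
      ...   | inj₂ eq | _ = leaf (subst (Inner G) eq (cycle-inner (suc i)))
      ...   | _ | inj₂ eq = leaf (subst (Inner G) eq (cycle-inner (i + (g ∸ 1))))
      ...   | inj₁ p | inj₁ q = ends≢ (trans p (sym q))

      -- A geodesic from `t` to `z` arrives through `y`, as `u` is a dead end. Hence `t` and `z` are
      -- more than r apart and are the poles, although neither of them is the pole `u`.
      conclude : ∀ t → t ≢ u → t ≢ z → r ≤ dist y t → ⊥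
      conclude t t≢u t≢z r≤ with dist t z in eq
      ... | zero = t≢z (dist-zero eq)
      ... | suc d with dist-pred eq
      ...   | w , wz , tw with nbrs w (edge-sym G wz)
      ...     | inj₁ refl with dist> (subst (r <_) (sym eq) (s≤s (subst (r ≤_) (trans (dist-sym w t) tw) r≤)))
      ...       | inj₁ (t≡u , _) = t≢u t≡u
      ...       | inj₂ (_ , z≡u) = z≢u z≡u
      conclude t t≢u t≢z r≤ | suc d | w , wz , tw | inj₂ refl =
        (linear 1 (λ d → (d :≡ con 1 :+ (con 1 :+ d)) ∷ [] ⊢ absurd) ((0 ∷ 1 ∷ []) , [])) d (trans (sym tw) (trans (leaf-dist t leaf uz t≢u) (cong suc eq)))

    -- A second leaf at `z` would be the other pole, at distance two from `u` instead of r + 1 ≥ 3.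
    -- So `u` is the only leaf at `z`, and `no-pendant-path` applies.
    pendant-step : ∀ {z y w} → ¬ Inner G w → w ≡ u → Edge G z w → Inner G z →
                   (∀ w → Edge G z w → w ≡ y ⊎ ¬ Inner G w) → ⊥
    pendant-step {z} {y} leaf refl zu iz nbrs = no-pendant-path leaf (edge-sym G zu) iz nbrs′
      where
      nbrs′ : ∀ w → Edge G z w → w ≡ y ⊎ w ≡ u
      nbrs′ w zw with nbrs w zw
      ... | inj₁ eq = inj₁ eq
      ... | inj₂ leaf′ with leaf⇒pole leaf′
      ...   | inj₁ w≡u = inj₂ w≡u
      ...   | inj₂ refl = ⊥-elim ((linear 2 (λ r d → (con 2 :≤ r) ∷ (d :≡ con 1 :+ r) ∷ (d :≤ con 2) ∷ [] ⊢ absurd) ((1 ∷ 0 ∷ 1 ∷ 1 ∷ []) , [])) r _ 2≤r apart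
                (dist-min (cons (edge-sym G zu) (cons zw nil))))

  next : ∀ {u v r} → Poles u v r → ∀ {z} y → Inner G z → ∃ λ w → Edge G z w × w ≢ y × Inner G w
  next {u} {v} P {z} y iz@(a , b , a≢b , za , zb)
    with any? (λ w → edge? G z w ×-dec ¬? (w Fin.≟ y) ×-dec inner? G w)
  ... | yes found = found
  ... | no none = ⊥-elim (case a Fin.≟ y of λ { (no a≢y) → stuck za a≢y ; (yes refl) → stuck zb (a≢b ∘ sym) })
    where
    nbrs : ∀ w → Edge G z w → w ≡ y ⊎ ¬ Inner G w
    nbrs w zw with w Fin.≟ y | inner? G w
    ... | yes eq | _ = inj₁ eq
    ... | no w≢y | yes iw = contradiction (w , zw , w≢y , iw) none
    ... | no _ | no leaf = inj₂ leaf
    stuck : ∀ {w} → Edge G z w → w ≢ y → ⊥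
    stuck {w} zw w≢y with nbrs w zw
    ... | inj₁ eq = w≢y eq
    ... | inj₂ leaf with leaf⇒pole P leaf
    ...   | inj₁ w≡u = pendant-step P leaf w≡u zw iz nbrs
    ...   | inj₂ w≡v = pendant-step (swap-poles P) leaf w≡v zw iz nbrs

-- Internally disjoint paths ("strands") from P to Q: a cycle for ν = 2, a theta graph for ν = 3.
record Strands {n} (G : Graph n) (ν : ℕ) : Set where
  field
    P Q    : Fin n
    P≢Q    : P ≢ Q
    len    : Fin ν → ℕ
    at     : Fin ν → ℕ → Fin n
    len>0  : ∀ σ → 0 < len σ
    at-0   : ∀ σ → at σ 0 ≡ P
    at-len : ∀ σ → at σ (len σ) ≡ Q
    link   : ∀ σ t → t < len σ → Edge G (at σ t) (at σ (suc t))
    inj    : ∀ σ τ i j → 0 < i → i < len σ → j ≤ len τ → at σ i ≡ at τ j → σ ≡ τ × i ≡ j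

  Along : Fin n → Fin n → Set
  Along x y = ∃₂ λ σ t → t < len σ × (x ≡ at σ t × y ≡ at σ (suc t) ⊎ x ≡ at σ (suc t) × y ≡ at σ t)

  On : Fin n → Set
  On x = ∃₂ λ σ i → i ≤ len σ × x ≡ at σ i

  along-sym : ∀ {x y} → Along x y → Along y x
  along-sym (σ , t , t< , inj₁ (p , q)) = σ , t , t< , inj₂ (q , p)
  along-sym (σ , t , t< , inj₂ (p , q)) = σ , t , t< , inj₁ (q , p)

  along⇒edge : ∀ {x y} → Along x y → Edge G x y
  along⇒edge (σ , t , t< , inj₁ (refl , refl)) = link σ t t<
  along⇒edge (σ , t , t< , inj₂ (refl , refl)) = edge-sym G (link σ t t<)

  at-injective : ∀ σ i j → i ≤ len σ → j ≤ len σ → at σ i ≡ at σ j → i ≡ j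
  at-injective σ zero zero _ _ _ = refl
  at-injective σ (suc i) j i≤ j≤ eq with suc i <? len σ
  ... | yes i< = proj₂ (inj σ σ (suc i) j z<s i< j≤ eq)
  at-injective σ (suc i) zero i≤ j≤ eq | no i≮ =
    contradiction (trans (sym (at-0 σ)) (trans (sym eq) (trans (cong (at σ) (≤-antisym i≤ (≮⇒≥ i≮))) (at-len σ)))) P≢Q
  at-injective σ (suc i) (suc j) i≤ j≤ eq | no i≮ with suc j <? len σ
  ... | yes j< = sym (proj₂ (inj σ σ (suc j) (suc i) z<s j< i≤ (sym eq)))
  ... | no j≮  = trans (≤-antisym i≤ (≮⇒≥ i≮)) (sym (≤-antisym j≤ (≮⇒≥ j≮)))
  at-injective σ zero (suc j) i≤ j≤ eq with suc j <? len σ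
  ... | yes j< = sym (proj₂ (inj σ σ (suc j) zero z<s j< i≤ (sym eq)))
  ... | no j≮  = contradiction (trans (sym (at-0 σ)) (trans eq (trans (cong (at σ) (≤-antisym j≤ (≮⇒≥ j≮))) (at-len σ)))) P≢Q

  P-on : Fin ν → On P
  P-on σ = σ , 0 , z≤n , sym (at-0 σ)

  Q-on : Fin ν → On Q
  Q-on σ = σ , len σ , ≤-refl , sym (at-len σ)

  -- Every inner vertex lies on a strand, and there are no further edges between inner vertices:
  -- the graph consists of the strands and of pendant edges.
  record Exact : Set where
    field
      cover  : ∀ {x} → Inner G x → On x
      exact  : ∀ {x y} → Inner G x → Inner G y → Edge G x y → Along x y
      innerP : Inner G P
      innerQ : Inner G Q

    interior-inner : ∀ σ t → suc t < len σ → Inner G (at σ (suc t))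
    interior-inner σ t t< = at σ t , at σ (suc (suc t))
      , (λ eq → <⇒≢ (n≤1+n _) (at-injective σ t (suc (suc t)) (<⇒≤ (<⇒≤ t<)) t< eq))
      , edge-sym G (link σ t (<⇒≤ t<)) , link σ (suc t) t<

    on-inner : ∀ σ i → i ≤ len σ → Inner G (at σ i)
    on-inner σ zero    _  = subst (Inner G) (sym (at-0 σ)) innerP
    on-inner σ (suc i) i≤ with suc i <? len σ
    ... | yes i< = interior-inner σ i i<
    ... | no i≮  = subst (Inner G) (sym (trans (cong (at σ) (≤-antisym i≤ (≮⇒≥ i≮))) (at-len σ))) innerQ

    interior-edge : ∀ σ t {y} → suc t < len σ → Inner G y → Edge G (at σ (suc t)) y →
                    y ≡ at σ t ⊎ y ≡ at σ (suc (suc t))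
    interior-edge σ t t< iy e with exact (interior-inner σ t t<) iy e
    ... | τ , s , s< , inj₁ (x≡ , refl) with inj σ τ (suc t) s z<s t< (<⇒≤ s<) x≡
    ...   | refl , refl = inj₂ refl
    interior-edge σ t t< iy e | τ , s , s< , inj₂ (x≡ , refl) with inj σ τ (suc t) (suc s) z<s t< s< x≡
    ...   | refl , refl = inj₁ refl

    P-edge : ∀ {y} → Inner G y → Edge G P y → ∃ λ σ → y ≡ at σ 1
    P-edge iy e with exact innerP iy e
    ... | τ , s , s< , inj₁ (P≡ , refl) with at-injective τ 0 s z≤n (<⇒≤ s<) (trans (at-0 τ) P≡)
    ...   | refl = τ , refl
    P-edge iy e | τ , s , s< , inj₂ (P≡ , _) with at-injective τ 0 (suc s) z≤n s< (trans (at-0 τ) P≡)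
    ...   | ()

    Q-edge : ∀ {y} → Inner G y → Edge G Q y → ∃₂ λ σ t → suc t ≡ len σ × y ≡ at σ t
    Q-edge iy e with exact innerQ iy e
    ... | τ , s , s< , inj₂ (Q≡ , refl) = τ , s , sym (at-injective τ (len τ) (suc s) ≤-refl s< (trans (at-len τ) Q≡)) , refl
    ... | τ , s , s< , inj₁ (Q≡ , _) = contradiction
      (at-injective τ s (len τ) (<⇒≤ s<) ≤-refl (trans (sym Q≡) (sym (at-len τ)))) (<⇒≢ s<)

-- Distances in a union of strands

module StrandMetric {n} (G : Graph n) (conn : Connected G) {ν} (S : Strands G ν) where

  open LeafMetric G conn public
  open Strands S public

  dist-P≤ : ∀ σ i → i ≤ len σ → dist P (at σ i) ≤ i
  dist-P≤ σ i i≤ = subst (λ z → dist z (at σ i) ≤ i) (at-0 σ) (dist-along (at σ) 0 i λ t _ t< → link σ t (<-≤-trans t< i≤))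

  dist-same≤ : ∀ σ i k → i + k ≤ len σ → dist (at σ i) (at σ (i + k)) ≤ k
  dist-same≤ σ i k i+k≤ = dist-along (at σ) i k λ t _ t< → link σ t (<-≤-trans t< i+k≤)

  dist-Q≤ : ∀ σ i j → i + j ≡ len σ → dist Q (at σ i) ≤ j
  dist-Q≤ σ i j i+j = subst₂ (λ z w → dist z w ≤ j) (trans (cong (at σ) i+j) (at-len σ)) refl
    (subst (_≤ j) (dist-sym _ _) (dist-same≤ σ i j (≤-reflexive i+j)))

  dist-PQ≤ : ∀ σ → dist P Q ≤ len σ
  dist-PQ≤ σ = subst (λ z → dist P z ≤ len σ) (at-len σ) (dist-P≤ σ (len σ) ≤-refl)

  dist-viaP : ∀ {σ τ i j} → i ≤ len σ → j ≤ len τ → dist (at σ i) (at τ j) ≤ i + j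
  dist-viaP {σ} {τ} {i} {j} i≤ j≤ = ≤-trans (dist-triangle _ P _)
    (+-mono-≤ (subst (_≤ i) (dist-sym _ _) (dist-P≤ σ i i≤)) (dist-P≤ τ j j≤))

  dist-viaQ : ∀ {σ τ i j} i′ j′ → i + i′ ≡ len σ → j + j′ ≡ len τ → dist (at σ i) (at τ j) ≤ i′ + j′
  dist-viaQ {σ} {τ} {i} {j} i′ j′ i+ j+ = ≤-trans (dist-triangle _ Q _)
    (+-mono-≤ (subst (_≤ i′) (dist-sym _ _) (dist-Q≤ σ i i′ i+)) (dist-Q≤ τ j j′ j+))

  dist-viaPQ : ∀ {σ τ i j} j′ ω → i ≤ len σ → j + j′ ≡ len τ → dist (at σ i) (at τ j) ≤ i + (len ω + j′)
  dist-viaPQ {σ} {τ} {i} {j} j′ ω i≤ j+ = ≤-trans (dist-triangle _ P _)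
    (+-mono-≤ (subst (_≤ i) (dist-sym _ _) (dist-P≤ σ i i≤))
      (≤-trans (dist-triangle P Q _) (+-mono-≤ (dist-PQ≤ ω) (dist-Q≤ τ j j′ j+))))

  rest : ∀ {i m} → i ≤ m → ∃ λ j → i + j ≡ m
  rest {i} {m} i≤m = m ∸ i , m+[n∸m]≡n i≤m

  -- The routes through `P` and through `Q` have total length `len σ + len τ`, so the shorter one is
  -- at most half of that.
  dist-half : ∀ {σ τ i j} → i ≤ len σ → j ≤ len τ → 2 * dist (at σ i) (at τ j) ≤ len σ + len τ
  dist-half {σ} {τ} {i} {j} i≤ j≤ =
    let i′ , i+ = rest i≤ ; j′ , j+ = rest j≤ in
    (linear 7 (λ d i j k l x y → (d :≤ i :+ j) ∷ (d :≤ k :+ l) ∷ (i :+ k :≡ x) ∷ (j :+ l :≡ y) ∷ [] ⊢ 2 :* d :≤ x :+ y) ((1 ∷ 1 ∷ 1 ∷ 1 ∷ 0 ∷ 1 ∷ 0 ∷ []) , [])) _ i j i′ j′ (len σ) (len τ)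
      (dist-viaP i≤ j≤) (dist-viaQ i′ j′ i+ j+) i+ j+

  -- The two competing routes are the piece of `σ` between the vertices and the way around through
  -- `P`, `ω` and `Q`; together they have length `len σ + len ω`.
  dist-same-half : ∀ σ ω {i j} → i ≤ len σ → j ≤ len σ → 2 * dist (at σ i) (at σ j) ≤ len σ + len ω
  dist-same-half σ ω {i} {j} i≤ j≤ = case ≤-total i j of λ
    { (inj₁ i≤j) → ordered i≤j j≤
    ; (inj₂ j≤i) → subst (λ d → 2 * d ≤ len σ + len ω) (dist-sym _ _) (ordered j≤i i≤) }
    where
    ordered : ∀ {i j} → i ≤ j → j ≤ len σ → 2 * dist (at σ i) (at σ j) ≤ len σ + len ω
    ordered {i} {j} i≤j j≤ with rest i≤j | rest j≤
    ... | k , refl | l , j+ = (linear 6 (λ d i k l x y → (d :≤ k) ∷ (d :≤ i :+ (y :+ l)) ∷ (i :+ k :+ l :≡ x) ∷ [] ⊢ 2 :* d :≤ x :+ y) ((1 ∷ 1 ∷ 1 ∷ 1 ∷ 0 ∷ []) , [])) _ i k l (len σ) (len ω)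
      (dist-same≤ σ i k j≤) (dist-viaPQ l ω (≤-trans i≤j j≤) j+) j+

  dist-P-half : ∀ {σ i} ω → i ≤ len σ → 2 * dist P (at σ i) ≤ len σ + len ω
  dist-P-half {σ} {i} ω i≤ = subst (λ z → 2 * dist z (at σ i) ≤ len σ + len ω) (at-0 ω)
    (subst (2 * dist (at ω 0) (at σ i) ≤_) (+-comm (len ω) (len σ)) (dist-half z≤n i≤))

  dist-Q-half : ∀ {σ i} ω → i ≤ len σ → 2 * dist Q (at σ i) ≤ len σ + len ω
  dist-Q-half {σ} {i} ω i≤ = subst (λ z → 2 * dist z (at σ i) ≤ len σ + len ω) (at-len ω)
    (subst (2 * dist (at ω (len ω)) (at σ i) ≤_) (+-comm (len ω) (len σ)) (dist-half ≤-refl i≤))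

  module _ (X : Exact) where
    open Exact X

    -- A geodesic from z to the interior of a stretch of a strand enters it through an end.
    segment : ∀ {z} σ lo k → Inner G z → lo + k ≤ len σ → (∀ t → lo < t → t < lo + k → z ≢ at σ t) →
              ∀ m i j → i + j ≡ k → m ≤ dist z (at σ lo) + i → m ≤ dist z (at σ (lo + k)) + j → m ≤ dist z (at σ (lo + i))
    segment {z} σ lo k iz hi≤ z∉ m i j i+j lower upper = go _ m i j i+j lower upper refl
      where
      -- Induction on the distance `d`. The last edge of a geodesic changes `i` by one in either
      -- direction: one of the two bounds keeps its slack, the other gains two, and `m` drops
      -- together with `d`.
      go : ∀ d m i j → i + j ≡ k → m ≤ dist z (at σ lo) + i → m ≤ dist z (at σ (lo + k)) + j →
           dist z (at σ (lo + i)) ≡ d → m ≤ d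
      go d zero i j i+j lower upper eq = z≤n
      go d (suc m) zero j i+j lower upper eq =
        subst (suc m ≤_) (trans (+-identityʳ _) (trans (cong (λ t → dist z (at σ t)) (sym (+-identityʳ lo))) eq)) lower
      go d (suc m) (suc i) zero i+j lower upper eq = subst (suc m ≤_)
        (trans (+-identityʳ _) (trans (cong (λ t → dist z (at σ (lo + t))) (trans (sym i+j) (+-identityʳ (suc i)))) eq)) upper
      go zero (suc m) (suc i) (suc j) i+j lower upper eq = contradiction (dist-zero eq)
        (z∉ (lo + suc i) ((linear 2 (λ i lo → [] ⊢ lo :< lo :+ (con 1 :+ i)) ((1 ∷ []) , [])) i lo)
          ((linear 4 (λ i j k lo → (con 1 :+ i :+ (con 1 :+ j) :≡ k) ∷ [] ⊢ lo :+ (con 1 :+ i) :< lo :+ k) ((1 ∷ 1 ∷ 0 ∷ []) , [])) i j k lo i+j))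
      go (suc d) (suc m) (suc i) (suc j) i+j lower upper eq with dist-pred eq
      ... | w , e , zw with inner? G w
      ...   | no leaf = ⊥-elim ((linear 1 (λ d → (d :≡ con 1 :+ (con 1 :+ d)) ∷ [] ⊢ absurd) ((0 ∷ 1 ∷ []) , [])) d
        (trans (sym zw) (trans (leaf-dist z leaf e (λ { refl → leaf iz })) (cong suc eq))))
      ...   | yes iw with interior-edge σ (lo + i) ((linear 5 (λ i j k lo x → (con 1 :+ i :+ (con 1 :+ j) :≡ k) ∷ (lo :+ k :≤ x) ∷ [] ⊢ con 1 :+ (lo :+ i) :< x) ((1 ∷ 1 ∷ 0 ∷ 1 ∷ []) , [])) i j k lo (len σ) i+j hi≤)
                         iw (subst (λ t → Edge G (at σ t) w) (+-suc lo i) (edge-sym G e))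
      ...     | inj₁ refl = s≤s (go d m i (suc (suc j)) (trans (+-suc i (suc j)) i+j)
        ((linear 3 (λ m x i → (con 1 :+ m :≤ x :+ (con 1 :+ i)) ∷ [] ⊢ m :≤ x :+ i) ((1 ∷ 1 ∷ []) , [])) m _ i lower)
        ((linear 3 (λ m x j → (con 1 :+ m :≤ x :+ (con 1 :+ j)) ∷ [] ⊢ m :≤ x :+ (con 1 :+ (con 1 :+ j))) ((1 ∷ 1 ∷ []) , [])) m _ j upper) zw)
      ...     | inj₂ refl = s≤s (go d m (suc (suc i)) j (trans (sym (+-suc (suc i) j)) i+j)
        ((linear 3 (λ m x i → (con 1 :+ m :≤ x :+ (con 1 :+ i)) ∷ [] ⊢ m :≤ x :+ (con 1 :+ (con 1 :+ i))) ((1 ∷ 1 ∷ []) , [])) m _ i lower)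
        ((linear 3 (λ m x j → (con 1 :+ m :≤ x :+ (con 1 :+ j)) ∷ [] ⊢ m :≤ x :+ j) ((1 ∷ 1 ∷ []) , [])) m _ j upper)
        (trans (cong (λ t → dist z (at σ t)) (trans (+-suc lo (suc i)) (cong suc (+-suc lo i)))) zw))

    -- The vertex before `Q` on a geodesic from `P` lies next to `Q` on some strand. If the distance
    -- δ + 1 of `P` and `Q` were below all strand lengths, `segment` would put this vertex at
    -- distance at least δ + 1 from `P` as well.
    dist-PQ≥ : ∀ m → (∀ σ → m ≤ len σ) → m ≤ dist P Q
    dist-PQ≥ m m≤ = ≮⇒≥ λ d<m → shorter d<m (dist P Q) refl
      where
      shorter : dist P Q < m → ∀ d → dist P Q ≡ d → ⊥
      shorter d<m zero eq = P≢Q (dist-zero eq)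
      shorter d<m (suc δ) eq with dist-pred eq
      ... | w , e , Pw with inner? G w
      ...   | no leaf = (linear 1 (λ d → (d :≡ con 1 :+ (con 1 :+ d)) ∷ [] ⊢ absurd) ((0 ∷ 1 ∷ []) , [])) δ
        (trans (sym Pw) (trans (leaf-dist P leaf e (λ { refl → leaf innerP })) (cong suc eq)))
      ...   | yes iw with Q-edge iw (edge-sym G e)
      ...     | τ , t , t≡ , refl = <-irrefl (sym Pw)
        (segment τ 0 (len τ) innerP ≤-refl
          (λ s 0<s s< P≡ → <⇒≢ 0<s (at-injective τ 0 s z≤n (<⇒≤ s<) (trans (at-0 τ) P≡)))
          (suc δ) t 1 (trans (+-comm t 1) t≡)
          ((linear 6 (λ δ m x d t e → (d :< m) ∷ (d :≡ con 1 :+ δ) ∷ (m :≤ x) ∷ (con 1 :+ t :≡ x) ∷ [] ⊢ con 1 :+ δ :≤ e :+ t) ((1 ∷ 1 ∷ 0 ∷ 1 ∷ 1 ∷ 0 ∷ 1 ∷ []) , [])) δ m (len τ) (dist P Q) t _ d<m eq (m≤ τ) t≡)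
          (subst (λ z → suc δ ≤ dist P z + 1) (sym (at-len τ)) ((linear 2 (λ δ d → (d :≡ con 1 :+ δ) ∷ [] ⊢ con 1 :+ δ :≤ d :+ con 1) ((1 ∷ 0 ∷ 1 ∷ []) , [])) δ _ eq)))

    module _ {pq} (pq≤ : pq ≤ dist P Q) where

      dist-P≥ : ∀ σ i j m → i + j ≡ len σ → m ≤ i → m ≤ pq + j → m ≤ dist P (at σ i)
      dist-P≥ σ i j m i+j m≤i m≤j = segment σ 0 (len σ) innerP ≤-refl
        (λ s 0<s s< P≡ → <⇒≢ 0<s (at-injective σ 0 s z≤n (<⇒≤ s<) (trans (at-0 σ) P≡)))
        m i j i+j (≤-trans m≤i (m≤n+m i _))
        (subst (λ z → m ≤ dist P z + j) (sym (at-len σ)) (≤-trans m≤j (+-mono-≤ pq≤ ≤-refl)))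

      dist-Q≥ : ∀ σ i j m → i + j ≡ len σ → m ≤ j → m ≤ pq + i → m ≤ dist Q (at σ i)
      dist-Q≥ σ i j m i+j m≤j m≤i = segment σ 0 (len σ) innerQ ≤-refl
        (λ s 0<s s< Q≡ → <⇒≢ s< (at-injective σ s (len σ) (<⇒≤ s<) ≤-refl (trans (sym Q≡) (sym (at-len σ)))))
        m i j i+j (subst (λ z → m ≤ dist Q z + i) (sym (at-0 σ)) (≤-trans m≤i (+-mono-≤ (subst (pq ≤_) (dist-sym P Q) pq≤) ≤-refl)))
        (≤-trans m≤j (m≤n+m j _))

      shift : ∀ {m e d} → (m ∸ e ≤ d) → m ≤ d + e
      shift {m} {e} {d} le = ≤-trans (m≤n+m∸n m e) (subst (_≤ d + e) (+-comm (m ∸ e) e) (+-mono-≤ le ≤-refl))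

      unshift : ∀ m e x → m ≤ x + e → m ∸ e ≤ x
      unshift m e x le = m≤n+o⇒m∸n≤o m e (subst (m ≤_) (+-comm x e) le)

      -- The four bounds on `m` are the four routes: through `P`, through `Q`, through `Q` and then
      -- `P`, through `P` and then `Q`. One application of `segment` handles `τ` and the second,
      -- inside `dist-P≥` and `dist-Q≥`, handles `σ`. The truncated differences are harmless: a
      -- bound that truncates to 0 is trivial.
      dist-cross≥ : ∀ σ τ → σ ≢ τ → ∀ i i′ j j′ m → i + i′ ≡ len σ → j + j′ ≡ len τ →
                    m ≤ i + j → m ≤ i′ + j′ → m ≤ (pq + i′) + j → m ≤ (pq + i) + j′ → m ≤ dist (at σ i) (at τ j)
      dist-cross≥ σ τ σ≢τ i i′ j j′ m i+ j+ P-P Q-Q Q-P P-Q =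
        segment τ 0 (len τ) (on-inner σ i (subst (i ≤_) i+ (m≤m+n i i′))) ≤-refl
          (λ t 0<t t< eq → σ≢τ (sym (proj₁ (inj τ σ t i 0<t t< (subst (i ≤_) i+ (m≤m+n i i′)) (sym eq)))))
          m j j′ j+
          (subst (λ z → m ≤ dist (at σ i) z + j) (sym (at-0 τ)) (shift (subst (m ∸ j ≤_) (dist-sym P (at σ i))
            (dist-P≥ σ i i′ (m ∸ j) i+ (unshift m j i P-P) (unshift m j (pq + i′) Q-P)))))
          (subst (λ z → m ≤ dist (at σ i) z + j′) (sym (at-len τ)) (shift (subst (m ∸ j′ ≤_) (dist-sym Q (at σ i))
            (dist-Q≥ σ i i′ (m ∸ j′) i+ (unshift m j′ i′ Q-Q) (unshift m j′ (pq + i) P-Q)))))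

halve : ∀ x → ∃ λ h → 2 * h ≤ x × x ≤ 2 * h + 1
halve zero = 0 , z≤n , z≤n
halve (suc zero) = 0 , z≤n , s≤s z≤n
halve (suc (suc x)) with halve x
... | h , lo , hi = suc h , (linear 2 (λ h x → (2 :* h :≤ x) ∷ [] ⊢ 2 :* (con 1 :+ h) :≤ con 1 :+ (con 1 :+ x)) ((2 ∷ 2 ∷ []) , [])) h x lo
                  , (linear 2 (λ h x → (x :≤ 2 :* h :+ con 1) ∷ [] ⊢ con 1 :+ (con 1 :+ x) :≤ 2 :* (con 1 :+ h) :+ con 1) ((2 ∷ 2 ∷ []) , [])) h x hi

even≢odd : ∀ x y → 2 * x ≢ 2 * y + 1
even≢odd zero    y       eq = (linear 1 (λ y → (con 0 :≡ 2 :* y :+ con 1) ∷ [] ⊢ absurd) ((0 ∷ 1 ∷ []) , [])) y eq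
even≢odd (suc x) zero    eq = (linear 1 (λ x → (2 :* (con 1 :+ x) :≡ con 1) ∷ [] ⊢ absurd) ((1 ∷ 0 ∷ []) , [])) x eq
even≢odd (suc x) (suc y) eq = even≢odd x y ((linear 2 (λ x y → (2 :* (con 1 :+ x) :≡ 2 :* (con 1 :+ y) :+ con 1) ∷ [] ⊢ 2 :* x :≡ 2 :* y :+ con 1) ((2 ∷ 2 ∷ 0 ∷ []) , (2 ∷ 0 ∷ 2 ∷ []))) x y eq)

parity : ∀ x → ∃ λ h → x ≡ 2 * h ⊎ x ≡ 2 * h + 1
parity x with halve x
... | h , lo , hi with x ≤? 2 * h
...   | yes le = h , inj₁ (≤-antisym le lo)
...   | no ≰   = h , inj₂ (≤-antisym hi ((linear 2 (λ h x → (2 :* h :< x) ∷ [] ⊢ 2 :* h :+ con 1 :≤ x) ((2 ∷ 2 ∷ []) , [])) h x (≰⇒> ≰)))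

pattern 𝟎 = zero
pattern 𝟏 = suc zero
pattern 𝟐 = suc (suc zero)

module _ {n} {G : Graph n} {ν} (S : Strands G ν) where
  open Strands S

  cross-distinct : ∀ {σ τ i j} → σ ≢ τ → i ≤ len σ → j ≤ len τ → at σ i ≡ at τ j →
                   (i ≡ 0 × j ≡ 0) ⊎ (i ≡ len σ × j ≡ len τ)
  cross-distinct {σ} {τ} {i} {j} σ≢τ i≤ j≤ eq with 0 <? i | i <? len σ
  ... | yes 0<i | yes i< = contradiction (proj₁ (inj σ τ i j 0<i i< j≤ eq)) σ≢τ
  ... | no 0≮i | _ with ≤-antisym (≮⇒≥ 0≮i) z≤n
  ...   | refl = inj₁ (refl , at-injective τ j 0 j≤ z≤n (trans (sym eq) (trans (at-0 σ) (sym (at-0 τ)))))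
  cross-distinct {σ} {τ} {i} {j} σ≢τ i≤ j≤ eq | _ | no i≮ with ≤-antisym i≤ (≮⇒≥ i≮)
  ...   | refl = inj₂ (refl , at-injective τ j (len τ) j≤ ≤-refl (trans (sym eq) (trans (at-len σ) (sym (at-len τ)))))

-- Theta graphs: vertex lists and distances for sorted strand lengths

module ThetaVertices {n} {G : Graph n} (S : Strands G 3) where
  open Strands S

  -- `P` is listed with strand `𝟎` and `Q` with strand `𝟏`, so that each vertex occurs exactly once.
  -- The same order serves as the numbering of the subdivisions of K₄.
  part : Fin 3 → List (Fin n)
  part 𝟎 = applyUpTo (at 𝟎) (len 𝟎)
  part 𝟏 = applyUpTo (at 𝟏 ∘ suc) (len 𝟏)
  part 𝟐 = applyUpTo (at 𝟐 ∘ suc) (len 𝟐 ∸ 1)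

  theta : List (Fin n)
  theta = part 𝟎 ++ part 𝟏 ++ part 𝟐

  suc-pred : ∀ {m} → 0 < m → suc (m ∸ 1) ≡ m
  suc-pred (s≤s _) = refl

  theta-length : suc (length theta) ≡ len 𝟎 + len 𝟏 + len 𝟐
  theta-length = trans (cong suc (trans (length-++ (part 𝟎)) (cong₂ _+_ (length-applyUpTo (at 𝟎) (len 𝟎))
      (trans (length-++ (part 𝟏)) (cong₂ _+_ (length-applyUpTo (at 𝟏 ∘ suc) (len 𝟏)) (length-applyUpTo (at 𝟐 ∘ suc) (len 𝟐 ∸ 1)))))))
    ((linear 4 (λ a b c d → (con 1 :+ d :≡ c) ∷ [] ⊢ con 1 :+ (a :+ (b :+ d)) :≡ a :+ b :+ c) ((1 ∷ 1 ∷ 0 ∷ []) , (1 ∷ 0 ∷ 1 ∷ []))) (len 𝟎) (len 𝟏) (len 𝟐) (len 𝟐 ∸ 1) (suc-pred (len>0 𝟐)))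

  ∈part𝟐⁻ : ∀ {z} → z ∈ part 𝟐 → ∃ λ i → suc i < len 𝟐 × z ≡ at 𝟐 (suc i)
  ∈part𝟐⁻ z∈ = let i , i< , z≡ = ∈-applyUpTo⁻ (at 𝟐 ∘ suc) z∈
               in i , subst (suc i <_) (suc-pred (len>0 𝟐)) (s≤s i<) , z≡

  theta-unique : Unique theta
  theta-unique = Unique.++⁺
    (Unique-window (at 𝟎) (len 𝟎) λ i j i<j j< eq → <⇒≢ i<j (at-injective 𝟎 i j (<⇒≤ (≤-trans i<j (<⇒≤ j<))) (<⇒≤ j<) eq))
    (Unique.++⁺
      (Unique-window (at 𝟏 ∘ suc) (len 𝟏) λ i j i<j j< eq →
        <⇒≢ i<j (suc-injective (at-injective 𝟏 (suc i) (suc j) (≤-trans i<j (<⇒≤ j<)) j< eq)))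
      (Unique-window (at 𝟐 ∘ suc) (len 𝟐 ∸ 1) λ i j i<j j< eq →
        <⇒≢ i<j (suc-injective (at-injective 𝟐 (suc i) (suc j) (≤-trans i<j (≤-trans (<⇒≤ j<) (m∸n≤m _ 1))) (≤-trans j< (m∸n≤m _ 1)) eq)))
      λ { (z∈ , z∈′) → let i , i< , z≡ = ∈-applyUpTo⁻ (at 𝟏 ∘ suc) z∈ ; j , j< , z≡′ = ∈part𝟐⁻ z∈′ in
          case cross-distinct S {𝟏} {𝟐} {suc i} {suc j} (λ ()) i< (<⇒≤ j<) (trans (sym z≡) z≡′) of λ
            { (inj₁ ()) ; (inj₂ (_ , eq)) → <⇒≢ j< eq } })
    λ { (z∈ , z∈′) → let i , i< , z≡ = ∈-applyUpTo⁻ (at 𝟎) z∈ in case ∈-++⁻ (part 𝟏) z∈′ of λ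
        { (inj₁ z∈𝟏) → let j , j< , z≡′ = ∈-applyUpTo⁻ (at 𝟏 ∘ suc) z∈𝟏 in
            case cross-distinct S {𝟎} {𝟏} {i} {suc j} (λ ()) (<⇒≤ i<) j< (trans (sym z≡) z≡′) of λ
              { (inj₁ ()) ; (inj₂ (eq , _)) → <⇒≢ i< eq }
        ; (inj₂ z∈𝟐) → let j , j< , z≡′ = ∈part𝟐⁻ z∈𝟐 in
            case cross-distinct S {𝟎} {𝟐} {i} {suc j} (λ ()) (<⇒≤ i<) (<⇒≤ j<) (trans (sym z≡) z≡′) of λ
              { (inj₁ ()) ; (inj₂ (eq , _)) → <⇒≢ i< eq } } }

  theta⇒on : ∀ {z} → z ∈ theta → On z
  theta⇒on z∈ with ∈-++⁻ (part 𝟎) z∈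
  ... | inj₁ z∈𝟎 = let i , i< , z≡ = ∈-applyUpTo⁻ (at 𝟎) z∈𝟎 in 𝟎 , i , <⇒≤ i< , z≡
  ... | inj₂ z∈′ with ∈-++⁻ (part 𝟏) z∈′
  ...   | inj₁ z∈𝟏 = let i , i< , z≡ = ∈-applyUpTo⁻ (at 𝟏 ∘ suc) z∈𝟏 in 𝟏 , suc i , i< , z≡
  ...   | inj₂ z∈𝟐 = let i , i< , z≡ = ∈part𝟐⁻ z∈𝟐 in 𝟐 , suc i , <⇒≤ i< , z≡

  P∈theta : P ∈ theta
  P∈theta = ∈-++⁺ˡ (subst (_∈ part 𝟎) (at-0 𝟎) (∈-applyUpTo⁺ (at 𝟎) (len>0 𝟎)))

  Q∈theta : Q ∈ theta
  Q∈theta = ∈-++⁺ʳ (part 𝟎) (∈-++⁺ˡ (subst (_∈ part 𝟏) (trans (cong (at 𝟏) (suc-pred (len>0 𝟏))) (at-len 𝟏))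
    (∈-applyUpTo⁺ (at 𝟏 ∘ suc) (subst (len 𝟏 ∸ 1 <_) (suc-pred (len>0 𝟏)) ≤-refl))))

  on⇒theta : ∀ {z} → On z → z ∈ theta
  on⇒theta (σ , zero , _ , refl) = subst (_∈ theta) (sym (at-0 σ)) P∈theta
  on⇒theta (σ , suc i , i≤ , refl) with suc i <? len σ
  ... | no i≮ = subst (_∈ theta) (sym (trans (cong (at σ) (≤-antisym i≤ (≮⇒≥ i≮))) (at-len σ))) Q∈theta
  on⇒theta (𝟎 , suc i , i≤ , refl) | yes i< = ∈-++⁺ˡ (∈-applyUpTo⁺ (at 𝟎) i<)
  on⇒theta (𝟏 , suc i , i≤ , refl) | yes i< = ∈-++⁺ʳ (part 𝟎) (∈-++⁺ˡ (∈-applyUpTo⁺ (at 𝟏 ∘ suc) i≤))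
  on⇒theta (𝟐 , suc i , i≤ , refl) | yes i< = ∈-++⁺ʳ (part 𝟎) (∈-++⁺ʳ (part 𝟏)
    (∈-applyUpTo⁺ (at 𝟐 ∘ suc) (s≤s⁻¹ (subst (suc i <_) (sym (suc-pred (len>0 𝟐))) i<))))

module SortedTheta {n} (G : Graph n) (conn : Connected G) (S : Strands G 3) (X : Strands.Exact S)
  (a≤b : Strands.len S 𝟎 ≤ Strands.len S 𝟏) (b≤c : Strands.len S 𝟏 ≤ Strands.len S 𝟐) where

  open StrandMetric G conn S public
  open Exact X public
  open ThetaVertices S public

  a b c : ℕ
  a = len 𝟎
  b = len 𝟏
  c = len 𝟐

  a≤c : a ≤ c
  a≤c = ≤-trans a≤b b≤c

  shortest-strand : ∀ σ → a ≤ len σ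
  shortest-strand 𝟎 = ≤-refl
  shortest-strand 𝟏 = a≤b
  shortest-strand 𝟐 = a≤c

  longest-strand : ∀ σ → len σ ≤ c
  longest-strand 𝟎 = a≤c
  longest-strand 𝟏 = b≤c
  longest-strand 𝟐 = ≤-refl

  a≤PQ : a ≤ dist P Q
  a≤PQ = dist-PQ≥ X a shortest-strand

  cross : ∀ σ τ → σ ≢ τ → ∀ i i′ j j′ m → i + i′ ≡ len σ → j + j′ ≡ len τ →
          m ≤ i + j → m ≤ i′ + j′ → m ≤ (a + i′) + j → m ≤ (a + i) + j′ → m ≤ dist (at σ i) (at τ j)
  cross = dist-cross≥ X a≤PQ

  diameter : ∀ {x y} → Inner G x → Inner G y → 2 * dist x y ≤ b + c
  diameter ix iy with cover ix | cover iy
  ... | 𝟎 , i , i≤ , refl | 𝟎 , j , j≤ , refl = ≤-trans (dist-same-half 𝟎 𝟏 i≤ j≤) (+-mono-≤ a≤b b≤c)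
  ... | 𝟎 , i , i≤ , refl | 𝟏 , j , j≤ , refl = ≤-trans (dist-half {𝟎} {𝟏} i≤ j≤) (+-mono-≤ a≤b b≤c)
  ... | 𝟎 , i , i≤ , refl | 𝟐 , j , j≤ , refl = ≤-trans (dist-half {𝟎} {𝟐} i≤ j≤) (+-mono-≤ a≤b ≤-refl)
  ... | 𝟏 , i , i≤ , refl | 𝟎 , j , j≤ , refl = ≤-trans (dist-half {𝟏} {𝟎} i≤ j≤) (+-mono-≤ ≤-refl a≤c)
  ... | 𝟏 , i , i≤ , refl | 𝟏 , j , j≤ , refl = dist-same-half 𝟏 𝟐 i≤ j≤
  ... | 𝟏 , i , i≤ , refl | 𝟐 , j , j≤ , refl = dist-half {𝟏} {𝟐} i≤ j≤
  ... | 𝟐 , i , i≤ , refl | 𝟎 , j , j≤ , refl = ≤-trans (dist-half {𝟐} {𝟎} i≤ j≤) ((linear 3 (λ a b c → (a :≤ b) ∷ [] ⊢ c :+ a :≤ b :+ c) ((1 ∷ 1 ∷ []) , [])) a b c a≤b)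
  ... | 𝟐 , i , i≤ , refl | 𝟏 , j , j≤ , refl = ≤-trans (dist-half {𝟐} {𝟏} i≤ j≤) (≤-reflexive (+-comm c b))
  ... | 𝟐 , i , i≤ , refl | 𝟐 , j , j≤ , refl = ≤-trans (dist-same-half 𝟐 𝟏 i≤ j≤) (≤-reflexive (+-comm c b))

  -- `P` lies on every strand, so the second strand of the enclosing cycle can always be the
  -- shortest one. This gap to `diameter` is what restricts b - a later on.
  ecc-P : ∀ {y} → Inner G y → 2 * dist P y ≤ a + c
  ecc-P iy with cover iy
  ... | σ , i , i≤ , refl = ≤-trans (dist-P-half {σ} 𝟎 i≤) (subst (len σ + a ≤_) (+-comm c a) (+-mono-≤ (longest-strand σ) ≤-refl))

  ecc-Q : ∀ {y} → Inner G y → 2 * dist Q y ≤ a + c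
  ecc-Q iy with cover iy
  ... | σ , i , i≤ , refl = ≤-trans (dist-Q-half {σ} 𝟎 i≤) (subst (len σ + a ≤_) (+-comm c a) (+-mono-≤ (longest-strand σ) ≤-refl))

  -- With i ranging over [(b - a)/2, (a + b)/2], the vertices at positions i and D - i of the two
  -- longer strands are at distance D; this interval contains two integers once a ≥ 2.
  module _ {D} (D≤ : 2 * D ≤ b + c) (≤D : b + c ≤ 2 * D + 1) where

    far-pair : ∀ i j → i + j ≡ D → b ≤ a + 2 * i → 2 * i ≤ a + b → D ≤ dist (at 𝟏 i) (at 𝟐 j)
    far-pair i j i+j lo hi =
      let i′ , i+ = rest ((linear 3 (λ i a b → (2 :* i :≤ a :+ b) ∷ (a :≤ b) ∷ [] ⊢ i :≤ b) ((2 ∷ 1 ∷ 1 ∷ []) , [])) i a b hi a≤b)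
          j′ , j+ = rest ((linear 5 (λ i j D b c → (i :+ j :≡ D) ∷ (2 :* D :≤ b :+ c) ∷ (b :≤ c) ∷ [] ⊢ j :≤ c) ((2 ∷ 2 ∷ 0 ∷ 1 ∷ 1 ∷ []) , [])) i j D b c i+j D≤ b≤c) in
      cross 𝟏 𝟐 (λ ()) i i′ j j′ D i+ j+ (≤-reflexive (sym i+j))
        ((linear 7 (λ i j k l D b c → (i :+ k :≡ b) ∷ (j :+ l :≡ c) ∷ (i :+ j :≡ D) ∷ (2 :* D :≤ b :+ c) ∷ [] ⊢ D :≤ k :+ l) ((1 ∷ 0 ∷ 1 ∷ 0 ∷ 1 ∷ 1 ∷ 0 ∷ 1 ∷ []) , [])) i j i′ j′ D b c i+ j+ i+j D≤)
        ((linear 6 (λ i j k D a b → (i :+ k :≡ b) ∷ (i :+ j :≡ D) ∷ (2 :* i :≤ a :+ b) ∷ [] ⊢ D :≤ a :+ k :+ j) ((1 ∷ 0 ∷ 1 ∷ 0 ∷ 1 ∷ 1 ∷ []) , [])) i j i′ D a b i+ i+j hi)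
        ((linear 7 (λ i j l D a b c → (j :+ l :≡ c) ∷ (i :+ j :≡ D) ∷ (2 :* D :≤ b :+ c) ∷ (b :≤ a :+ 2 :* i) ∷ [] ⊢ D :≤ a :+ i :+ l) ((1 ∷ 0 ∷ 1 ∷ 1 ∷ 0 ∷ 1 ∷ 1 ∷ []) , [])) i j j′ D a b c j+ i+j D≤ lo)

    middle : ∃₂ λ i j → i + j ≡ D × b ≤ a + 2 * i × 2 * i ≤ a + b × 2 * i + a ≤ b + 1
    middle with rest a≤b
    -- The witness is (b - a)/2 rounded up, the smallest admissible position.
    ... | β , a+β with halve (β + 1)
    ...   | i , lo , hi with rest ((linear 6 (λ i β a b c D → (a :+ β :≡ b) ∷ (2 :* i :≤ β :+ con 1) ∷ (b :≤ c) ∷ (b :+ c :≤ 2 :* D :+ con 1) ∷ [] ⊢ i :≤ D) ((8 ∷ 4 ∷ 0 ∷ 4 ∷ 2 ∷ 2 ∷ []) , []))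
                                     i β a b c D a+β lo b≤c ≤D)
    ...     | j , i+j = i , j , i+j , (linear 4 (λ i β a b → (a :+ β :≡ b) ∷ (β :+ con 1 :≤ 2 :* i :+ con 1) ∷ [] ⊢ b :≤ a :+ 2 :* i) ((2 ∷ 0 ∷ 2 ∷ 2 ∷ []) , [])) i β a b a+β hi
      , (linear 4 (λ i β a b → (a :+ β :≡ b) ∷ (2 :* i :≤ β :+ con 1) ∷ (con 0 :< a) ∷ [] ⊢ 2 :* i :≤ a :+ b) ((2 ∷ 2 ∷ 0 ∷ 2 ∷ 4 ∷ []) , [])) i β a b a+β lo (len>0 𝟎)
      , (linear 4 (λ i β a b → (a :+ β :≡ b) ∷ (2 :* i :≤ β :+ con 1) ∷ [] ⊢ 2 :* i :+ a :≤ b :+ con 1) ((2 ∷ 2 ∷ 0 ∷ 2 ∷ []) , [])) i β a b a+β lo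

    one-far-pair : ∃₂ λ i j → i ≤ b × j ≤ c × D ≤ dist (at 𝟏 i) (at 𝟐 j)
    one-far-pair with middle
    ... | i , j , i+j , lo , hi , _ = i , j , (linear 3 (λ i a b → (2 :* i :≤ a :+ b) ∷ (a :≤ b) ∷ [] ⊢ i :≤ b) ((2 ∷ 1 ∷ 1 ∷ []) , [])) i a b hi a≤b
      , (linear 5 (λ i j D b c → (i :+ j :≡ D) ∷ (2 :* D :≤ b :+ c) ∷ (b :≤ c) ∷ [] ⊢ j :≤ c) ((2 ∷ 2 ∷ 0 ∷ 1 ∷ 1 ∷ []) , [])) i j D b c i+j D≤ b≤c , far-pair i j i+j lo hi

    two-far-pairs : 2 ≤ a → ∃₂ λ i j → suc i ≤ b × suc j ≤ c × D ≤ dist (at 𝟏 i) (at 𝟐 (suc j)) × D ≤ dist (at 𝟏 (suc i)) (at 𝟐 j)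
    two-far-pairs 2≤a with middle
    ... | i , zero , i+j , lo , _ , hi = ⊥-elim
      ((linear 5 (λ i D a b c → (i :+ con 0 :≡ D) ∷ (2 :* i :+ a :≤ b :+ con 1) ∷ (con 2 :≤ a) ∷ (b :≤ c) ∷ (b :+ c :≤ 2 :* D :+ con 1) ∷ [] ⊢ absurd) ((0 ∷ 4 ∷ 4 ∷ 4 ∷ 2 ∷ 2 ∷ []) , [])) i D a b c i+j hi 2≤a b≤c ≤D)
    ... | i , suc j , i+j , lo , hi₀ , hi = i , j
      , (linear 3 (λ i a b → (2 :* i :+ a :≤ b :+ con 1) ∷ (con 2 :≤ a) ∷ [] ⊢ con 1 :+ i :≤ b) ((2 ∷ 2 ∷ 2 ∷ []) , [])) i a b hi 2≤a
      , (linear 5 (λ i j D b c → (i :+ (con 1 :+ j) :≡ D) ∷ (2 :* D :≤ b :+ c) ∷ (b :≤ c) ∷ [] ⊢ con 1 :+ j :≤ c) ((2 ∷ 2 ∷ 0 ∷ 1 ∷ 1 ∷ []) , [])) i j D b c i+j D≤ b≤c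
      , far-pair i (suc j) i+j lo hi₀
      , far-pair (suc i) j (trans (sym (+-suc i j)) i+j) ((linear 3 (λ i a b → (b :≤ a :+ 2 :* i) ∷ [] ⊢ b :≤ a :+ 2 :* (con 1 :+ i)) ((2 ∷ 2 ∷ []) , [])) i a b lo)
          ((linear 3 (λ i a b → (2 :* i :+ a :≤ b :+ con 1) ∷ (con 2 :≤ a) ∷ [] ⊢ 2 :* (con 1 :+ i) :≤ a :+ b) ((2 ∷ 2 ∷ 4 ∷ []) , [])) i a b hi 2≤a)

-- Metric constraints on theta graphs with pendant edges

count-vertices : ∀ {n} {xs : List (Fin n)} → Unique xs → (∀ v → v ∈ xs) → n ≡ length xs
count-vertices {xs = xs} u all = ≤-antisym (complete⇒length≥ {xs = xs} all) (Unique⇒length≤ u)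

module LeafPoles {n} (G : Graph n) (conn : Connected G) {g} (girth : ∀ k → HasCycle G k → g ≤ k) (4≤g : 4 ≤ g)
  {c₀} (C : Periodic G g c₀) where

  open LeafMetric G conn
  open Leaves G conn girth 4≤g C using (dist>; far-from; leaf⇒pole; 2≤r)

  inner≢leaf : ∀ {x y} → Inner G x → ¬ Inner G y → x ≢ y
  inner≢leaf ix ¬iy refl = ¬iy ix

  to-leaf : ∀ {x y p} → ¬ Inner G x → Edge G x p → y ≢ x → dist y x ≡ suc (dist y p)
  to-leaf {y = y} leaf xp = leaf-dist y leaf xp

  module _ {u v r} (poles : Poles u v r) where
    open Poles poles

    u≢v : u ≢ v
    u≢v refl = contradiction (trans (sym apart) (dist-refl u)) λ ()

    dist≤suc-r : ∀ x y → dist x y ≤ suc r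
    dist≤suc-r x y with near x y
    ... | inj₁ le = ≤-trans le (n≤1+n r)
    ... | inj₂ (inj₁ (refl , refl)) = ≤-reflexive apart
    ... | inj₂ (inj₂ (refl , refl)) = ≤-reflexive (trans (dist-sym x y) apart)

    others : ∀ x → x ≢ u → x ≢ v → Inner G x
    others x x≢u x≢v with inner? G x
    ... | yes ix = ix
    ... | no leaf = case leaf⇒pole poles leaf of λ { (inj₁ eq) → contradiction eq x≢u ; (inj₂ eq) → contradiction eq x≢v }

    others′ : Inner G v → ∀ x → x ≢ u → Inner G x
    others′ iv x x≢u with x Fin.≟ v
    ... | yes refl = iv
    ... | no x≢v   = others x x≢u x≢v

    toward : ∃ λ p → Edge G u p × dist v p ≡ r
    toward with dist-pred {v} {u} (trans (dist-sym v u) apart)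
    ... | p , p-u , vp = p , edge-sym G p-u , vp

    neighbour-inner : ∀ {p} → Edge G u p → Inner G p
    neighbour-inner {p} up = others p (λ { refl → edge-irr G up }) λ
      { refl → <⇒≱ (2≤r poles) (≤-trans (n≤1+n r) (subst (_≤ 1) apart (dist-edge up))) }

    -- One more step leads from `p` to the leaf `u`, so `y` is at distance at least r + 1 from `u`.
    beyond-leaf : ∀ {p y} → ¬ Inner G u → Edge G u p → Inner G y → r ≤ dist p y → y ≡ v
    beyond-leaf {p} {y} leaf up iy r≤
      with dist> poles (subst (r <_) (sym (to-leaf leaf up (inner≢leaf iy leaf))) (s≤s (subst (r ≤_) (dist-sym p y) r≤)))
    ... | inj₁ (_ , u≡v) = contradiction u≡v u≢v
    ... | inj₂ (y≡v , _) = y≡v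

    near-leaves : ∀ {p y} → ¬ Inner G u → ¬ Inner G v → Edge G u p → Inner G y → dist p y < r
    near-leaves {p} {y} leaf-u leaf-v up iy =
      ≰⇒> λ r≤ → inner≢leaf iy leaf-v (beyond-leaf leaf-u up iy r≤)

    module _ {p q} (leaf-u : ¬ Inner G u) (leaf-v : ¬ Inner G v) (up : Edge G u p) (vq : Edge G v q) where

      private
        inner-q : Inner G q
        inner-q = others q (λ { refl → <⇒≱ (2≤r poles) (≤-trans (n≤1+n r) (subst (_≤ 1) apart (dist-edge (edge-sym G vq)))) })
          (λ { refl → edge-irr G vq })

      between-leaves : suc (dist p q) ≡ r
      between-leaves = suc-injective (trans (cong suc (trans (cong suc (dist-sym p q)) (trans (sym (to-leaf leaf-u up (inner≢leaf inner-q leaf-u))) (dist-sym q u))))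
        (trans (sym (to-leaf leaf-v vq u≢v)) apart))

      -- The neighbour of p on a geodesic from p to q is close to both leaves.
      far-inner-pair : 3 ≤ r → ∃₂ λ x y → Inner G x × Inner G y × r ≤ dist x y
      far-inner-pair 3≤r with dist q p in qp
      ... | zero = ⊥-elim ((linear 2 (λ r d → (con 1 :+ d :≡ r) ∷ (d :≡ con 0) ∷ (con 3 :≤ r) ∷ [] ⊢ absurd) ((0 ∷ 1 ∷ 1 ∷ 0 ∷ 1 ∷ []) , [])) r _ between-leaves (trans (dist-sym p q) qp) 3≤r)
      ... | suc d with dist-pred qp
      ...   | w , w-p , qw with far-from poles w
      ...     | y , r≤ = w , y , inner-w , inner-y , r≤
        where
        d≡ : suc (suc d) ≡ r
        d≡ = trans (cong suc (trans (sym qp) (dist-sym q p))) between-leaves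
        w≢u : w ≢ u
        w≢u refl = (linear 1 (λ d → (d :≡ con 1 :+ (con 1 :+ d)) ∷ [] ⊢ absurd) ((0 ∷ 1 ∷ []) , [])) d
          (trans (sym qw) (trans (to-leaf leaf-u up (inner≢leaf inner-q leaf-u)) (cong suc qp)))
        w≢v : w ≢ v
        w≢v refl with leaf-unique G leaf-v w-p vq
        ... | refl = contradiction (trans (sym qp) (dist-refl q)) λ ()
        inner-w : Inner G w
        inner-w = others w w≢u w≢v
        inner-y : Inner G y
        inner-y = others y
          (λ { refl → <⇒≱ 3≤r (≤-trans r≤ (dist-min (cons w-p (cons (edge-sym G up) nil)))) })
          (λ { refl → (linear 2 (λ r d → (r :≤ con 1 :+ d) ∷ (con 1 :+ (con 1 :+ d) :≡ r) ∷ [] ⊢ absurd) ((1 ∷ 1 ∷ 0 ∷ []) , [])) r d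
                        (subst (r ≤_) (trans (to-leaf leaf-v vq w≢v) (cong suc (trans (dist-sym w q) qw))) r≤) d≡ })

module ThetaPoles {n} (G : Graph n) (conn : Connected G) {g} (girth : ∀ k → HasCycle G k → g ≤ k) (4≤g : 4 ≤ g)
  {c₀} (C : Periodic G g c₀) (S : Strands G 3) (X : Strands.Exact S)
  (a≤b : Strands.len S 𝟎 ≤ Strands.len S 𝟏) (b≤c : Strands.len S 𝟏 ≤ Strands.len S 𝟐) where

  open SortedTheta G conn S X a≤b b≤c
  open Leaves G conn girth 4≤g C using (dist>; far-from; 2≤r; swap-poles)
  open LeafPoles G conn girth 4≤g C

  count : (ls : List (Fin n)) → Unique ls → (∀ {z} → z ∈ ls → ¬ Inner G z) → (∀ z → z ∈ ls ⊎ Inner G z) →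
          suc n ≡ length ls + (a + b + c)
  count ls uls leaf all = trans (cong suc (count-vertices
      (Unique.++⁺ uls theta-unique λ { (z∈ , z∈θ) → let σ , i , i≤ , z≡ = theta⇒on z∈θ in
        leaf z∈ (subst (Inner G) (sym z≡) (on-inner σ i i≤)) })
      (λ z → case all z of λ { (inj₁ z∈) → ∈-++⁺ˡ z∈ ; (inj₂ iz) → ∈-++⁺ʳ ls (on⇒theta (cover iz)) })))
    (trans (cong suc (length-++ ls)) (trans (sym (+-suc (length ls) _)) (cong (length ls +_) theta-length)))

  -- A form of `dist-cross≥` with the complementary positions eliminated: every route becomes a
  -- linear condition on `i` and `j` alone.
  antipode : ∀ σ τ → σ ≢ τ → ∀ i j m → i ≤ len σ → j ≤ len τ → m ≤ i + j → m + (i + j) ≤ len σ + len τ →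
             m + i ≤ a + len σ + j → m + j ≤ a + i + len τ → m ≤ dist (at σ i) (at τ j)
  antipode σ τ σ≢τ i j m i≤ j≤ m≤ m+ h₁ h₂ =
    let i′ , i+ = rest i≤ ; j′ , j+ = rest j≤ in
    cross σ τ σ≢τ i i′ j j′ m i+ j+ m≤
      ((linear 7 (λ i k j l m x y → (i :+ k :≡ x) ∷ (j :+ l :≡ y) ∷ (m :+ (i :+ j) :≤ x :+ y) ∷ [] ⊢ m :≤ k :+ l) ((1 ∷ 0 ∷ 1 ∷ 0 ∷ 1 ∷ 1 ∷ []) , [])) i i′ j j′ m (len σ) (len τ) i+ j+ m+)
      ((linear 6 (λ i k j m x a → (i :+ k :≡ x) ∷ (m :+ i :≤ a :+ x :+ j) ∷ [] ⊢ m :≤ a :+ k :+ j) ((1 ∷ 0 ∷ 1 ∷ 1 ∷ []) , [])) i i′ j m (len σ) a i+ h₁)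
      ((linear 6 (λ i j l m y a → (j :+ l :≡ y) ∷ (m :+ j :≤ a :+ i :+ y) ∷ [] ⊢ m :≤ a :+ i :+ l) ((1 ∷ 0 ∷ 1 ∷ 1 ∷ []) , [])) i j j′ m (len τ) a j+ h₂)

  distinct-points : ∀ σ i τ j → i ≤ len σ → j ≤ len τ → 0 < i → i < len σ → σ ≢ τ ⊎ i ≢ j → at σ i ≢ at τ j
  distinct-points σ i τ j i≤ j≤ 0<i i< diff eq = let σ≡τ , i≡j = inj σ τ i j 0<i i< j≤ eq in
    case diff of λ { (inj₁ σ≢τ) → σ≢τ σ≡τ ; (inj₂ i≢j) → i≢j i≡j }

  module WithPoles {u v r} (poles : Poles u v r) where
    open Poles poles

    -- Without leaves r + 1 ≤ (b + c)/2, so every pair at distance D = ⌊(b + c)/2⌋ would be the pair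
    -- of poles; for a ≥ 2 there are two such pairs. For a = 1 the order forces c ≤ b, and the
    -- eccentricity (1 + c)/2 of `P` is then too small compared with D - 1 ≤ r, as D ≥ 4.
    no-leaf : (∀ x → Inner G x) → g ≡ a + b → 5 ≤ g → n + 2 ≤ 2 * g → ⊥
    no-leaf all-inner g≡ 5≤g n≤ with halve (b + c)
    ... | D , D≤ , ≤D with 2 ≤? a
    ...   | yes 2≤a = let i , j , i< , j< , d₁ , d₂ = two-far-pairs D≤ ≤D 2≤a in
        case dist> poles (<-≤-trans r<D d₁) , dist> poles (<-≤-trans r<D d₂) of λ
          { (inj₁ (p , _) , inj₁ (q , _)) → same-B i< (trans p (sym q))
          ; (inj₂ (p , _) , inj₂ (q , _)) → same-B i< (trans p (sym q))
          ; (inj₁ (p , _) , inj₂ (_ , q)) → same-BC j< d₁ (trans p (sym q))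
          ; (inj₂ (p , _) , inj₁ (_ , q)) → same-BC j< d₁ (trans p (sym q)) }
      where
      r<D : r < D
      r<D = (linear 5 (λ d r b c D → (2 :* d :≤ b :+ c) ∷ (d :≡ con 1 :+ r) ∷ (b :+ c :≤ 2 :* D :+ con 1) ∷ [] ⊢ r :< D) ((2 ∷ 1 ∷ 0 ∷ 2 ∷ 1 ∷ []) , [])) _ r b c D
              (diameter (all-inner u) (all-inner v)) apart ≤D
      same-B : ∀ {i} → suc i ≤ b → at 𝟏 i ≢ at 𝟏 (suc i)
      same-B {i} i< eq = <⇒≢ ≤-refl (at-injective 𝟏 i (suc i) (<⇒≤ i<) i< eq)
      -- If the two far pairs were the poles in opposite order, `at 𝟏 i` would be the neighbour
      -- `at 𝟐 j` of `at 𝟐 (suc j)`, at distance one instead of D > r ≥ 2.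
      same-BC : ∀ {i j} → suc j ≤ c → D ≤ dist (at 𝟏 i) (at 𝟐 (suc j)) → at 𝟏 i ≢ at 𝟐 j
      same-BC {i} {j} j< d₁ eq = (linear 3 (λ r D d → (con 2 :≤ r) ∷ (r :< D) ∷ (D :≤ d) ∷ (d :≤ con 1) ∷ [] ⊢ absurd) ((1 ∷ 1 ∷ 1 ∷ 1 ∷ []) , [])) r D _ (2≤r poles) r<D d₁
        (subst (λ z → dist z (at 𝟐 (suc j)) ≤ 1) (sym eq) (dist-edge (link 𝟐 j j<)))
    ...   | no 2≰a = let i , j , _ , _ , d₁ = one-far-pair D≤ ≤D ; y , r≤ = far-from poles P in
      finish (≤-trans d₁ (dist≤suc-r poles _ _)) (≤-trans (*-monoʳ-≤ 2 r≤) (ecc-P (all-inner y)))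
        (count [] AllPairs.[] (λ ()) (λ z → inj₂ (all-inner z)))
      where
      finish : D ≤ suc r → 2 * r ≤ a + c → suc n ≡ a + b + c → ⊥
      finish D≤r r≤ cnt = (linear 7 (λ r a b c D n g → (con 4 :≤ D) ∷ (D :≤ con 1 :+ r) ∷ (2 :* r :≤ a :+ c) ∷ (con 1 :+ n :≡ a :+ b :+ c) ∷ (n :+ con 2 :≤ 2 :* g) ∷ (g :≡ a :+ b) ∷ (a :< con 2) ∷ (b :+ c :≤ 2 :* D :+ con 1) ∷ [] ⊢ absurd) ((4 ∷ 8 ∷ 4 ∷ 0 ∷ 2 ∷ 2 ∷ 4 ∷ 0 ∷ 6 ∷ 2 ∷ []) , []))
        r a b c D n g
        ((linear 5 (λ a b c D g → (g :≡ a :+ b) ∷ (con 5 :≤ g) ∷ (a :< con 2) ∷ (b :≤ c) ∷ (b :+ c :≤ 2 :* D :+ con 1) ∷ [] ⊢ con 4 :≤ D) ((2 ∷ 2 ∷ 0 ∷ 2 ∷ 2 ∷ 1 ∷ 1 ∷ []) , [])) a b c D g g≡ 5≤g (≰⇒> 2≰a) b≤c ≤D)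
        D≤r r≤ cnt n≤ g≡ (≰⇒> 2≰a) ≤D

    -- The first two bounds pin r to ⌊(b + c)/2⌋; the third, from the eccentricities of `P` and `Q`,
    -- then leaves only b = a and b = a + 1.
    record OneLeaf : Set where
      field
        p      : Fin n
        u-p    : Edge G u p
        leaf   : ¬ Inner G u
        rest-inner : ∀ x → x ≢ u → Inner G x
        2r≤    : 2 * r ≤ b + c
        ≤2r    : b + c ≤ 2 * r + 1
        2r≤a+c : 2 * r ≤ a + c
        cnt    : n ≡ a + b + c

    one-leaf : ¬ Inner G u → Inner G v → g ≡ a + b → 5 ≤ g → n + 2 ≤ 2 * g → OneLeaf
    one-leaf leaf iv g≡ 5≤g n≤ with toward poles
    ... | p , u-p , vp = record
      { p = p ; u-p = u-p ; leaf = leaf ; rest-inner = rest-inner ; 2r≤ = 2r≤ ; ≤2r = ≤2r ; 2r≤a+c = 2r≤a+c ; cnt = cnt }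
      where
      rest-inner : ∀ x → x ≢ u → Inner G x
      rest-inner = others′ poles iv

      inner-p : Inner G p
      inner-p = neighbour-inner poles u-p

      2r≤ : 2 * r ≤ b + c
      2r≤ = subst (λ d → 2 * d ≤ b + c) vp (diameter iv inner-p)

      ≤2r : b + c ≤ 2 * r + 1
      ≤2r with halve (b + c)
      ... | D , D≤ , ≤D with one-far-pair D≤ ≤D
      ...   | i , j , i≤ , j≤ , far with near (at 𝟏 i) (at 𝟐 j)
      ...     | inj₁ le = (linear 5 (λ b c D d r → (b :+ c :≤ 2 :* D :+ con 1) ∷ (D :≤ d) ∷ (d :≤ r) ∷ [] ⊢ b :+ c :≤ 2 :* r :+ con 1) ((1 ∷ 1 ∷ 2 ∷ 2 ∷ []) , [])) b c D _ r ≤D far le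
      ...     | inj₂ (inj₁ (eq , _)) = contradiction (subst (Inner G) eq (on-inner 𝟏 i i≤)) leaf
      ...     | inj₂ (inj₂ (_ , eq)) = contradiction (subst (Inner G) eq (on-inner 𝟐 j j≤)) leaf

      cnt : n ≡ a + b + c
      cnt = suc-injective (count (u ∷ []) (All.[] AllPairs.∷ AllPairs.[]) (λ { (here refl) → leaf })
        λ z → case z Fin.≟ u of λ { (yes z≡u) → inj₁ (here z≡u) ; (no z≢u) → inj₂ (rest-inner z z≢u) })

      reach : ∀ z → Inner G z → (∀ {y} → Inner G y → 2 * dist z y ≤ a + c) → 2 * r ≤ a + c ⊎ r ≤ suc (dist z p)
      reach z iz ecc with far-from poles z
      ... | y , r≤ with y Fin.≟ u
      ...   | yes refl = inj₂ (subst (r ≤_) (to-leaf leaf u-p (inner≢leaf iz leaf)) r≤)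
      ...   | no y≢u = inj₁ (≤-trans (*-monoʳ-≤ 2 r≤) (ecc (rest-inner y y≢u)))

      -- If the leaf is the vertex found far from both `P` and `Q`, then `p` is at distance at least
      -- r - 1 from both ends of its strand, so 2r ≤ c + 2. This suffices for a ≥ 2; for a = 1 it
      -- gives b ≤ 3, against a + b ≥ 5.
      2r≤a+c : 2 * r ≤ a + c
      2r≤a+c with reach P innerP ecc-P | reach Q innerQ ecc-Q
      ... | inj₁ le | _ = le
      ... | _ | inj₁ le = le
      ... | inj₂ viaP | inj₂ viaQ with cover inner-p
      ...   | σ , i , i≤ , refl = let j , i+j = rest i≤ in
        (linear 10 (λ r i j x y z a b c g → (r :≤ con 1 :+ y) ∷ (r :≤ con 1 :+ z) ∷ (y :≤ i) ∷ (z :≤ j) ∷ (i :+ j :≡ x) ∷ (x :≤ c) ∷ (b :+ c :≤ 2 :* r :+ con 1) ∷ (g :≡ a :+ b) ∷ (con 5 :≤ g) ∷ [] ⊢ 2 :* r :≤ a :+ c) ((1 ∷ 2 ∷ 2 ∷ 2 ∷ 2 ∷ 2 ∷ 0 ∷ 2 ∷ 1 ∷ 1 ∷ 0 ∷ 1 ∷ []) , []))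
          r i j (len σ) _ _ a b c g viaP viaQ (dist-P≤ σ i i≤) (dist-Q≤ σ i j i+j) i+j (longest-strand σ) ≤2r g≡ 5≤g

    -- Stripping both leaves from a geodesic between the poles leaves the distance r - 1 for their
    -- neighbours. An inner vertex at distance r from such a neighbour would be the opposite pole,
    -- which is a leaf; hence the strict bounds.
    record TwoLeaves : Set where
      field
        p q     : Fin n
        inner-p : Inner G p
        inner-q : Inner G q
        near-p  : ∀ {y} → Inner G y → dist p y < r
        near-q  : ∀ {y} → Inner G y → dist q y < r
        pq      : suc (dist p q) ≡ r
        2r≤     : 2 * r ≤ b + c
        ≤2r     : b + c ≤ 2 * r + 1
        2r≤a+c  : 2 * r ≤ a + c + 2
        cnt     : n ≡ suc (a + b + c)

    two-leaves : ¬ Inner G u → ¬ Inner G v → g ≡ a + b → n + 2 ≤ 2 * g → TwoLeaves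
    two-leaves leaf-u leaf-v g≡ n≤ with toward poles | toward (swap-poles poles)
    ... | p , u-p , _ | q , v-q , _ = record
      { p = p ; q = q ; inner-p = inner-p ; inner-q = inner-q′
      ; near-p = near-leaves poles leaf-u leaf-v u-p ; near-q = near-leaves (swap-poles poles) leaf-v leaf-u v-q
      ; pq = between-leaves poles leaf-u leaf-v u-p v-q ; 2r≤ = 2r≤ ; ≤2r = ≤2r ; 2r≤a+c = 2r≤a+c ; cnt = cnt }
      where
      inner-p : Inner G p
      inner-p = neighbour-inner poles u-p

      inner-q′ : Inner G q
      inner-q′ = neighbour-inner (swap-poles poles) v-q

      cnt : n ≡ suc (a + b + c)
      cnt = suc-injective (count (u ∷ v ∷ []) ((u≢v poles All.∷ All.[]) AllPairs.∷ (All.[] AllPairs.∷ AllPairs.[]))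
        (λ { (here refl) → leaf-u ; (there (here refl)) → leaf-v })
        λ z → case (z Fin.≟ u) , (z Fin.≟ v) of λ
          { (yes z≡u , _) → inj₁ (here z≡u) ; (_ , yes z≡v) → inj₁ (there (here z≡v))
          ; (no z≢u , no z≢v) → inj₂ (others poles z z≢u z≢v) })

      ≤2r : b + c ≤ 2 * r + 1
      ≤2r with halve (b + c)
      ... | D , D≤ , ≤D with one-far-pair D≤ ≤D
      ...   | i , j , i≤ , j≤ , far with near (at 𝟏 i) (at 𝟐 j)
      ...     | inj₁ le = (linear 5 (λ b c D d r → (b :+ c :≤ 2 :* D :+ con 1) ∷ (D :≤ d) ∷ (d :≤ r) ∷ [] ⊢ b :+ c :≤ 2 :* r :+ con 1) ((1 ∷ 1 ∷ 2 ∷ 2 ∷ []) , [])) b c D _ r ≤D far le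
      ...     | inj₂ (inj₁ (eq , _)) = contradiction (subst (Inner G) eq (on-inner 𝟏 i i≤)) leaf-u
      ...     | inj₂ (inj₂ (eq , _)) = contradiction (subst (Inner G) eq (on-inner 𝟏 i i≤)) leaf-v

      3≤r : 3 ≤ r
      3≤r = (linear 6 (λ r a b c n g → (b :+ c :≤ 2 :* r :+ con 1) ∷ (n :≡ con 1 :+ (a :+ b :+ c)) ∷ (n :+ con 2 :≤ 2 :* g) ∷ (g :≡ a :+ b) ∷ (a :≤ b) ∷ (b :≤ c) ∷ [] ⊢ con 3 :≤ r) ((4 ∷ 2 ∷ 0 ∷ 4 ∷ 4 ∷ 8 ∷ 0 ∷ 4 ∷ 6 ∷ []) , []))
              r a b c n g ≤2r cnt n≤ g≡ a≤b b≤c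

      2r≤ : 2 * r ≤ b + c
      2r≤ with far-inner-pair poles leaf-u leaf-v u-p v-q 3≤r
      ... | x , y , ix , iy , r≤ = ≤-trans (*-monoʳ-≤ 2 r≤) (diameter ix iy)

      -- The summand 2 pays for the case that the vertex far from `P` is a leaf.
      2r≤a+c : 2 * r ≤ a + c + 2
      2r≤a+c with far-from poles P
      ... | y , r≤ with y Fin.≟ u | y Fin.≟ v
      ...   | yes refl | _ = (linear 4 (λ r d a c → (r :≤ con 1 :+ d) ∷ (2 :* d :≤ a :+ c) ∷ [] ⊢ 2 :* r :≤ a :+ c :+ con 2) ((2 ∷ 4 ∷ 2 ∷ []) , [])) r _ a c
                (subst (r ≤_) (to-leaf leaf-u u-p (inner≢leaf innerP leaf-u)) r≤) (ecc-P inner-p)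
      ...   | _ | yes refl = (linear 4 (λ r d a c → (r :≤ con 1 :+ d) ∷ (2 :* d :≤ a :+ c) ∷ [] ⊢ 2 :* r :≤ a :+ c :+ con 2) ((2 ∷ 4 ∷ 2 ∷ []) , [])) r _ a c
                (subst (r ≤_) (to-leaf leaf-v v-q (inner≢leaf innerP leaf-v)) r≤) (ecc-P inner-q′)
      ...   | no y≢u | no y≢v = ≤-trans (*-monoʳ-≤ 2 r≤) (≤-trans (ecc-P (others poles y y≢u y≢v)) (m≤m+n (a + c) 2))

-- Exclusion of theta graphs of large girth, and the extremal one

module ThetaImpossible {n} (G : Graph n) (conn : Connected G) {g} (girth : ∀ k → HasCycle G k → g ≤ k) (4≤g : 4 ≤ g)
  {c₀} (C : Periodic G g c₀) (S : Strands G 3) (X : Strands.Exact S)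
  (a≤b : Strands.len S 𝟎 ≤ Strands.len S 𝟏) (b≤c : Strands.len S 𝟏 ≤ Strands.len S 𝟐) where

  open SortedTheta G conn S X a≤b b≤c
  open Leaves G conn girth 4≤g C using (leaf⇒pole; swap-poles)
  open LeafPoles G conn girth 4≤g C
  open ThetaPoles G conn girth 4≤g C S X a≤b b≤c

  other : Fin 3 → Fin 3
  other 𝟎 = 𝟏
  other 𝟏 = 𝟐
  other 𝟐 = 𝟎

  other≢ : ∀ σ → σ ≢ other σ
  other≢ 𝟎 ()
  other≢ 𝟏 ()
  other≢ 𝟐 ()

  other²≢ : ∀ σ → σ ≢ other (other σ)
  other²≢ 𝟎 ()
  other²≢ 𝟏 ()
  other²≢ 𝟐 ()

  module Equal (b≡a : b ≡ a) (c≡a : c ≡ a) where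

    len≡ : ∀ σ → len σ ≡ a
    len≡ 𝟎 = refl
    len≡ 𝟏 = b≡a
    len≡ 𝟐 = c≡a

    -- Two strands form a cycle of length 2a, on which these positions are antipodal; the routes
    -- that contain the whole third strand are no shorter.
    equal-antipode : ∀ σ τ → σ ≢ τ → ∀ i j → i + j ≡ a → a ≤ dist (at σ i) (at τ j)
    equal-antipode σ τ σ≢τ i j i+j = antipode σ τ σ≢τ i j a
      ((linear 4 (λ i j x a → (i :+ j :≡ a) ∷ (x :≡ a) ∷ [] ⊢ i :≤ x) ((1 ∷ 1 ∷ 0 ∷ 0 ∷ 1 ∷ []) , [])) i j (len σ) a i+j (len≡ σ))
      ((linear 4 (λ i j x a → (i :+ j :≡ a) ∷ (x :≡ a) ∷ [] ⊢ j :≤ x) ((1 ∷ 1 ∷ 0 ∷ 0 ∷ 1 ∷ []) , [])) i j (len τ) a i+j (len≡ τ))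
      (≤-reflexive (sym i+j))
      ((linear 5 (λ i j x y a → (i :+ j :≡ a) ∷ (x :≡ a) ∷ (y :≡ a) ∷ [] ⊢ a :+ (i :+ j) :≤ x :+ y) ((1 ∷ 1 ∷ 0 ∷ 0 ∷ 1 ∷ 0 ∷ 1 ∷ []) , [])) i j (len σ) (len τ) a i+j (len≡ σ) (len≡ τ))
      ((linear 4 (λ i j x a → (i :+ j :≡ a) ∷ (x :≡ a) ∷ [] ⊢ a :+ i :≤ a :+ x :+ j) ((1 ∷ 1 ∷ 0 ∷ 0 ∷ 1 ∷ []) , [])) i j (len σ) a i+j (len≡ σ))
      ((linear 4 (λ i j x a → (i :+ j :≡ a) ∷ (x :≡ a) ∷ [] ⊢ a :+ j :≤ a :+ i :+ x) ((1 ∷ 1 ∷ 0 ∷ 0 ∷ 1 ∷ []) , [])) i j (len τ) a i+j (len≡ τ))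

    equal-far : ∀ {p} → Inner G p → ∃ λ y → Inner G y × a ≤ dist p y
    equal-far ip with cover ip
    ... | σ , i , i≤ , refl = let j , i+j = rest (subst (i ≤_) (len≡ σ) i≤) in
      at (other σ) j
      , on-inner (other σ) j ((linear 4 (λ i j x a → (i :+ j :≡ a) ∷ (x :≡ a) ∷ [] ⊢ j :≤ x) ((1 ∷ 1 ∷ 0 ∷ 0 ∷ 1 ∷ []) , [])) i j (len (other σ)) a i+j (len≡ (other σ)))
      , equal-antipode σ (other σ) (other≢ σ) i j i+j

    -- A vertex inside a strand has an antipode inside each of the other two strands. These coincide
    -- only if the vertex is `P` or `Q`.
    equal-ends : ∀ {p v} → Inner G p → (∀ {y} → Inner G y → a ≤ dist p y → y ≡ v) → p ≡ P ⊎ p ≡ Q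
    equal-ends ip unique with cover ip
    ... | σ , zero , _ , refl = inj₁ (at-0 σ)
    ... | σ , suc i , i≤ , refl with suc i <? len σ
    ...   | no i≮ = inj₂ (trans (cong (at σ) (≤-antisym i≤ (≮⇒≥ i≮))) (at-len σ))
    ...   | yes i< = let j , i+j = rest (subst (suc i ≤_) (len≡ σ) i≤)
                         y≤ = λ τ → (linear 4 (λ i j x a → (con 1 :+ i :+ j :≡ a) ∷ (x :≡ a) ∷ [] ⊢ j :< x) ((1 ∷ 1 ∷ 0 ∷ 0 ∷ 1 ∷ []) , [])) i j (len τ) a i+j (len≡ τ) in
      contradiction
        (trans (unique (on-inner (other σ) j (<⇒≤ (y≤ (other σ)))) (equal-antipode σ _ (other≢ σ) (suc i) j i+j))
          (sym (unique (on-inner (other (other σ)) j (<⇒≤ (y≤ (other (other σ))))) (equal-antipode σ _ (other²≢ σ) (suc i) j i+j))))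
        (distinct-points _ j _ j (<⇒≤ (y≤ (other σ))) (<⇒≤ (y≤ (other (other σ))))
          ((linear 4 (λ i j x a → (con 1 :+ i :+ j :≡ a) ∷ (x :≡ a) ∷ (con 1 :+ i :< x) ∷ [] ⊢ con 0 :< j) ((1 ∷ 0 ∷ 1 ∷ 1 ∷ 0 ∷ 1 ∷ []) , [])) i j (len σ) a i+j (len≡ σ) i<) (y≤ (other σ)) (inj₁ (other≢ (other σ))))

  module AlmostEqual (b≡a : b ≡ a) (c≡ : c ≡ suc a) where

    -- Every vertex of θ_{a,a,a+1} lies on an odd cycle of length 2a + 1, on which two vertices are
    -- at distance a. With r ≤ a this contradicts `beyond-leaf`, which allows the neighbour of the
    -- leaf only one.
    TwoFar : Fin n → Set
    TwoFar p = ∃₂ λ y y′ → y ≢ y′ × Inner G y × Inner G y′ × a ≤ dist p y × a ≤ dist p y′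

    short-far : ∀ σ i → σ ≢ 𝟐 → len σ ≡ a → i ≤ a → TwoFar (at σ i)
    short-far σ i σ≢𝟐 len≡ i≤ with rest i≤
    ... | j , i+j = at 𝟐 j , at 𝟐 (suc j) , (λ eq → <⇒≢ ≤-refl (at-injective 𝟐 j (suc j) (<⇒≤ j<) j< eq))
      , on-inner 𝟐 j (<⇒≤ j<) , on-inner 𝟐 (suc j) j<
      , antipode σ 𝟐 σ≢𝟐 i j a i≤σ (<⇒≤ j<) (≤-reflexive (sym i+j))
          ((linear 5 (λ i j x a c → (i :+ j :≡ a) ∷ (x :≡ a) ∷ (c :≡ con 1 :+ a) ∷ [] ⊢ a :+ (i :+ j) :≤ x :+ c) ((1 ∷ 1 ∷ 0 ∷ 0 ∷ 1 ∷ 0 ∷ 1 ∷ []) , [])) i j (len σ) a c i+j len≡ c≡)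
          ((linear 4 (λ i j x a → (i :+ j :≡ a) ∷ (x :≡ a) ∷ [] ⊢ a :+ i :≤ a :+ x :+ j) ((1 ∷ 1 ∷ 0 ∷ 0 ∷ 1 ∷ []) , [])) i j (len σ) a i+j len≡)
          ((linear 4 (λ i j a c → (i :+ j :≡ a) ∷ (c :≡ con 1 :+ a) ∷ [] ⊢ a :+ j :≤ a :+ i :+ c) ((1 ∷ 1 ∷ 0 ∷ 0 ∷ 1 ∷ []) , [])) i j a c i+j c≡)
      , antipode σ 𝟐 σ≢𝟐 i (suc j) a i≤σ j< ((linear 3 (λ i j a → (i :+ j :≡ a) ∷ [] ⊢ a :≤ i :+ (con 1 :+ j)) ((1 ∷ 0 ∷ 1 ∷ []) , [])) i j a i+j)
          ((linear 5 (λ i j x a c → (i :+ j :≡ a) ∷ (x :≡ a) ∷ (c :≡ con 1 :+ a) ∷ [] ⊢ a :+ (i :+ (con 1 :+ j)) :≤ x :+ c) ((1 ∷ 1 ∷ 0 ∷ 0 ∷ 1 ∷ 0 ∷ 1 ∷ []) , [])) i j (len σ) a c i+j len≡ c≡)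
          ((linear 4 (λ i j x a → (i :+ j :≡ a) ∷ (x :≡ a) ∷ [] ⊢ a :+ i :≤ a :+ x :+ (con 1 :+ j)) ((1 ∷ 1 ∷ 0 ∷ 0 ∷ 1 ∷ []) , [])) i j (len σ) a i+j len≡)
          ((linear 4 (λ i j a c → (i :+ j :≡ a) ∷ (c :≡ con 1 :+ a) ∷ [] ⊢ a :+ (con 1 :+ j) :≤ a :+ i :+ c) ((1 ∷ 1 ∷ 0 ∷ 0 ∷ 1 ∷ []) , [])) i j a c i+j c≡)
      where
      j< : j < c
      j< = (linear 4 (λ i j a c → (i :+ j :≡ a) ∷ (c :≡ con 1 :+ a) ∷ [] ⊢ j :< c) ((1 ∷ 1 ∷ 0 ∷ 0 ∷ 1 ∷ []) , [])) i j a c i+j c≡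
      i≤σ : i ≤ len σ
      i≤σ = subst (i ≤_) (sym len≡) i≤

    almost-equal-far : ∀ {p} → Inner G p → TwoFar p
    almost-equal-far ip with cover ip
    ... | 𝟎 , i , i≤ , refl = short-far 𝟎 i (λ ()) refl i≤
    ... | 𝟏 , i , i≤ , refl = short-far 𝟏 i (λ ()) b≡a (subst (i ≤_) b≡a i≤)
    ... | 𝟐 , zero , _ , refl = subst TwoFar (trans (at-0 𝟎) (sym (at-0 𝟐))) (short-far 𝟎 0 (λ ()) refl z≤n)
    ... | 𝟐 , suc i , i≤ , refl with suc i ≤? a
    ...   | no i≰ = subst TwoFar (trans (at-len 𝟎) (sym (trans (cong (at 𝟐) i≡c) (at-len 𝟐)))) (short-far 𝟎 a (λ ()) refl ≤-refl)
      where
      i≡c : suc i ≡ c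
      i≡c = ≤-antisym i≤ (subst (_≤ suc i) (sym c≡) (≰⇒> i≰))
    ...   | yes i≤a with rest i≤a
    ...     | j , i+j = at 𝟎 j , at 𝟎 (suc j) , (λ eq → <⇒≢ ≤-refl (at-injective 𝟎 j (suc j) (<⇒≤ j<) j< eq))
      , on-inner 𝟎 j (<⇒≤ j<) , on-inner 𝟎 (suc j) j<
      , antipode 𝟐 𝟎 (λ ()) (suc i) j a i≤ (<⇒≤ j<) (≤-reflexive (sym i+j))
          ((linear 4 (λ i j a c → (con 1 :+ i :+ j :≡ a) ∷ (c :≡ con 1 :+ a) ∷ [] ⊢ a :+ (con 1 :+ i :+ j) :≤ c :+ a) ((1 ∷ 1 ∷ 0 ∷ 0 ∷ 1 ∷ []) , [])) i j a c i+j c≡)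
          ((linear 4 (λ i j a c → (con 1 :+ i :+ j :≡ a) ∷ (c :≡ con 1 :+ a) ∷ [] ⊢ a :+ (con 1 :+ i) :≤ a :+ c :+ j) ((1 ∷ 1 ∷ 0 ∷ 0 ∷ 1 ∷ []) , [])) i j a c i+j c≡)
          ((linear 3 (λ i j a → (con 1 :+ i :+ j :≡ a) ∷ [] ⊢ a :+ j :≤ a :+ (con 1 :+ i) :+ a) ((1 ∷ 1 ∷ 0 ∷ []) , [])) i j a i+j)
      , antipode 𝟐 𝟎 (λ ()) (suc i) (suc j) a i≤ j< ((linear 3 (λ i j a → (con 1 :+ i :+ j :≡ a) ∷ [] ⊢ a :≤ con 1 :+ i :+ (con 1 :+ j)) ((1 ∷ 0 ∷ 1 ∷ []) , [])) i j a i+j)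
          ((linear 4 (λ i j a c → (con 1 :+ i :+ j :≡ a) ∷ (c :≡ con 1 :+ a) ∷ [] ⊢ a :+ (con 1 :+ i :+ (con 1 :+ j)) :≤ c :+ a) ((1 ∷ 1 ∷ 0 ∷ 0 ∷ 1 ∷ []) , [])) i j a c i+j c≡)
          ((linear 4 (λ i j a c → (con 1 :+ i :+ j :≡ a) ∷ (c :≡ con 1 :+ a) ∷ [] ⊢ a :+ (con 1 :+ i) :≤ a :+ c :+ (con 1 :+ j)) ((1 ∷ 1 ∷ 0 ∷ 0 ∷ 1 ∷ []) , [])) i j a c i+j c≡)
          ((linear 3 (λ i j a → (con 1 :+ i :+ j :≡ a) ∷ [] ⊢ a :+ (con 1 :+ j) :≤ a :+ (con 1 :+ i) :+ a) ((1 ∷ 1 ∷ 0 ∷ []) , [])) i j a i+j)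
      where
      j< : j < a
      j< = (linear 3 (λ i j a → (con 1 :+ i :+ j :≡ a) ∷ [] ⊢ j :< a) ((1 ∷ 1 ∷ 0 ∷ []) , [])) i j a i+j

  module Skew (b≡ : b ≡ suc a) (c≡ : c ≡ suc (suc a)) where

    -- In θ_{a,a+1,a+2} the shortest and the longest strand form a cycle of length 2a + 2, each
    -- vertex of which has an antipode at distance a + 1 = r. The neighbours of the two leaves must
    -- avoid this cycle, so both lie inside the middle strand, which is too short to keep them r - 1
    -- = a apart.
    Far : Fin n → Set
    Far p = ∃ λ y → Inner G y × suc a ≤ dist p y

    far-𝟎 : ∀ i → i ≤ a → Far (at 𝟎 i)
    far-𝟎 i i≤ with rest i≤
    ... | j , i+j = at 𝟐 (suc j) , on-inner 𝟐 (suc j) j≤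
      , antipode 𝟎 𝟐 (λ ()) i (suc j) (suc a) i≤ j≤ ((linear 3 (λ i j a → (i :+ j :≡ a) ∷ [] ⊢ con 1 :+ a :≤ i :+ (con 1 :+ j)) ((1 ∷ 0 ∷ 1 ∷ []) , [])) i j a i+j)
          ((linear 4 (λ i j a c → (i :+ j :≡ a) ∷ (c :≡ con 1 :+ (con 1 :+ a)) ∷ [] ⊢ con 1 :+ a :+ (i :+ (con 1 :+ j)) :≤ a :+ c) ((1 ∷ 1 ∷ 0 ∷ 0 ∷ 1 ∷ []) , [])) i j a c i+j c≡)
          ((linear 3 (λ i j a → (i :+ j :≡ a) ∷ [] ⊢ con 1 :+ a :+ i :≤ a :+ a :+ (con 1 :+ j)) ((1 ∷ 1 ∷ 0 ∷ []) , [])) i j a i+j)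
          ((linear 4 (λ i j a c → (i :+ j :≡ a) ∷ (c :≡ con 1 :+ (con 1 :+ a)) ∷ [] ⊢ con 1 :+ a :+ (con 1 :+ j) :≤ a :+ i :+ c) ((1 ∷ 1 ∷ 0 ∷ 0 ∷ 1 ∷ []) , [])) i j a c i+j c≡)
      where
      j≤ : suc j ≤ c
      j≤ = (linear 4 (λ i j a c → (i :+ j :≡ a) ∷ (c :≡ con 1 :+ (con 1 :+ a)) ∷ [] ⊢ con 1 :+ j :≤ c) ((1 ∷ 1 ∷ 0 ∷ 0 ∷ 1 ∷ []) , [])) i j a c i+j c≡

    far-𝟐 : ∀ i → i ≤ c → Far (at 𝟐 i)
    far-𝟐 zero _ = subst Far (trans (at-0 𝟎) (sym (at-0 𝟐))) (far-𝟎 0 z≤n)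
    far-𝟐 (suc i) i≤ with i ≤? a
    ... | no i≰ = subst Far (trans (at-len 𝟎) (sym (trans (cong (at 𝟐) (≤-antisym i≤ (subst (_≤ suc i) (sym c≡) (s≤s (≰⇒> i≰))))) (at-len 𝟐))))
                    (far-𝟎 a ≤-refl)
    ... | yes i≤a with rest i≤a
    ...   | j , i+j = at 𝟎 j , on-inner 𝟎 j j≤
      , antipode 𝟐 𝟎 (λ ()) (suc i) j (suc a) i≤ j≤ ((linear 3 (λ i j a → (i :+ j :≡ a) ∷ [] ⊢ con 1 :+ a :≤ con 1 :+ i :+ j) ((1 ∷ 0 ∷ 1 ∷ []) , [])) i j a i+j)
          ((linear 4 (λ i j a c → (i :+ j :≡ a) ∷ (c :≡ con 1 :+ (con 1 :+ a)) ∷ [] ⊢ con 1 :+ a :+ (con 1 :+ i :+ j) :≤ c :+ a) ((1 ∷ 1 ∷ 0 ∷ 0 ∷ 1 ∷ []) , [])) i j a c i+j c≡)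
          ((linear 4 (λ i j a c → (i :+ j :≡ a) ∷ (c :≡ con 1 :+ (con 1 :+ a)) ∷ [] ⊢ con 1 :+ a :+ (con 1 :+ i) :≤ a :+ c :+ j) ((1 ∷ 1 ∷ 0 ∷ 0 ∷ 1 ∷ []) , [])) i j a c i+j c≡)
          ((linear 3 (λ i j a → (i :+ j :≡ a) ∷ [] ⊢ con 1 :+ a :+ j :≤ a :+ (con 1 :+ i) :+ a) ((1 ∷ 1 ∷ 0 ∷ []) , [])) i j a i+j)
      where
      j≤ : j ≤ a
      j≤ = (linear 3 (λ i j a → (i :+ j :≡ a) ∷ [] ⊢ j :≤ a) ((1 ∷ 1 ∷ 0 ∷ []) , [])) i j a i+j

    not-far : ∀ {p} → Inner G p → ¬ Far p → ∃ λ i → 0 < i × i < b × p ≡ at 𝟏 i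
    not-far ip ¬far with cover ip
    ... | 𝟎 , i , i≤ , refl = contradiction (far-𝟎 i i≤) ¬far
    ... | 𝟐 , i , i≤ , refl = contradiction (far-𝟐 i i≤) ¬far
    ... | 𝟏 , zero , _ , refl = contradiction (subst Far (trans (at-0 𝟎) (sym (at-0 𝟏))) (far-𝟎 0 z≤n)) ¬far
    ... | 𝟏 , suc i , i≤ , refl with suc i <? b
    ...   | yes i< = suc i , z<s , i< , refl
    ...   | no i≮ = contradiction (subst Far (trans (at-len 𝟎) (sym (trans (cong (at 𝟏) (≤-antisym i≤ (≮⇒≥ i≮))) (at-len 𝟏)))) (far-𝟎 a ≤-refl)) ¬far

    near-in-𝟏 : ∀ i j → 0 < i → i < b → 0 < j → j < b → dist (at 𝟏 i) (at 𝟏 j) < a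
    near-in-𝟏 i j 0<i i<b 0<j j<b with ≤-total i j
    ... | inj₁ i≤j with rest i≤j
    ...   | k , refl = (linear 5 (λ i k d a b → (d :≤ k) ∷ (con 0 :< i) ∷ (i :+ k :< b) ∷ (b :≡ con 1 :+ a) ∷ [] ⊢ d :< a) ((1 ∷ 1 ∷ 1 ∷ 1 ∷ 1 ∷ 0 ∷ []) , [])) i k _ a b (dist-same≤ 𝟏 i k (<⇒≤ j<b)) 0<i j<b b≡
    near-in-𝟏 i j 0<i i<b 0<j j<b | inj₂ j≤i with rest j≤i
    ...   | k , refl = (linear 5 (λ j k d a b → (d :≤ k) ∷ (con 0 :< j) ∷ (j :+ k :< b) ∷ (b :≡ con 1 :+ a) ∷ [] ⊢ d :< a) ((1 ∷ 1 ∷ 1 ∷ 1 ∷ 1 ∷ 0 ∷ []) , [])) j k _ a b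
      (subst (_≤ k) (dist-sym _ _) (dist-same≤ 𝟏 j k (<⇒≤ i<b))) 0<j i<b b≡

  module Bounds {u v r} (poles : Poles u v r) (g≡ : g ≡ a + b) (5≤g : 5 ≤ g) (n≤ : n + 2 ≤ 2 * g) where
    open WithPoles poles

    module _ {k N} (even : n ≡ 2 * N) (n≤6k+4 : n ≤ 6 * k + 4) (4k<g : 4 * k < g) where

      -- If b = a + 1, then a + c = 2r and n = a + 1 + 2r, so a is odd, and g > 4k gives n ≥ 6k + 5.
      -- If b = a, then c is even and a > 2k, and n ≤ 6k + 4 leaves only the lengths 2k + 1, 2k + 1,
      -- 2k + 2.
      one-leaf-impossible : OneLeaf → ⊥
      one-leaf-impossible L with b ≤? a
      ... | no b≰a = case parity a of λ
        { (h , inj₁ a≡) → even≢odd N (h + r)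
            ((linear 7 (λ a b c n N h r → (a :< b) ∷ (a :≡ 2 :* h) ∷ (n :≡ a :+ b :+ c) ∷ (n :≡ 2 :* N) ∷ (2 :* r :≤ a :+ c) ∷ (b :+ c :≤ 2 :* r :+ con 1) ∷ [] ⊢ 2 :* N :≡ 2 :* (h :+ r) :+ con 1) ((4 ∷ 0 ∷ 4 ∷ 0 ∷ 4 ∷ 0 ∷ 0 ∷ 4 ∷ 0 ∷ 4 ∷ []) , (4 ∷ 4 ∷ 0 ∷ 4 ∷ 0 ∷ 4 ∷ 4 ∷ 0 ∷ 4 ∷ 0 ∷ [])))
              a b c n N h r (≰⇒> b≰a) a≡ cnt even 2r≤a+c ≤2r)
        ; (h , inj₂ a≡) → (linear 6 (λ a b c n k h → (k :≤ h) ∷ (a :≡ 2 :* h :+ con 1) ∷ (a :< b) ∷ (b :≤ c) ∷ (n :≡ a :+ b :+ c) ∷ (n :≤ 6 :* k :+ con 4) ∷ [] ⊢ absurd) ((12 ∷ 0 ∷ 6 ∷ 4 ∷ 2 ∷ 0 ∷ 2 ∷ 2 ∷ []) , [])) a b c n k h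
            ((linear 7 (λ a b c k h g r → (a :≡ 2 :* h :+ con 1) ∷ (4 :* k :< g) ∷ (g :≡ a :+ b) ∷ (2 :* r :≤ a :+ c) ∷ (b :+ c :≤ 2 :* r :+ con 1) ∷ [] ⊢ k :≤ h) ((4 ∷ 2 ∷ 0 ∷ 1 ∷ 1 ∷ 0 ∷ 1 ∷ 1 ∷ []) , [])) a b c k h g r a≡ 4k<g g≡ 2r≤a+c ≤2r)
            a≡ (≰⇒> b≰a) b≤c cnt n≤6k+4 }
        where open OneLeaf L
      ... | yes b≤a = case parity c of λ
        { (h , inj₂ c≡) → even≢odd N (a + h)
            ((linear 6 (λ a b c n N h → (b :≡ a) ∷ (c :≡ 2 :* h :+ con 1) ∷ (n :≡ a :+ b :+ c) ∷ (n :≡ 2 :* N) ∷ [] ⊢ 2 :* N :≡ 2 :* (a :+ h) :+ con 1) ((2 ∷ 2 ∷ 0 ∷ 2 ∷ 0 ∷ 2 ∷ 0 ∷ 0 ∷ 2 ∷ []) , (2 ∷ 0 ∷ 2 ∷ 0 ∷ 2 ∷ 0 ∷ 2 ∷ 2 ∷ 0 ∷ []))) a b c n N h b≡a c≡ cnt even)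
        ; (h , inj₁ c≡) → finish h c≡ }
        where
        open OneLeaf L
        b≡a : b ≡ a
        b≡a = ≤-antisym b≤a a≤b
        2k<a : 2 * k < a
        2k<a = (linear 4 (λ a b k g → (b :≡ a) ∷ (4 :* k :< g) ∷ (g :≡ a :+ b) ∷ [] ⊢ 2 :* k :< a) ((4 ∷ 2 ∷ 0 ∷ 2 ∷ 2 ∷ 0 ∷ []) , [])) a b k g b≡a 4k<g g≡
        finish : ∀ h → c ≡ 2 * h → ⊥
        finish h c≡ = let y , y′ , y≢y′ , iy , iy′ , d , d′ = almost-equal-far (neighbour-inner poles u-p) in
          y≢y′ (trans (beyond-leaf poles leaf u-p iy (≤-trans r≤a d)) (sym (beyond-leaf poles leaf u-p iy′ (≤-trans r≤a d′))))
          where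
          k<h : k < h
          k<h = (linear 5 (λ a b c k h → (2 :* k :< a) ∷ (a :≤ b) ∷ (b :≤ c) ∷ (c :≡ 2 :* h) ∷ [] ⊢ k :< h) ((2 ∷ 1 ∷ 1 ∷ 1 ∷ 1 ∷ 0 ∷ []) , [])) a b c k h 2k<a a≤b b≤c c≡
          c≡a+1 : c ≡ suc a
          c≡a+1 = (linear 6 (λ a b c k h n → (k :< h) ∷ (2 :* k :< a) ∷ (b :≡ a) ∷ (c :≡ 2 :* h) ∷ (n :≡ a :+ b :+ c) ∷ (n :≤ 6 :* k :+ con 4) ∷ [] ⊢ c :≡ con 1 :+ a) ((2 ∷ 0 ∷ 6 ∷ 0 ∷ 2 ∷ 0 ∷ 0 ∷ 0 ∷ 2 ∷ 2 ∷ []) , (4 ∷ 12 ∷ 0 ∷ 0 ∷ 2 ∷ 0 ∷ 6 ∷ 0 ∷ 2 ∷ 2 ∷ [])))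
                    a b c k h n k<h 2k<a b≡a c≡ cnt n≤6k+4
          r≤a : r ≤ a
          r≤a = (linear 3 (λ a c r → (2 :* r :≤ a :+ c) ∷ (c :≡ con 1 :+ a) ∷ [] ⊢ r :≤ a) ((2 ∷ 1 ∷ 1 ∷ 0 ∷ []) , [])) a c r 2r≤a+c c≡a+1
          open AlmostEqual b≡a c≡a+1

      -- Here a + b + c ≤ 6k + 3. For g ≥ 4k + 2 all lengths are 2k + 1. For g = 4k + 1 there are
      -- three cases: lengths 2k, 2k + 1, 2k + 1 make n odd; b ≥ 2k + 2 makes r too large for the
      -- eccentricity of `P`; and 2k, 2k + 1, 2k + 2 is the skew case.
      two-leaves-impossible : TwoLeaves → ⊥
      two-leaves-impossible L with g ≤? 4 * k + 1
      ... | no g≰ = let y , iy , far = equal-far inner-p in <⇒≱ (near-p iy) (≤-trans r≤a far)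
        where
        open TwoLeaves L
        b≡a : b ≡ a
        b≡a = (linear 6 (λ a b c n k g → (4 :* k :+ con 1 :< g) ∷ (g :≡ a :+ b) ∷ (n :≡ con 1 :+ (a :+ b :+ c)) ∷ (n :≤ 6 :* k :+ con 4) ∷ (a :≤ b) ∷ (b :≤ c) ∷ [] ⊢ b :≡ a) ((2 ∷ 6 ∷ 6 ∷ 0 ∷ 0 ∷ 4 ∷ 4 ∷ 0 ∷ 4 ∷ []) , (1 ∷ 0 ∷ 0 ∷ 0 ∷ 0 ∷ 0 ∷ 0 ∷ 1 ∷ 0 ∷ [])))
                a b c n k g (≰⇒> g≰) g≡ cnt n≤6k+4 a≤b b≤c
        c≡a : c ≡ a
        c≡a = (linear 6 (λ a b c n k g → (4 :* k :+ con 1 :< g) ∷ (g :≡ a :+ b) ∷ (n :≡ con 1 :+ (a :+ b :+ c)) ∷ (n :≤ 6 :* k :+ con 4) ∷ (a :≤ b) ∷ (b :≤ c) ∷ [] ⊢ c :≡ a) ((8 ∷ 24 ∷ 24 ∷ 0 ∷ 0 ∷ 16 ∷ 16 ∷ 0 ∷ 8 ∷ []) , (1 ∷ 0 ∷ 0 ∷ 0 ∷ 0 ∷ 0 ∷ 0 ∷ 1 ∷ 1 ∷ [])))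
                a b c n k g (≰⇒> g≰) g≡ cnt n≤6k+4 a≤b b≤c
        r≤a : r ≤ a
        r≤a = (linear 4 (λ a b c r → (b :≡ a) ∷ (c :≡ a) ∷ (2 :* r :≤ b :+ c) ∷ [] ⊢ r :≤ a) ((2 ∷ 1 ∷ 0 ∷ 1 ∷ 0 ∷ 1 ∷ []) , [])) a b c r b≡a c≡a 2r≤
        open Equal b≡a c≡a
      ... | yes g≤ with c ≤? 2 * k + 1
      ...   | yes c≤ = even≢odd N (3 * k + 1) ((linear 7 (λ a b c n k g N → (g :≤ 4 :* k :+ con 1) ∷ (4 :* k :< g) ∷ (g :≡ a :+ b) ∷ (n :≡ con 1 :+ (a :+ b :+ c)) ∷ (2 :* k :< b) ∷ (b :≤ c) ∷ (c :≤ 2 :* k :+ con 1) ∷ (n :≡ 2 :* N) ∷ [] ⊢ 2 :* N :≡ 2 :* (3 :* k :+ con 1) :+ con 1) ((2 ∷ 2 ∷ 0 ∷ 0 ∷ 2 ∷ 2 ∷ 0 ∷ 0 ∷ 0 ∷ 2 ∷ 0 ∷ 2 ∷ []) , (4 ∷ 0 ∷ 4 ∷ 4 ∷ 0 ∷ 0 ∷ 4 ∷ 4 ∷ 4 ∷ 0 ∷ 4 ∷ 0 ∷ [])))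
                a b c n k g N g≤ 4k<g g≡ cnt ((linear 4 (λ a b k g → (4 :* k :< g) ∷ (g :≡ a :+ b) ∷ (a :≤ b) ∷ [] ⊢ 2 :* k :< b) ((4 ∷ 2 ∷ 2 ∷ 0 ∷ 2 ∷ []) , [])) a b k g 4k<g g≡ a≤b) b≤c c≤ even)
        where open TwoLeaves L
      ...   | no c≰ with b ≤? 2 * k + 1
      ...     | no b≰ = (linear 6 (λ a b c n k r → (2 :* k :+ con 2 :≤ r) ∷ (n :≡ con 1 :+ (a :+ b :+ c)) ∷ (n :≤ 6 :* k :+ con 4) ∷ (2 :* k :+ con 1 :< b) ∷ (2 :* r :≤ a :+ c :+ con 2) ∷ [] ⊢ absurd) ((4 ∷ 0 ∷ 2 ∷ 2 ∷ 2 ∷ 2 ∷ []) , []))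
                a b c n k r ((linear 4 (λ k b c r → (2 :* k :+ con 1 :< b) ∷ (b :≤ c) ∷ (b :+ c :≤ 2 :* r :+ con 1) ∷ [] ⊢ 2 :* k :+ con 2 :≤ r) ((4 ∷ 4 ∷ 2 ∷ 2 ∷ []) , [])) k b c r (≰⇒> b≰) b≤c ≤2r)
                 cnt n≤6k+4 (≰⇒> b≰) 2r≤a+c
        where open TwoLeaves L
      ...     | yes b≤ = let i , 0<i , i<b , p≡ = not-far inner-p (excluded near-p) ; j , 0<j , j<b , q≡ = not-far inner-q (excluded near-q) in
        (linear 3 (λ r d a → (con 1 :+ d :≡ r) ∷ (d :< a) ∷ (con 1 :+ a :≤ r) ∷ [] ⊢ absurd) ((0 ∷ 1 ∷ 1 ∷ 1 ∷ []) , [])) r _ a pq (subst₂ (λ x y → dist x y < a) (sym p≡) (sym q≡) (near-in-𝟏 i j 0<i i<b 0<j j<b)) a<r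
        where
        open TwoLeaves L hiding (≤2r)
        2k<b : 2 * k < b
        2k<b = (linear 4 (λ a b k g → (4 :* k :< g) ∷ (g :≡ a :+ b) ∷ (a :≤ b) ∷ [] ⊢ 2 :* k :< b) ((4 ∷ 2 ∷ 2 ∷ 0 ∷ 2 ∷ []) , [])) a b k g 4k<g g≡ a≤b
        b≡ : b ≡ suc a
        b≡ = (linear 4 (λ a b k g → (g :≤ 4 :* k :+ con 1) ∷ (4 :* k :< g) ∷ (g :≡ a :+ b) ∷ (b :≤ 2 :* k :+ con 1) ∷ (2 :* k :< b) ∷ [] ⊢ b :≡ con 1 :+ a) ((1 ∷ 0 ∷ 1 ∷ 1 ∷ 0 ∷ 2 ∷ 0 ∷ []) , (2 ∷ 2 ∷ 0 ∷ 0 ∷ 2 ∷ 0 ∷ 4 ∷ []))) a b k g g≤ 4k<g g≡ b≤ 2k<b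
        c≡ : c ≡ suc (suc a)
        c≡ = (linear 6 (λ a b c n k g → (4 :* k :< g) ∷ (g :≡ a :+ b) ∷ (b :≤ 2 :* k :+ con 1) ∷ (2 :* k :< b) ∷ (2 :* k :+ con 1 :< c) ∷ (n :≡ con 1 :+ (a :+ b :+ c)) ∷ (n :≤ 6 :* k :+ con 4) ∷ [] ⊢ c :≡ con 1 :+ (con 1 :+ a)) ((2 ∷ 4 ∷ 4 ∷ 0 ∷ 2 ∷ 0 ∷ 0 ∷ 0 ∷ 2 ∷ 2 ∷ []) , (2 ∷ 0 ∷ 0 ∷ 0 ∷ 0 ∷ 2 ∷ 4 ∷ 0 ∷ 2 ∷ 2 ∷ [])))
               a b c n k g 4k<g g≡ b≤ 2k<b (≰⇒> c≰) cnt n≤6k+4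
        a<r : suc a ≤ r
        a<r = (linear 4 (λ a b c r → (b :≡ con 1 :+ a) ∷ (c :≡ con 1 :+ (con 1 :+ a)) ∷ (b :+ c :≤ 2 :* r :+ con 1) ∷ [] ⊢ con 1 :+ a :≤ r) ((2 ∷ 0 ∷ 1 ∷ 0 ∷ 1 ∷ 1 ∷ []) , [])) a b c r b≡ c≡ (TwoLeaves.≤2r L)
        r≤ : r ≤ suc a
        r≤ = (linear 4 (λ a b c r → (b :≡ con 1 :+ a) ∷ (c :≡ con 1 :+ (con 1 :+ a)) ∷ (2 :* r :≤ b :+ c) ∷ [] ⊢ r :≤ con 1 :+ a) ((2 ∷ 1 ∷ 0 ∷ 1 ∷ 0 ∷ 1 ∷ []) , [])) a b c r b≡ c≡ 2r≤
        open Skew b≡ c≡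
        excluded : ∀ {x} → (∀ {y} → Inner G y → dist x y < r) → ¬ Far x
        excluded near (y , iy , far) = <⇒≱ (near iy) (≤-trans r≤ far)

  leaf-cases : ∀ {u v r} (poles : Poles u v r) → g ≡ a + b → 5 ≤ g → n + 2 ≤ 2 * g →
               WithPoles.OneLeaf poles ⊎ WithPoles.OneLeaf (swap-poles poles) ⊎ WithPoles.TwoLeaves poles
  leaf-cases {u} {v} poles g≡ 5≤g n≤ with inner? G u | inner? G v
  ... | no ¬iu | yes iv = inj₁ (WithPoles.one-leaf poles ¬iu iv g≡ 5≤g n≤)
  ... | yes iu | no ¬iv = inj₂ (inj₁ (WithPoles.one-leaf (swap-poles poles) ¬iv iu g≡ 5≤g n≤))
  ... | no ¬iu | no ¬iv = inj₂ (inj₂ (WithPoles.two-leaves poles ¬iu ¬iv g≡ n≤))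
  ... | yes iu | yes iv = ⊥-elim (WithPoles.no-leaf poles all-inner g≡ 5≤g n≤)
    where
    all-inner : ∀ x → Inner G x
    all-inner x with inner? G x
    ... | yes ix = ix
    ... | no leaf = case leaf⇒pole poles leaf of λ { (inj₁ refl) → iu ; (inj₂ refl) → iv }

  theta-impossible : ∀ {u v r k N} → Poles u v r → g ≡ a + b → 5 ≤ g → n + 2 ≤ 2 * g →
                     n ≡ 2 * N → n ≤ 6 * k + 4 → 4 * k < g → ⊥
  theta-impossible {k = k} {N} poles g≡ 5≤g n≤ even n≤6k+4 4k<g with leaf-cases poles g≡ 5≤g n≤
  ... | inj₁ L        = Bounds.one-leaf-impossible poles g≡ 5≤g n≤ {k} {N} even n≤6k+4 4k<g L
  ... | inj₂ (inj₁ L) = Bounds.one-leaf-impossible (swap-poles poles) g≡ 5≤g n≤ {k} {N} even n≤6k+4 4k<g L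
  ... | inj₂ (inj₂ L) = Bounds.two-leaves-impossible poles g≡ 5≤g n≤ {k} {N} even n≤6k+4 4k<g L

  record PendantTheta (k : ℕ) : Set where
    field
      len≡   : ∀ σ → len σ ≡ 2 * k
      w      : Fin n
      rest-inner : ∀ x → x ≢ w → Inner G x
      leaf   : ¬ Inner G w
      joined : Edge G w P ⊎ Edge G w Q

  module _ {u v r} (poles : Poles u v r) {k} (g≡ : g ≡ a + b) (n≡ : n ≡ 6 * k) (g≡4k : g ≡ 4 * k) where

    -- The equation c = n - g = 2k and the bound b ≥ g/2 = 2k force three equal lengths, and
    -- `equal-ends` then places the leaf at a branch vertex.
    one-leaf⇒pendant : WithPoles.OneLeaf poles → PendantTheta k
    one-leaf⇒pendant L = record
      { len≡ = λ σ → trans (len≡ σ) a≡ ; w = u ; rest-inner = rest-inner ; leaf = leaf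
      ; joined = case equal-ends (neighbour-inner poles u-p) (λ iy far → beyond-leaf poles leaf u-p iy (≤-trans r≤a far)) of λ
          { (inj₁ p≡) → inj₁ (subst (Edge G u) p≡ u-p) ; (inj₂ p≡) → inj₂ (subst (Edge G u) p≡ u-p) } }
      where
      open WithPoles.OneLeaf L
      2k≤b : 2 * k ≤ b
      2k≤b = (linear 4 (λ a b k g → (g :≡ 4 :* k) ∷ (g :≡ a :+ b) ∷ (a :≤ b) ∷ [] ⊢ 2 :* k :≤ b) ((4 ∷ 0 ∷ 2 ∷ 2 ∷ 0 ∷ 2 ∷ []) , [])) a b k g g≡4k g≡ a≤b
      a≡ : a ≡ 2 * k
      a≡ = (linear 6 (λ a b c k g n → (g :≡ 4 :* k) ∷ (g :≡ a :+ b) ∷ (n :≡ 6 :* k) ∷ (n :≡ a :+ b :+ c) ∷ (2 :* k :≤ b) ∷ (b :≤ c) ∷ [] ⊢ a :≡ 2 :* k) ((2 ∷ 2 ∷ 0 ∷ 0 ∷ 2 ∷ 0 ∷ 0 ∷ 0 ∷ 0 ∷ 2 ∷ 0 ∷ []) , (8 ∷ 0 ∷ 16 ∷ 16 ∷ 0 ∷ 8 ∷ 0 ∷ 0 ∷ 8 ∷ 0 ∷ 8 ∷ []))) a b c k g n g≡4k g≡ n≡ cnt 2k≤b b≤c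
      b≡a : b ≡ a
      b≡a = (linear 6 (λ a b c k g n → (g :≡ 4 :* k) ∷ (g :≡ a :+ b) ∷ (n :≡ 6 :* k) ∷ (n :≡ a :+ b :+ c) ∷ (2 :* k :≤ b) ∷ (b :≤ c) ∷ [] ⊢ b :≡ a) ((2 ∷ 0 ∷ 6 ∷ 6 ∷ 0 ∷ 4 ∷ 0 ∷ 0 ∷ 4 ∷ 0 ∷ 4 ∷ []) , (2 ∷ 0 ∷ 0 ∷ 0 ∷ 0 ∷ 2 ∷ 0 ∷ 0 ∷ 2 ∷ 6 ∷ 2 ∷ []))) a b c k g n g≡4k g≡ n≡ cnt 2k≤b b≤c
      c≡a : c ≡ a
      c≡a = (linear 6 (λ a b c k g n → (g :≡ 4 :* k) ∷ (g :≡ a :+ b) ∷ (n :≡ 6 :* k) ∷ (n :≡ a :+ b :+ c) ∷ (2 :* k :≤ b) ∷ (b :≤ c) ∷ [] ⊢ c :≡ a) ((8 ∷ 0 ∷ 24 ∷ 24 ∷ 0 ∷ 16 ∷ 0 ∷ 0 ∷ 16 ∷ 0 ∷ 8 ∷ []) , (8 ∷ 16 ∷ 0 ∷ 0 ∷ 16 ∷ 0 ∷ 8 ∷ 8 ∷ 0 ∷ 8 ∷ 0 ∷ []))) a b c k g n g≡4k g≡ n≡ cnt 2k≤b b≤c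
      r≤a : r ≤ a
      r≤a = (linear 3 (λ a c r → (2 :* r :≤ a :+ c) ∷ (c :≡ a) ∷ [] ⊢ r :≤ a) ((2 ∷ 1 ∷ 1 ∷ 0 ∷ []) , [])) a c r 2r≤a+c c≡a
      open Equal b≡a c≡a

    two-leaves⇒⊥ : WithPoles.TwoLeaves poles → ⊥
    two-leaves⇒⊥ L = (linear 6 (λ a b c k g n → (g :≡ 4 :* k) ∷ (g :≡ a :+ b) ∷ (n :≡ 6 :* k) ∷ (n :≡ con 1 :+ (a :+ b :+ c)) ∷ (a :≤ b) ∷ (b :≤ c) ∷ [] ⊢ absurd) ((0 ∷ 6 ∷ 6 ∷ 0 ∷ 4 ∷ 0 ∷ 0 ∷ 4 ∷ 2 ∷ 4 ∷ []) , []))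
      a b c k g n g≡4k g≡ n≡ (WithPoles.TwoLeaves.cnt L) a≤b b≤c

  pendant-theta : ∀ {u v r k} → Poles u v r → g ≡ a + b → 5 ≤ g → n + 2 ≤ 2 * g → n ≡ 6 * k → g ≡ 4 * k → PendantTheta k
  pendant-theta {k = k} poles g≡ 5≤g n≤ n≡ g≡4k with leaf-cases poles g≡ 5≤g n≤
  ... | inj₁ L        = one-leaf⇒pendant poles {k} g≡ n≡ g≡4k L
  ... | inj₂ (inj₁ L) = one-leaf⇒pendant (swap-poles poles) {k} g≡ n≡ g≡4k L
  ... | inj₂ (inj₂ L) = ⊥-elim (two-leaves⇒⊥ poles {k} g≡ n≡ g≡4k L)

-- Chords and bridges

module AlongWalks {n} {G : Graph n} {ν} (S : Strands G ν) where
  open Strands S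

  along-onʳ : ∀ {x y} → Along x y → On y
  along-onʳ (σ , t , t< , inj₁ (_ , q)) = σ , suc t , t< , q
  along-onʳ (σ , t , t< , inj₂ (_ , q)) = σ , t , <⇒≤ t< , q

  along? : ∀ x y → Dec (Along x y)
  along? x y = any? λ σ → map′
    (λ { (t , p) → toℕ t , toℕ<n t , p })
    (λ { (t , t< , p) → fromℕ< t< , subst (λ s → x ≡ at σ s × y ≡ at σ (suc s) ⊎ x ≡ at σ (suc s) × y ≡ at σ s) (sym (toℕ-fromℕ< t<)) p })
    (any? λ t → (x Fin.≟ at σ (toℕ t) ×-dec y Fin.≟ at σ (suc (toℕ t))) ⊎-dec (x Fin.≟ at σ (suc (toℕ t)) ×-dec y Fin.≟ at σ (toℕ t)))

  walk-same : ∀ σ i k → i + k ≤ len σ → RWalk Along (at σ i) (at σ (i + k)) k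
  walk-same σ i k i+k≤ = rwalk-along (at σ) i k λ t _ t< → σ , t , <-≤-trans t< i+k≤ , inj₁ (refl , refl)

  walk-from-P : ∀ σ i → i ≤ len σ → RWalk Along P (at σ i) i
  walk-from-P σ i i≤ = subst (λ z → RWalk Along z (at σ i) i) (at-0 σ) (walk-same σ 0 i i≤)

  walk-to-Q : ∀ σ i j → i + j ≡ len σ → RWalk Along (at σ i) Q j
  walk-to-Q σ i j i+j = subst (λ z → RWalk Along (at σ i) z j) (trans (cong (at σ) i+j) (at-len σ)) (walk-same σ i j (≤-reflexive i+j))

  walk-PQ : ∀ σ → RWalk Along P Q (len σ)
  walk-PQ σ = subst (λ z → RWalk Along P z (len σ)) (at-len σ) (walk-from-P σ (len σ) ≤-refl)

  walk-viaP : ∀ σ τ i j → i ≤ len σ → j ≤ len τ → RWalk Along (at σ i) (at τ j) (i + j)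
  walk-viaP σ τ i j i≤ j≤ = rwalk-++ (rwalk-reverse along-sym (walk-from-P σ i i≤)) (walk-from-P τ j j≤)

  walk-viaQ : ∀ σ τ i i′ j j′ → i + i′ ≡ len σ → j + j′ ≡ len τ → RWalk Along (at σ i) (at τ j) (i′ + j′)
  walk-viaQ σ τ i i′ j j′ i+ j+ = rwalk-++ (walk-to-Q σ i i′ i+) (rwalk-reverse along-sym (walk-to-Q τ j j′ j+))

  walk-viaPQ : ∀ σ τ ω i j j′ → i ≤ len σ → j + j′ ≡ len τ → RWalk Along (at σ i) (at τ j) (i + (len ω + j′))
  walk-viaPQ σ τ ω i j j′ i≤ j+ = rwalk-++ (rwalk-reverse along-sym (walk-from-P σ i i≤))
    (rwalk-++ (walk-PQ ω) (rwalk-reverse along-sym (walk-to-Q τ j j′ j+)))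

  walk-viaQP : ∀ σ τ ω i i′ j → i + i′ ≡ len σ → j ≤ len τ → RWalk Along (at σ i) (at τ j) (i′ + (len ω + j))
  walk-viaQP σ τ ω i i′ j i+ j≤ = rwalk-++ (walk-to-Q σ i i′ i+)
    (rwalk-++ (rwalk-reverse along-sym (walk-PQ ω)) (walk-from-P τ j j≤))

  walks-cross : ∀ σ τ i j → i ≤ len σ → j ≤ len τ →
                ∃₂ λ l l′ → l + l′ ≡ len σ + len τ × RWalk Along (at σ i) (at τ j) l × RWalk Along (at σ i) (at τ j) l′
  walks-cross σ τ i j i≤ j≤ =
    i + j , i′ + j′
    , (linear 6 (λ i j k l x y → (i :+ k :≡ x) ∷ (j :+ l :≡ y) ∷ [] ⊢ i :+ j :+ (k :+ l) :≡ x :+ y) ((1 ∷ 1 ∷ 0 ∷ 1 ∷ 0 ∷ []) , (1 ∷ 0 ∷ 1 ∷ 0 ∷ 1 ∷ []))) i j i′ j′ (len σ) (len τ) i+ j+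
    , walk-viaP σ τ i j i≤ j≤ , walk-viaQ σ τ i i′ j j′ i+ j+
    where
    i′ = len σ ∸ i
    j′ = len τ ∸ j
    i+ : i + i′ ≡ len σ
    i+ = m+[n∸m]≡n i≤
    j+ : j + j′ ≡ len τ
    j+ = m+[n∸m]≡n j≤

  walks-same : ∀ σ i k → i + k ≤ len σ → ∀ ω →
               RWalk Along (at σ i) (at σ (i + k)) k × ∃ λ l → k + l ≡ len σ + len ω × RWalk Along (at σ i) (at σ (i + k)) l
  walks-same σ i k i+k≤ ω = walk-same σ i k i+k≤ , i + (len ω + j′)
    , (linear 5 (λ i k j x y → (i :+ k :+ j :≡ x) ∷ [] ⊢ k :+ (i :+ (y :+ j)) :≡ x :+ y) ((1 ∷ 1 ∷ 0 ∷ []) , (1 ∷ 0 ∷ 1 ∷ []))) i k j′ (len σ) (len ω) j+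
    , walk-viaPQ σ σ ω i (i + k) j′ (≤-trans (m≤m+n i k) i+k≤) j+
    where
    j′ = len σ ∸ (i + k)
    j+ : (i + k) + j′ ≡ len σ
    j+ = m+[n∸m]≡n i+k≤

  -- A chord (m = 0) or a path through further vertices, joining two vertices of the strands.
  record Bridge (m : ℕ) (p : ℕ → Fin n) : Set where
    field
      links    : ∀ i → i ≤ m → Edge G (p i) (p (suc i))
      off      : ∀ i → 0 < i → i ≤ m → ¬ On (p i)
      inj-p    : ∀ i j → i < j → j ≤ m → p i ≢ p j
      ends     : p 0 ≢ p (suc m)
      new-edge : m ≡ 0 → ¬ Along (p 0) (p 1)

  -- The first edge of the bridge is closed up by the walk along the strands followed by the rest of
  -- the bridge in reverse. Neither piece traverses that edge forwards, so the closed walk contains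
  -- a cycle.
  bridge-bound : ∀ {g} → (∀ k → HasCycle G k → g ≤ k) → ∀ {m p l} → Bridge m p → RWalk Along (p 0) (p (suc m)) l → g ≤ l + suc m
  bridge-bound {g} girth {m} {p} {l} B w =
    let k , k≤ , cyc = edge+walk⇒cycle G (links 0 z≤n) (rwalk-++
          (rwalk-map (λ al → along⇒edge al , λ { (refl , refl) → not-first al }) w)
          (rwalk-reverse {R = λ x y → Edge G x y × y ≢ p 0} (λ { (e , y≢) → edge-sym G e , λ { (y≡ , _) → y≢ y≡ } })
            (rwalk-along p 1 m λ t 0<t t< → links t (s≤s⁻¹ t<) , avoid t t<)))
    in ≤-trans (girth k cyc) (subst (k ≤_) (sym (+-suc l m)) k≤)
    where
    open Bridge B
    not-first : ¬ Along (p 0) (p 1)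
    not-first al = case 1 ≤? m of λ
      { (yes 1≤m) → off 1 z<s 1≤m (along-onʳ al)
      ; (no 1≰m) → new-edge (≤-antisym (s≤s⁻¹ (≰⇒> 1≰m)) z≤n) al }
    avoid : ∀ t → t < 1 + m → p (suc t) ≢ p 0
    avoid t t< eq = case suc t ≤? m of λ
      { (yes st≤m) → inj-p 0 (suc t) z<s st≤m (sym eq)
      ; (no st≰m) → ends (trans (sym eq) (cong (p ∘ suc) (≤-antisym (s≤s⁻¹ t<) (s≤s⁻¹ (≰⇒> st≰m))))) }

module Exactness {n} (G : Graph n) (conn : Connected G) {g} (girth : ∀ k → HasCycle G k → g ≤ k) (4≤g : 4 ≤ g)
  {c} (C : Periodic G g c) {u v r} (poles : Metric.Poles G conn u v r)
  {ν} (S : Strands G ν) (vs : List (Fin n)) (unique : Unique vs)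
  (vs⇒on : ∀ {z} → z ∈ vs → Strands.On S z) (on⇒vs : ∀ {z} → Strands.On S z → z ∈ vs) (large : suc n < g + length vs)
  (innerP : Inner G (Strands.P S)) (innerQ : Inner G (Strands.Q S)) (P-on : Strands.On S (Strands.P S)) where

  open Strands S hiding (P-on)
  open AlongWalks S
  open Shape G conn girth 4≤g C using (find-ear)
  open Leaves G conn girth 4≤g C using (next)

  BridgeOn : Set
  BridgeOn = ∃₂ λ m p → Bridge m p × On (p 0) × On (p (suc m)) × m + length vs ≤ n

  cover-or-bridge : (∀ {x} → Inner G x → On x) ⊎ BridgeOn
  cover-or-bridge with any? (λ z → inner? G z ×-dec ¬? (Any.any? (z Fin.≟_) vs))
  ... | no none = inj₁ λ {x} ix → vs⇒on (decidable-stable (Any.any? (x Fin.≟_) vs) λ x∉ → none (x , ix , x∉))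
  ... | yes (z , iz , z∉) with find-ear (next poles) vs unique large (on⇒vs P-on) iz z∉
  ...   | E , 0<m = inj₂ (m , p , record
      { links = links ; off = λ i 0<i i≤ on → outside i 0<i i≤ (on⇒vs on) ; inj-p = Ear.inj E ; ends = ends
      ; new-edge = λ { refl → contradiction 0<m λ () } } , vs⇒on start , vs⇒on finish , fits)
    where open Ear E

  exact-or-chord : (∀ {x} → Inner G x → On x) → Exact ⊎ ∃ λ p → Bridge 0 p × On (p 0) × On (p 1)
  exact-or-chord cover with any? (λ x → any? λ y → inner? G x ×-dec inner? G y ×-dec edge? G x y ×-dec ¬? (along? x y))
  ... | no none = inj₁ record
      { cover = cover ; innerP = innerP ; innerQ = innerQ
      ; exact = λ {x} {y} ix iy e → decidable-stable (along? x y) λ ¬al → none (x , y , ix , iy , e , ¬al) }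
  ... | yes (x , y , ix , iy , e , ¬al) = inj₂ (p , record
      { links = λ { zero _ → e } ; off = λ { (suc i) _ () } ; inj-p = λ { _ zero () _ ; _ (suc _) _ () }
      ; ends = λ { refl → edge-irr G e } ; new-edge = λ _ → ¬al } , cover ix , cover iy)
    where
    p : ℕ → Fin n
    p zero    = x
    p (suc _) = y

  -- A chord counts as a bridge with m = 0, so that a single counting argument treats vertices and
  -- edges off the strands.
  exact-or-bridge : Exact ⊎ BridgeOn
  exact-or-bridge with cover-or-bridge
  ... | inj₂ B = inj₂ B
  ... | inj₁ cover with exact-or-chord cover
  ...   | inj₁ X = inj₁ X
  ...   | inj₂ (p , B , on , on′) = inj₂ (0 , p , B , on , on′ , Unique⇒length≤ unique)

-- Arcs of a cycle and rearrangements of strands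

module _ {n} {G : Graph n} {g c} (C : Periodic G g c) where
  open Periodic C

  cycle-injective : ∀ {i j} → i < g → j < g → c i ≡ c j → i ≡ j
  cycle-injective {i} {j} i< j< eq with <-cmp i j
  ... | tri< i<j _ _ = contradiction eq (distinct i j i<j (<-≤-trans j< (m≤n+m g i)))
  ... | tri≈ _ i≡j _ = i≡j
  ... | tri> _ _ j<i = contradiction (sym eq) (distinct j i j<i (<-≤-trans i< (m≤n+m g j)))

  reduce : 0 < g → ∀ i → ∃ λ j → j < g × c i ≡ c j
  reduce 0<g i = go i i ≤-refl
    where
    go : ∀ fuel i → i ≤ fuel → ∃ λ j → j < g × c i ≡ c j
    go fuel i i≤ with i <? g
    ... | yes i< = i , i< , refl
    go zero i i≤ | no i≮ = contradiction (≤-trans 0<g (≤-trans (≮⇒≥ i≮) i≤)) λ ()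
    go (suc fuel) i i≤ | no i≮ =
      let g+ = m+[n∸m]≡n (≮⇒≥ i≮)
          j , j< , eq = go fuel (i ∸ g) ((linear 4 (λ i g d f → (g :+ d :≡ i) ∷ (i :≤ con 1 :+ f) ∷ (con 0 :< g) ∷ [] ⊢ d :≤ f) ((1 ∷ 1 ∷ 0 ∷ 1 ∷ 1 ∷ []) , [])) i g (i ∸ g) fuel g+ i≤ 0<g)
      in j , j< , trans (cong c (sym g+)) (trans (period (i ∸ g)) eq)

  -- Strand `𝟏` runs backwards from `c g`, which equals `c 0`, down to `c a`; hence the index
  -- `g ∸ t`.
  arcs : ∀ a b → 0 < a → 0 < b → a + b ≡ g → Strands G 2
  arcs a b 0<a 0<b a+b = record
    { P = c 0 ; Q = c a
    ; P≢Q = λ eq → <⇒≢ 0<a (cycle-injective (<-≤-trans 0<a (<⇒≤ a<g)) a<g eq)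
    ; len = len ; at = at
    ; len>0 = λ { 𝟎 → 0<a ; 𝟏 → 0<b }
    ; at-0 = λ { 𝟎 → refl ; 𝟏 → trans (cong c (sym (+-identityʳ g))) (period 0) }
    ; at-len = λ { 𝟎 → refl ; 𝟏 → cong c (trans (cong (_∸ b) (trans (sym a+b) (+-comm a b))) (m+n∸m≡n b a)) }
    ; link = λ { 𝟎 t _ → link t
               ; 𝟏 t t< → subst (λ s → Edge G (c s) (c (g ∸ suc t))) (sym (mirror-step t t<)) (edge-sym G (link (g ∸ suc t))) }
    ; inj = inj }
    where
    a<g : a < g
    a<g = (linear 3 (λ a b g → (con 0 :< b) ∷ (a :+ b :≡ g) ∷ [] ⊢ a :< g) ((1 ∷ 1 ∷ 1 ∷ 0 ∷ []) , [])) a b g 0<b a+b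
    len : Fin 2 → ℕ
    len 𝟎 = a
    len 𝟏 = b
    at : Fin 2 → ℕ → Fin n
    at 𝟎 t = c t
    at 𝟏 t = c (g ∸ t)
    mirror : ∀ t → t ≤ b → t + (g ∸ t) ≡ g
    mirror t t≤b = m+[n∸m]≡n ((linear 4 (λ a b g t → (t :≤ b) ∷ (a :+ b :≡ g) ∷ [] ⊢ t :≤ g) ((1 ∷ 1 ∷ 1 ∷ 0 ∷ []) , [])) a b g t t≤b a+b)
    mirror-step : ∀ t → t < b → g ∸ t ≡ suc (g ∸ suc t)
    mirror-step t t< = (linear 4 (λ t g x y → (t :+ x :≡ g) ∷ (con 1 :+ t :+ y :≡ g) ∷ [] ⊢ x :≡ con 1 :+ y) ((1 ∷ 1 ∷ 0 ∷ 0 ∷ 1 ∷ []) , (1 ∷ 0 ∷ 1 ∷ 1 ∷ 0 ∷ []))) t g (g ∸ t) (g ∸ suc t) (mirror t (<⇒≤ t<)) (mirror (suc t) t<)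
    inj : ∀ σ τ i j → 0 < i → i < len σ → j ≤ len τ → at σ i ≡ at τ j → σ ≡ τ × i ≡ j
    inj 𝟎 𝟎 i j 0<i i< j≤ eq = refl , cycle-injective (≤-trans i< (<⇒≤ a<g)) (≤-<-trans j≤ a<g) eq
    inj 𝟎 𝟏 i zero 0<i i< j≤ eq = contradiction
      (sym (cycle-injective i<g (<-≤-trans 0<i (<⇒≤ i<g)) (trans eq (trans (cong c (sym (+-identityʳ g))) (period 0))))) (<⇒≢ 0<i)
      where
      i<g : i < g
      i<g = ≤-trans i< (<⇒≤ a<g)
    inj 𝟎 𝟏 i (suc j) 0<i i< j≤ eq = ⊥-elim
      ((linear 6 (λ i j a b g x → (i :≡ x) ∷ (con 1 :+ j :+ x :≡ g) ∷ (i :< a) ∷ (con 1 :+ j :≤ b) ∷ (a :+ b :≡ g) ∷ [] ⊢ absurd) ((0 ∷ 1 ∷ 0 ∷ 1 ∷ 1 ∷ 1 ∷ 1 ∷ 0 ∷ []) , [])) i j a b g (g ∸ suc j)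
        (cycle-injective (≤-trans i< (<⇒≤ a<g)) ((linear 3 (λ j g x → (con 1 :+ j :+ x :≡ g) ∷ [] ⊢ x :< g) ((1 ∷ 1 ∷ 0 ∷ []) , [])) j g _ (mirror (suc j) j≤)) eq) (mirror (suc j) j≤) i< j≤ a+b)
    inj 𝟏 𝟎 i j 0<i i< j≤ eq = ⊥-elim
      ((linear 6 (λ i j a b g x → (x :≡ j) ∷ (i :+ x :≡ g) ∷ (i :< b) ∷ (j :≤ a) ∷ (a :+ b :≡ g) ∷ [] ⊢ absurd) ((1 ∷ 0 ∷ 0 ∷ 1 ∷ 1 ∷ 1 ∷ 1 ∷ 0 ∷ []) , [])) i j a b g (g ∸ i)
        (cycle-injective ((linear 3 (λ i g x → (con 0 :< i) ∷ (i :+ x :≡ g) ∷ [] ⊢ x :< g) ((1 ∷ 1 ∷ 1 ∷ 0 ∷ []) , [])) i g _ 0<i (mirror i (<⇒≤ i<))) (≤-<-trans j≤ a<g) eq) (mirror i (<⇒≤ i<)) i< j≤ a+b)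
    inj 𝟏 𝟏 i zero 0<i i< j≤ eq = ⊥-elim
      ((linear 5 (λ i a b g x → (x :≡ con 0) ∷ (i :+ x :≡ g) ∷ (i :< b) ∷ (a :+ b :≡ g) ∷ [] ⊢ absurd) ((1 ∷ 0 ∷ 0 ∷ 1 ∷ 1 ∷ 1 ∷ 0 ∷ []) , [])) i a b g (g ∸ i)
        (cycle-injective ((linear 3 (λ i g x → (con 0 :< i) ∷ (i :+ x :≡ g) ∷ [] ⊢ x :< g) ((1 ∷ 1 ∷ 1 ∷ 0 ∷ []) , [])) i g _ 0<i (mirror i (<⇒≤ i<))) (<-≤-trans 0<a (<⇒≤ a<g))
          (trans eq (trans (cong c (sym (+-identityʳ g))) (period 0)))) (mirror i (<⇒≤ i<)) i< a+b)
    inj 𝟏 𝟏 i (suc j) 0<i i< j≤ eq = refl ,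
      (linear 5 (λ i j g x y → (x :≡ y) ∷ (i :+ x :≡ g) ∷ (con 1 :+ j :+ y :≡ g) ∷ [] ⊢ i :≡ con 1 :+ j) ((1 ∷ 0 ∷ 1 ∷ 1 ∷ 0 ∷ 0 ∷ 1 ∷ []) , (1 ∷ 1 ∷ 0 ∷ 0 ∷ 1 ∷ 1 ∷ 0 ∷ []))) i j g (g ∸ i) (g ∸ suc j)
        (cycle-injective ((linear 3 (λ i g x → (con 0 :< i) ∷ (i :+ x :≡ g) ∷ [] ⊢ x :< g) ((1 ∷ 1 ∷ 1 ∷ 0 ∷ []) , [])) i g _ 0<i (mirror i (<⇒≤ i<)))
          ((linear 3 (λ j g x → (con 1 :+ j :+ x :≡ g) ∷ [] ⊢ x :< g) ((1 ∷ 1 ∷ 0 ∷ []) , [])) j g _ (mirror (suc j) j≤)) eq) (mirror i (<⇒≤ i<)) (mirror (suc j) j≤)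

  arcs-on : ∀ a b (0<a : 0 < a) (0<b : 0 < b) (a+b : a + b ≡ g) i → Strands.On (arcs a b 0<a 0<b a+b) (c i)
  arcs-on a b 0<a 0<b a+b i with reduce ((linear 3 (λ a b g → (con 0 :< a) ∷ (a :+ b :≡ g) ∷ [] ⊢ con 0 :< g) ((1 ∷ 1 ∷ 1 ∷ 0 ∷ []) , [])) a b g 0<a a+b) i
  ... | j , j< , eq with j ≤? a
  ...   | yes j≤a = 𝟎 , j , j≤a , eq
  ...   | no j≰a = let j+ = m+[n∸m]≡n (<⇒≤ j<) in
    𝟏 , g ∸ j , (linear 5 (λ a b g j x → (j :+ x :≡ g) ∷ (a :+ b :≡ g) ∷ (a :< j) ∷ [] ⊢ x :≤ b) ((1 ∷ 1 ∷ 0 ∷ 0 ∷ 1 ∷ 1 ∷ []) , [])) a b g j (g ∸ j) j+ a+b (≰⇒> j≰a)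
      , trans eq (cong c ((linear 4 (λ g j x y → (j :+ x :≡ g) ∷ (x :+ y :≡ g) ∷ [] ⊢ j :≡ y) ((1 ∷ 1 ∷ 0 ∷ 0 ∷ 1 ∷ []) , (1 ∷ 0 ∷ 1 ∷ 1 ∷ 0 ∷ []))) g j (g ∸ j) (g ∸ (g ∸ j)) j+ (m+[n∸m]≡n (m∸n≤m g j))))

  on-arcs : ∀ a b (0<a : 0 < a) (0<b : 0 < b) (a+b : a + b ≡ g) {z} → Strands.On (arcs a b 0<a 0<b a+b) z → ∃ λ i → z ≡ c i
  on-arcs a b _ _ _ (𝟎 , i , _ , z≡) = i , z≡
  on-arcs a b _ _ _ (𝟏 , i , _ , z≡) = g ∸ i , z≡

  relocate : ∀ k i → k < g → ∃ λ j → c i ≡ c (k + j)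
  relocate k i k< = j , trans (sym (period i)) (cong c (sym k+j))
    where
    j : ℕ
    j = (g + i) ∸ k
    k+j : k + j ≡ g + i
    k+j = m+[n∸m]≡n (≤-trans (<⇒≤ k<) (m≤m+n g i))

swap : Fin 2 → Fin 2
swap 𝟎 = 𝟏
swap 𝟏 = 𝟎

swap-injective : ∀ σ τ → swap σ ≡ swap τ → σ ≡ τ
swap-injective 𝟎 𝟎 _ = refl
swap-injective 𝟏 𝟏 _ = refl
swap-injective 𝟎 𝟏 ()
swap-injective 𝟏 𝟎 ()

arrange : (σ τ ω : Fin 3) → Fin 3 → Fin 3
arrange σ τ ω 𝟎 = σ
arrange σ τ ω 𝟏 = τ
arrange σ τ ω 𝟐 = ω

arrange-injective : ∀ {σ τ ω} → σ ≢ τ → τ ≢ ω → σ ≢ ω → ∀ x y → arrange σ τ ω x ≡ arrange σ τ ω y → x ≡ y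
arrange-injective p q r 𝟎 𝟎 eq = refl
arrange-injective p q r 𝟎 𝟏 eq = contradiction eq p
arrange-injective p q r 𝟎 𝟐 eq = contradiction eq r
arrange-injective p q r 𝟏 𝟎 eq = contradiction (sym eq) p
arrange-injective p q r 𝟏 𝟏 eq = refl
arrange-injective p q r 𝟏 𝟐 eq = contradiction eq q
arrange-injective p q r 𝟐 𝟎 eq = contradiction (sym eq) r
arrange-injective p q r 𝟐 𝟏 eq = contradiction (sym eq) q
arrange-injective p q r 𝟐 𝟐 eq = refl

record Third (f : Fin 3 → ℕ) (σ τ : Fin 3) : Set where
  field
    ω     : Fin 3
    σ≢ω   : σ ≢ ω
    τ≢ω   : τ ≢ ω
    total : f σ + f τ + f ω ≡ f 𝟎 + f 𝟏 + f 𝟐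

third : ∀ f σ τ → σ ≢ τ → Third f σ τ
third f 𝟎 𝟎 ne = contradiction refl ne
third f 𝟏 𝟏 ne = contradiction refl ne
third f 𝟐 𝟐 ne = contradiction refl ne
third f 𝟎 𝟏 _ = record { ω = 𝟐 ; σ≢ω = λ () ; τ≢ω = λ () ; total = refl }
third f 𝟎 𝟐 _ = record { ω = 𝟏 ; σ≢ω = λ () ; τ≢ω = λ () ; total = (linear 3 (λ x y z → [] ⊢ x :+ z :+ y :≡ x :+ y :+ z) ((1 ∷ []) , (1 ∷ []))) (f 𝟎) (f 𝟏) (f 𝟐) }
third f 𝟏 𝟎 _ = record { ω = 𝟐 ; σ≢ω = λ () ; τ≢ω = λ () ; total = (linear 3 (λ x y z → [] ⊢ y :+ x :+ z :≡ x :+ y :+ z) ((1 ∷ []) , (1 ∷ []))) (f 𝟎) (f 𝟏) (f 𝟐) }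
third f 𝟏 𝟐 _ = record { ω = 𝟎 ; σ≢ω = λ () ; τ≢ω = λ () ; total = (linear 3 (λ x y z → [] ⊢ y :+ z :+ x :≡ x :+ y :+ z) ((1 ∷ []) , (1 ∷ []))) (f 𝟎) (f 𝟏) (f 𝟐) }
third f 𝟐 𝟎 _ = record { ω = 𝟏 ; σ≢ω = λ () ; τ≢ω = λ () ; total = (linear 3 (λ x y z → [] ⊢ z :+ x :+ y :≡ x :+ y :+ z) ((1 ∷ []) , (1 ∷ []))) (f 𝟎) (f 𝟏) (f 𝟐) }
third f 𝟐 𝟏 _ = record { ω = 𝟎 ; σ≢ω = λ () ; τ≢ω = λ () ; total = (linear 3 (λ x y z → [] ⊢ z :+ y :+ x :≡ x :+ y :+ z) ((1 ∷ []) , (1 ∷ []))) (f 𝟎) (f 𝟏) (f 𝟐) }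

module _ {n} {G : Graph n} where

  permute : ∀ {ν} (π : Fin ν → Fin ν) → (∀ σ τ → π σ ≡ π τ → σ ≡ τ) → Strands G ν → Strands G ν
  permute π π-inj S = record
    { P = P ; Q = Q ; P≢Q = P≢Q ; len = len ∘ π ; at = at ∘ π ; len>0 = len>0 ∘ π ; at-0 = at-0 ∘ π ; at-len = at-len ∘ π
    ; link = link ∘ π
    ; inj = λ σ τ i j 0<i i< j≤ eq → let πσ≡πτ , i≡j = inj (π σ) (π τ) i j 0<i i< j≤ eq in π-inj σ τ πσ≡πτ , i≡j }
    where open Strands S

  on-permute : ∀ {ν} (π : Fin ν → Fin ν) (π-inj : ∀ σ τ → π σ ≡ π τ → σ ≡ τ) (S : Strands G ν) {z} →
               Strands.On (permute π π-inj S) z → Strands.On S z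
  on-permute π _ S (σ , i , i≤ , z≡) = π σ , i , i≤ , z≡

  add-strand : (T : Strands G 2) → ∀ m p → AlongWalks.Bridge T m p → p 0 ≡ Strands.P T → p (suc m) ≡ Strands.Q T → Strands G 3
  add-strand T m p B p-0 p-len = record
    { P = P ; Q = Q ; P≢Q = P≢Q ; len = len′ ; at = at′
    ; len>0 = λ { 𝟎 → len>0 𝟎 ; 𝟏 → len>0 𝟏 ; 𝟐 → z<s }
    ; at-0 = λ { 𝟎 → at-0 𝟎 ; 𝟏 → at-0 𝟏 ; 𝟐 → p-0 }
    ; at-len = λ { 𝟎 → at-len 𝟎 ; 𝟏 → at-len 𝟏 ; 𝟐 → p-len }
    ; link = λ { 𝟎 → link 𝟎 ; 𝟏 → link 𝟏 ; 𝟐 t t< → links t (s≤s⁻¹ t<) }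
    ; inj = inj′ }
    where
    open Strands T
    open AlongWalks.Bridge B
    len′ : Fin 3 → ℕ
    len′ 𝟎 = len 𝟎
    len′ 𝟏 = len 𝟏
    len′ 𝟐 = suc m
    at′ : Fin 3 → ℕ → Fin n
    at′ 𝟎 = at 𝟎
    at′ 𝟏 = at 𝟏
    at′ 𝟐 = p
    interior-off : ∀ σ i j → 0 < i → i < len σ → j ≤ suc m → at σ i ≢ p j
    interior-off σ i zero 0<i i< j≤ eq = <⇒≢ 0<i (sym (at-injective σ i 0 (<⇒≤ i<) z≤n (trans eq (trans p-0 (sym (at-0 σ))))))
    interior-off σ i (suc j) 0<i i< j≤ eq with suc j ≤? m
    ... | yes j≤m = off (suc j) z<s j≤m (σ , i , <⇒≤ i< , sym eq)
    ... | no j≰m = <⇒≢ i< (at-injective σ i (len σ) (<⇒≤ i<) ≤-refl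
      (trans eq (trans (cong p (≤-antisym j≤ (≰⇒> j≰m))) (trans p-len (sym (at-len σ))))))
    inj′ : ∀ σ τ i j → 0 < i → i < len′ σ → j ≤ len′ τ → at′ σ i ≡ at′ τ j → σ ≡ τ × i ≡ j
    inj′ 𝟎 𝟎 i j 0<i i< j≤ eq = refl , proj₂ (inj 𝟎 𝟎 i j 0<i i< j≤ eq)
    inj′ 𝟎 𝟏 i j 0<i i< j≤ eq = contradiction (proj₁ (inj 𝟎 𝟏 i j 0<i i< j≤ eq)) λ ()
    inj′ 𝟏 𝟎 i j 0<i i< j≤ eq = contradiction (proj₁ (inj 𝟏 𝟎 i j 0<i i< j≤ eq)) λ ()
    inj′ 𝟏 𝟏 i j 0<i i< j≤ eq = refl , proj₂ (inj 𝟏 𝟏 i j 0<i i< j≤ eq)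
    inj′ 𝟎 𝟐 i j 0<i i< j≤ eq = contradiction eq (interior-off 𝟎 i j 0<i i< j≤)
    inj′ 𝟏 𝟐 i j 0<i i< j≤ eq = contradiction eq (interior-off 𝟏 i j 0<i i< j≤)
    inj′ 𝟐 𝟎 i j 0<i i< j≤ eq = contradiction (𝟎 , j , j≤ , eq) (off i 0<i (s≤s⁻¹ i<))
    inj′ 𝟐 𝟏 i j 0<i i< j≤ eq = contradiction (𝟏 , j , j≤ , eq) (off i 0<i (s≤s⁻¹ i<))
    inj′ 𝟐 𝟐 i j 0<i i< j≤ eq with j ≤? m
    ... | no j≰m = contradiction
      (𝟎 , len 𝟎 , ≤-refl , trans eq (trans (cong p (≤-antisym j≤ (≰⇒> j≰m))) (trans p-len (sym (at-len 𝟎))))) (off i 0<i (s≤s⁻¹ i<))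
    ... | yes j≤m with <-cmp i j
    ...   | tri< i<j _ _ = contradiction eq (inj-p i j i<j j≤m)
    ...   | tri≈ _ i≡j _ = refl , i≡j
    ...   | tri> _ _ j<i = contradiction (sym eq) (inj-p j i j<i (s≤s⁻¹ i<))

  -- A subdivision of K₄ in which opposite edges have equal lengths a, i and j.
  record K₄ (g : ℕ) : Set where
    field
      S     : Strands G 3
      a b i j m : ℕ
      p     : ℕ → Fin n
    open Strands S public
    field
      len𝟎  : len 𝟎 ≡ b
      len𝟏  : len 𝟏 ≡ b
      len𝟐  : len 𝟐 ≡ a
      m≡    : suc m ≡ a
      i+j   : i + j ≡ b
      a+b   : a + b ≡ g
      order : n + 2 ≡ 2 * g
      a≤b   : a ≤ b
      i-big : b ≤ a + 2 * i
      j-big : b ≤ a + 2 * j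
      from  : p 0 ≡ at 𝟎 i
      to    : p (suc m) ≡ at 𝟏 j
      links : ∀ t → t ≤ m → Edge G (p t) (p (suc t))
      off   : ∀ t → 0 < t → t ≤ m → ¬ On (p t)
      inj-p : ∀ s t → s < t → t ≤ m → p s ≢ p t

-- Summing the girth bounds for the four shortest cycles through a bridge of a theta graph
-- gives 4g ≤ 2n + 4, with equality only for K₄.
module ThetaBridge {n} {G : Graph n} {g} (girth : ∀ k → HasCycle G k → g ≤ k) (S : Strands G 3)
  (pairs : ∀ σ τ → σ ≢ τ → g ≤ Strands.len S σ + Strands.len S τ) (n≤ : n + 2 ≤ 2 * g) where

  open Strands S
  open AlongWalks S
  open ThetaVertices S

  module _ {m p} (B : Bridge m p) (fits : m + length theta ≤ n) where

    open Bridge B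

    bound : ∀ {x y l} → p 0 ≡ x → p (suc m) ≡ y → RWalk Along x y l → g ≤ l + suc m
    bound refl refl w = bridge-bound girth B w

    -- With strand lengths x, y, z, the four cycles have lengths x + z, y + z and, through the
    -- bridge and `P` or `Q`, a total of x + y + 2(m + 1). The count `fits` makes all four bounds
    -- tight, which gives the equations. The bounds `i-big` and `j-big` come from the two further
    -- cycles that contain the bridge and all of `ω`.
    cross-bridge : ∀ {σ τ i j} → σ ≢ τ → i ≤ len σ → j ≤ len τ → p 0 ≡ at σ i → p (suc m) ≡ at τ j → K₄ {G = G} g
    cross-bridge {σ} {τ} {i} {j} σ≢τ i≤ j≤ from to = record
      { S = permute (arrange σ τ ω) (arrange-injective σ≢τ τ≢ω σ≢ω) S
      ; a = len ω ; b = len σ ; i = i ; j = j ; m = m ; p = p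
      ; len𝟎 = refl ; len𝟐 = refl
      ; len𝟏 = (linear 7 (λ x y z q L n g → (g :≤ x :+ z) ∷ (g :≤ y :+ z) ∷ (x :+ y :+ z :≡ con 1 :+ L) ∷ (q :+ L :≤ n) ∷ (n :+ con 2 :≤ 2 :* g) ∷ (2 :* g :≤ x :+ y :+ 2 :* (con 1 :+ q)) ∷ [] ⊢ y :≡ x) ((1 ∷ 2 ∷ 0 ∷ 2 ∷ 0 ∷ 2 ∷ 2 ∷ 1 ∷ []) , (1 ∷ 0 ∷ 2 ∷ 2 ∷ 0 ∷ 2 ∷ 2 ∷ 1 ∷ [])))
          x y z m L n g xz yz Λ fits n≤ both
      ; m≡ = (linear 7 (λ x y z q L n g → (g :≤ x :+ z) ∷ (g :≤ y :+ z) ∷ (x :+ y :+ z :≡ con 1 :+ L) ∷ (q :+ L :≤ n) ∷ (n :+ con 2 :≤ 2 :* g) ∷ (2 :* g :≤ x :+ y :+ 2 :* (con 1 :+ q)) ∷ [] ⊢ con 1 :+ q :≡ z) ((1 ∷ 1 ∷ 1 ∷ 1 ∷ 0 ∷ 1 ∷ 1 ∷ 0 ∷ []) , (1 ∷ 0 ∷ 0 ∷ 1 ∷ 0 ∷ 1 ∷ 1 ∷ 1 ∷ [])))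
          x y z m L n g xz yz Λ fits n≤ both
      ; i+j = (linear 11 (λ x y z q L n g i j k l → (g :≤ x :+ z) ∷ (g :≤ y :+ z) ∷ (x :+ y :+ z :≡ con 1 :+ L) ∷ (q :+ L :≤ n) ∷ (n :+ con 2 :≤ 2 :* g) ∷ (i :+ k :≡ x) ∷ (j :+ l :≡ y) ∷ (g :≤ i :+ j :+ (con 1 :+ q)) ∷ (g :≤ k :+ l :+ (con 1 :+ q)) ∷ [] ⊢ i :+ j :≡ x) ((1 ∷ 1 ∷ 0 ∷ 1 ∷ 0 ∷ 1 ∷ 1 ∷ 1 ∷ 0 ∷ 1 ∷ 0 ∷ 0 ∷ 1 ∷ []) , (1 ∷ 0 ∷ 1 ∷ 1 ∷ 0 ∷ 1 ∷ 1 ∷ 0 ∷ 0 ∷ 0 ∷ 0 ∷ 1 ∷ 0 ∷ [])))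
          x y z m L n g i j i′ j′ xz yz Λ fits n≤ i+ j+ viaP viaQ
      ; a+b = (linear 7 (λ x y z q L n g → (g :≤ x :+ z) ∷ (g :≤ y :+ z) ∷ (x :+ y :+ z :≡ con 1 :+ L) ∷ (q :+ L :≤ n) ∷ (n :+ con 2 :≤ 2 :* g) ∷ (2 :* g :≤ x :+ y :+ 2 :* (con 1 :+ q)) ∷ [] ⊢ z :+ x :≡ g) ((1 ∷ 0 ∷ 1 ∷ 2 ∷ 0 ∷ 2 ∷ 2 ∷ 1 ∷ []) , (1 ∷ 1 ∷ 0 ∷ 0 ∷ 0 ∷ 0 ∷ 0 ∷ 0 ∷ [])))
          x y z m L n g xz yz Λ fits n≤ both
      ; order = (linear 7 (λ x y z q L n g → (g :≤ x :+ z) ∷ (g :≤ y :+ z) ∷ (x :+ y :+ z :≡ con 1 :+ L) ∷ (q :+ L :≤ n) ∷ (n :+ con 2 :≤ 2 :* g) ∷ (2 :* g :≤ x :+ y :+ 2 :* (con 1 :+ q)) ∷ [] ⊢ n :+ con 2 :≡ 2 :* g) ((1 ∷ 0 ∷ 0 ∷ 0 ∷ 0 ∷ 0 ∷ 1 ∷ 0 ∷ []) , (2 ∷ 1 ∷ 1 ∷ 2 ∷ 0 ∷ 2 ∷ 0 ∷ 1 ∷ [])))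
          x y z m L n g xz yz Λ fits n≤ both
      ; a≤b = (linear 7 (λ x y z q L n g → (g :≤ x :+ z) ∷ (g :≤ x :+ y) ∷ (x :+ y :+ z :≡ con 1 :+ L) ∷ (q :+ L :≤ n) ∷ (n :+ con 2 :≤ 2 :* g) ∷ (2 :* g :≤ x :+ y :+ 2 :* (con 1 :+ q)) ∷ [] ⊢ z :≤ x) ((4 ∷ 4 ∷ 4 ∷ 8 ∷ 0 ∷ 8 ∷ 8 ∷ 4 ∷ []) , []))
          x y z m L n g xz (pairs σ τ σ≢τ) Λ fits n≤ both
      ; i-big = (linear 10 (λ x y z q L n g i j l → (g :≤ x :+ z) ∷ (x :+ y :+ z :≡ con 1 :+ L) ∷ (q :+ L :≤ n) ∷ (n :+ con 2 :≤ 2 :* g) ∷ (j :+ l :≡ y) ∷ (i :+ j :≡ x) ∷ (g :≤ i :+ (z :+ l) :+ (con 1 :+ q)) ∷ [] ⊢ x :≤ z :+ 2 :* i) ((1 ∷ 1 ∷ 1 ∷ 0 ∷ 1 ∷ 1 ∷ 1 ∷ 0 ∷ 0 ∷ 1 ∷ 1 ∷ []) , []))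
          x y z m L n g i j j′ xz Λ fits n≤ j+ i+j (bound from to (walk-viaPQ σ τ ω i j j′ i≤ j+))
      ; j-big = (linear 10 (λ x y z q L n g i j k → (g :≤ y :+ z) ∷ (x :+ y :+ z :≡ con 1 :+ L) ∷ (q :+ L :≤ n) ∷ (n :+ con 2 :≤ 2 :* g) ∷ (i :+ k :≡ x) ∷ (i :+ j :≡ x) ∷ (g :≤ k :+ (z :+ j) :+ (con 1 :+ q)) ∷ [] ⊢ x :≤ z :+ 2 :* j) ((1 ∷ 1 ∷ 1 ∷ 0 ∷ 1 ∷ 1 ∷ 1 ∷ 0 ∷ 0 ∷ 1 ∷ 1 ∷ []) , []))
          x y z m L n g i j i′ yz Λ fits n≤ i+ i+j (bound from to (walk-viaQP σ τ ω i i′ j i+ j≤))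
      ; from = from ; to = to ; links = links
      ; off = λ t 0<t t≤ on → off t 0<t t≤ (on-permute (arrange σ τ ω) (arrange-injective σ≢τ τ≢ω σ≢ω) S on) ; inj-p = inj-p }
      where
      open Third (third len σ τ σ≢τ)
      x = len σ
      y = len τ
      z = len ω
      L = length theta
      i′ = x ∸ i
      j′ = y ∸ j
      i+ : i + i′ ≡ x
      i+ = m+[n∸m]≡n i≤
      j+ : j + j′ ≡ y
      j+ = m+[n∸m]≡n j≤
      xz : g ≤ x + z
      xz = pairs σ ω σ≢ω
      yz : g ≤ y + z
      yz = pairs τ ω τ≢ω
      Λ : x + y + z ≡ suc L
      Λ = trans total (sym theta-length)
      viaP : g ≤ i + j + suc m
      viaP = bound from to (walk-viaP σ τ i j i≤ j≤)
      viaQ : g ≤ i′ + j′ + suc m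
      viaQ = bound from to (walk-viaQ σ τ i i′ j j′ i+ j+)
      both : 2 * g ≤ x + y + 2 * suc m
      both = (linear 8 (λ x y q g i j k l → (i :+ k :≡ x) ∷ (j :+ l :≡ y) ∷ (g :≤ i :+ j :+ (con 1 :+ q)) ∷ (g :≤ k :+ l :+ (con 1 :+ q)) ∷ [] ⊢ 2 :* g :≤ x :+ y :+ 2 :* (con 1 :+ q)) ((2 ∷ 2 ∷ 0 ∷ 2 ∷ 0 ∷ 2 ∷ 2 ∷ []) , []))
        x y m g i j i′ j′ i+ j+ viaP viaQ
      i+j : i + j ≡ x
      i+j = (linear 11 (λ x y z q L n g i j k l → (g :≤ x :+ z) ∷ (g :≤ y :+ z) ∷ (x :+ y :+ z :≡ con 1 :+ L) ∷ (q :+ L :≤ n) ∷ (n :+ con 2 :≤ 2 :* g) ∷ (i :+ k :≡ x) ∷ (j :+ l :≡ y) ∷ (g :≤ i :+ j :+ (con 1 :+ q)) ∷ (g :≤ k :+ l :+ (con 1 :+ q)) ∷ [] ⊢ i :+ j :≡ x) ((1 ∷ 1 ∷ 0 ∷ 1 ∷ 0 ∷ 1 ∷ 1 ∷ 1 ∷ 0 ∷ 1 ∷ 0 ∷ 0 ∷ 1 ∷ []) , (1 ∷ 0 ∷ 1 ∷ 1 ∷ 0 ∷ 1 ∷ 1 ∷ 0 ∷ 0 ∷ 0 ∷ 0 ∷ 1 ∷ 0 ∷ [])))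
          x y z m L n g i j i′ j′ xz yz Λ fits n≤ i+ j+ viaP viaQ


    -- Two vertices of the same strand must be P and Q, which also lie on another strand.
    same-bridge : ∀ σ i k → i + k ≤ len σ → (∀ {l} → RWalk Along (at σ i) (at σ (i + k)) l → g ≤ l + suc m) →
                  ∃ λ τ → σ ≢ τ × i ≤ len τ × i + k ≤ len τ × at σ i ≡ at τ i × at σ (i + k) ≡ at τ (i + k)
    same-bridge σ i k i+k≤ bounded with another σ
      where
      another : ∀ σ → ∃ λ (τ : Fin 3) → σ ≢ τ
      another 𝟎 = 𝟏 , λ ()
      another 𝟏 = 𝟐 , λ ()
      another 𝟐 = 𝟎 , λ ()
    ... | τ , σ≢τ = τ , σ≢τ , subst (_≤ len τ) (sym i≡0) z≤n , ≤-reflexive i+k≡τ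
      , trans (cong (at σ) i≡0) (trans (at-0 σ) (sym (trans (cong (at τ) i≡0) (at-0 τ))))
      , trans (cong (at σ) i+k≡σ) (trans (at-len σ) (sym (trans (cong (at τ) i+k≡τ) (at-len τ))))
      where
      open Third (third len σ τ σ≢τ)
      x = len σ
      y = len τ
      z = len ω
      L = length theta
      w = walks-same σ i k i+k≤ τ
      w′ = walks-same σ i k i+k≤ ω
      l = proj₁ (proj₂ w)
      l′ = proj₁ (proj₂ w′)
      k≡x : k ≡ x
      k≡x = (linear 9 (λ x y z q L n g k i → (g :≤ y :+ z) ∷ (x :+ y :+ z :≡ con 1 :+ L) ∷ (q :+ L :≤ n) ∷ (n :+ con 2 :≤ 2 :* g) ∷ (g :≤ k :+ (con 1 :+ q)) ∷ (i :+ k :≤ x) ∷ [] ⊢ k :≡ x) ((1 ∷ 0 ∷ 0 ∷ 0 ∷ 0 ∷ 0 ∷ 0 ∷ 1 ∷ []) , (1 ∷ 1 ∷ 1 ∷ 0 ∷ 1 ∷ 1 ∷ 1 ∷ 0 ∷ [])))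
        x y z m L n g k i (pairs τ ω τ≢ω) (trans total (sym theta-length)) fits n≤
        (bounded (proj₁ w))
         i+k≤
      k≡y : k ≡ y
      k≡y = (linear 9 (λ x y z q L n g k l → (g :≤ x :+ z) ∷ (g :≤ y :+ z) ∷ (x :+ y :+ z :≡ con 1 :+ L) ∷ (q :+ L :≤ n) ∷ (n :+ con 2 :≤ 2 :* g) ∷ (g :≤ k :+ (con 1 :+ q)) ∷ (k :+ l :≡ x :+ y) ∷ (g :≤ l :+ (con 1 :+ q)) ∷ [] ⊢ k :≡ y) ((1 ∷ 0 ∷ 1 ∷ 1 ∷ 0 ∷ 1 ∷ 1 ∷ 0 ∷ 1 ∷ 0 ∷ 1 ∷ []) , (1 ∷ 1 ∷ 0 ∷ 1 ∷ 0 ∷ 1 ∷ 1 ∷ 1 ∷ 0 ∷ 0 ∷ 0 ∷ [])))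
        x y z m L n g k l (pairs σ ω σ≢ω) (pairs τ ω τ≢ω) (trans total (sym theta-length)) fits n≤
        (bounded (proj₁ w)) (proj₁ (proj₂ (proj₂ w))) (bounded (proj₂ (proj₂ (proj₂ w))))
        
      i≡0 : i ≡ 0
      i≡0 = (linear 3 (λ i k x → (i :+ k :≤ x) ∷ (k :≡ x) ∷ [] ⊢ i :≡ con 0) ((1 ∷ 1 ∷ 0 ∷ 1 ∷ []) , (1 ∷ 0 ∷ 0 ∷ 0 ∷ []))) i k x i+k≤ k≡x
      i+k≡σ : i + k ≡ len σ
      i+k≡σ = (linear 3 (λ i k x → (i :≡ con 0) ∷ (k :≡ x) ∷ [] ⊢ i :+ k :≡ x) ((1 ∷ 1 ∷ 0 ∷ 1 ∷ 0 ∷ []) , (1 ∷ 0 ∷ 1 ∷ 0 ∷ 1 ∷ []))) i k x i≡0 k≡x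
      i+k≡τ : i + k ≡ len τ
      i+k≡τ = (linear 3 (λ i k x → (i :≡ con 0) ∷ (k :≡ x) ∷ [] ⊢ i :+ k :≡ x) ((1 ∷ 1 ∷ 0 ∷ 1 ∷ 0 ∷ []) , (1 ∷ 0 ∷ 1 ∷ 0 ∷ 1 ∷ []))) i k y i≡0 k≡y

    bridge⇒K₄ : On (p 0) → On (p (suc m)) → K₄ {G = G} g
    bridge⇒K₄ (σ , i , i≤ , from) (τ , j , j≤ , to) with σ Fin.≟ τ
    ... | no σ≢τ = cross-bridge σ≢τ i≤ j≤ from to
    ... | yes refl with ≤-total i j
    ...   | inj₁ i≤j with m+[n∸m]≡n i≤j
    ...     | i+k with same-bridge σ i (j ∸ i) (subst (_≤ len σ) (sym i+k) j≤)
                        (λ {l} w → bound from to (subst (λ j → RWalk Along (at σ i) (at σ j) l) i+k w))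
    ...       | ω , σ≢ω , _ , j≤ω , _ , eq = cross-bridge σ≢ω i≤ (subst (_≤ len ω) i+k j≤ω) from
      (trans to (subst (λ j → at σ j ≡ at ω j) i+k eq))
    bridge⇒K₄ (σ , i , i≤ , from) (τ , j , j≤ , to) | yes refl | inj₂ j≤i with m+[n∸m]≡n j≤i
    ...     | j+k with same-bridge σ j (i ∸ j) (subst (_≤ len σ) (sym j+k) i≤)
                        (λ {l} w → bound from to (rwalk-reverse along-sym (subst (λ i → RWalk Along (at σ j) (at σ i) l) j+k w)))
    ...       | ω , σ≢ω , j≤ω , _ , eq , _ = cross-bridge σ≢ω i≤ j≤ω from (trans to eq)

-- The structure of graphs with n + 2 ≤ 2g

module Structure {n} (G : Graph n) (conn : Connected G) {g} (girth : ∀ k → HasCycle G k → g ≤ k) (4≤g : 4 ≤ g)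
  {c} (C : Periodic G g c) {u v r} (poles : Metric.Poles G conn u v r) (n≤ : n + 2 ≤ 2 * g) where

  open LeafMetric G conn
  open Shape G conn girth 4≤g C using (cycle-inner)
  open Leaves G conn girth 4≤g C using (next; swap-poles)
  open LeafPoles G conn girth 4≤g C

  0<g : 0 < g
  0<g = ≤-trans (s≤s z≤n) 4≤g

  cycle : List (Fin n)
  cycle = applyUpTo c g

  cycle-unique : Unique cycle
  cycle-unique = Unique-window c g λ i j i<j j< → Periodic.distinct C i j i<j (<-≤-trans j< (m≤n+m g i))

  g≤n : g ≤ n
  g≤n = subst (_≤ n) (length-applyUpTo c g) (Unique⇒length≤ cycle-unique)

  cycle-complete : ∀ i → c i ∈ cycle
  cycle-complete i = let j , j< , eq = reduce C 0<g i in subst (_∈ cycle) (sym eq) (∈-applyUpTo⁺ c j<)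

  ∈cycle : ∀ {z} → z ∈ cycle → ∃ λ i → i < g × z ≡ c i
  ∈cycle = ∈-applyUpTo⁻ c

  large : suc n < g + length cycle
  large = subst (λ l → suc n < g + l) (sym (length-applyUpTo c g)) ((linear 2 (λ n g → (n :+ con 2 :≤ 2 :* g) ∷ [] ⊢ con 1 :+ n :< g :+ g) ((1 ∷ 1 ∷ []) , [])) n g n≤)

  module Arcs k (k<g : k < g) a b (0<a : 0 < a) (0<b : 0 < b) (a+b : a + b ≡ g) where

    Arc : Strands G 2
    Arc = arcs (rotate G k C) a b 0<a 0<b a+b

    open Strands Arc
    open AlongWalks Arc

    cycle⇒on : ∀ {z} → z ∈ cycle → On z
    cycle⇒on z∈ = let i , i< , z≡ = ∈cycle z∈ ; j , eq = relocate C k i k<g in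
      subst On (sym (trans z≡ eq)) (arcs-on (rotate G k C) a b 0<a 0<b a+b j)

    on⇒cycle : ∀ {z} → On z → z ∈ cycle
    on⇒cycle on = let i , z≡ = on-arcs (rotate G k C) a b 0<a 0<b a+b on in subst (_∈ cycle) (sym z≡) (cycle-complete (k + i))

    module E = Exactness G conn girth 4≤g C poles Arc cycle cycle-unique cycle⇒on on⇒cycle large
                 (cycle-inner (k + 0)) (cycle-inner (k + a)) (P-on 𝟎)

    len-cross : ∀ σ τ → σ ≢ τ → len σ + len τ ≡ g
    len-cross 𝟎 𝟎 σ≢τ = contradiction refl σ≢τ
    len-cross 𝟎 𝟏 σ≢τ = a+b
    len-cross 𝟏 𝟎 σ≢τ = trans (+-comm b a) a+b
    len-cross 𝟏 𝟏 σ≢τ = contradiction refl σ≢τ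

    swap≢ : ∀ σ → σ ≢ swap σ
    swap≢ 𝟎 ()
    swap≢ 𝟏 ()

    -- A chord closes both arcs between its ends to cycles. The arcs have total length g, so 2g ≤ g
    -- + 2, against g ≥ 4.
    no-chord : ∀ {p} → Bridge 0 p → On (p 0) → On (p 1) → ⊥
    no-chord {p} B (σ , i , i≤ , from) (τ , j , j≤ , to) with σ Fin.≟ τ
    ... | no σ≢τ = let l , l′ , l+ , w , w′ = walks-cross σ τ i j i≤ j≤ in impossible (trans l+ (len-cross σ τ σ≢τ)) w w′
      where
      impossible : ∀ {l l′} → l + l′ ≡ g → RWalk Along (at σ i) (at τ j) l → RWalk Along (at σ i) (at τ j) l′ → ⊥
      impossible {l} {l′} l+ w w′ = (linear 3 (λ l l' g → (l :+ l' :≡ g) ∷ (g :≤ l :+ con 1) ∷ (g :≤ l' :+ con 1) ∷ (con 4 :≤ g) ∷ [] ⊢ absurd) ((1 ∷ 0 ∷ 1 ∷ 1 ∷ 1 ∷ []) , [])) l l′ g l+ (bound w) (bound w′) 4≤g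
        where
        bound : ∀ {l} → RWalk Along (at σ i) (at τ j) l → g ≤ l + 1
        bound {l} w = bridge-bound girth B (subst₂ (λ x y → RWalk Along x y l) (sym from) (sym to) w)
    ... | yes refl with ≤-total i j
    ...   | inj₁ i≤j with m+[n∸m]≡n i≤j
    ...     | i+k = let w , l , l+ , w′ = walks-same σ i (j ∸ i) (subst (_≤ len σ) (sym i+k) j≤) (swap σ) in
      (linear 3 (λ l l' g → (l :+ l' :≡ g) ∷ (g :≤ l :+ con 1) ∷ (g :≤ l' :+ con 1) ∷ (con 4 :≤ g) ∷ [] ⊢ absurd) ((1 ∷ 0 ∷ 1 ∷ 1 ∷ 1 ∷ []) , [])) _ l g (trans l+ (len-cross σ (swap σ) (swap≢ σ))) (bound w) (bound w′) 4≤g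
      where
      bound : ∀ {l} → RWalk Along (at σ i) (at σ (i + (j ∸ i))) l → g ≤ l + 1
      bound {l} w = bridge-bound girth B (subst₂ (λ x y → RWalk Along x y l) (sym from) (trans (cong (at σ) i+k) (sym to)) w)
    no-chord {p} B (σ , i , i≤ , from) (τ , j , j≤ , to) | yes refl | inj₂ j≤i with m+[n∸m]≡n j≤i
    ...     | j+k = let w , l , l+ , w′ = walks-same σ j (i ∸ j) (subst (_≤ len σ) (sym j+k) i≤) (swap σ) in
      (linear 3 (λ l l' g → (l :+ l' :≡ g) ∷ (g :≤ l :+ con 1) ∷ (g :≤ l' :+ con 1) ∷ (con 4 :≤ g) ∷ [] ⊢ absurd) ((1 ∷ 0 ∷ 1 ∷ 1 ∷ 1 ∷ []) , [])) _ l g (trans l+ (len-cross σ (swap σ) (swap≢ σ))) (bound w) (bound w′) 4≤g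
      where
      bound : ∀ {l} → RWalk Along (at σ j) (at σ (j + (i ∸ j))) l → g ≤ l + 1
      bound {l} w = bridge-bound girth B (rwalk-reverse along-sym
        (subst₂ (λ x y → RWalk Along x y l) (sym to) (trans (cong (at σ) j+k) (sym from)) w))

  module SingleCycle (all-on : ∀ {z} → Inner G z → z ∈ cycle) where

    module _ k (k<g : k < g) a b (0<a : 0 < a) (0<b : 0 < b) (a+b : a + b ≡ g) where
      open Arcs k k<g a b 0<a 0<b a+b
      open Strands Arc
      open StrandMetric G conn Arc using (dist-PQ≥; dist-half; dist-same-half)

      arcs-exact : Exact
      arcs-exact with E.exact-or-chord (λ iz → cycle⇒on (all-on iz))
      ... | inj₁ X = X
      ... | inj₂ (p , B , on , on′) = ⊥-elim (no-chord B on on′)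

      arc-dist : ∀ m → m ≤ a → m ≤ b → m ≤ dist (c k) (c (k + a))
      arc-dist m m≤a m≤b = subst (λ z → m ≤ dist (c z) (c (k + a))) (+-identityʳ k) (dist-PQ≥ arcs-exact m λ { 𝟎 → m≤a ; 𝟏 → m≤b })

      arc-diameter : ∀ {x y} → Inner G x → Inner G y → 2 * dist x y ≤ g
      arc-diameter ix iy with cycle⇒on (all-on ix) | cycle⇒on (all-on iy)
      ... | σ , i , i≤ , refl | τ , j , j≤ , refl with σ Fin.≟ τ
      ...   | yes refl = subst (2 * dist (at σ i) (at σ j) ≤_) (len-cross σ (swap σ) (swap≢ σ)) (dist-same-half σ (swap σ) i≤ j≤)
      ...   | no σ≢τ   = subst (2 * dist (at σ i) (at τ j) ≤_) (len-cross σ τ σ≢τ) (dist-half {σ} {τ} i≤ j≤)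

    far-along : ∀ k a → k < g → ∀ m → 0 < a → m ≤ a → m + a ≤ g → a < g → m ≤ dist (c k) (c (k + a))
    far-along k a k<g m 0<a m≤a m+a≤g a<g = let a+b = m+[n∸m]≡n (<⇒≤ a<g) in
      arc-dist k k<g a (g ∸ a) 0<a ((linear 3 (λ a b g → (a :+ b :≡ g) ∷ (a :< g) ∷ [] ⊢ con 0 :< b) ((1 ∷ 0 ∷ 1 ∷ 1 ∷ []) , [])) a (g ∸ a) g a+b a<g) a+b m m≤a
        ((linear 4 (λ a b g m → (a :+ b :≡ g) ∷ (m :+ a :≤ g) ∷ [] ⊢ m :≤ b) ((1 ∷ 0 ∷ 1 ∷ 1 ∷ []) , [])) a (g ∸ a) g m a+b m+a≤g)

    cycle-diameter : ∀ {x y} → Inner G x → Inner G y → 2 * dist x y ≤ g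
    cycle-diameter = let 1+ = m+[n∸m]≡n 0<g in arc-diameter 0 0<g 1 (g ∸ 1) z<s
      ((linear 2 (λ h g → (con 1 :+ h :≡ g) ∷ (con 4 :≤ g) ∷ [] ⊢ con 0 :< h) ((1 ∷ 0 ∷ 1 ∷ 1 ∷ []) , [])) (g ∸ 1) g 1+ 4≤g) 1+

    index : ∀ {z} → Inner G z → ∃ λ k → k < g × z ≡ c k
    index iz = ∈cycle (all-on iz)

    count : (ls : List (Fin n)) → Unique ls → (∀ {z} → z ∈ ls → ¬ Inner G z) → (∀ z → z ∈ ls ⊎ Inner G z) → n ≡ length ls + g
    count ls uls leaf all = trans (count-vertices
        (Unique.++⁺ uls cycle-unique λ { (z∈ , z∈C) → let i , _ , z≡ = ∈cycle z∈C in leaf z∈ (subst (Inner G) (sym z≡) (cycle-inner i)) })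
        (λ z → case all z of λ { (inj₁ z∈) → ∈-++⁺ˡ z∈ ; (inj₂ iz) → ∈-++⁺ʳ ls (all-on iz) }))
      (trans (length-++ ls) (cong (length ls +_) (length-applyUpTo c g)))

    -- The poles give r + 1 ≤ g/2, so r < ρ = ⌊g/2⌋. A third vertex and a vertex ρ steps further
    -- along the cycle would then be another pair at distance more than r.
    no-leaf : ∀ {u v r} → Poles u v r → Inner G u → Inner G v → ⊥
    no-leaf {u} {v} {r} poles iu iv with avoid-two ((linear 2 (λ n g → (g :≤ n) ∷ (con 4 :≤ g) ∷ [] ⊢ con 3 :≤ n) ((1 ∷ 1 ∷ 1 ∷ []) , [])) n g g≤n 4≤g) u v | halve g
    ... | x , x≢u , x≢v | ρ , ρ≤ , ≤ρ with index (others poles x x≢u x≢v)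
    ...   | k , k< , refl = case near (c k) (c (k + ρ)) of λ
      { (inj₁ le) → (linear 5 (λ r ρ d e g → (ρ :≤ d) ∷ (d :≤ r) ∷ (2 :* e :≤ g) ∷ (e :≡ con 1 :+ r) ∷ (g :≤ 2 :* ρ :+ con 1) ∷ [] ⊢ absurd) ((4 ∷ 4 ∷ 2 ∷ 0 ∷ 4 ∷ 2 ∷ []) , [])) r ρ _ _ g
          (far-along k ρ k< ρ ((linear 2 (λ ρ g → (g :≤ 2 :* ρ :+ con 1) ∷ (con 4 :≤ g) ∷ [] ⊢ con 0 :< ρ) ((2 ∷ 1 ∷ 1 ∷ []) , [])) ρ g ≤ρ 4≤g) ≤-refl
            ((linear 2 (λ ρ g → (2 :* ρ :≤ g) ∷ [] ⊢ ρ :+ ρ :≤ g) ((2 ∷ 2 ∷ []) , [])) ρ g ρ≤) ((linear 2 (λ ρ g → (2 :* ρ :≤ g) ∷ (con 4 :≤ g) ∷ [] ⊢ ρ :< g) ((2 ∷ 1 ∷ 1 ∷ []) , [])) ρ g ρ≤ 4≤g))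
          le (cycle-diameter iu iv) apart ≤ρ
      ; (inj₂ (inj₁ (x≡u , _))) → x≢u x≡u
      ; (inj₂ (inj₂ (x≡v , _))) → x≢v x≡v }
      where open Poles poles

    -- Here n = g + 1, so g = 2ρ + 1 is odd and the neighbour of the leaf has two vertices at
    -- distance ρ ≥ r; by `beyond-leaf` both would be `v`.
    one-leaf : ∀ {N u v r} → n ≡ 2 * N → Poles u v r → ¬ Inner G u → Inner G v → ⊥
    one-leaf {N} {u} {v} {r} even poles leaf iv with toward poles | halve g
    ... | p , up , vp | ρ , ρ≤ , ≤ρ with index (neighbour-inner poles up)
    ...   | k , k< , refl = Periodic.distinct C (k + ρ) (k + suc ρ)
            ((linear 2 (λ k ρ → [] ⊢ k :+ ρ :< k :+ (con 1 :+ ρ)) ((1 ∷ []) , [])) k ρ) ((linear 3 (λ k ρ g → (con 4 :≤ g) ∷ [] ⊢ k :+ (con 1 :+ ρ) :< k :+ ρ :+ g) ((1 ∷ 1 ∷ []) , [])) k ρ g 4≤g)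
            (trans (at-v ρ ((linear 2 (λ ρ g → (g :≡ 2 :* ρ :+ con 1) ∷ (con 4 :≤ g) ∷ [] ⊢ con 0 :< ρ) ((2 ∷ 1 ∷ 0 ∷ 1 ∷ []) , [])) ρ g g≡ 4≤g) ≤-refl ((linear 2 (λ ρ g → (g :≡ 2 :* ρ :+ con 1) ∷ [] ⊢ ρ :+ ρ :≤ g) ((2 ∷ 0 ∷ 2 ∷ []) , [])) ρ g g≡))
              (sym (at-v (suc ρ) z<s (n≤1+n ρ) ((linear 2 (λ ρ g → (g :≡ 2 :* ρ :+ con 1) ∷ [] ⊢ ρ :+ (con 1 :+ ρ) :≤ g) ((2 ∷ 0 ∷ 2 ∷ []) , [])) ρ g g≡))))
      where
      cnt : n ≡ 1 + g
      cnt = count (u ∷ []) (All.[] AllPairs.∷ AllPairs.[]) (λ { (here refl) → leaf })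
        λ z → case z Fin.≟ u of λ { (yes z≡u) → inj₁ (here z≡u) ; (no z≢u) → inj₂ (others′ poles iv z z≢u) }
      g≡ : g ≡ 2 * ρ + 1
      g≡ = case g ≤? 2 * ρ of λ
        { (no g≰) → ≤-antisym ≤ρ ((linear 2 (λ ρ g → (2 :* ρ :< g) ∷ [] ⊢ 2 :* ρ :+ con 1 :≤ g) ((2 ∷ 2 ∷ []) , [])) ρ g (≰⇒> g≰))
        ; (yes g≤) → ⊥-elim (even≢odd N ρ ((linear 4 (λ n N g ρ → (n :≡ 2 :* N) ∷ (n :≡ con 1 :+ g) ∷ (g :≤ 2 :* ρ) ∷ (2 :* ρ :≤ g) ∷ [] ⊢ 2 :* N :≡ 2 :* ρ :+ con 1) ((2 ∷ 0 ∷ 2 ∷ 2 ∷ 0 ∷ 2 ∷ 0 ∷ []) , (2 ∷ 2 ∷ 0 ∷ 0 ∷ 2 ∷ 0 ∷ 2 ∷ []))) n N g ρ even cnt g≤ ρ≤)) }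
      r≤ρ : r ≤ ρ
      r≤ρ = (linear 4 (λ r ρ g d → (2 :* d :≤ g) ∷ (d :≡ r) ∷ (g :≡ 2 :* ρ :+ con 1) ∷ [] ⊢ r :≤ ρ) ((2 ∷ 1 ∷ 0 ∷ 2 ∷ 1 ∷ 0 ∷ []) , [])) r ρ g _ (cycle-diameter iv (cycle-inner k)) vp g≡
      at-v : ∀ a → 0 < a → ρ ≤ a → ρ + a ≤ g → c (k + a) ≡ v
      at-v a 0<a ρ≤a ρ+a≤g = beyond-leaf poles leaf up (cycle-inner (k + a)) (≤-trans r≤ρ
        (far-along k a k< ρ 0<a ρ≤a ρ+a≤g ((linear 3 (λ ρ a g → (ρ :+ a :≤ g) ∷ (g :≡ 2 :* ρ :+ con 1) ∷ (con 4 :≤ g) ∷ [] ⊢ a :< g) ((2 ∷ 2 ∷ 1 ∷ 0 ∷ 1 ∷ []) , [])) ρ a g ρ+a≤g g≡ 4≤g)))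

    -- Here n = g + 2, so g = 2ρ is even. The antipode of the neighbour of `u` is inner, which gives
    -- ρ < r, whereas `far-inner-pair` needs an inner pair at distance at least r in a cycle of
    -- diameter ρ.
    two-leaves : ∀ {N u v r} → 5 ≤ g → n ≡ 2 * N → Poles u v r → ¬ Inner G u → ¬ Inner G v → ⊥
    two-leaves {N} {u} {v} {r} 5≤g even poles leaf-u leaf-v with toward poles | toward (swap-poles poles) | halve g
    ... | p , up , _ | q , vq , _ | ρ , ρ≤ , ≤ρ with index (neighbour-inner poles up)
    ...   | k , k< , refl = let x , y , ix , iy , r≤ = far-inner-pair poles leaf-u leaf-v up vq ((linear 3 (λ ρ g r → (g :≡ 2 :* ρ) ∷ (con 5 :≤ g) ∷ (ρ :< r) ∷ [] ⊢ con 3 :≤ r) ((2 ∷ 1 ∷ 0 ∷ 1 ∷ 2 ∷ []) , [])) ρ g r g≡ 5≤g ρ<r) in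
      (linear 4 (λ ρ g r d → (g :≡ 2 :* ρ) ∷ (ρ :< r) ∷ (r :≤ d) ∷ (2 :* d :≤ g) ∷ [] ⊢ absurd) ((1 ∷ 0 ∷ 2 ∷ 2 ∷ 1 ∷ []) , [])) ρ g r _ g≡ ρ<r r≤ (cycle-diameter ix iy)
      where
      cnt : n ≡ 2 + g
      cnt = count (u ∷ v ∷ []) ((u≢v poles All.∷ All.[]) AllPairs.∷ (All.[] AllPairs.∷ AllPairs.[]))
        (λ { (here refl) → leaf-u ; (there (here refl)) → leaf-v })
        λ z → case (z Fin.≟ u) , (z Fin.≟ v) of λ
          { (yes z≡u , _) → inj₁ (here z≡u) ; (_ , yes z≡v) → inj₁ (there (here z≡v))
          ; (no z≢u , no z≢v) → inj₂ (others poles z z≢u z≢v) }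
      g≡ : g ≡ 2 * ρ
      g≡ = case g ≤? 2 * ρ of λ
        { (yes g≤) → ≤-antisym g≤ ρ≤
        ; (no g≰) → ⊥-elim (even≢odd N (ρ + 1) ((linear 4 (λ n N g ρ → (n :≡ 2 :* N) ∷ (n :≡ con 2 :+ g) ∷ (2 :* ρ :< g) ∷ (g :≤ 2 :* ρ :+ con 1) ∷ [] ⊢ 2 :* N :≡ 2 :* (ρ :+ con 1) :+ con 1) ((2 ∷ 0 ∷ 2 ∷ 2 ∷ 0 ∷ 0 ∷ 2 ∷ []) , (2 ∷ 2 ∷ 0 ∷ 0 ∷ 2 ∷ 2 ∷ 0 ∷ []))) n N g ρ even cnt (≰⇒> g≰) ≤ρ)) }
      ρ<r : ρ < r
      ρ<r = ≤-<-trans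
        (far-along k ρ k< ρ ((linear 2 (λ ρ g → (g :≡ 2 :* ρ) ∷ (con 4 :≤ g) ∷ [] ⊢ con 0 :< ρ) ((2 ∷ 1 ∷ 0 ∷ 1 ∷ []) , [])) ρ g g≡ 4≤g) ≤-refl ((linear 2 (λ ρ g → (g :≡ 2 :* ρ) ∷ [] ⊢ ρ :+ ρ :≤ g) ((2 ∷ 0 ∷ 2 ∷ []) , [])) ρ g g≡)
          ((linear 2 (λ ρ g → (g :≡ 2 :* ρ) ∷ (con 4 :≤ g) ∷ [] ⊢ ρ :< g) ((2 ∷ 0 ∷ 1 ∷ 1 ∷ []) , [])) ρ g g≡ 4≤g))
        (near-leaves poles leaf-u leaf-v up (cycle-inner (k + ρ)))

    single-cycle-impossible : ∀ {N} → 5 ≤ g → n ≡ 2 * N → ⊥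
    single-cycle-impossible {N} 5≤g even with inner? G u | inner? G v
    ... | yes iu | yes iv = no-leaf poles iu iv
    ... | no ¬iu | yes iv = one-leaf {N} even poles ¬iu iv
    ... | yes iu | no ¬iv = one-leaf {N} even (swap-poles poles) ¬iv iu
    ... | no ¬iu | no ¬iv = two-leaves {N} 5≤g even poles ¬iu ¬iv

  record ExactTheta : Set where
    field
      S     : Strands G 3
      exact : Strands.Exact S
      a≤b   : Strands.len S 𝟎 ≤ Strands.len S 𝟏
      b≤c   : Strands.len S 𝟏 ≤ Strands.len S 𝟐
      g≡    : g ≡ Strands.len S 𝟎 + Strands.len S 𝟏

  module Theta (S : Strands G 3) (a≤b : Strands.len S 𝟎 ≤ Strands.len S 𝟏) (b≤c : Strands.len S 𝟏 ≤ Strands.len S 𝟐)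
    (g≡ : g ≡ Strands.len S 𝟎 + Strands.len S 𝟏) (innerP : Inner G (Strands.P S)) (innerQ : Inner G (Strands.Q S)) where

    open Strands S
    open ThetaVertices S

    pairs : ∀ σ τ → σ ≢ τ → g ≤ len σ + len τ
    pairs 𝟎 𝟎 σ≢τ = contradiction refl σ≢τ
    pairs 𝟏 𝟏 σ≢τ = contradiction refl σ≢τ
    pairs 𝟐 𝟐 σ≢τ = contradiction refl σ≢τ
    pairs 𝟎 𝟏 _ = ≤-reflexive g≡
    pairs 𝟏 𝟎 _ = ≤-reflexive (trans g≡ (+-comm (len 𝟎) (len 𝟏)))
    pairs 𝟎 𝟐 _ = (linear 4 (λ g a b c → (g :≡ a :+ b) ∷ (b :≤ c) ∷ [] ⊢ g :≤ a :+ c) ((1 ∷ 1 ∷ 0 ∷ 1 ∷ []) , [])) g (len 𝟎) (len 𝟏) (len 𝟐) g≡ b≤c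
    pairs 𝟐 𝟎 _ = (linear 4 (λ g a b c → (g :≡ a :+ b) ∷ (b :≤ c) ∷ [] ⊢ g :≤ c :+ a) ((1 ∷ 1 ∷ 0 ∷ 1 ∷ []) , [])) g (len 𝟎) (len 𝟏) (len 𝟐) g≡ b≤c
    pairs 𝟏 𝟐 _ = (linear 4 (λ g a b c → (g :≡ a :+ b) ∷ (a :≤ b) ∷ (b :≤ c) ∷ [] ⊢ g :≤ b :+ c) ((1 ∷ 1 ∷ 0 ∷ 1 ∷ 1 ∷ []) , [])) g (len 𝟎) (len 𝟏) (len 𝟐) g≡ a≤b b≤c
    pairs 𝟐 𝟏 _ = (linear 4 (λ g a b c → (g :≡ a :+ b) ∷ (a :≤ b) ∷ (b :≤ c) ∷ [] ⊢ g :≤ c :+ b) ((1 ∷ 1 ∷ 0 ∷ 1 ∷ 1 ∷ []) , [])) g (len 𝟎) (len 𝟏) (len 𝟐) g≡ a≤b b≤c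

    module E = Exactness G conn girth 4≤g C poles S theta theta-unique theta⇒on on⇒theta
      ((linear 6 (λ n g a b c l → (n :+ con 2 :≤ 2 :* g) ∷ (g :≡ a :+ b) ∷ (con 1 :+ l :≡ a :+ b :+ c) ∷ (b :≤ c) ∷ (a :≤ b) ∷ [] ⊢ con 1 :+ n :< g :+ l) ((4 ∷ 5 ∷ 6 ∷ 0 ∷ 0 ∷ 4 ∷ 4 ∷ 2 ∷ []) , []))
        n g (len 𝟎) (len 𝟏) (len 𝟐) (length theta) n≤ g≡ theta-length b≤c a≤b)
      innerP innerQ (P-on 𝟎)

    exact-or-K₄ : ExactTheta ⊎ K₄ {G = G} g
    exact-or-K₄ with E.exact-or-bridge
    ... | inj₁ X = inj₁ record { S = S ; exact = X ; a≤b = a≤b ; b≤c = b≤c ; g≡ = g≡ }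
    ... | inj₂ (m , p , B , on , on′ , fits) = inj₂ (ThetaBridge.bridge⇒K₄ girth S pairs n≤ B fits on on′)

  off-cycle : ∀ {z} → Inner G z → z ∉ cycle → ExactTheta ⊎ K₄ {G = G} g
  off-cycle {z} iz z∉ with Shape.find-ear G conn girth 4≤g C (next poles) cycle cycle-unique large (cycle-complete 0) iz z∉
  ... | E , 0<m with ∈cycle (Ear.start E) | ∈cycle (Ear.finish E)
  ...   | k , k< , from | k′ , k′< , to with relocate C k k′ k<
  ...     | j , kj with reduce (rotate G k C) 0<g j
  ...       | a , a< , ja = build
    where
    open Ear E using (m; p; outside)
    p-0 : p 0 ≡ c (k + 0)
    p-0 = trans from (cong c (sym (+-identityʳ k)))
    p-len : p (suc m) ≡ c (k + a)
    p-len = trans to (trans kj ja)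
    b = g ∸ a
    a+b : a + b ≡ g
    a+b = m+[n∸m]≡n (<⇒≤ a<)
    0<b : 0 < b
    0<b = (linear 3 (λ a b g → (a :+ b :≡ g) ∷ (a :< g) ∷ [] ⊢ con 0 :< b) ((1 ∷ 0 ∷ 1 ∷ 1 ∷ []) , [])) a b g a+b a<
    0<a : 0 < a
    0<a = ≰⇒> λ a≤0 → Ear.ends E (trans p-0 (sym (trans p-len (cong (λ t → c (k + t)) (≤-antisym a≤0 z≤n)))))

    -- The shorter arc and the ear form a cycle, so the ear is at least as long as the longer arc:
    -- the three strands come out sorted.
    from-arcs : (A : Strands G 2) → Strands.P A ≡ c (k + 0) → Strands.Q A ≡ c (k + a) → Strands.len A 𝟎 ≤ Strands.len A 𝟏 →
                Strands.len A 𝟎 + Strands.len A 𝟏 ≡ g → (∀ {z} → Strands.On A z → z ∈ cycle) → ExactTheta ⊎ K₄ {G = G} g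
    from-arcs A P≡ Q≡ a≤b sum on⇒cycle = Theta.exact-or-K₄ (add-strand A m p B (trans p-0 (sym P≡)) (trans p-len (sym Q≡))) a≤b
        ((linear 4 (λ x y g q → (x :+ y :≡ g) ∷ (g :≤ x :+ (con 1 :+ q)) ∷ [] ⊢ y :≤ con 1 :+ q) ((1 ∷ 1 ∷ 0 ∷ 1 ∷ []) , [])) (len 𝟎) (len 𝟏) g m sum
          (bridge-bound girth B (subst₂ (λ x y → RWalk Along x y (len 𝟎)) (trans P≡ (sym p-0)) (trans Q≡ (sym p-len)) (walk-PQ 𝟎))))
        (sym sum) (subst (Inner G) (sym P≡) (cycle-inner (k + 0))) (subst (Inner G) (sym Q≡) (cycle-inner (k + a)))
      where
      open Strands A
      open AlongWalks A
      B : Bridge m p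
      B = record { links = Ear.links E ; off = λ i 0<i i≤ on → outside i 0<i i≤ (on⇒cycle on) ; inj-p = Ear.inj E ; ends = Ear.ends E
                 ; new-edge = λ m≡0 → contradiction (subst (0 <_) m≡0 0<m) λ () }

    build : ExactTheta ⊎ K₄ {G = G} g
    build with ≤-total a b
    ... | inj₁ a≤b = from-arcs Arc refl refl a≤b a+b on⇒cycle
      where open Arcs k k< a b 0<a 0<b a+b
    ... | inj₂ b≤a = from-arcs (permute swap swap-injective Arc) refl refl b≤a (trans (+-comm b a) a+b)
                       (λ on → on⇒cycle (on-permute swap swap-injective Arc on))
      where open Arcs k k< a b 0<a 0<b a+b

  structure : ∀ {N} → 5 ≤ g → n ≡ 2 * N → ExactTheta ⊎ K₄ {G = G} g
  structure {N} 5≤g even with any? (λ z → inner? G z ×-dec ¬? (Any.any? (z Fin.≟_) cycle))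
  ... | yes (z , iz , z∉) = off-cycle iz z∉
  ... | no none = ⊥-elim (SingleCycle.single-cycle-impossible
    (λ {z} iz → decidable-stable (Any.any? (z Fin.≟_) cycle) λ z∉ → none (z , iz , z∉)) {N} 5≤g even)

-- Excluding the subdivisions of K₄ of orders 8, 10 and 16

allᵇ anyᵇ : ℕ → (ℕ → Bool) → Bool
allᵇ zero    p = true
allᵇ (suc n) p = p n ∧ allᵇ n p
anyᵇ zero    p = false
anyᵇ (suc n) p = p n ∨ anyᵇ n p

∧-split : ∀ {x y} → T (x ∧ y) → T x × T y
∧-split = Equivalence.to T-∧

∨-split : ∀ {x y} → T (x ∨ y) → T x ⊎ T y
∨-split = Equivalence.to T-∨

allᵇ-sound : ∀ n {p} → T (allᵇ n p) → ∀ i → i < n → T (p i)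
allᵇ-sound (suc n) {p} t i i< with i <? n | ∧-split {p n} t
... | yes i<n | _ , ts = allᵇ-sound n ts i i<n
... | no i≮n | tn , _ = subst (T ∘ p) (≤-antisym (≮⇒≥ i≮n) (s≤s⁻¹ i<)) tn

anyᵇ-sound : ∀ n {p} → T (anyᵇ n p) → ∃ λ i → i < n × T (p i)
anyᵇ-sound (suc n) {p} t with ∨-split {p n} t
... | inj₁ tn = n , ≤-refl , tn
... | inj₂ ts = let i , i< , ti = anyᵇ-sound n ts in i , ≤-trans i< (n≤1+n n) , ti

nth : ∀ {A : Set} → A → List A → ℕ → A
nth d []       _       = d
nth d (x ∷ xs) zero    = x
nth d (x ∷ xs) (suc i) = nth d xs i

-- All-pairs distances by repeated relaxation; the result is only ever used together with a check.
module Distances (N : ℕ) (adj : ℕ → ℕ → Bool) where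

  neighbours : List (List ℕ)
  neighbours = List.map (λ x → List.filterᵇ (adj x) (List.upTo N)) (List.upTo N)

  relax : List (List ℕ) → List ℕ → List ℕ
  relax nbrs row = List.zipWith (λ ns d → List.foldr (λ z m → let s = suc (nth N row z) in if s <ᵇ m then s else m) d ns) nbrs row

  iterate : ℕ → List (List ℕ) → List ℕ → List ℕ
  iterate zero    nbrs row = row
  iterate (suc k) nbrs row = iterate k nbrs (relax nbrs row)

  table : List (List ℕ)
  -- The initial value `N` stands for infinity; seven rounds suffice as long as the diameter is at
  -- most seven.
  table = List.map (λ y → iterate 7 neighbours (List.map (λ x → if x ≡ᵇ y then 0 else N) (List.upTo N))) (List.upTo N)

entry : List (List ℕ) → ℕ → ℕ → ℕ
entry tab x y = nth 0 (nth [] tab y) x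

module Checks (N : ℕ) (adj : ℕ → ℕ → Bool) (D : ℕ → ℕ → ℕ) where

  -- Local conditions that characterise the metric: a neighbour one step closer yields a walk of
  -- length `D x y`, and the Lipschitz condition, added up along a walk, bounds the length of every
  -- walk from below.
  is-distance : Bool
  is-distance = allᵇ N λ x → (D x x ≡ᵇ 0) ∧ allᵇ N λ y →
    ((x ≡ᵇ y) ∨ anyᵇ N λ z → adj x z ∧ (suc (D z y) ≡ᵇ D x y)) ∧ allᵇ N λ z → not (adj x z) ∨ (D x y ≤ᵇ suc (D z y))

  -- The listed edges are known to be present in the graph, but more might be. A further edge
  -- between vertices at distance at most g - 2 would close a cycle shorter than g, so in girth g
  -- the list is complete.
  saturated : ℕ → Bool
  saturated g = allᵇ N λ x → allᵇ N λ y → (x ≡ᵇ y) ∨ (adj x y ∨ (suc (suc (D x y)) ≤ᵇ g))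

  far-pair : ℕ → ℕ → ℕ → Bool
  far-pair m x y = (x <ᵇ y) ∧ (m ≤ᵇ D x y)

  two-far-pairs : ℕ → Bool
  two-far-pairs m = anyᵇ N λ x → anyᵇ N λ y → far-pair m x y ∧
    anyᵇ N λ x′ → anyᵇ N λ y′ → far-pair m x′ y′ ∧ not ((x ≡ᵇ x′) ∧ (y ≡ᵇ y′))

  -- Each alternative gives r < m in a graph with poles: either some vertex has eccentricity below
  -- m, or the diameter r + 1 is at most m.
  small-radius : ℕ → Bool
  small-radius m = (anyᵇ N λ x → allᵇ N λ y → D x y <ᵇ m) ∨ (allᵇ N λ x → allᵇ N λ y → D x y ≤ᵇ m)

  -- With r < m, two different unordered pairs at distance at least m contradict the uniqueness of
  -- the polar pair.
  not-ASC : Bool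
  not-ASC = anyᵇ N λ m → small-radius m ∧ two-far-pairs m

strandEdges : (ℕ → ℕ) → ℕ → List (ℕ × ℕ)
strandEdges f = applyUpTo (λ t → f t , f (suc t))

-- Labels for the vertices of a subdivided K₄, in the order of the list `vertices` below.
module Labels (a b i j : ℕ) where

  labelQ : ℕ
  labelQ = b + (b ∸ 1)

  labelX labelY labelZ labelE : ℕ → ℕ
  labelX t = if t <ᵇ b then t else labelQ
  labelY zero    = 0
  labelY (suc t) = b + t
  labelZ zero    = 0
  labelZ (suc t) = if suc t <ᵇ a then b + (b + t) else labelQ
  labelE zero    = labelX i
  labelE (suc t) = if suc t <ᵇ a then b + (b + ((a ∸ 1) + t)) else labelY j

  edges : List (ℕ × ℕ)
  edges = strandEdges labelX b ++ strandEdges labelY b ++ strandEdges labelZ a ++ strandEdges labelE a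

passes : ℕ → (N : ℕ) (linked : ℕ → ℕ → Bool) (D : ℕ → ℕ → ℕ) → Bool
passes g N linked D = is-distance ∧ (saturated g ∧ not-ASC)
  where open Checks N linked D

tabulated : ℕ → ℕ → (ℕ → ℕ → Bool) → Bool
tabulated g N linked = passes g N linked (entry (Distances.table N linked))

checkK₄ : ℕ → ℕ → ℕ → ℕ → ℕ → Bool
checkK₄ g a b i j = tabulated g ((g + g) ∸ 2) (anyMatch (Labels.edges a b i j))

admissible : ℕ → ℕ → ℕ → ℕ → Bool
admissible a b i j = (a ≤ᵇ b) ∧ ((b ≤ᵇ a + 2 * i) ∧ (b ≤ᵇ a + 2 * j))

-- In a `K₄` of girth g the numbers b and i determine a = g - b and j = b - i, so two loops
-- enumerate all subdivisions.
caseK₄ : ℕ → ℕ → ℕ → Bool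
caseK₄ g b i = not (admissible (g ∸ b) b i (b ∸ i)) ∨ checkK₄ g (g ∸ b) b i (b ∸ i)

checkAllK₄ : ℕ → Bool
checkAllK₄ g = allᵇ g λ b → allᵇ (suc b) (caseK₄ g b)

-- Abstract, so that the tables of all subdivisions of K₄ with girth g and 2g - 2 vertices are
-- evaluated only once.
abstract
  Passed : ℕ → Set
  Passed g = checkAllK₄ g ≡ true

  passed⇒case : ∀ g b i → Passed g → b < g → i ≤ b → T (caseK₄ g b i)
  passed⇒case g b i t b<g i≤b = allᵇ-sound (suc b) {caseK₄ g b} (allᵇ-sound g {λ b → allᵇ (suc b) (caseK₄ g b)} (Equivalence.from T-≡ t) b b<g) i (s≤s i≤b)

  passed₅ : Passed 5
  passed₅ = refl

  passed₆ : Passed 6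
  passed₆ = refl

  passed₉ : Passed 9
  passed₉ = refl

-- Soundness of the table checks

∨-implies : ∀ {x y} → T (not x ∨ y) → T x → T y
∨-implies {true} t _ = t

≡ᵇ-T : ∀ {m n} → T (m ≡ᵇ n) → m ≡ n
≡ᵇ-T {m} {n} = ≡ᵇ⇒≡ m n

rwalk-image : ∀ {A B : Set} {R : A → A → Set} {S : B → B → Set} (f : A → B) → (∀ {x y} → R x y → S (f x) (f y)) →
              ∀ {u v k} → RWalk R u v k → RWalk S (f u) (f v) k
rwalk-image f h nil        = nil
rwalk-image f h (cons e p) = cons (h e) (rwalk-image f h p)

toWalk : ∀ {n} {G : Graph n} {u v k} → RWalk (Edge G) u v k → Walk G u v k
toWalk nil        = nil
toWalk (cons e p) = cons e (toWalk p)

matches-sound : ∀ {R : ℕ → ℕ → Set} → (∀ {x y} → R x y → R y x) → ∀ {e x y} → R (proj₁ e) (proj₂ e) → T (matches e x y) → R x y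
matches-sound {R} R-sym {a , b} {x} {y} r t with ∨-split {(a ≡ᵇ x) ∧ (b ≡ᵇ y)} t
... | inj₁ s = let p , q = ∧-split {a ≡ᵇ x} s in subst₂ R (≡ᵇ-T p) (≡ᵇ-T q) r
... | inj₂ s = let p , q = ∧-split {a ≡ᵇ y} s in R-sym (subst₂ R (≡ᵇ-T p) (≡ᵇ-T q) r)

anyMatch-sound : ∀ {R : ℕ → ℕ → Set} → (∀ {x y} → R x y → R y x) → ∀ {es x y} → All (λ e → R (proj₁ e) (proj₂ e)) es →
                 T (anyMatch es x y) → R x y
anyMatch-sound {R} R-sym {e ∷ es} {x} {y} (r All.∷ rs) t with ∨-split {matches e x y} t
... | inj₁ s = matches-sound {R} R-sym {e} r s
... | inj₂ s = anyMatch-sound {R} R-sym rs s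

module Sound {n} (G : Graph n) (N : ℕ) (linked : ℕ → ℕ → Bool) (D : ℕ → ℕ → ℕ) (φ : ℕ → Fin n)
  (φ-injective : ∀ {x y} → x < N → y < N → φ x ≡ φ y → x ≡ y) (φ-onto : ∀ v → ∃ λ x → x < N × φ x ≡ v)
  (linked⇒edge : ∀ {x y} → x < N → y < N → T (linked x y) → Edge G (φ x) (φ y))
  (ok : T (Checks.is-distance N linked D)) where

  open Checks N linked D

  D-refl : ∀ {x} → x < N → D x x ≡ 0
  D-refl {x} x< = ≡ᵇ-T (proj₁ (∧-split {D x x ≡ᵇ 0} (allᵇ-sound N ok x x<)))

  D-step : ∀ {x y} → x < N → y < N → x ≡ y ⊎ ∃ λ z → z < N × T (linked x z) × suc (D z y) ≡ D x y
  D-step {x} {y} x< y< with ∨-split {x ≡ᵇ y} (proj₁ (∧-split (allᵇ-sound N (proj₂ (∧-split {D x x ≡ᵇ 0} (allᵇ-sound N ok x x<))) y y<)))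
  ... | inj₁ t = inj₁ (≡ᵇ-T t)
  ... | inj₂ t = let z , z< , s = anyᵇ-sound N t ; l , e = ∧-split {linked x z} s in inj₂ (z , z< , l , ≡ᵇ-T e)

  D-lipschitz : ∀ {x y z} → x < N → y < N → z < N → T (linked x z) → D x y ≤ suc (D z y)
  D-lipschitz {x} {y} {z} x< y< z< l = ≤ᵇ⇒≤ (D x y) (suc (D z y)) (∨-implies {linked x z} (allᵇ-sound N
    (proj₂ (∧-split {(x ≡ᵇ y) ∨ _} (allᵇ-sound N (proj₂ (∧-split {D x x ≡ᵇ 0} (allᵇ-sound N ok x x<))) y y<))) z z<) l)

  Linked : ℕ → ℕ → Set
  Linked x y = x < N × y < N × T (linked x y)

  label-walk : ∀ {x y} → x < N → y < N → RWalk Linked x y (D x y)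
  label-walk {x} {y} x< y< = go (D x y) x< refl
    where
    go : ∀ d {x} → x < N → D x y ≡ d → RWalk Linked x y d
    go d {x} x< eq with D-step x< y<
    go d x< eq | inj₁ refl = subst (RWalk Linked _ _) (trans (sym (D-refl x<)) eq) nil
    go zero x< eq | inj₂ (z , z< , l , s) = contradiction (trans s eq) λ ()
    go (suc d) x< eq | inj₂ (z , z< , l , s) = cons (x< , z< , l) (go d z< (suc-injective (trans s eq)))

  walk : ∀ {x y} → x < N → y < N → Walk G (φ x) (φ y) (D x y)
  walk x< y< = toWalk (rwalk-image φ (λ (a< , b< , l) → linked⇒edge a< b< l) (label-walk x< y<))

  walk-connected : Connected G
  walk-connected u v with φ-onto u | φ-onto v
  ... | x , x< , refl | y , y< , refl = D x y , walk x< y<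

  module _ (edge⇒linked : ∀ {x y} → x < N → y < N → Edge G (φ x) (φ y) → T (linked x y)) where

    lower : ∀ {x y w k} → x < N → y < N → w ≡ φ y → Walk G (φ x) w k → D x y ≤ k
    lower {x} x< y< eq nil with φ-injective x< y< eq
    ... | refl = ≤-reflexive (D-refl x<)
    lower x< y< eq (cons {w = w} e p) with φ-onto w
    ... | z , z< , refl = ≤-trans (D-lipschitz x< y< z< (edge⇒linked x< z< e)) (s≤s (lower z< y< eq p))

    dist≡D : ∀ (conn : Connected G) {x y} → x < N → y < N → Metric.dist G conn (φ x) (φ y) ≡ D x y
    dist≡D conn x< y< = ≤-antisym (dist-min (walk x< y<)) (lower x< y< refl (dist-walk _ _))
      where open Metric G conn

  saturated⇒complete : ∀ {g} → (∀ k → HasCycle G k → g ≤ k) → T (saturated g) →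
                       ∀ {x y} → x < N → y < N → Edge G (φ x) (φ y) → T (linked x y)
  saturated⇒complete {g} girth sat {x} {y} x< y< e with ∨-split {x ≡ᵇ y} (allᵇ-sound N (allᵇ-sound N sat x x<) y y<)
  ... | inj₁ t = contradiction (subst (λ z → Edge G (φ x) (φ z)) (sym (≡ᵇ-T {x} {y} t)) e) (edge-irr G)
  ... | inj₂ t with linked x y in xy | ∨-split {linked x y} t
  ...   | true  | _ = tt
  ...   | false | inj₂ le =
    let k , k≤ , cyc = edge+walk⇒cycle G e (rwalk-image φ avoid (label-walk x< y<)) in
    (linear 3 (λ k d g → (k :≤ con 1 :+ d) ∷ (g :≤ k) ∷ (con 1 :+ (con 1 :+ d) :≤ g) ∷ [] ⊢ absurd) ((1 ∷ 1 ∷ 1 ∷ []) , [])) k (D x y) g k≤ (girth k cyc) (≤ᵇ⇒≤ (suc (suc (D x y))) g le)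
    where
    avoid : ∀ {a b} → Linked a b → Edge G (φ a) (φ b) × ¬ (φ a ≡ φ x × φ b ≡ φ y)
    avoid (a< , b< , l) = linked⇒edge a< b< l , λ (p , q) →
      subst T (trans (cong₂ linked (φ-injective a< x< p) (φ-injective b< y< q)) xy) l

  module _ (conn : Connected G) (dist≡ : ∀ {x y} → x < N → y < N → Metric.dist G conn (φ x) (φ y) ≡ D x y)
    {u v r} (poles : Metric.Poles G conn u v r) where

    open Metric G conn
    open Poles poles

    radius< : ∀ m → (∀ z → ∃ λ y → r ≤ dist z y) → T (small-radius m) → r < m
    radius< m far-from t with ∨-split {anyᵇ N _} t
    ... | inj₁ s with anyᵇ-sound N s
    ...   | x , x< , all with far-from (φ x)
    ...     | w , r≤ with φ-onto w
    ...       | y , y< , refl = ≤-<-trans (subst (r ≤_) (dist≡ x< y<) r≤) (<ᵇ⇒< (D x y) m (allᵇ-sound N all y y<))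
    radius< m far-from t | inj₂ s with φ-onto u | φ-onto v
    ... | x , x< , refl | y , y< , refl = subst (_≤ m) (trans (sym (dist≡ x< y<)) apart) (≤ᵇ⇒≤ (D x y) m (allᵇ-sound N (allᵇ-sound N s x x<) y y<))

    is-polar : ∀ {m x y} → r < m → x < N → y < N → T (far-pair m x y) → x < y × ((φ x ≡ u × φ y ≡ v) ⊎ (φ x ≡ v × φ y ≡ u))
    is-polar {m} {x} {y} r<m x< y< t with ∧-split {x <ᵇ y} t | near (φ x) (φ y)
    ... | t₁ , t₂ | inj₂ eq = <ᵇ⇒< x y t₁ , eq
    ... | t₁ , t₂ | inj₁ le = contradiction (≤ᵇ⇒≤ m (D x y) t₂) (<⇒≱ (≤-<-trans (subst (_≤ r) (dist≡ x< y<) le) r<m))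

    clash : ∀ {x x′ y y′} → T (not ((x ≡ᵇ x′) ∧ (y ≡ᵇ y′))) → x ≡ x′ → y ≡ y′ → ⊥
    clash {x} {y = y} t refl refl rewrite ≡ᵇ-refl x | ≡ᵇ-refl y = t

    reversed : ∀ {x y x′ y′} → x < y → x′ < y′ → x ≡ y′ → y ≡ x′ → ⊥
    reversed x<y x′<y′ refl refl = <⇒≱ x<y (<⇒≤ x′<y′)

    not-ASC-sound : (∀ z → ∃ λ y → r ≤ dist z y) → T not-ASC → ⊥
    not-ASC-sound far-from t with anyᵇ-sound N t
    ... | m , _ , s with ∧-split {small-radius m} s
    ...   | small , two with anyᵇ-sound N two
    ...     | x , x< , s₁ with anyᵇ-sound N s₁
    ...       | y , y< , s₂ with ∧-split {far-pair m x y} s₂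
    ...         | xy , s₃ with anyᵇ-sound N s₃
    ...           | x′ , x′< , s₄ with anyᵇ-sound N s₄
    ...             | y′ , y′< , s₅ with ∧-split {far-pair m x′ y′} s₅
    ...               | xy′ , differ with radius< m far-from small
    ...                 | r<m with is-polar r<m x< y< xy | is-polar r<m x′< y′< xy′
    ...                   | x<y , inj₁ (p , q) | x′<y′ , inj₁ (p′ , q′) = clash differ (φ-injective x< x′< (trans p (sym p′))) (φ-injective y< y′< (trans q (sym q′)))
    ...                   | x<y , inj₂ (p , q) | x′<y′ , inj₂ (p′ , q′) = clash differ (φ-injective x< x′< (trans p (sym p′))) (φ-injective y< y′< (trans q (sym q′)))
    ...                   | x<y , inj₁ (p , q) | x′<y′ , inj₂ (p′ , q′) = reversed x<y x′<y′ (φ-injective x< y′< (trans p (sym q′))) (φ-injective y< x′< (trans q (sym p′)))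
    ...                   | x<y , inj₂ (p , q) | x′<y′ , inj₁ (p′ , q′) = reversed x<y x′<y′ (φ-injective x< y′< (trans p (sym q′))) (φ-injective y< x′< (trans q (sym p′)))

nth-++ˡ : ∀ {A : Set} (d : A) xs ys {i} → i < length xs → nth d (xs ++ ys) i ≡ nth d xs i
nth-++ˡ d (x ∷ xs) ys {zero}  _  = refl
nth-++ˡ d (x ∷ xs) ys {suc i} i< = nth-++ˡ d xs ys (s≤s⁻¹ i<)

nth-++ʳ : ∀ {A : Set} (d : A) xs ys i → nth d (xs ++ ys) (length xs + i) ≡ nth d ys i
nth-++ʳ d []       ys i = refl
nth-++ʳ d (x ∷ xs) ys i = nth-++ʳ d xs ys i

nth-applyUpTo : ∀ {A : Set} (d : A) f k {i} → i < k → nth d (applyUpTo f k) i ≡ f i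
nth-applyUpTo d f (suc k) {zero}  _  = refl
nth-applyUpTo d f (suc k) {suc i} i< = nth-applyUpTo d (f ∘ suc) k (s≤s⁻¹ i<)

nth-∈ : ∀ {A : Set} (d : A) xs {i} → i < length xs → nth d xs i ∈ xs
nth-∈ d (x ∷ xs) {zero}  _  = here refl
nth-∈ d (x ∷ xs) {suc i} i< = there (nth-∈ d xs (s≤s⁻¹ i<))

∈-nth : ∀ {A : Set} (d : A) {xs v} → v ∈ xs → ∃ λ i → i < length xs × nth d xs i ≡ v
∈-nth d (here refl) = 0 , z<s , refl
∈-nth d (there v∈) = let i , i< , eq = ∈-nth d v∈ in suc i , s<s i< , eq

nth-injective : ∀ {A : Set} (d : A) {xs} → Unique xs → ∀ {i j} → i < length xs → j < length xs → nth d xs i ≡ nth d xs j → i ≡ j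
nth-injective d {x ∷ xs} u {zero} {zero} _ _ _ = refl
nth-injective d {x ∷ xs} (x∉ AllPairs.∷ _) {zero} {suc j} _ j< eq = contradiction eq (All.lookup x∉ (nth-∈ d xs (s≤s⁻¹ j<)))
nth-injective d {x ∷ xs} (x∉ AllPairs.∷ _) {suc i} {zero} i< _ eq = contradiction (sym eq) (All.lookup x∉ (nth-∈ d xs (s≤s⁻¹ i<)))
nth-injective d {x ∷ xs} (_ AllPairs.∷ u) {suc i} {suc j} i< j< eq = cong suc (nth-injective d u (s≤s⁻¹ i<) (s≤s⁻¹ j<) eq)

if-< : ∀ {A : Set} {x y} (p q : A) → x < y → (if x <ᵇ y then p else q) ≡ p
if-< {x = x} {y} p q lt with x <ᵇ y | <⇒<ᵇ lt
... | true | _ = refl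

if-≮ : ∀ {A : Set} {x y} (p q : A) → ¬ x < y → (if x <ᵇ y then p else q) ≡ q
if-≮ {x = x} {y} p q ≮ with x <ᵇ y in eq
... | true  = contradiction (<ᵇ⇒< x y (subst T (sym eq) tt)) ≮
... | false = refl

module LabelledK₄ {n} {G : Graph n} {g} (K : K₄ {G = G} g) where
  open K₄ K
  open ThetaVertices S
  open Labels a b i j

  vertices : List (Fin n)
  vertices = theta ++ applyUpTo (p ∘ suc) m

  vertices-unique : Unique vertices
  vertices-unique = Unique.++⁺ theta-unique (Unique-window (p ∘ suc) m λ s t s<t t< → inj-p (suc s) (suc t) (s≤s s<t) t<)
    λ { (z∈ , z∈p) → let t , t< , z≡ = ∈-applyUpTo⁻ (p ∘ suc) z∈p in off (suc t) z<s t< (theta⇒on (subst (_∈ theta) z≡ z∈)) }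

  vertices-length : length vertices ≡ n
  vertices-length = trans (trans (length-++ theta) (cong (length theta +_) (length-applyUpTo (p ∘ suc) m)))
    ((linear 9 (λ l q x y z a b g n → (con 1 :+ l :≡ x :+ y :+ z) ∷ (x :≡ b) ∷ (y :≡ b) ∷ (z :≡ a) ∷ (con 1 :+ q :≡ a) ∷ (a :+ b :≡ g) ∷ (n :+ con 2 :≡ 2 :* g) ∷ [] ⊢ l :+ q :≡ n) ((2 ∷ 2 ∷ 0 ∷ 2 ∷ 0 ∷ 2 ∷ 0 ∷ 2 ∷ 0 ∷ 2 ∷ 0 ∷ 4 ∷ 0 ∷ 0 ∷ 2 ∷ []) , (1 ∷ 0 ∷ 1 ∷ 0 ∷ 1 ∷ 0 ∷ 1 ∷ 0 ∷ 1 ∷ 0 ∷ 1 ∷ 0 ∷ 2 ∷ 1 ∷ 0 ∷ [])))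
      (length theta) m (len 𝟎) (len 𝟏) (len 𝟐) a b g n theta-length len𝟎 len𝟏 len𝟐 m≡ a+b order)

  φ : ℕ → Fin n
  φ = nth P vertices

  φ-injective : ∀ {x y} → x < n → y < n → φ x ≡ φ y → x ≡ y
  φ-injective {x} {y} x< y< = nth-injective P vertices-unique (subst (x <_) (sym vertices-length) x<) (subst (y <_) (sym vertices-length) y<)

  φ-onto : ∀ v → ∃ λ x → x < n × φ x ≡ v
  φ-onto v = let x , x< , eq = ∈-nth P (Unique⇒complete vertices-unique (≤-reflexive (sym vertices-length)) v)
             in x , subst (x <_) vertices-length x< , eq

  0<b : 0 < b
  0<b = subst (0 <_) len𝟎 (len>0 𝟎)

  length𝟎 : length (part 𝟎) ≡ b
  length𝟎 = trans (length-applyUpTo (at 𝟎) (len 𝟎)) len𝟎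

  length𝟏 : length (part 𝟏) ≡ b
  length𝟏 = trans (length-applyUpTo (at 𝟏 ∘ suc) (len 𝟏)) len𝟏

  length𝟐 : length (part 𝟐) ≡ a ∸ 1
  length𝟐 = trans (length-applyUpTo (at 𝟐 ∘ suc) (len 𝟐 ∸ 1)) (cong (_∸ 1) len𝟐)

  m≡a∸1 : m ≡ a ∸ 1
  m≡a∸1 = cong (_∸ 1) m≡

  φ-X : ∀ t → t < b → φ t ≡ at 𝟎 t
  φ-X t t<b = trans (nth-++ˡ P theta _ (subst (t <_) (sym (trans (length-++ (part 𝟎)) (cong (_+ length (part 𝟏 ++ part 𝟐)) length𝟎))) (≤-trans t<b (m≤m+n b _))))
    (trans (nth-++ˡ P (part 𝟎) _ (subst (t <_) (sym length𝟎) t<b)) (nth-applyUpTo P (at 𝟎) (len 𝟎) (subst (t <_) (sym len𝟎) t<b)))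

  after-X : ∀ t → φ (b + t) ≡ nth P (part 𝟏 ++ part 𝟐 ++ applyUpTo (p ∘ suc) m) t
  after-X t = trans (cong₂ (nth P) {u = b + t} (trans (++-assoc (part 𝟎) (part 𝟏 ++ part 𝟐) _) (cong (part 𝟎 ++_) (++-assoc (part 𝟏) (part 𝟐) _))) (cong (_+ t) (sym length𝟎)))
    (nth-++ʳ P (part 𝟎) _ t)

  after-Y : ∀ t → φ (b + (b + t)) ≡ nth P (part 𝟐 ++ applyUpTo (p ∘ suc) m) t
  after-Y t = trans (after-X (b + t)) (trans (cong (λ l → nth P (part 𝟏 ++ part 𝟐 ++ applyUpTo (p ∘ suc) m) (l + t)) (sym length𝟏)) (nth-++ʳ P (part 𝟏) _ t))

  φ-Y : ∀ t → t < b → φ (b + t) ≡ at 𝟏 (suc t)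
  φ-Y t t<b = trans (after-X t) (trans (nth-++ˡ P (part 𝟏) _ (subst (t <_) (sym length𝟏) t<b)) (nth-applyUpTo P (at 𝟏 ∘ suc) (len 𝟏) (subst (t <_) (sym len𝟏) t<b)))

  φ-Z : ∀ t → t < a ∸ 1 → φ (b + (b + t)) ≡ at 𝟐 (suc t)
  φ-Z t t< = trans (after-Y t) (trans (nth-++ˡ P (part 𝟐) _ (subst (t <_) (sym length𝟐) t<))
    (nth-applyUpTo P (at 𝟐 ∘ suc) (len 𝟐 ∸ 1) (subst (λ l → t < l ∸ 1) (sym len𝟐) t<)))

  φ-E : ∀ t → t < a ∸ 1 → φ (b + (b + ((a ∸ 1) + t))) ≡ p (suc t)
  φ-E t t< = trans (after-Y ((a ∸ 1) + t)) (trans (cong (λ l → nth P (part 𝟐 ++ applyUpTo (p ∘ suc) m) (l + t)) (sym length𝟐))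
    (trans (nth-++ʳ P (part 𝟐) _ t) (nth-applyUpTo P (p ∘ suc) m (subst (t <_) (sym m≡a∸1) t<))))

  φ-Q : φ labelQ ≡ Q
  φ-Q = trans (φ-Y (b ∸ 1) (subst (b ∸ 1 <_) (suc-pred 0<b) ≤-refl)) (trans (cong (at 𝟏) (trans (suc-pred 0<b) (sym len𝟏))) (at-len 𝟏))

  φ-labelX : ∀ t → t ≤ b → φ (labelX t) ≡ at 𝟎 t
  φ-labelX t t≤b = case t <? b of λ
    { (yes t<b) → trans (cong φ (if-< t labelQ t<b)) (φ-X t t<b)
    ; (no t≮b) → trans (cong φ (if-≮ t labelQ t≮b)) (trans φ-Q (sym (trans (cong (at 𝟎) (trans (≤-antisym t≤b (≮⇒≥ t≮b)) (sym len𝟎))) (at-len 𝟎)))) }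

  φ-0 : φ 0 ≡ P
  φ-0 = trans (φ-X 0 0<b) (at-0 𝟎)

  φ-labelY : ∀ t → t ≤ b → φ (labelY t) ≡ at 𝟏 t
  φ-labelY zero    _   = trans φ-0 (sym (at-0 𝟏))
  φ-labelY (suc t) t<b = φ-Y t t<b

  below-a : ∀ {t} → suc t < a → t < a ∸ 1
  below-a (s≤s t<) = t<

  φ-labelZ : ∀ t → t ≤ a → φ (labelZ t) ≡ at 𝟐 t
  φ-labelZ zero    _   = trans φ-0 (sym (at-0 𝟐))
  φ-labelZ (suc t) t≤a = case suc t <? a of λ
    { (yes t<a) → trans (cong φ (if-< _ labelQ t<a)) (φ-Z t (below-a t<a))
    ; (no t≮a) → trans (cong φ (if-≮ _ labelQ t≮a)) (trans φ-Q (sym (trans (cong (at 𝟐) (trans (≤-antisym t≤a (≮⇒≥ t≮a)) (sym len𝟐))) (at-len 𝟐)))) }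

  φ-labelE : ∀ t → t ≤ a → φ (labelE t) ≡ p t
  φ-labelE zero    _   = trans (φ-labelX i (subst (i ≤_) i+j (m≤m+n i j))) (sym from)
  φ-labelE (suc t) t≤a = case suc t <? a of λ
    { (yes t<a) → trans (cong φ (if-< _ (labelY j) t<a)) (φ-E t (below-a t<a))
    ; (no t≮a) → trans (cong φ (if-≮ _ (labelY j) t≮a)) (trans (φ-labelY j (subst (j ≤_) i+j (m≤n+m j i)))
                   (trans (sym to) (cong p (trans m≡ (sym (≤-antisym t≤a (≮⇒≥ t≮a))))))) }

  strand-edges : ∀ (f : ℕ → ℕ) (q : ℕ → Fin n) k → (∀ t → t ≤ k → φ (f t) ≡ q t) → (∀ t → t < k → Edge G (q t) (q (suc t))) →
                 All (λ e → Edge G (φ (proj₁ e)) (φ (proj₂ e))) (strandEdges f k)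
  strand-edges f q k label e = All.applyUpTo⁺₁ _ k λ {t} t<k → subst₂ (Edge G) (sym (label t (<⇒≤ t<k))) (sym (label (suc t) t<k)) (e t t<k)

  edges-present : ∀ {x y} → T (anyMatch edges x y) → Edge G (φ x) (φ y)
  edges-present = anyMatch-sound {λ x y → Edge G (φ x) (φ y)} (edge-sym G)
    (All.++⁺ (strand-edges labelX (at 𝟎) b φ-labelX λ t t< → link 𝟎 t (subst (t <_) (sym len𝟎) t<))
    (All.++⁺ (strand-edges labelY (at 𝟏) b φ-labelY λ t t< → link 𝟏 t (subst (t <_) (sym len𝟏) t<))
    (All.++⁺ (strand-edges labelZ (at 𝟐) a φ-labelZ λ t t< → link 𝟐 t (subst (t <_) (sym len𝟐) t<))
             (strand-edges labelE p a φ-labelE λ t t< → links t (s≤s⁻¹ (subst (suc t ≤_) (sym m≡) t<))))))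

module _ {n} {G : Graph n} (conn : Connected G) {g} (girth : ∀ k → HasCycle G k → g ≤ k) (4≤g : 4 ≤ g)
  {c} (C : Periodic G g c) {u v r} (poles : Metric.Poles G conn u v r) where

  table-impossible : ∀ N linked D (φ : ℕ → Fin n) → (∀ {x y} → x < N → y < N → φ x ≡ φ y → x ≡ y) →
                     (∀ v → ∃ λ x → x < N × φ x ≡ v) → (∀ {x y} → T (linked x y) → Edge G (φ x) (φ y)) → ¬ T (passes g N linked D)
  table-impossible N linked D φ φ-inj φ-surj present t = S.not-ASC-sound conn (S.dist≡D (S.saturated⇒complete girth (proj₁ t₂)) conn) poles
      (Leaves.far-from G conn girth 4≤g C poles) (proj₂ t₂)
    where
    t₁ : T (Checks.is-distance N linked D) × T (Checks.saturated N linked D g ∧ Checks.not-ASC N linked D)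
    t₁ = ∧-split {Checks.is-distance N linked D} t
    t₂ : T (Checks.saturated N linked D g) × T (Checks.not-ASC N linked D)
    t₂ = ∧-split {Checks.saturated N linked D g} (proj₂ t₁)
    module S = Sound G N linked D φ φ-inj φ-surj (λ _ _ → present) (proj₁ t₁)

  tabulated-impossible : ∀ N linked (φ : ℕ → Fin n) → (∀ {x y} → x < N → y < N → φ x ≡ φ y → x ≡ y) →
                         (∀ v → ∃ λ x → x < N × φ x ≡ v) → (∀ {x y} → T (linked x y) → Edge G (φ x) (φ y)) → ¬ T (tabulated g N linked)
  tabulated-impossible N linked = table-impossible N linked (entry (Distances.table N linked))

  K₄-check-impossible : (K : K₄ {G = G} g) → ¬ T (checkK₄ g (K₄.a K) (K₄.b K) (K₄.i K) (K₄.j K))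
  K₄-check-impossible K = tabulated-impossible N (anyMatch (Labels.edges a b i j)) φ
      (λ {x} {y} x< y< → φ-injective (subst (x <_) N≡n x<) (subst (y <_) N≡n y<))
      (λ v → let x , x< , eq = φ-onto v in x , subst (x <_) (sym N≡n) x< , eq) edges-present
    where
    open K₄ K using (a; b; i; j; order)
    open LabelledK₄ K
    N : ℕ
    N = (g + g) ∸ 2
    N≡n : N ≡ n
    N≡n = cong (_∸ 2) ((linear 2 (λ n g → (n :+ con 2 :≡ 2 :* g) ∷ [] ⊢ g :+ g :≡ con 2 :+ n) ((2 ∷ 0 ∷ 2 ∷ []) , (1 ∷ 1 ∷ 0 ∷ []))) n g order)

  K₄-impossible : Passed g → ¬ K₄ {G = G} g
  K₄-impossible checked K = K₄-check-impossible K (subst₂ (λ a j → T (checkK₄ g a b i j)) a≡ j≡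
      (∨-implies {admissible (g ∸ b) b i (b ∸ i)} {checkK₄ g (g ∸ b) b i (b ∸ i)} at-bi
        (subst₂ (λ a j → T (admissible a b i j)) (sym a≡) (sym j≡) conditions)))
    where
    open K₄ K
    a≡ : g ∸ b ≡ a
    a≡ = trans (cong (_∸ b) (trans (sym a+b) (+-comm a b))) (m+n∸m≡n b a)
    j≡ : b ∸ i ≡ j
    j≡ = trans (cong (_∸ i) (sym i+j)) (m+n∸m≡n i j)
    b<g : b < g
    b<g = subst (b <_) a+b ((linear 3 (λ a b q → (con 1 :+ q :≡ a) ∷ [] ⊢ b :< a :+ b) ((1 ∷ 1 ∷ 0 ∷ []) , [])) a b m m≡)
    at-bi : T (caseK₄ g b i)
    at-bi = passed⇒case g b i checked b<g (subst (i ≤_) i+j (m≤m+n i j))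
    conditions : T (admissible a b i j)
    conditions = Equivalence.from T-∧ (≤⇒≤ᵇ a≤b , Equivalence.from (T-∧ {b ≤ᵇ a + 2 * i}) (≤⇒≤ᵇ i-big , ≤⇒≤ᵇ j-big))

-- Strands with one pendant edge

Unique-⊆⇒length≤ : ∀ {A : Set} {xs ys : List A} → Unique xs → (∀ {z} → z ∈ xs → z ∈ ys) → length xs ≤ length ys
Unique-⊆⇒length≤ {xs = xs} {ys} u sub = injective⇒≤ {f = f} λ {i} {j} eq → lookup-injective u i j
    (trans (Any.lookup-index (sub (∈-lookup i))) (trans (cong (List.lookup ys) eq) (sym (Any.lookup-index (sub (∈-lookup j))))))
  where
  f : Fin (length xs) → Fin (length ys)
  f i = Any.index (sub (∈-lookup {xs = xs} i))

-- For ν = 2 this is a cycle and for ν = 3 a theta graph, with a pendant edge at `P`. The extremal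
-- examples and the uniqueness statement share this description.
record Pendant {n} (G : Graph n) (ν : ℕ) : Set where
  field
    strands : Strands G ν
  open Strands strands public
  field
    exact′ : Exact
    w      : Fin n
    leaf   : ¬ Inner G w
    inner  : ∀ x → x ≢ w → Inner G x
    w-P    : Edge G w P
  open Exact exact′ public

  view : ∀ x → x ≡ w ⊎ On x
  view x with x Fin.≟ w
  ... | yes x≡w = inj₁ x≡w
  ... | no x≢w  = inj₂ (cover (inner x x≢w))

  w≢on : ∀ {x} → On x → x ≢ w
  w≢on (σ , i , i≤ , refl) eq = leaf (subst (Inner G) eq (on-inner σ i i≤))

  walk-P : ∀ σ i → i ≤ len σ → Walk G P (at σ i) i
  walk-P σ i i≤ = toWalk (rwalk-map along⇒edge (AlongWalks.walk-from-P strands σ i i≤))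

  to-P : ∀ x → ∃ (Walk G x P)
  to-P x with view x
  ... | inj₁ refl = 1 , cons w-P nil
  ... | inj₂ (σ , i , i≤ , refl) = i , walk-reverse (walk-P σ i i≤)

  connected : Connected G
  connected x y = let j , p = to-P x ; k , q = to-P y in j + k , walk-++ p (walk-reverse q)

module PendantGirth {n} (G : Graph n) {ν} (𝒫 : Pendant G ν) {m} (2≤m : 2 ≤ m) (m≤len : ∀ σ → m ≤ Strands.len (Pendant.strands 𝒫) σ) where

  open Pendant 𝒫

  -- A cycle through an interior vertex of a strand contains the whole strand, hence P and
  -- then a second strand.
  module _ {k c} (3≤k : 3 ≤ k) (C : Periodic G k c) where

    OnCycle : Fin n → Set
    OnCycle z = ∃ λ i → z ≡ c i

    inner-c : ∀ i → Inner G (c i)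
    inner-c i = _ , _ , periodic-neighbours G C 3≤k i

    both-neighbours : ∀ {z x y} → OnCycle z → (∀ {w} → Inner G w → Edge G z w → w ≡ x ⊎ w ≡ y) → OnCycle x × OnCycle y
    both-neighbours (i , refl) only with periodic-neighbours G C 3≤k i
    ... | ends≢ , fore , back with only (inner-c _) fore | only (inner-c _) back
    ...   | inj₁ p | inj₂ q = (_ , sym p) , (_ , sym q)
    ...   | inj₂ p | inj₁ q = (_ , sym q) , (_ , sym p)
    ...   | inj₁ p | inj₁ q = contradiction (trans p (sym q)) ends≢
    ...   | inj₂ p | inj₂ q = contradiction (trans p (sym q)) ends≢

    spread : ∀ σ t → suc t < len σ → OnCycle (at σ (suc t)) → OnCycle (at σ t) × OnCycle (at σ (suc (suc t)))
    spread σ t t< on = both-neighbours on λ iw e → interior-edge σ t t< iw e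

    down : ∀ σ t → t < len σ → OnCycle (at σ t) → OnCycle (at σ 0)
    down σ zero    t< on = on
    down σ (suc t) t< on = down σ t (<⇒≤ t<) (proj₁ (spread σ t t< on))

    up : ∀ σ → OnCycle (at σ 1) → ∀ t → t ≤ len σ → 0 < t → OnCycle (at σ t)
    up σ on (suc zero)    t≤ _ = on
    up σ on (suc (suc t)) t≤ _ = proj₂ (spread σ t t≤ (up σ on (suc t) (<⇒≤ t≤) z<s))

    P-on-cycle : OnCycle P
    P-on-cycle with cover (inner-c 0)
    ... | σ , i , i≤ , c≡ with i <? len σ
    ...   | yes i< = subst OnCycle (at-0 σ) (down σ i i< (0 , sym c≡))
    ...   | no i≮ with Q-edge (inner-c 1) (subst (λ z → Edge G z (c 1)) (trans c≡ (trans (cong (at σ) (≤-antisym i≤ (≮⇒≥ i≮))) (at-len σ))) (Periodic.link C 0))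
    ...     | τ , t , st , c₁≡ = subst OnCycle (at-0 τ) (down τ t (≤-reflexive st) (1 , sym c₁≡))

    whole : ∀ σ → OnCycle (at σ 1) → ∀ t → t ≤ len σ → OnCycle (at σ t)
    whole σ on zero    _  = subst OnCycle (sym (at-0 σ)) P-on-cycle
    whole σ on (suc t) t≤ = up σ on (suc t) t≤ z<s

    2m≤k : 2 * m ≤ k
    2m≤k with P-on-cycle
    ... | i , P≡ with periodic-neighbours G C 3≤k i
    ...   | ends≢ , fore , back with P-edge (inner-c _) (subst (λ z → Edge G z _) (sym P≡) fore) | P-edge (inner-c _) (subst (λ z → Edge G z _) (sym P≡) back)
    ...     | σ , p | τ , q = (linear 4 (λ m x y k → (m :≤ x) ∷ (m :≤ y) ∷ (x :+ y :≤ k) ∷ [] ⊢ 2 :* m :≤ k) ((1 ∷ 1 ∷ 1 ∷ 1 ∷ []) , [])) m (len σ) (len τ) k (m≤len σ) (m≤len τ)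
        (subst₂ _≤_ (trans (length-++ part₁) (cong₂ _+_ (length-applyUpTo (at σ) (len σ)) (length-applyUpTo (at τ ∘ suc) (len τ)))) (length-applyUpTo c k)
          (Unique-⊆⇒length≤ (Unique.++⁺
            (Unique-window (at σ) (len σ) λ i j i<j j< eq → <⇒≢ i<j (at-injective σ i j (<⇒≤ (≤-trans i<j (<⇒≤ j<))) (<⇒≤ j<) eq))
            (Unique-window (at τ ∘ suc) (len τ) λ i j i<j j< eq → <⇒≢ i<j (suc-injective (at-injective τ (suc i) (suc j) (≤-trans i<j (<⇒≤ j<)) j< eq)))
            λ { (z∈ , z∈′) → let s , s< , z≡ = ∈-applyUpTo⁻ (at σ) z∈ ; t , t< , z≡′ = ∈-applyUpTo⁻ (at τ ∘ suc) z∈′ in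
                case cross-distinct strands {σ} {τ} {s} {suc t} σ≢τ (<⇒≤ s<) t< (trans (sym z≡) z≡′) of λ { (inj₁ ()) ; (inj₂ (eq , _)) → <⇒≢ s< eq } })
          λ z∈ → on-list (case ∈-++⁻ part₁ z∈ of λ
            { (inj₁ z∈₁) → let s , s< , z≡ = ∈-applyUpTo⁻ (at σ) z∈₁ in subst OnCycle (sym z≡) (whole σ (_ , sym p) s (<⇒≤ s<))
            ; (inj₂ z∈₂) → let t , t< , z≡ = ∈-applyUpTo⁻ (at τ ∘ suc) z∈₂ in subst OnCycle (sym z≡) (whole τ (_ , sym q) (suc t) t<) })))
      where
      part₁ : List (Fin n)
      part₁ = applyUpTo (at σ) (len σ)
      σ≢τ : σ ≢ τ
      σ≢τ refl = ends≢ (trans p (sym q))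
      on-list : ∀ {z} → OnCycle z → z ∈ applyUpTo c k
      on-list (i , refl) = let j , j< , eq = reduce C (≤-trans z<s 3≤k) i in subst (_∈ applyUpTo c k) (sym eq) (∈-applyUpTo⁺ c j<)

  girth≥ : ∀ k → HasCycle G k → 2 * m ≤ k
  girth≥ k cyc = let c , C = cycle⇒periodic G cyc in 2m≤k (proj₁ cyc) C

  -- The first edge of `σ` is closed up by `τ` and the rest of `σ` in reverse, so some cycle has
  -- length at most 2m; `girth≥` makes this an equality.
  is-girth : ∀ σ τ → σ ≢ τ → len σ ≡ m → len τ ≡ m → IsGirth G (2 * m)
  is-girth σ τ σ≢τ lenσ lenτ = subst (HasCycle G) (≤-antisym k≤2m (girth≥ k cyc)) cyc , girth≥
    where
    1<σ : 1 < len σ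
    1<σ = subst (1 <_) (sym lenσ) 2≤m
    R : Fin n → Fin n → Set
    R a b = Edge G a b × ¬ (a ≡ at σ 0 × b ≡ at σ 1)
    forth : RWalk R (at σ 0) (at σ (len σ)) (len τ)
    forth = subst₂ (λ x y → RWalk R x y (len τ)) (trans (at-0 τ) (sym (at-0 σ))) (trans (at-len τ) (sym (at-len σ)))
      (rwalk-along (at τ) 0 (len τ) λ t _ t< → link τ t t< , λ (_ , eq) →
        σ≢τ (proj₁ (inj σ τ 1 (suc t) z<s 1<σ t< (sym eq))))
    back : RWalk R (at σ (len σ)) (at σ 1) (len σ ∸ 1)
    back = rwalk-reverse {R = λ a b → Edge G a b × b ≢ at σ 0} (λ (e , b≢) → edge-sym G e , λ (eq , _) → b≢ eq)
      (subst (λ l → RWalk _ (at σ 1) (at σ l) (len σ ∸ 1)) 1+ (rwalk-along (at σ) 1 (len σ ∸ 1) λ t 1≤t t< →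
        let t<σ = subst (t <_) 1+ t< in link σ t t<σ , λ eq → contradiction (at-injective σ (suc t) 0 t<σ z≤n eq) λ ()))
      where
      1+ : 1 + (len σ ∸ 1) ≡ len σ
      1+ = m+[n∸m]≡n (<⇒≤ 1<σ)
    found : ∃ λ k → k ≤ suc (len τ + (len σ ∸ 1)) × HasCycle G k
    found = edge+walk⇒cycle G (link σ 0 (<⇒≤ 1<σ)) (rwalk-++ forth back)
    k = proj₁ found
    cyc = proj₂ (proj₂ found)
    k≤2m : k ≤ 2 * m
    k≤2m = (linear 5 (λ k x y z m → (k :≤ con 1 :+ (y :+ z)) ∷ (con 1 :+ z :≡ x) ∷ (x :≡ m) ∷ (y :≡ m) ∷ [] ⊢ k :≤ 2 :* m) ((1 ∷ 1 ∷ 1 ∷ 0 ∷ 1 ∷ 0 ∷ 1 ∷ 0 ∷ []) , [])) k (len σ) (len τ) (len σ ∸ 1) m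
      (proj₁ (proj₂ found)) (m+[n∸m]≡n (<⇒≤ 1<σ)) lenσ lenτ

module PendantASC {n} (G : Graph n) {ν} (𝒫 : Pendant G ν) (κ ο : Fin ν) (ο≢κ : ο ≢ κ) {m s}
  (len-κ : Strands.len (Pendant.strands 𝒫) κ ≡ m + 2 * s)
  (len-other : ∀ σ → σ ≢ κ → Strands.len (Pendant.strands 𝒫) σ ≡ m) where

  open Pendant 𝒫
  open StrandMetric G connected strands using (dist; dist-sym; dist-refl; dist-triangle; dist-P≤; dist-Q≤; dist-PQ≤; dist-half; dist-same-half;
    rest; leaf-dist; Poles; segment; dist-PQ≥; dist-P≥; dist-Q≥; dist-cross≥; Poles⇒AlmostSelfCentered)

  r : ℕ
  r = m + s

  -- The antipode of `P` on the cycle of length 2r that `κ` forms with any other strand; it is `Q`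
  -- when s = 0.
  v : Fin n
  v = at κ r

  m≤len : ∀ σ → m ≤ len σ
  m≤len σ with σ Fin.≟ κ
  ... | yes refl = subst (m ≤_) (sym len-κ) (m≤m+n m (2 * s))
  ... | no σ≢κ   = ≤-reflexive (sym (len-other σ σ≢κ))

  m≤PQ : m ≤ dist P Q
  m≤PQ = dist-PQ≥ exact′ m m≤len

  r≤κ : r ≤ len κ
  r≤κ = (linear 3 (λ m s x → (x :≡ m :+ 2 :* s) ∷ [] ⊢ m :+ s :≤ x) ((1 ∷ 0 ∷ 1 ∷ []) , [])) m s (len κ) len-κ

  to-w : ∀ {y} → On y → dist y w ≡ suc (dist y P)
  to-w on = leaf-dist _ leaf w-P (w≢on on)

  dist-Pv : dist P v ≡ r
  dist-Pv = ≤-antisym (dist-P≤ κ r r≤κ)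
    (dist-P≥ exact′ m≤PQ κ r s r ((linear 3 (λ m s x → (x :≡ m :+ 2 :* s) ∷ [] ⊢ m :+ s :+ s :≡ x) ((1 ∷ 0 ∷ 1 ∷ []) , (1 ∷ 1 ∷ 0 ∷ []))) m s (len κ) len-κ) ≤-refl ≤-refl)

  sum≤ : ∀ σ τ → σ ≢ τ → len σ + len τ ≤ 2 * r
  sum≤ σ τ σ≢τ with σ Fin.≟ κ | τ Fin.≟ κ
  ... | yes refl | yes refl = contradiction refl σ≢τ
  ... | yes refl | no τ≢κ = (linear 4 (λ m s x y → (x :≡ m :+ 2 :* s) ∷ (y :≡ m) ∷ [] ⊢ x :+ y :≤ 2 :* (m :+ s)) ((1 ∷ 1 ∷ 0 ∷ 1 ∷ 0 ∷ []) , [])) m s (len σ) (len τ) len-κ (len-other τ τ≢κ)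
  ... | no σ≢κ | yes refl = (linear 4 (λ m s x y → (x :≡ m :+ 2 :* s) ∷ (y :≡ m) ∷ [] ⊢ y :+ x :≤ 2 :* (m :+ s)) ((1 ∷ 1 ∷ 0 ∷ 1 ∷ 0 ∷ []) , [])) m s (len τ) (len σ) len-κ (len-other σ σ≢κ)
  ... | no σ≢κ | no τ≢κ = (linear 4 (λ m s x y → (x :≡ m) ∷ (y :≡ m) ∷ [] ⊢ x :+ y :≤ 2 :* (m :+ s)) ((1 ∷ 1 ∷ 0 ∷ 1 ∷ 0 ∷ []) , [])) m s (len σ) (len τ) (len-other σ σ≢κ) (len-other τ τ≢κ)

  inner-near : ∀ {x y} → On x → On y → dist x y ≤ r
  inner-near (σ , i , i≤ , refl) (τ , j , j≤ , refl) = (linear 2 (λ d r → (2 :* d :≤ 2 :* r) ∷ [] ⊢ d :≤ r) ((2 ∷ 1 ∷ []) , [])) _ r bound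
    where
    bound : 2 * dist (at σ i) (at τ j) ≤ 2 * r
    bound with σ Fin.≟ τ
    ... | no σ≢τ = ≤-trans (dist-half {σ} {τ} i≤ j≤) (sum≤ σ τ σ≢τ)
    ... | yes refl with σ Fin.≟ κ
    ...   | yes refl = ≤-trans (dist-same-half σ ο i≤ j≤) (sum≤ σ ο (ο≢κ ∘ sym))
    ...   | no σ≢κ   = ≤-trans (dist-same-half σ σ i≤ j≤) ((linear 3 (λ m s x → (x :≡ m) ∷ [] ⊢ x :+ x :≤ 2 :* (m :+ s)) ((1 ∷ 2 ∷ 0 ∷ []) , [])) m s (len σ) (len-other σ σ≢κ))

  -- Beyond position r on `κ`, the route through `Q` along a strand of length m is shorter than r.
  -- On another strand position r is reached only for s = 0, at `Q`, which is then `v`.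
  near-P : ∀ {y} → On y → dist P y < r ⊎ y ≡ v
  near-P (σ , i , i≤ , refl) with i <? r
  ... | yes i<r = inj₁ (≤-<-trans (dist-P≤ σ i i≤) i<r)
  ... | no i≮r with σ Fin.≟ κ
  ...   | no σ≢κ = inj₂ (trans (cong (at σ) i≡len) (trans (at-len σ) (sym (trans (cong (at κ) r≡κ) (at-len κ)))))
    where
    i≡len : i ≡ len σ
    i≡len = (linear 4 (λ m s i x → (m :+ s :≤ i) ∷ (i :≤ x) ∷ (x :≡ m) ∷ [] ⊢ i :≡ x) ((1 ∷ 0 ∷ 1 ∷ 0 ∷ 0 ∷ []) , (1 ∷ 1 ∷ 0 ∷ 1 ∷ 0 ∷ []))) m s i (len σ) (≮⇒≥ i≮r) i≤ (len-other σ σ≢κ)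
    r≡κ : r ≡ len κ
    r≡κ = (linear 5 (λ m s i x y → (m :+ s :≤ i) ∷ (i :≤ x) ∷ (x :≡ m) ∷ (y :≡ m :+ 2 :* s) ∷ [] ⊢ m :+ s :≡ y) ((1 ∷ 0 ∷ 0 ∷ 0 ∷ 0 ∷ 0 ∷ 1 ∷ []) , (1 ∷ 1 ∷ 1 ∷ 1 ∷ 0 ∷ 1 ∷ 0 ∷ []))) m s i (len σ) (len κ) (≮⇒≥ i≮r) i≤ (len-other σ σ≢κ) len-κ
  ...   | yes refl with i ≤? r
  ...     | yes i≤r = inj₂ (cong (at κ) (≤-antisym i≤r (≮⇒≥ i≮r)))
  ...     | no i≰r = let j , i+j = rest i≤ in inj₁ ((linear 9 (λ m s i j x y d e f → (d :≤ e :+ f) ∷ (e :≤ y) ∷ (f :≤ j) ∷ (i :+ j :≡ x) ∷ (x :≡ m :+ 2 :* s) ∷ (y :≡ m) ∷ (m :+ s :< i) ∷ [] ⊢ d :< m :+ s) ((1 ∷ 1 ∷ 1 ∷ 1 ∷ 1 ∷ 0 ∷ 1 ∷ 0 ∷ 1 ∷ 0 ∷ 1 ∷ []) , []))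
      m s i j (len σ) (len ο) _ _ _ (dist-triangle P Q _) (dist-PQ≤ ο) (dist-Q≤ σ i j i+j) i+j len-κ (len-other ο ο≢κ) (≰⇒> i≰r))

  -- If j is what remains of `κ` after position i + r, then i + j = s, so the way around through `P`
  -- and `Q` has length at least i + m + j = r as well.
  same-strand-far : ∀ i → i ≤ s → r ≤ dist (at κ i) (at κ (i + r))
  same-strand-far i i≤s =
    let i′ , i+ = rest ((linear 4 (λ m s i x → (i :≤ s) ∷ (x :≡ m :+ 2 :* s) ∷ [] ⊢ i :≤ x) ((2 ∷ 2 ∷ 0 ∷ 1 ∷ []) , [])) m s i (len κ) i≤s len-κ)
        j , r+j = rest ((linear 5 (λ m s i k x → (i :≤ s) ∷ (i :+ k :≡ x) ∷ (x :≡ m :+ 2 :* s) ∷ [] ⊢ m :+ s :≤ k) ((1 ∷ 1 ∷ 0 ∷ 1 ∷ 0 ∷ 1 ∷ []) , [])) m s i i′ (len κ) i≤s i+ len-κ) in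
    segment exact′ κ i i′ (on-inner κ i (subst (i ≤_) i+ (m≤m+n i i′))) (≤-reflexive i+)
      (λ t i<t t< eq → <⇒≢ i<t (at-injective κ i t (subst (i ≤_) i+ (m≤m+n i i′)) (<⇒≤ (subst (t <_) i+ t<)) eq))
      r r j r+j (subst (λ d → r ≤ d + r) (sym (dist-refl _)) ≤-refl)
      (subst (λ z → r ≤ dist (at κ i) z + j) (sym (trans (cong (at κ) i+) (at-len κ)))
        ((linear 7 (λ m s i k j x d → (m :+ i :≤ d) ∷ (m :+ s :+ j :≡ k) ∷ (i :+ k :≡ x) ∷ (x :≡ m :+ 2 :* s) ∷ [] ⊢ m :+ s :≤ d :+ j) ((1 ∷ 1 ∷ 0 ∷ 1 ∷ 0 ∷ 1 ∷ 0 ∷ 1 ∷ []) , [])) m s i i′ j (len κ) _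
          (subst (m + i ≤_) (dist-sym Q (at κ i)) (dist-Q≥ exact′ m≤PQ κ i i′ (m + i) i+
            ((linear 5 (λ m s i k x → (i :≤ s) ∷ (i :+ k :≡ x) ∷ (x :≡ m :+ 2 :* s) ∷ [] ⊢ m :+ i :≤ k) ((1 ∷ 2 ∷ 0 ∷ 1 ∷ 0 ∷ 1 ∷ []) , [])) m s i i′ (len κ) i≤s i+ len-κ) ≤-refl)) r+j i+ len-κ))

  -- Each vertex lies on a cycle of length 2r formed by `κ` and a strand of length m, and its
  -- antipode there is no closer in the whole graph. The cases locate this antipode: on `κ`, further
  -- along or further back, or on the other strand.
  on-far : ∀ {x} → On x → ∃ λ y → r ≤ dist x y
  on-far (σ , i , i≤ , refl) with σ Fin.≟ κ
  ... | no σ≢κ = let i′ , i+ = rest i≤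
                     j , i+j = rest ((linear 4 (λ m s i x → (i :≤ x) ∷ (x :≡ m) ∷ [] ⊢ i :≤ m :+ s) ((1 ∷ 1 ∷ 1 ∷ 0 ∷ []) , [])) m s i (len σ) i≤ (len-other σ σ≢κ))
                     j′ , j+ = rest ((linear 5 (λ m s i j x → (i :+ j :≡ m :+ s) ∷ (x :≡ m :+ 2 :* s) ∷ [] ⊢ j :≤ x) ((1 ∷ 1 ∷ 0 ∷ 0 ∷ 1 ∷ []) , [])) m s i j (len κ) i+j len-κ) in
    at κ j , dist-cross≥ exact′ m≤PQ σ κ σ≢κ i i′ j j′ r i+ j+ (≤-reflexive (sym i+j))
      ((linear 8 (λ m s i k j l x y → (i :+ k :≡ x) ∷ (j :+ l :≡ y) ∷ (i :+ j :≡ m :+ s) ∷ (x :≡ m) ∷ (y :≡ m :+ 2 :* s) ∷ [] ⊢ m :+ s :≤ k :+ l) ((1 ∷ 0 ∷ 1 ∷ 0 ∷ 1 ∷ 1 ∷ 0 ∷ 0 ∷ 1 ∷ 0 ∷ 1 ∷ []) , [])) m s i i′ j j′ (len σ) (len κ) i+ j+ i+j (len-other σ σ≢κ) len-κ)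
      ((linear 6 (λ m s i k j x → (i :+ k :≡ x) ∷ (i :+ j :≡ m :+ s) ∷ (x :≡ m) ∷ [] ⊢ m :+ s :≤ m :+ k :+ j) ((1 ∷ 1 ∷ 0 ∷ 0 ∷ 1 ∷ 1 ∷ 0 ∷ []) , [])) m s i i′ j (len σ) i+ i+j (len-other σ σ≢κ))
      ((linear 6 (λ m s i j l y → (j :+ l :≡ y) ∷ (i :+ j :≡ m :+ s) ∷ (y :≡ m :+ 2 :* s) ∷ [] ⊢ m :+ s :≤ m :+ i :+ l) ((2 ∷ 0 ∷ 2 ∷ 2 ∷ 0 ∷ 0 ∷ 2 ∷ []) , [])) m s i j j′ (len κ) j+ i+j len-κ)
  ... | yes refl with s ≤? i | i ≤? r
  ...   | no s≰i | _ = at σ (i + r) , same-strand-far i (<⇒≤ (≰⇒> s≰i))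
  ...   | yes s≤i | no i≰r = let j , r+j = rest (<⇒≤ (≰⇒> i≰r)) in
    at σ j , subst (r ≤_) (dist-sym _ _) (subst (λ t → r ≤ dist (at σ j) (at σ t)) (trans (+-comm j r) r+j)
      (same-strand-far j ((linear 5 (λ m s i j x → (m :+ s :+ j :≡ i) ∷ (i :≤ x) ∷ (x :≡ m :+ 2 :* s) ∷ [] ⊢ j :≤ s) ((1 ∷ 1 ∷ 0 ∷ 1 ∷ 1 ∷ 0 ∷ []) , [])) m s i j (len σ) r+j i≤ len-κ)))
  ...   | yes s≤i | yes i≤r = let i′ , i+ = rest i≤
                                  j , i+j = rest i≤r
                                  j′ , j+ = rest ((linear 5 (λ m s i j x → (i :+ j :≡ m :+ s) ∷ (s :≤ i) ∷ (x :≡ m) ∷ [] ⊢ j :≤ x) ((1 ∷ 1 ∷ 0 ∷ 1 ∷ 0 ∷ 1 ∷ []) , [])) m s i j (len ο) i+j s≤i (len-other ο ο≢κ)) in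
    at ο j , dist-cross≥ exact′ m≤PQ σ ο (ο≢κ ∘ sym) i i′ j j′ r i+ j+ (≤-reflexive (sym i+j))
      ((linear 8 (λ m s i k j l x y → (i :+ k :≡ x) ∷ (j :+ l :≡ y) ∷ (i :+ j :≡ m :+ s) ∷ (y :≡ m) ∷ (x :≡ m :+ 2 :* s) ∷ [] ⊢ m :+ s :≤ k :+ l) ((1 ∷ 0 ∷ 1 ∷ 0 ∷ 1 ∷ 1 ∷ 0 ∷ 0 ∷ 1 ∷ 0 ∷ 1 ∷ []) , [])) m s i i′ j j′ (len σ) (len ο) i+ j+ i+j (len-other ο ο≢κ) len-κ)
      ((linear 6 (λ m s i k j x → (i :+ k :≡ x) ∷ (i :+ j :≡ m :+ s) ∷ (x :≡ m :+ 2 :* s) ∷ [] ⊢ m :+ s :≤ m :+ k :+ j) ((1 ∷ 0 ∷ 1 ∷ 1 ∷ 0 ∷ 0 ∷ 1 ∷ []) , [])) m s i i′ j (len σ) i+ i+j len-κ)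
      ((linear 4 (λ m s i l → (s :≤ i) ∷ [] ⊢ m :+ s :≤ m :+ i :+ l) ((1 ∷ 1 ∷ []) , [])) m s i j′ s≤i)

  pendant-poles : Poles w v r
  pendant-poles = record
    { apart = trans (dist-sym w v) (trans (to-w (κ , r , r≤κ , refl)) (cong suc (trans (dist-sym v P) dist-Pv)))
    ; near = near ; far = λ x x≢w _ → on-far (cover (inner x x≢w)) }
    where
    from-w : ∀ {y} → On y → dist y w ≤ r ⊎ y ≡ v
    from-w on with near-P on
    ... | inj₁ lt  = inj₁ (subst (_≤ r) (sym (trans (to-w on) (cong suc (dist-sym _ P)))) lt)
    ... | inj₂ y≡v = inj₂ y≡v
    near : ∀ x y → dist x y ≤ r ⊎ (x ≡ w × y ≡ v) ⊎ (x ≡ v × y ≡ w)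
    near x y with view x | view y
    ... | inj₁ refl | inj₁ refl = inj₁ (subst (_≤ r) (sym (dist-refl x)) z≤n)
    ... | inj₂ onx  | inj₂ ony  = inj₁ (inner-near onx ony)
    ... | inj₂ onx  | inj₁ refl = case from-w onx of λ { (inj₁ le) → inj₁ le ; (inj₂ eq) → inj₂ (inj₂ (eq , refl)) }
    ... | inj₁ refl | inj₂ ony  = case from-w ony of λ
      { (inj₁ le) → inj₁ (subst (_≤ r) (dist-sym y x) le) ; (inj₂ eq) → inj₂ (inj₁ (refl , eq)) }

  almost-self-centered : 3 ≤ n → AlmostSelfCentered G
  almost-self-centered n≥3 = Poles⇒AlmostSelfCentered n≥3 pendant-poles

module PendantIso {n} {G H : Graph n} {ν} (𝒢 : Pendant G ν) (ℋ : Pendant H ν)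
  (same-len : ∀ σ → Strands.len (Pendant.strands 𝒢) σ ≡ Strands.len (Pendant.strands ℋ) σ) where

  private
    module A = Pendant 𝒢
    module B = Pendant ℋ

  -- Only the ends have several positions, one on each strand, and they correspond to the ends on
  -- the other side. This makes the positionwise map well defined.
  transfer : ∀ σ i τ j → i ≤ A.len σ → j ≤ A.len τ → A.at σ i ≡ A.at τ j → B.at σ i ≡ B.at τ j
  transfer σ i τ j i≤ j≤ eq with σ Fin.≟ τ
  ... | yes refl = cong (B.at σ) (A.at-injective σ i j i≤ j≤ eq)
  ... | no σ≢τ with cross-distinct A.strands σ≢τ i≤ j≤ eq
  ...   | inj₁ (refl , refl) = trans (B.at-0 σ) (sym (B.at-0 τ))
  ...   | inj₂ (refl , refl) = trans (trans (cong (B.at σ) (same-len σ)) (B.at-len σ))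
                                     (sym (trans (cong (B.at τ) (same-len τ)) (B.at-len τ)))

  abstract
    to : Fin n → Fin n
    to x with A.view x
    ... | inj₁ _ = B.w
    ... | inj₂ (σ , i , _) = B.at σ i

    to-w : to A.w ≡ B.w
    to-w with A.view A.w
    ... | inj₁ _ = refl
    ... | inj₂ on = contradiction refl (A.w≢on on)

    to-at : ∀ σ i → i ≤ A.len σ → to (A.at σ i) ≡ B.at σ i
    to-at σ i i≤ with A.view (A.at σ i)
    ... | inj₁ eq = contradiction eq (A.w≢on (σ , i , i≤ , refl))
    ... | inj₂ (τ , j , j≤ , eq) = sym (transfer σ i τ j i≤ j≤ eq)

    to-P : to A.P ≡ B.P
    to-P with A.view A.P
    ... | inj₁ eq = contradiction A.innerP λ iP → A.leaf (subst (Inner G) eq iP)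
    ... | inj₂ (τ , j , j≤ , eq) with A.at-injective τ 0 j z≤n j≤ (trans (A.at-0 τ) eq)
    ...   | refl = B.at-0 τ

  preserves : ∀ {x y} → Edge G x y → Edge H (to x) (to y)
  preserves {x} {y} e with x Fin.≟ A.w | y Fin.≟ A.w
  ... | yes refl | _ with leaf-unique G A.leaf e A.w-P
  ...   | refl = subst₂ (Edge H) (sym to-w) (sym to-P) B.w-P
  preserves {x} {y} e | no _ | yes refl with leaf-unique G A.leaf (edge-sym G e) A.w-P
  ...   | refl = subst₂ (Edge H) (sym to-P) (sym to-w) (edge-sym H B.w-P)
  preserves {x} {y} e | no x≢w | no y≢w with A.exact (A.inner x x≢w) (A.inner y y≢w) e
  ...   | σ , t , t< , inj₁ (refl , refl) = subst₂ (Edge H) (sym (to-at σ t (<⇒≤ t<))) (sym (to-at σ (suc t) t<))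
            (B.link σ t (subst (t <_) (same-len σ) t<))
  ...   | σ , t , t< , inj₂ (refl , refl) = subst₂ (Edge H) (sym (to-at σ (suc t) t<)) (sym (to-at σ t (<⇒≤ t<)))
            (edge-sym H (B.link σ t (subst (t <_) (same-len σ) t<)))

pendant-isomorphic : ∀ {n} {G H : Graph n} {ν} (𝒢 : Pendant G ν) (ℋ : Pendant H ν) →
                     (∀ σ → Strands.len (Pendant.strands 𝒢) σ ≡ Strands.len (Pendant.strands ℋ) σ) → Isomorphic G H
pendant-isomorphic {n} {G} {H} 𝒢 ℋ same-len = mk↔ₛ′ F.to B.to (inverse ℋ 𝒢 (sym ∘ same-len) same-len) (inverse 𝒢 ℋ same-len (sym ∘ same-len)) , adj-eq
  where
  module F = PendantIso 𝒢 ℋ same-len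
  module B = PendantIso ℋ 𝒢 (sym ∘ same-len)

  inverse : ∀ {G H : Graph n} {ν} (𝒢 : Pendant G ν) (ℋ : Pendant H ν) s s′ x → PendantIso.to ℋ 𝒢 s′ (PendantIso.to 𝒢 ℋ s x) ≡ x
  inverse 𝒢 ℋ s s′ x with Pendant.view 𝒢 x
  ... | inj₁ refl = trans (cong (PendantIso.to ℋ 𝒢 s′) (PendantIso.to-w 𝒢 ℋ s)) (PendantIso.to-w ℋ 𝒢 s′)
  ... | inj₂ (σ , i , i≤ , refl) = trans (cong (PendantIso.to ℋ 𝒢 s′) (PendantIso.to-at 𝒢 ℋ s σ i i≤))
    (PendantIso.to-at ℋ 𝒢 s′ σ i (subst (i ≤_) (s σ) i≤))

  adj-eq : ∀ u v → adj G u v ≡ adj H (F.to u) (F.to v)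
  adj-eq u v with adj G u v in g | adj H (F.to u) (F.to v) in h
  ... | true  | true  = refl
  ... | false | false = refl
  ... | true  | false = trans (sym (F.preserves g)) h
  ... | false | true  = trans (sym g) (subst₂ (Edge G) (inverse 𝒢 ℋ same-len (sym ∘ same-len) u) (inverse 𝒢 ℋ same-len (sym ∘ same-len) v) (B.preserves h))

-- Explicit graphs

path : ℕ → ℕ → List ℕ
path start l = 0 ∷ (List.map (λ t → start + t) (List.upTo l) ++ 1 ∷ [])

label : ℕ → ℕ → ℕ → ℕ
label start l zero    = 0
label start l (suc t) = if t <ᵇ l then start + t else 1

applyUpTo-cong : ∀ {A : Set} (f g : ℕ → A) k → (∀ t → t < k → f t ≡ g t) → applyUpTo f k ≡ applyUpTo g k
applyUpTo-cong f g zero    eq = refl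
applyUpTo-cong f g (suc k) eq = cong₂ _∷_ (eq 0 z<s) (applyUpTo-cong (f ∘ suc) (g ∘ suc) k λ t t< → eq (suc t) (s<s t<))

pathEdges-applyUpTo : ∀ f k → pathEdges (applyUpTo f (suc k)) ≡ strandEdges f k
pathEdges-applyUpTo f zero    = refl
pathEdges-applyUpTo f (suc k) = cong (_ ∷_) (pathEdges-applyUpTo (f ∘ suc) k)

label-interior : ∀ start l {t} → t < l → label start l (suc t) ≡ start + t
label-interior start l t<l = if-< _ _ t<l

label-end : ∀ start l → label start l (suc l) ≡ 1
label-end start l = if-≮ (start + l) 1 (<-irrefl (refl {x = l}))

pathEdges-path : ∀ start l → pathEdges (path start l) ≡ strandEdges (label start l) (suc l)
pathEdges-path start l = trans (cong (λ xs → pathEdges (0 ∷ xs)) (trans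
    (cong₂ (λ xs x → xs ++ x ∷ []) (trans (map-upTo (start +_) l) (applyUpTo-cong _ _ l λ t t<l → sym (label-interior start l t<l))) (sym (label-end start l)))
    (applyUpTo-∷ʳ (label start l ∘ suc) l)))
  (pathEdges-applyUpTo (label start l) (suc l))

matches-complete : ∀ x y → T (matches (x , y) x y)
matches-complete x y rewrite ≡ᵇ-refl x | ≡ᵇ-refl y = tt

anyMatch-complete : ∀ {es x y} → (x , y) ∈ es → T (anyMatch es x y)
anyMatch-complete {x = x} {y} (here refl) = Equivalence.from (T-∨ {matches (x , y) x y}) (inj₁ (matches-complete x y))
anyMatch-complete {e ∷ es} {x} {y} (there e∈) = Equivalence.from (T-∨ {matches e x y}) (inj₂ (anyMatch-complete e∈))

-- The labels 0 and 1 are the ends of the strands and `w` is the leaf. The interiors of the strands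
-- are disjoint blocks of consecutive labels that together fill 2, ..., w - 1.
module LabelGraph {ν} (start l : Fin ν → ℕ) (w : ℕ) (es : List (ℕ × ℕ)) (κ ο : Fin ν) (κ≢ο : κ ≢ ο)
  (l>0 : ∀ σ → 0 < l σ) (2≤start : ∀ σ → 2 ≤ start σ) (2≤w : 2 ≤ w)
  (block< : ∀ σ t → t < l σ → start σ + t < w)
  (disjoint : ∀ σ τ t t′ → t < l σ → t′ < l τ → start σ + t ≡ start τ + t′ → σ ≡ τ)
  (decode : ∀ x → 2 ≤ x → x < w → ∃₂ λ σ t → t < l σ × x ≡ start σ + t) where

  n : ℕ
  n = suc w

  G : Graph n
  G = fromEdges n es

  lab : Fin ν → ℕ → ℕ
  lab σ = label (start σ) (l σ)

  Step : ℕ → ℕ → Set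
  Step x y = (∃₂ λ σ t → t < suc (l σ) × (x ≡ lab σ t × y ≡ lab σ (suc t) ⊎ x ≡ lab σ (suc t) × y ≡ lab σ t))
           ⊎ (x ≡ 0 × y ≡ w) ⊎ (x ≡ w × y ≡ 0)

  step-sym : ∀ {x y} → Step x y → Step y x
  step-sym (inj₁ (σ , t , t< , inj₁ (p , q))) = inj₁ (σ , t , t< , inj₂ (q , p))
  step-sym (inj₁ (σ , t , t< , inj₂ (p , q))) = inj₁ (σ , t , t< , inj₁ (q , p))
  step-sym (inj₂ (inj₁ (p , q))) = inj₂ (inj₂ (q , p))
  step-sym (inj₂ (inj₂ (p , q))) = inj₂ (inj₁ (q , p))

  module _ (only : All (λ e → Step (proj₁ e) (proj₂ e)) es)
           (has : ∀ σ t → t < suc (l σ) → (lab σ t , lab σ (suc t)) ∈ es) (has-w : (0 , w) ∈ es) where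

    vertex : ℕ → Fin n
    vertex x = fromℕ< (m%n<n x n)

    toℕ-vertex : ∀ {x} → x < n → toℕ (vertex x) ≡ x
    toℕ-vertex {x} x< = trans (toℕ-fromℕ< (m%n<n x n)) (m<n⇒m%n≡m x<)

    vertex-toℕ : ∀ {u x} → toℕ u ≡ x → u ≡ vertex x
    vertex-toℕ {u} refl = toℕ-injective (sym (toℕ-vertex (toℕ<n u)))

    vertex-injective : ∀ {x y} → x < n → y < n → vertex x ≡ vertex y → x ≡ y
    vertex-injective x< y< eq = trans (sym (toℕ-vertex x<)) (trans (cong toℕ eq) (toℕ-vertex y<))

    edge-intro : ∀ {x y} → x < n → y < n → x ≢ y → (x , y) ∈ es → Edge G (vertex x) (vertex y)
    edge-intro {x} {y} x< y< x≢y e∈ rewrite toℕ-vertex x< | toℕ-vertex y< = Equivalence.to T-≡ (Equivalence.from T-∧ (differ , anyMatch-complete e∈))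
      where
      differ : T (not (x ≡ᵇ y))
      differ with x ≡ᵇ y in eq
      ... | true  = contradiction (≡ᵇ-T (subst T (sym eq) tt)) x≢y
      ... | false = tt

    edge-elim : ∀ {u v} → Edge G u v → Step (toℕ u) (toℕ v)
    edge-elim {u} {v} e = anyMatch-sound {Step} step-sym only (proj₂ (∧-split {not (toℕ u ≡ᵇ toℕ v)} (Equivalence.from T-≡ e)))

    data LabelView (σ : Fin ν) : ℕ → Set where
      at-start : LabelView σ 0
      inside   : ∀ t → t < l σ → lab σ (suc t) ≡ start σ + t → LabelView σ (suc t)
      at-end   : lab σ (suc (l σ)) ≡ 1 → LabelView σ (suc (l σ))

    label-view : ∀ σ t → t ≤ suc (l σ) → LabelView σ t
    label-view σ zero    _  = at-start
    label-view σ (suc t) t≤ with t <? l σ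
    ... | yes t< = inside t t< (label-interior (start σ) (l σ) t<)
    ... | no t≮ with ≤-antisym (s≤s⁻¹ t≤) (≮⇒≥ t≮)
    ...   | refl = at-end (label-end (start σ) (l σ))

    lab< : ∀ σ t → t ≤ suc (l σ) → lab σ t < w
    lab< σ t t≤ with label-view σ t t≤
    ... | at-start        = ≤-trans (s≤s z≤n) 2≤w
    ... | inside t′ t< eq = subst (_< w) (sym eq) (block< σ t′ t<)
    ... | at-end eq       = subst (_< w) (sym eq) 2≤w

    lab<n : ∀ σ t → t ≤ suc (l σ) → lab σ t < n
    lab<n σ t t≤ = ≤-trans (lab< σ t t≤) (n≤1+n w)

    lab-inj : ∀ σ τ i j → 0 < i → i < suc (l σ) → j ≤ suc (l τ) → lab σ i ≡ lab τ j → σ ≡ τ × i ≡ j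
    lab-inj σ τ (suc i) j _ i< j≤ eq with label-interior (start σ) (l σ) (s≤s⁻¹ i<) | label-view τ j j≤
    ... | p | at-start = ⊥-elim ((linear 2 (λ s i → (con 2 :≤ s) ∷ (s :+ i :≡ con 0) ∷ [] ⊢ absurd) ((1 ∷ 1 ∷ 0 ∷ []) , [])) (start σ) i (2≤start σ) (trans (sym p) eq))
    ... | p | at-end q = ⊥-elim ((linear 2 (λ s i → (con 2 :≤ s) ∷ (s :+ i :≡ con 1) ∷ [] ⊢ absurd) ((1 ∷ 1 ∷ 0 ∷ []) , [])) (start σ) i (2≤start σ) (trans (sym p) (trans eq q)))
    ... | p | inside t t< q with disjoint σ τ i t (s≤s⁻¹ i<) t< (trans (sym p) (trans eq q))
    ...   | refl = refl , cong suc (+-cancelˡ-≡ (start σ) i t (trans (sym p) (trans eq q)))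

    1<len : ∀ σ → 1 < suc (l σ)
    1<len σ = s≤s (l>0 σ)

    lab-consecutive : ∀ σ t → t < suc (l σ) → lab σ t ≢ lab σ (suc t)
    lab-consecutive σ zero    t< eq = contradiction (proj₂ (lab-inj σ σ 1 0 z<s (1<len σ) z≤n (sym eq))) λ ()
    lab-consecutive σ (suc t) t< eq = <⇒≢ ≤-refl (proj₂ (lab-inj σ σ (suc t) (suc (suc t)) z<s t< t< eq))

    label-strands : Strands G ν
    label-strands = record
      { P = vertex 0 ; Q = vertex 1
      ; P≢Q = λ eq → contradiction (vertex-injective z<s (≤-trans 2≤w (n≤1+n w)) eq) λ ()
      ; len = suc ∘ l ; at = λ σ → vertex ∘ lab σ
      ; len>0 = λ _ → z<s ; at-0 = λ _ → refl ; at-len = λ σ → cong vertex (label-end (start σ) (l σ))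
      ; link = λ σ t t< → edge-intro (lab<n σ t (<⇒≤ t<)) (lab<n σ (suc t) t<) (lab-consecutive σ t t<) (has σ t t<)
      ; inj = λ σ τ i j 0<i i< j≤ eq → lab-inj σ τ i j 0<i i< j≤ (vertex-injective (lab<n σ i (<⇒≤ i<)) (lab<n τ j j≤) eq) }

    open Strands label-strands

    leaf-w : ¬ Inner G (vertex w)
    leaf-w (a , b , a≢b , wa , wb) = a≢b (trans (only-0 wa) (sym (only-0 wb)))
      where
      only-0 : ∀ {a} → Edge G (vertex w) a → a ≡ vertex 0
      only-0 {a} e with edge-elim e
      ... | inj₁ (σ , t , t< , inj₁ (p , _)) = contradiction (lab< σ t (<⇒≤ t<)) (<-irrefl (trans (sym p) (toℕ-vertex ≤-refl)))
      ... | inj₁ (σ , t , t< , inj₂ (p , _)) = contradiction (lab< σ (suc t) t<) (<-irrefl (trans (sym p) (toℕ-vertex ≤-refl)))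
      ... | inj₂ (inj₂ (_ , q)) = vertex-toℕ q
      ... | inj₂ (inj₁ (p , _)) = contradiction (subst (2 ≤_) (trans (sym (toℕ-vertex ≤-refl)) p) 2≤w) λ ()

    locate : ∀ u → u ≢ vertex w → On u
    locate u u≢w with toℕ u in eq
    ... | zero = κ , 0 , z≤n , vertex-toℕ eq
    ... | suc zero = κ , suc (l κ) , ≤-refl , trans (vertex-toℕ eq) (sym (at-len κ))
    ... | suc (suc x) with decode (suc (suc x)) (s≤s (s≤s z≤n))
                          (≤∧≢⇒< (s≤s⁻¹ (subst (_< n) eq (toℕ<n u))) (λ x≡w → u≢w (vertex-toℕ (trans eq x≡w))))
    ...   | σ , t , t< , x≡ = σ , suc t , s≤s (<⇒≤ t<) , trans (vertex-toℕ eq) (cong vertex (trans x≡ (sym (label-interior (start σ) (l σ) t<))))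

    on⇒inner : ∀ {u} → On u → Inner G u
    on⇒inner (σ , zero , _ , refl) = at κ 1 , at ο 1 , (λ eq → κ≢ο (proj₁ (inj κ ο 1 1 z<s (1<len κ) (<⇒≤ (1<len ο)) eq)))
      , link κ 0 z<s , link ο 0 z<s
    on⇒inner (σ , suc i , i≤ , refl) with suc i <? suc (l σ)
    ... | yes i< = at σ i , at σ (suc (suc i)) , (λ eq → <⇒≢ (n≤1+n (suc i)) (at-injective σ i (suc (suc i)) (≤-trans (n≤1+n i) i≤) i< eq))
      , edge-sym G (link σ i i≤) , link σ (suc i) i<
    ... | no i≮ = subst (Inner G) (sym (trans (cong (at σ) (≤-antisym i≤ (≮⇒≥ i≮))) (at-len σ)))
      (at κ (l κ) , at ο (l ο) , (λ eq → κ≢ο (proj₁ (inj κ ο (l κ) (l ο) (l>0 κ) ≤-refl (n≤1+n (l ο)) eq))) , back κ , back ο)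
      where
      back : ∀ σ → Edge G Q (at σ (l σ))
      back σ = edge-sym G (subst (Edge G (at σ (l σ))) (at-len σ) (link σ (l σ) ≤-refl))

    pendant : Pendant G ν
    pendant = record
      { strands = label-strands ; w = vertex w ; leaf = leaf-w
      ; inner = λ x x≢w → on⇒inner (locate x x≢w)
      ; w-P = edge-sym G (edge-intro z<s ≤-refl (λ eq → contradiction (subst (2 ≤_) (sym eq) 2≤w) λ ()) has-w)
      ; exact′ = record
        { cover = λ {x} ix → locate x λ { refl → leaf-w ix }
        ; innerP = on⇒inner (P-on κ) ; innerQ = on⇒inner (Q-on κ)
        ; exact = exact } }
      where
      exact : ∀ {x y} → Inner G x → Inner G y → Edge G x y → Along x y
      exact ix iy e with edge-elim e
      ... | inj₁ (σ , t , t< , inj₁ (p , q)) = σ , t , t< , inj₁ (vertex-toℕ p , vertex-toℕ q)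
      ... | inj₁ (σ , t , t< , inj₂ (p , q)) = σ , t , t< , inj₂ (vertex-toℕ p , vertex-toℕ q)
      ... | inj₂ (inj₁ (_ , q)) = contradiction (subst (Inner G) (vertex-toℕ q) iy) leaf-w
      ... | inj₂ (inj₂ (p , _)) = contradiction (subst (Inner G) (vertex-toℕ p) ix) leaf-w

strandEdges-∈ : ∀ f {k t} → t < k → (f t , f (suc t)) ∈ strandEdges f k
strandEdges-∈ f = ∈-applyUpTo⁺ (λ t → f t , f (suc t))

PendantWith : ∀ {n} → Graph n → (ν : ℕ) → (Fin ν → ℕ) → Set
PendantWith G ν len = ∃ λ (𝒫 : Pendant G ν) → ∀ σ → Strands.len (Pendant.strands 𝒫) σ ≡ len σ

-- The block starts are written `2 + 1 * h` and `2 + 2 * h`, so that for h′ = h the list agrees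
-- definitionally with `thetaPendantEdges (suc h)` up to the label of the leaf.
thetaEdges : ℕ → ℕ → List (ℕ × ℕ)
thetaEdges h h′ = (0 , 2 + h + h + h′) ∷ (pathEdges (path 2 h) ++ pathEdges (path (2 + 1 * h) h) ++ pathEdges (path (2 + 2 * h) h′))

theta-lengths : ℕ → ℕ → Fin 3 → ℕ
theta-lengths a c 𝟎 = a
theta-lengths a c 𝟏 = a
theta-lengths a c 𝟐 = c

theta-pendant : ∀ h h′ → 0 < h → 0 < h′ → PendantWith (fromEdges (3 + h + h + h′) (thetaEdges h h′)) 3 (theta-lengths (suc h) (suc h′))
theta-pendant h h′ 0<h 0<h′ = L.pendant only has (here refl) , λ { 𝟎 → refl ; 𝟏 → refl ; 𝟐 → refl }
  where
  l start : Fin 3 → ℕ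
  l = theta-lengths h h′
  l>0 : ∀ σ → 0 < l σ
  l>0 𝟎 = 0<h
  l>0 𝟏 = 0<h
  l>0 𝟐 = 0<h′
  start σ = 2 + toℕ σ * h
  w = 2 + h + h + h′
  block< : ∀ σ t → t < l σ → start σ + t < w
  block< 𝟎 t t< = (linear 3 (λ h h' t → (t :< h) ∷ [] ⊢ con 2 :+ t :< con 2 :+ h :+ h :+ h') ((1 ∷ 2 ∷ []) , [])) h h′ t t<
  block< 𝟏 t t< = (linear 3 (λ h h' t → (t :< h) ∷ [] ⊢ con 2 :+ 1 :* h :+ t :< con 2 :+ h :+ h :+ h') ((1 ∷ 1 ∷ []) , [])) h h′ t t<
  block< 𝟐 t t< = (linear 3 (λ h h' t → (t :< h') ∷ [] ⊢ con 2 :+ 2 :* h :+ t :< con 2 :+ h :+ h :+ h') ((1 ∷ 1 ∷ []) , [])) h h′ t t<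
  disjoint : ∀ σ τ t t′ → t < l σ → t′ < l τ → start σ + t ≡ start τ + t′ → σ ≡ τ
  disjoint 𝟎 𝟎 _ _ _ _ _ = refl
  disjoint 𝟏 𝟏 _ _ _ _ _ = refl
  disjoint 𝟐 𝟐 _ _ _ _ _ = refl
  disjoint 𝟎 𝟏 t t′ t< _ eq = ⊥-elim ((linear 3 (λ h t t' → (t :< h) ∷ (con 2 :+ t :≡ con 2 :+ 1 :* h :+ t') ∷ [] ⊢ absurd) ((1 ∷ 0 ∷ 1 ∷ []) , [])) h t t′ t< eq)
  disjoint 𝟎 𝟐 t t′ t< _ eq = ⊥-elim ((linear 3 (λ h t t' → (t :< h) ∷ (con 2 :+ t :≡ con 2 :+ 2 :* h :+ t') ∷ [] ⊢ absurd) ((2 ∷ 0 ∷ 1 ∷ []) , [])) h t t′ t< eq)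
  disjoint 𝟏 𝟐 t t′ t< _ eq = ⊥-elim ((linear 3 (λ h t t' → (t :< h) ∷ (con 2 :+ 1 :* h :+ t :≡ con 2 :+ 2 :* h :+ t') ∷ [] ⊢ absurd) ((1 ∷ 0 ∷ 1 ∷ []) , [])) h t t′ t< eq)
  disjoint 𝟏 𝟎 t t′ _ t< eq = ⊥-elim ((linear 3 (λ h t t' → (t' :< h) ∷ (con 2 :+ 1 :* h :+ t :≡ con 2 :+ t') ∷ [] ⊢ absurd) ((1 ∷ 1 ∷ 0 ∷ []) , [])) h t t′ t< eq)
  disjoint 𝟐 𝟎 t t′ _ t< eq = ⊥-elim ((linear 3 (λ h t t' → (t' :< h) ∷ (con 2 :+ 2 :* h :+ t :≡ con 2 :+ t') ∷ [] ⊢ absurd) ((2 ∷ 1 ∷ 0 ∷ []) , [])) h t t′ t< eq)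
  disjoint 𝟐 𝟏 t t′ _ t< eq = ⊥-elim ((linear 3 (λ h t t' → (t' :< h) ∷ (con 2 :+ 2 :* h :+ t :≡ con 2 :+ 1 :* h :+ t') ∷ [] ⊢ absurd) ((1 ∷ 1 ∷ 0 ∷ []) , [])) h t t′ t< eq)
  decode : ∀ x → 2 ≤ x → x < w → ∃₂ λ σ t → t < l σ × x ≡ start σ + t
  decode x 2≤x x<w with x <? 2 + h | x <? 2 + h + h
  ... | yes x< | _ = 𝟎 , x ∸ 2 , (linear 3 (λ x y h → (con 2 :+ y :≡ x) ∷ (x :< con 2 :+ h) ∷ [] ⊢ y :< h) ((1 ∷ 1 ∷ 0 ∷ 1 ∷ []) , [])) x (x ∸ 2) h e x< , sym e
    where e = m+[n∸m]≡n 2≤x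
  ... | no x≮ | yes x< = 𝟏 , x ∸ (2 + h) , (linear 3 (λ x y h → (con 2 :+ h :+ y :≡ x) ∷ (x :< con 2 :+ h :+ h) ∷ [] ⊢ y :< h) ((1 ∷ 1 ∷ 0 ∷ 1 ∷ []) , [])) x (x ∸ (2 + h)) h e x<
      , (linear 3 (λ x y h → (con 2 :+ h :+ y :≡ x) ∷ [] ⊢ x :≡ con 2 :+ 1 :* h :+ y) ((1 ∷ 0 ∷ 1 ∷ []) , (1 ∷ 1 ∷ 0 ∷ []))) x (x ∸ (2 + h)) h e
    where e = m+[n∸m]≡n (≮⇒≥ x≮)
  ... | _ | no x≮ = 𝟐 , x ∸ (2 + h + h) , (linear 4 (λ x y h h' → (con 2 :+ h :+ h :+ y :≡ x) ∷ (x :< con 2 :+ h :+ h :+ h') ∷ [] ⊢ y :< h') ((1 ∷ 1 ∷ 0 ∷ 1 ∷ []) , [])) x (x ∸ (2 + h + h)) h h′ e x<w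
      , (linear 3 (λ x y h → (con 2 :+ h :+ h :+ y :≡ x) ∷ [] ⊢ x :≡ con 2 :+ 2 :* h :+ y) ((1 ∷ 0 ∷ 1 ∷ []) , (1 ∷ 1 ∷ 0 ∷ []))) x (x ∸ (2 + h + h)) h e
    where e = m+[n∸m]≡n (≮⇒≥ x≮)
  module L = LabelGraph start l w (thetaEdges h h′) 𝟎 𝟏 (λ ())
    l>0 (λ σ → m≤m+n 2 _) (s≤s (s≤s z≤n)) block< disjoint decode
  strand : ∀ σ → All (λ e → L.Step (proj₁ e) (proj₂ e)) (pathEdges (path (start σ) (l σ)))
  strand σ = subst (All _) (sym (pathEdges-path (start σ) (l σ))) (All.applyUpTo⁺₁ _ _ λ {t} t< → inj₁ (σ , t , t< , inj₁ (refl , refl)))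
  only : All (λ e → L.Step (proj₁ e) (proj₂ e)) (thetaEdges h h′)
  only = inj₂ (inj₁ (refl , refl)) All.∷ All.++⁺ (strand 𝟎) (All.++⁺ (strand 𝟏) (strand 𝟐))
  member : ∀ σ t → t < suc (l σ) → (L.lab σ t , L.lab σ (suc t)) ∈ pathEdges (path (start σ) (l σ))
  member σ t t< = subst ((L.lab σ t , L.lab σ (suc t)) ∈_) (sym (pathEdges-path (start σ) (l σ))) (strandEdges-∈ (L.lab σ) t<)
  has : ∀ σ t → t < suc (l σ) → (L.lab σ t , L.lab σ (suc t)) ∈ thetaEdges h h′
  has 𝟎 t t< = there (∈-++⁺ˡ (member 𝟎 t t<))
  has 𝟏 t t< = there (∈-++⁺ʳ (pathEdges (path 2 h)) (∈-++⁺ˡ (member 𝟏 t t<)))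
  has 𝟐 t t< = there (∈-++⁺ʳ (pathEdges (path 2 h)) (∈-++⁺ʳ (pathEdges (path (2 + 1 * h) h)) (member 𝟐 t t<)))

cycleEdges : ℕ → List (ℕ × ℕ)
cycleEdges h = (0 , 2 + h + h) ∷ (pathEdges (path 2 h) ++ pathEdges (path (2 + 1 * h) h))

cycle-pendant : ∀ h → 0 < h → PendantWith (fromEdges (3 + h + h) (cycleEdges h)) 2 (λ _ → suc h)
cycle-pendant h 0<h = L.pendant only has (here refl) , λ _ → refl
  where
  l start : Fin 2 → ℕ
  l _ = h
  start σ = 2 + toℕ σ * h
  w = 2 + h + h
  block< : ∀ σ t → t < l σ → start σ + t < w
  block< 𝟎 t t< = (linear 2 (λ h t → (t :< h) ∷ [] ⊢ con 2 :+ t :< con 2 :+ h :+ h) ((1 ∷ 2 ∷ []) , [])) h t t<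
  block< 𝟏 t t< = (linear 2 (λ h t → (t :< h) ∷ [] ⊢ con 2 :+ 1 :* h :+ t :< con 2 :+ h :+ h) ((1 ∷ 1 ∷ []) , [])) h t t<
  disjoint : ∀ σ τ t t′ → t < l σ → t′ < l τ → start σ + t ≡ start τ + t′ → σ ≡ τ
  disjoint 𝟎 𝟎 _ _ _ _ _ = refl
  disjoint 𝟏 𝟏 _ _ _ _ _ = refl
  disjoint 𝟎 𝟏 t t′ t< _ eq = ⊥-elim ((linear 3 (λ h t t' → (t :< h) ∷ (con 2 :+ t :≡ con 2 :+ 1 :* h :+ t') ∷ [] ⊢ absurd) ((1 ∷ 0 ∷ 1 ∷ []) , [])) h t t′ t< eq)
  disjoint 𝟏 𝟎 t t′ _ t< eq = ⊥-elim ((linear 3 (λ h t t' → (t' :< h) ∷ (con 2 :+ 1 :* h :+ t :≡ con 2 :+ t') ∷ [] ⊢ absurd) ((1 ∷ 1 ∷ 0 ∷ []) , [])) h t t′ t< eq)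
  decode : ∀ x → 2 ≤ x → x < w → ∃₂ λ σ t → t < l σ × x ≡ start σ + t
  decode x 2≤x x<w with x <? 2 + h
  ... | yes x< = 𝟎 , x ∸ 2 , (linear 3 (λ x y h → (con 2 :+ y :≡ x) ∷ (x :< con 2 :+ h) ∷ [] ⊢ y :< h) ((1 ∷ 1 ∷ 0 ∷ 1 ∷ []) , [])) x (x ∸ 2) h e x< , sym e
    where e = m+[n∸m]≡n 2≤x
  ... | no x≮ = 𝟏 , x ∸ (2 + h) , (linear 3 (λ x y h → (con 2 :+ h :+ y :≡ x) ∷ (x :< con 2 :+ h :+ h) ∷ [] ⊢ y :< h) ((1 ∷ 1 ∷ 0 ∷ 1 ∷ []) , [])) x (x ∸ (2 + h)) h e x<w
      , (linear 3 (λ x y h → (con 2 :+ h :+ y :≡ x) ∷ [] ⊢ x :≡ con 2 :+ 1 :* h :+ y) ((1 ∷ 0 ∷ 1 ∷ []) , (1 ∷ 1 ∷ 0 ∷ []))) x (x ∸ (2 + h)) h e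
    where e = m+[n∸m]≡n (≮⇒≥ x≮)
  module L = LabelGraph start l w (cycleEdges h) 𝟎 𝟏 (λ ()) (λ _ → 0<h) (λ σ → m≤m+n 2 _) (s≤s (s≤s z≤n)) block< disjoint decode
  strand : ∀ σ → All (λ e → L.Step (proj₁ e) (proj₂ e)) (pathEdges (path (start σ) (l σ)))
  strand σ = subst (All _) (sym (pathEdges-path (start σ) (l σ))) (All.applyUpTo⁺₁ _ _ λ {t} t< → inj₁ (σ , t , t< , inj₁ (refl , refl)))
  only : All (λ e → L.Step (proj₁ e) (proj₂ e)) (cycleEdges h)
  only = inj₂ (inj₁ (refl , refl)) All.∷ All.++⁺ (strand 𝟎) (strand 𝟏)
  member : ∀ σ t → t < suc (l σ) → (L.lab σ t , L.lab σ (suc t)) ∈ pathEdges (path (start σ) (l σ))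
  member σ t t< = subst ((L.lab σ t , L.lab σ (suc t)) ∈_) (sym (pathEdges-path (start σ) (l σ))) (strandEdges-∈ (L.lab σ) t<)
  has : ∀ σ t → t < suc (l σ) → (L.lab σ t , L.lab σ (suc t)) ∈ cycleEdges h
  has 𝟎 t t< = there (∈-++⁺ˡ (member 𝟎 t t<))
  has 𝟏 t t< = there (∈-++⁺ʳ (pathEdges (path 2 h)) (member 𝟏 t t<))

module _ {n} {G : Graph n} {ν} (S : Strands G ν) where
  open Strands S

  private
    back : ∀ σ t → t < len σ → len σ ∸ t ≡ suc (len σ ∸ suc t)
    back σ t t< = (linear 4 (λ t x y z → (t :+ y :≡ x) ∷ (con 1 :+ t :+ z :≡ x) ∷ [] ⊢ y :≡ con 1 :+ z) ((1 ∷ 1 ∷ 0 ∷ 0 ∷ 1 ∷ []) , (1 ∷ 0 ∷ 1 ∷ 1 ∷ 0 ∷ []))) t (len σ) _ _ (m+[n∸m]≡n (<⇒≤ t<)) (m+[n∸m]≡n t<)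

  -- Exchanges the roles of `P` and `Q`, for a leaf that is attached at `Q`.
  reverse-strands : Strands G ν
  reverse-strands = record
    { P = Q ; Q = P ; P≢Q = P≢Q ∘ sym ; len = len ; at = λ σ t → at σ (len σ ∸ t) ; len>0 = len>0
    ; at-0 = at-len ; at-len = λ σ → trans (cong (at σ) (n∸n≡0 (len σ))) (at-0 σ)
    ; link = λ σ t t< → edge-sym G (subst (λ s → Edge G (at σ (len σ ∸ suc t)) (at σ s)) (sym (back σ t t<))
        (link σ (len σ ∸ suc t) (subst (_≤ len σ) (back σ t t<) (m∸n≤m (len σ) t))))
    ; inj = inj′ }
    where
    inj′ : ∀ σ τ i j → 0 < i → i < len σ → j ≤ len τ → at σ (len σ ∸ i) ≡ at τ (len τ ∸ j) → σ ≡ τ × i ≡ j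
    inj′ σ τ i j 0<i i< j≤ eq with inj σ τ (len σ ∸ i) (len τ ∸ j)
        ((linear 3 (λ i x y → (i :+ y :≡ x) ∷ (i :< x) ∷ [] ⊢ con 0 :< y) ((1 ∷ 0 ∷ 1 ∷ 1 ∷ []) , [])) i (len σ) _ (m+[n∸m]≡n (<⇒≤ i<)) i<)
        ((linear 3 (λ i x y → (i :+ y :≡ x) ∷ (con 0 :< i) ∷ [] ⊢ y :< x) ((1 ∷ 1 ∷ 0 ∷ 1 ∷ []) , [])) i (len σ) _ (m+[n∸m]≡n (<⇒≤ i<)) 0<i) (m∸n≤m (len τ) j) eq
    ... | refl , p = refl , (linear 5 (λ i j x y z → (i :+ y :≡ x) ∷ (j :+ z :≡ x) ∷ (y :≡ z) ∷ [] ⊢ i :≡ j) ((1 ∷ 1 ∷ 0 ∷ 0 ∷ 1 ∷ 0 ∷ 1 ∷ []) , (1 ∷ 0 ∷ 1 ∷ 1 ∷ 0 ∷ 1 ∷ 0 ∷ []))) i j (len σ) _ _ (m+[n∸m]≡n (<⇒≤ i<)) (m+[n∸m]≡n j≤) p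

  reverse-exact : Exact → Strands.Exact reverse-strands
  reverse-exact X = record
    { cover = λ ix → let σ , i , i≤ , x≡ = cover ix in σ , len σ ∸ i , m∸n≤m (len σ) i , trans x≡ (cong (at σ) (sym (m∸[m∸n]≡n i≤)))
    ; exact = λ ix iy e → let σ , t , t< , o = exact ix iy e in σ , len σ ∸ suc t
      , subst (_≤ len σ) (back σ t t<) (m∸n≤m (len σ) t) , flip σ t t< o
    ; innerP = innerQ ; innerQ = innerP }
    where
    open Exact X
    flip : ∀ σ t → t < len σ → ∀ {x y} → (x ≡ at σ t × y ≡ at σ (suc t)) ⊎ (x ≡ at σ (suc t) × y ≡ at σ t) →
           let s = len σ ∸ suc t in
           (x ≡ at σ (len σ ∸ s) × y ≡ at σ (len σ ∸ suc s)) ⊎ (x ≡ at σ (len σ ∸ suc s) × y ≡ at σ (len σ ∸ s))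
    flip σ t t< (inj₁ (p , q)) = inj₂ (trans p (cong (at σ) lo) , trans q (cong (at σ) hi))
      where
      hi : suc t ≡ len σ ∸ (len σ ∸ suc t)
      hi = sym (m∸[m∸n]≡n t<)
      lo : t ≡ len σ ∸ suc (len σ ∸ suc t)
      lo = trans (sym (m∸[m∸n]≡n (<⇒≤ t<))) (cong (len σ ∸_) (back σ t t<))
    flip σ t t< (inj₂ (p , q)) with flip σ t t< (inj₁ (q , p))
    ... | inj₂ (r , s) = inj₁ (s , r)
    ... | inj₁ (r , s) = inj₂ (s , r)

pendantTheta⇒pendant : ∀ {n} {G : Graph n} (S : Strands G 3) → Strands.Exact S → ∀ w → ¬ Inner G w → (∀ x → x ≢ w → Inner G x) →
                       Edge G w (Strands.P S) ⊎ Edge G w (Strands.Q S) → PendantWith G 3 (Strands.len S)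
pendantTheta⇒pendant S X w leaf rest (inj₁ w-P) =
  record { strands = S ; exact′ = X ; w = w ; leaf = leaf ; inner = rest ; w-P = w-P } , λ _ → refl
pendantTheta⇒pendant S X w leaf rest (inj₂ w-Q) =
  record { strands = reverse-strands S ; exact′ = reverse-exact S X ; w = w ; leaf = leaf ; inner = rest ; w-P = w-Q } , λ _ → refl

-- The poles of this graph are 2 and 7, and its radius is 3.
edges₁₀ : List (ℕ × ℕ)
edges₁₀ = (0 , 3) ∷ (0 , 4) ∷ (0 , 9) ∷ (1 , 4) ∷ (1 , 8) ∷ (2 , 4) ∷ (3 , 8) ∷ (4 , 5) ∷ (5 , 6) ∷ (6 , 7) ∷ (6 , 9) ∷ (7 , 8) ∷ []

G₁₀ : Graph 10
G₁₀ = fromEdges 10 edges₁₀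

-- The sporadic graph of order 10

module Order10 where

  -- Abstract, so that the checks below are evaluated only once.
  abstract
    ten : ℕ
    ten = 10

    ten<10 : ∀ {x} → x < ten → x < 10
    ten<10 x< = x<

    below : ∀ (u : Fin 10) → toℕ u < ten
    below = toℕ<n

    linked : ℕ → ℕ → Bool
    linked x y = not (x ≡ᵇ y) ∧ anyMatch edges₁₀ x y

    D : ℕ → ℕ → ℕ
    D = entry (Distances.table 10 linked)

    edge⇒linked : ∀ {u v} → Edge G₁₀ u v → T (linked (toℕ u) (toℕ v))
    edge⇒linked = Equivalence.from T-≡

    linked⇒edge : ∀ {u v} → T (linked (toℕ u) (toℕ v)) → Edge G₁₀ u v
    linked⇒edge = Equivalence.to T-≡

  vertex : ℕ → Fin 10
  vertex x = fromℕ< (m%n<n x 10)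

  toℕ-vertex : ∀ {x} → x < ten → toℕ (vertex x) ≡ x
  toℕ-vertex {x} x< = trans (toℕ-fromℕ< (m%n<n x 10)) (m<n⇒m%n≡m (ten<10 x<))

  vertex-toℕ : ∀ u → vertex (toℕ u) ≡ u
  vertex-toℕ u = toℕ-injective (toℕ-vertex (below u))

  near₁₀ : ℕ → ℕ → Bool
  near₁₀ x y = (D x y ≤ᵇ 3) ∨ (((x ≡ᵇ 2) ∧ (y ≡ᵇ 7)) ∨ ((x ≡ᵇ 7) ∧ (y ≡ᵇ 2)))

  far₁₀ : ℕ → ℕ → Bool
  far₁₀ x y = 3 ≤ᵇ D x y

  closes₄ : ℕ → ℕ → ℕ → ℕ → Bool
  closes₄ a b c d = not (linked c d) ∨ ((d ≡ᵇ b) ∨ not (linked d a))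

  closes₃ : ℕ → ℕ → ℕ → Bool
  closes₃ a b c = not (linked c a) ∧ allᵇ ten (closes₄ a b c)

  open-path : ℕ → ℕ → ℕ → Bool
  open-path a b c = not (linked b c) ∨ ((a ≡ᵇ c) ∨ closes₃ a b c)

  -- Paths a, b, c with a ≠ c are enumerated; such a path must close neither directly to a triangle
  -- nor through a fourth vertex d ≠ b to a cycle of length four.
  no-short-cycle : Bool
  no-short-cycle = allᵇ ten λ a → allᵇ ten λ b → not (linked a b) ∨ allᵇ ten (open-path a b)

  abstract
    distance-check : Checks.is-distance ten linked D ≡ true
    distance-check = refl

    apart-check : D 2 7 ≡ 4
    apart-check = refl

    near-check : (allᵇ ten λ x → allᵇ ten (near₁₀ x)) ≡ true
    near-check = refl

    far-check : (allᵇ ten λ x → anyᵇ ten (far₁₀ x)) ≡ true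
    far-check = refl

    cycle-check : no-short-cycle ≡ true
    cycle-check = refl

  module S = Sound G₁₀ ten linked D vertex
    (λ x< y< eq → trans (sym (toℕ-vertex x<)) (trans (cong toℕ eq) (toℕ-vertex y<)))
    (λ v → toℕ v , below v , vertex-toℕ v)
    (λ {x} {y} x< y< t → linked⇒edge (subst₂ (λ a b → T (linked a b)) (sym (toℕ-vertex x<)) (sym (toℕ-vertex y<)) t))
    (Equivalence.from T-≡ distance-check)

  open Metric G₁₀ S.walk-connected

  dist≡ : ∀ u v → dist u v ≡ D (toℕ u) (toℕ v)
  dist≡ u v = subst₂ (λ a b → dist a b ≡ D (toℕ u) (toℕ v)) (vertex-toℕ u) (vertex-toℕ v)
    (S.dist≡D (λ {x} {y} x< y< e → subst₂ (λ a b → T (linked a b)) (toℕ-vertex x<) (toℕ-vertex y<) (edge⇒linked e))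
      S.walk-connected (below u) (below v))

  poles₁₀ : Poles (vertex 2) (vertex 7) 3
  poles₁₀ = record
    { apart = trans (dist≡ (vertex 2) (vertex 7)) apart-check ; near = near
    ; far = λ x _ _ → let y , y< , t = anyᵇ-sound ten {far₁₀ (toℕ x)} (allᵇ-sound ten {λ x → anyᵇ ten (far₁₀ x)} (Equivalence.from T-≡ far-check) (toℕ x) (below x)) in
        vertex y , subst (3 ≤_) (sym (trans (dist≡ x (vertex y)) (cong (D (toℕ x)) (toℕ-vertex y<)))) (≤ᵇ⇒≤ 3 (D (toℕ x) y) t) }
    where
    named : ∀ u k → T (toℕ u ≡ᵇ k) → u ≡ vertex k
    named u k t = trans (sym (vertex-toℕ u)) (cong vertex (≡ᵇ-T {toℕ u} {k} t))
    near : ∀ x y → dist x y ≤ 3 ⊎ (x ≡ vertex 2 × y ≡ vertex 7) ⊎ (x ≡ vertex 7 × y ≡ vertex 2)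
    near x y with ∨-split {D (toℕ x) (toℕ y) ≤ᵇ 3} {((toℕ x ≡ᵇ 2) ∧ (toℕ y ≡ᵇ 7)) ∨ ((toℕ x ≡ᵇ 7) ∧ (toℕ y ≡ᵇ 2))}
      (allᵇ-sound ten {near₁₀ (toℕ x)} (allᵇ-sound ten {λ x → allᵇ ten (near₁₀ x)} (Equivalence.from T-≡ near-check) (toℕ x) (below x)) (toℕ y) (below y))
    ... | inj₁ t = inj₁ (subst (_≤ 3) (sym (dist≡ x y)) (≤ᵇ⇒≤ (D (toℕ x) (toℕ y)) 3 t))
    ... | inj₂ t with ∨-split {(toℕ x ≡ᵇ 2) ∧ (toℕ y ≡ᵇ 7)} {(toℕ x ≡ᵇ 7) ∧ (toℕ y ≡ᵇ 2)} t
    ...   | inj₁ s = let p , q = ∧-split {toℕ x ≡ᵇ 2} s in inj₂ (inj₁ (named x 2 p , named y 7 q))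
    ...   | inj₂ s = let p , q = ∧-split {toℕ x ≡ᵇ 7} s in inj₂ (inj₂ (named x 7 p , named y 2 q))

  path-check : ∀ (a b c : Fin 10) → T (linked (toℕ a) (toℕ b)) → T (linked (toℕ b) (toℕ c)) → a ≢ c → T (closes₃ (toℕ a) (toℕ b) (toℕ c))
  path-check a b c ab bc a≢c
    with ∨-split {toℕ a ≡ᵇ toℕ c} {closes₃ (toℕ a) (toℕ b) (toℕ c)} (∨-implies {linked (toℕ b) (toℕ c)}
      (allᵇ-sound ten {open-path (toℕ a) (toℕ b)} (∨-implies {linked (toℕ a) (toℕ b)} {allᵇ ten (open-path (toℕ a) (toℕ b))}
        (allᵇ-sound ten {λ y → not (linked (toℕ a) y) ∨ allᵇ ten (open-path (toℕ a) y)}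
          (allᵇ-sound ten {λ x → allᵇ ten λ y → not (linked x y) ∨ allᵇ ten (open-path x y)} (Equivalence.from T-≡ cycle-check) (toℕ a) (below a)) (toℕ b) (below b))
        ab) (toℕ c) (below c)) bc)
  ... | inj₁ t = contradiction (toℕ-injective (≡ᵇ-T t)) a≢c
  ... | inj₂ t = t

  ¬-T : ∀ {b} → T (not b) → ¬ T b
  ¬-T {false} _ ()

  no-3-cycle : ∀ (a b c : Fin 10) → T (linked (toℕ a) (toℕ b)) → T (linked (toℕ b) (toℕ c)) → a ≢ c → ¬ T (linked (toℕ c) (toℕ a))
  no-3-cycle a b c ab bc a≢c ca =
    ¬-T (proj₁ (∧-split {not (linked (toℕ c) (toℕ a))} {allᵇ ten (closes₄ (toℕ a) (toℕ b) (toℕ c))} (path-check a b c ab bc a≢c))) ca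

  no-4-cycle : ∀ (a b c d : Fin 10) → T (linked (toℕ a) (toℕ b)) → T (linked (toℕ b) (toℕ c)) → a ≢ c → T (linked (toℕ c) (toℕ d)) → d ≢ b → ¬ T (linked (toℕ d) (toℕ a))
  no-4-cycle a b c d ab bc a≢c cd d≢b da
    with ∨-split {toℕ d ≡ᵇ toℕ b} (∨-implies {linked (toℕ c) (toℕ d)} (allᵇ-sound ten {closes₄ (toℕ a) (toℕ b) (toℕ c)}
      (proj₂ (∧-split {not (linked (toℕ c) (toℕ a))} {allᵇ ten (closes₄ (toℕ a) (toℕ b) (toℕ c))} (path-check a b c ab bc a≢c))) (toℕ d) (below d))
      cd)
  ... | inj₁ t = d≢b (toℕ-injective (≡ᵇ-T t))
  ... | inj₂ t = ¬-T t da

  no-3-or-4-cycle : ∀ {k c} → Periodic G₁₀ k c → 3 ≤ k → k ≤ 4 → ⊥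
  no-3-or-4-cycle {k} {c} C 3≤k k≤4 = case k ≤? 3 of λ
    { (yes k≤3) → no-3-cycle (c 0) (c 1) (c 2) (linked-at 0) (linked-at 1) c₀≢c₂
        (subst (λ z → T (linked (toℕ (c 2)) (toℕ z))) (wrap 3 (≤-antisym k≤3 3≤k)) (linked-at 2))
    ; (no k≰3) → no-4-cycle (c 0) (c 1) (c 2) (c 3) (linked-at 0) (linked-at 1) c₀≢c₂ (linked-at 2)
        (λ eq → distinct 1 3 (s<s z<s) ((linear 1 (λ k → (con 3 :< k) ∷ [] ⊢ con 3 :< con 1 :+ k) ((1 ∷ 1 ∷ []) , [])) k (≰⇒> k≰3)) (sym eq))
        (subst (λ z → T (linked (toℕ (c 3)) (toℕ z))) (wrap 4 (≤-antisym k≤4 (≰⇒> k≰3))) (linked-at 3)) }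
    where
    open Periodic C
    linked-at : ∀ i → T (linked (toℕ (c i)) (toℕ (c (suc i))))
    linked-at i = edge⇒linked {c i} {c (suc i)} (link i)
    wrap : ∀ j → k ≡ j → c j ≡ c 0
    wrap j refl = trans (cong c (sym (+-identityʳ j))) (period 0)
    c₀≢c₂ : c 0 ≢ c 2
    c₀≢c₂ = distinct 0 2 z<s 3≤k

  girth₁₀ : IsGirth G₁₀ 5
  girth₁₀ = subst (HasCycle G₁₀) (≤-antisym (proj₁ (proj₂ five)) (at-least (proj₁ five) (proj₂ (proj₂ five)))) (proj₂ (proj₂ five)) , at-least
    where
    at-least : ∀ k → HasCycle G₁₀ k → 5 ≤ k
    at-least k cyc = ≰⇒> λ k≤4 → no-3-or-4-cycle (proj₂ (cycle⇒periodic G₁₀ cyc)) (proj₁ cyc) k≤4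
    five : ∃ λ k → k ≤ 5 × HasCycle G₁₀ k
    -- The cycle 0, 4, 5, 6, 9.
    five = edge+walk⇒cycle G₁₀ {vertex 0} {vertex 9} refl
      (cons {w = vertex 4} (refl , λ ()) (cons {w = vertex 5} (refl , λ ()) (cons {w = vertex 6} (refl , λ ()) (cons (refl , λ ()) nil))))

-- Upper bounds, uniqueness and the final case distinction

module Extremal {n} {G : Graph n} (conn : Connected G) {g} (girth : ∀ k → HasCycle G k → g ≤ k) (5≤g : 5 ≤ g) (4≤g : 4 ≤ g)
  (n≤ : n + 2 ≤ 2 * g) {c} (C : Periodic G g c) {u v r} (poles : Metric.Poles G conn u v r) where

  open Structure G conn girth 4≤g C poles n≤ using (ExactTheta; structure)

  theta-case : ∀ N k → n ≡ 2 * N → n ≤ 6 * k + 4 → 4 * k < g → ExactTheta → ⊥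
  theta-case N k even n≤6k+4 4k<g Θ =
    ThetaImpossible.theta-impossible G conn girth 4≤g C S exact a≤b b≤c {k = k} {N = N} poles g≡ 5≤g n≤ even n≤6k+4 4k<g
    where open ExactTheta Θ

  -- From 2g = n + 2 ≤ 6k + 6 and g > 4k follows k ≤ 2. Then k = 2 means g = 9, and k ≤ 1 with g ≥ 5
  -- means g = 5 or g = 6.
  checked : ∀ k → n + 2 ≡ 2 * g → n ≤ 6 * k + 4 → 4 * k < g → Passed g
  checked k order n≤6k+4 4k<g with k ≤? 1 | g ≤? 5
  ... | no k≰1 | _ = subst Passed (sym ((linear 3 (λ n g k → (n :+ con 2 :≡ 2 :* g) ∷ (n :≤ 6 :* k :+ con 4) ∷ (4 :* k :< g) ∷ (con 1 :< k) ∷ (k :≤ con 2) ∷ [] ⊢ g :≡ con 9) ((2 ∷ 0 ∷ 1 ∷ 1 ∷ 0 ∷ 0 ∷ 6 ∷ []) , (1 ∷ 0 ∷ 0 ∷ 0 ∷ 1 ∷ 4 ∷ 0 ∷ []))) n g k order n≤6k+4 4k<g (≰⇒> k≰1) k≤2)) passed₉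
    where
    k≤2 : k ≤ 2
    k≤2 = (linear 3 (λ n g k → (n :+ con 2 :≡ 2 :* g) ∷ (n :≤ 6 :* k :+ con 4) ∷ (4 :* k :< g) ∷ [] ⊢ k :≤ con 2) ((2 ∷ 0 ∷ 1 ∷ 1 ∷ 2 ∷ []) , [])) n g k order n≤6k+4 4k<g
  ... | yes _ | yes g≤5 = subst Passed (≤-antisym 5≤g g≤5) passed₅
  ... | yes k≤1 | no g≰5 = subst Passed (sym ((linear 3 (λ n g k → (n :+ con 2 :≡ 2 :* g) ∷ (n :≤ 6 :* k :+ con 4) ∷ (k :≤ con 1) ∷ (con 5 :< g) ∷ [] ⊢ g :≡ con 6) ((2 ∷ 0 ∷ 1 ∷ 1 ∷ 6 ∷ 0 ∷ []) , (1 ∷ 0 ∷ 0 ∷ 0 ∷ 0 ∷ 1 ∷ []))) n g k order n≤6k+4 k≤1 (≰⇒> g≰5))) passed₆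

  even-impossible : ∀ N k → n ≡ 2 * N → n ≤ 6 * k + 4 → 4 * k < g → ⊥
  even-impossible N k even n≤6k+4 4k<g = case structure {N} 5≤g even of λ
    { (inj₁ Θ) → theta-case N k even n≤6k+4 4k<g Θ
    ; (inj₂ K) → K₄-impossible conn girth 4≤g C poles (checked k (K₄.order K) n≤6k+4 4k<g) K }

  pendant-of : ∀ k → n ≡ 6 * k → g ≡ 4 * k → ExactTheta → PendantWith G 3 (λ _ → 2 * k)
  pendant-of k n≡ g≡4k Θ = from (ThetaImpossible.pendant-theta G conn girth 4≤g C S exact a≤b b≤c {k = k} poles g≡ 5≤g n≤ n≡ g≡4k)
    where
    open ExactTheta Θ
    from : ThetaImpossible.PendantTheta G conn girth 4≤g C S exact a≤b b≤c k → PendantWith G 3 (λ _ → 2 * k)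
    from Π = let 𝒫 , len = pendantTheta⇒pendant S exact w leaf rest-inner joined in 𝒫 , λ σ → trans (len σ) (len≡ σ)
      where open ThetaImpossible.PendantTheta Π

  extremal-pendant : ∀ N k → 2 ≤ k → n ≡ 2 * N → n ≡ 6 * k → g ≡ 4 * k → PendantWith G 3 (λ _ → 2 * k)
  extremal-pendant N k 2≤k even n≡ g≡4k = case structure {N} 5≤g even of λ
    { (inj₁ Θ) → pendant-of k n≡ g≡4k Θ
    ; (inj₂ K) → ⊥-elim ((linear 3 (λ n g k → (n :+ con 2 :≡ 2 :* g) ∷ (n :≡ 6 :* k) ∷ (g :≡ 4 :* k) ∷ (con 2 :≤ k) ∷ [] ⊢ absurd) ((0 ∷ 1 ∷ 1 ∷ 0 ∷ 0 ∷ 2 ∷ 2 ∷ []) , [])) n g k (K₄.order K) n≡ g≡4k 2≤k) }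

  module Str = Structure G conn girth 4≤g C poles n≤

  -- A cycle through all vertices makes every vertex inner, so the argument for a cycle without
  -- leaves applies. This is the upper bound for odd orders.
  g≢n : g ≢ n
  g≢n g≡n = Str.SingleCycle.no-leaf (λ {z} _ → everywhere z) poles (inner u) (inner v)
    where
    everywhere : ∀ z → z ∈ Str.cycle
    everywhere = Unique⇒complete Str.cycle-unique (≤-reflexive (trans (sym g≡n) (sym (length-applyUpTo c g))))
    inner : ∀ z → Inner G z
    inner z = let i , _ , z≡ = Str.∈cycle (everywhere z) in subst (Inner G) (sym z≡) (Shape.cycle-inner G conn girth 4≤g C i)

module _ {n} {G : Graph n} (3≤n : 3 ≤ n) (asc : AlmostSelfCentered G) {g} (isGirth : IsGirth G g) (n≤ : n + 2 ≤ 2 * g) (5≤g : 5 ≤ g) where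

  abstract
    -- Continuation form, abstract so that the chosen cycle and poles are not unfolded where the
    -- conclusions are used.
    extremal-setup : ∀ {A : Set} → (∀ {c} (C : Periodic G g c) {u v r} → Metric.Poles G (proj₁ asc) u v r → A) → A
    extremal-setup f = let _ , C = cycle⇒periodic G (proj₁ isGirth)
                           _ , _ , _ , poles = Metric.AlmostSelfCentered⇒Poles G (proj₁ asc) 3≤n asc in f C poles

  even-impossible : ∀ N k → n ≡ 2 * N → n ≤ 6 * k + 4 → 4 * k < g → ⊥
  even-impossible N k even n≤6k+4 4k<g = extremal-setup λ C poles →
    Extremal.even-impossible (proj₁ asc) (proj₂ isGirth) 5≤g (≤-trans (n≤1+n 4) 5≤g) n≤ C poles N k even n≤6k+4 4k<g

  not-hamiltonian-girth : g ≢ n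
  not-hamiltonian-girth g≡n = extremal-setup λ C poles →
    Extremal.g≢n (proj₁ asc) (proj₂ isGirth) 5≤g (≤-trans (n≤1+n 4) 5≤g) n≤ C poles g≡n

  extremal-pendant : ∀ N k → 2 ≤ k → n ≡ 2 * N → n ≡ 6 * k → g ≡ 4 * k → PendantWith G 3 (λ _ → 2 * k)
  extremal-pendant N k 2≤k even n≡ g≡4k = extremal-setup λ C poles →
    Extremal.extremal-pendant (proj₁ asc) (proj₂ isGirth) 5≤g (≤-trans (n≤1+n 4) 5≤g) n≤ C poles N k 2≤k even n≡ g≡4k

cycle-length≤ : ∀ {n} {G : Graph n} {k} → HasCycle G k → k ≤ n
cycle-length≤ (_ , f , inj , _) = injective⇒≤ inj

theta-extremal : ∀ {n} {G : Graph n} m s → 2 ≤ m → 3 ≤ n → PendantWith G 3 (theta-lengths m (m + 2 * s)) →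
                 AlmostSelfCentered G × IsGirth G (2 * m)
theta-extremal {G = G} m s 2≤m 3≤n (𝒫 , len) =
    PendantASC.almost-self-centered G 𝒫 𝟐 𝟎 (λ ()) {s = s} (len 𝟐) (λ { 𝟎 _ → len 𝟎 ; 𝟏 _ → len 𝟏 ; 𝟐 ne → contradiction refl ne }) 3≤n
  , PendantGirth.is-girth G 𝒫 2≤m (λ { 𝟎 → ≤-reflexive (sym (len 𝟎)) ; 𝟏 → ≤-reflexive (sym (len 𝟏)) ; 𝟐 → subst (m ≤_) (sym (len 𝟐)) (m≤m+n m (2 * s)) })
      𝟎 𝟏 (λ ()) (len 𝟎) (len 𝟏)

cycle-extremal : ∀ {n} {G : Graph n} m → 2 ≤ m → 3 ≤ n → PendantWith G 2 (λ _ → m) → AlmostSelfCentered G × IsGirth G (2 * m)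
cycle-extremal {G = G} m 2≤m 3≤n (𝒫 , len) =
    PendantASC.almost-self-centered G 𝒫 𝟏 𝟎 (λ ()) {m} {0} (trans (len 𝟏) (sym (+-identityʳ m))) (λ σ _ → len σ) 3≤n
  , PendantGirth.is-girth G 𝒫 2≤m (λ σ → ≤-reflexive (sym (len σ))) 𝟎 𝟏 (λ ()) (len 𝟎) (len 𝟏)

theta-graph : ∀ n m s → 2 ≤ m → n ≡ 3 * m + 2 * s → ∃ λ (G : Graph n) → PendantWith G 3 (theta-lengths m (m + 2 * s))
theta-graph n (suc h) s (s≤s 1≤h) n≡ = subst (λ n → ∃ λ (G : Graph n) → PendantWith G 3 (theta-lengths (suc h) (suc h + 2 * s)))
  (sym (trans n≡ ((linear 2 (λ h s → [] ⊢ 3 :* (con 1 :+ h) :+ 2 :* s :≡ con 3 :+ h :+ h :+ (h :+ 2 :* s)) ((1 ∷ []) , (1 ∷ []))) h s)))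
  (_ , theta-pendant h (h + 2 * s) 1≤h (≤-trans 1≤h (m≤m+n h (2 * s))))

cycle-graph : ∀ n m → 2 ≤ m → n ≡ 2 * m + 1 → ∃ λ (G : Graph n) → PendantWith G 2 (λ _ → m)
cycle-graph n (suc h) (s≤s 1≤h) n≡ = subst (λ n → ∃ λ (G : Graph n) → PendantWith G 2 (λ _ → suc h))
  (sym (trans n≡ ((linear 1 (λ h → [] ⊢ 2 :* (con 1 :+ h) :+ con 1 :≡ con 3 :+ h :+ h) ((1 ∷ []) , (1 ∷ []))) h))) (_ , cycle-pendant h 1≤h)

ThetaPendant-pendant : ∀ n k → 2 ≤ k → n ≡ 6 * k → PendantWith (ThetaPendant n) 3 (λ _ → 2 * k)
ThetaPendant-pendant n k 2≤k n≡ = subst (λ m → PendantWith (fromEdges n (thetaPendantEdges m)) 3 (λ _ → 2 * k)) (sym n/3≡)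
    (from (2 * k) ((linear 1 (λ k → (con 2 :≤ k) ∷ [] ⊢ con 2 :≤ 2 :* k) ((1 ∷ 2 ∷ []) , [])) k 2≤k) (trans n≡ ((linear 1 (λ k → [] ⊢ 6 :* k :≡ 3 :* 2 :* k) ((1 ∷ []) , (1 ∷ []))) k)))
  where
  n/3≡ : n / 3 ≡ 2 * k
  n/3≡ = trans (cong (_/ 3) (trans n≡ (lemma k))) (m*n/n≡m (2 * k) 3)
    where
    lemma : ∀ k → 6 * k ≡ 2 * k * 3
    lemma = solve-∀
  from : ∀ m → 2 ≤ m → n ≡ 3 * m → PendantWith (fromEdges n (thetaPendantEdges m)) 3 (λ _ → m)
  from (suc h) (s≤s 1≤h) n≡3m with trans n≡3m ((linear 1 (λ h → [] ⊢ 3 :* (con 1 :+ h) :≡ con 3 :+ h :+ h :+ h) ((1 ∷ []) , (1 ∷ []))) h)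
  ... | refl = subst (λ w → PendantWith (fromEdges (3 + h + h + h) ((0 , w) ∷ (pathEdges (path 2 h) ++ pathEdges (path (2 + 1 * h) h) ++ pathEdges (path (2 + 2 * h) h)))) 3 (λ _ → suc h))
    ((linear 2 (λ h w → (con 1 :+ w :≡ 3 :* (con 1 :+ h)) ∷ [] ⊢ con 2 :+ h :+ h :+ h :≡ w) ((3 ∷ 0 ∷ 3 ∷ []) , (1 ∷ 1 ∷ 0 ∷ []))) h (3 * suc h ∸ 1) refl)
    (let 𝒫 , len = theta-pendant h h 1≤h 1≤h in 𝒫 , λ { 𝟎 → len 𝟎 ; 𝟏 → len 𝟏 ; 𝟐 → len 𝟐 })

odd-case : ∀ n → 5 ≤ n → ¬ 2 ∣ n → IsMaxASCGirth n (n ∸ 1)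
odd-case n 5≤n ¬2∣n with parity n
... | m , inj₁ n≡ = contradiction (divides m (trans n≡ (lemma m))) ¬2∣n
  where
  lemma : ∀ m → 2 * m ≡ m * 2
  lemma = solve-∀
... | m , inj₂ n≡ = (G , proj₁ extremal , subst (IsGirth G) 2m≡ (proj₂ extremal)) , upper
  where
  2m≡ : 2 * m ≡ n ∸ 1
  2m≡ = sym (trans (cong (_∸ 1) n≡) (cong (_∸ 1) (+-comm (2 * m) 1)))
  2≤m : 2 ≤ m
  2≤m = (linear 2 (λ n m → (n :≡ 2 :* m :+ con 1) ∷ (con 5 :≤ n) ∷ [] ⊢ con 2 :≤ m) ((2 ∷ 1 ∷ 0 ∷ 1 ∷ []) , [])) n m n≡ 5≤n
  3≤n : 3 ≤ n
  3≤n = ≤-trans (s≤s (s≤s (s≤s z≤n))) 5≤n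
  G = proj₁ (cycle-graph n m 2≤m n≡)
  extremal = cycle-extremal {G = G} m 2≤m 3≤n (proj₂ (cycle-graph n m 2≤m n≡))
  upper : ∀ (G : Graph n) → AlmostSelfCentered G → ∀ h → IsGirth G h → h ≤ n ∸ 1
  upper G asc h isGirth = subst (h ≤_) 2m≡ (≮⇒≥ λ 2m<h →
    let h≡n = ≤-antisym (cycle-length≤ {G = G} (proj₁ isGirth)) ((linear 3 (λ n m h → (n :≡ 2 :* m :+ con 1) ∷ (2 :* m :< h) ∷ [] ⊢ n :≤ h) ((2 ∷ 2 ∷ 0 ∷ 2 ∷ []) , [])) n m h n≡ 2m<h) in
    not-hamiltonian-girth 3≤n asc isGirth ((linear 2 (λ n h → (h :≡ n) ∷ (con 5 :≤ n) ∷ [] ⊢ n :+ con 2 :≤ 2 :* h) ((1 ∷ 0 ∷ 2 ∷ 1 ∷ []) , [])) n h h≡n 5≤n) (subst (5 ≤_) (sym h≡n) 5≤n) h≡n)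

module EvenOrder n (5≤n : 5 ≤ n) (2∣n : 2 ∣ n) where

  N : ℕ
  N = _∣_.quotient 2∣n

  n≡2N : n ≡ 2 * N
  n≡2N = trans (_∣_.equality 2∣n) (lemma N)
    where
    lemma : ∀ N → N * 2 ≡ 2 * N
    lemma = solve-∀

  k : ℕ
  k = n / 6

  3≤n : 3 ≤ n
  3≤n = ≤-trans (s≤s (s≤s (s≤s z≤n))) 5≤n

  n≡6k+s : n ≡ 6 * k + n % 6
  n≡6k+s = trans (m≡m%n+[m/n]*n n 6) (lemma (n % 6) k)
    where
    lemma : ∀ s k → s + k * 6 ≡ 6 * k + s
    lemma = solve-∀

  split : ∃ λ s → s ≤ 2 × n ≡ 6 * k + 2 * s
  split with parity (n % 6)
  ... | s , inj₁ eq = s , (linear 2 (λ r s → (r :≡ 2 :* s) ∷ (r :< con 6) ∷ [] ⊢ s :≤ con 2) ((2 ∷ 0 ∷ 1 ∷ 1 ∷ []) , [])) (n % 6) s eq (m%n<n n 6)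
                        , (linear 4 (λ n k r s → (n :≡ 6 :* k :+ r) ∷ (r :≡ 2 :* s) ∷ [] ⊢ n :≡ 6 :* k :+ 2 :* s) ((1 ∷ 1 ∷ 0 ∷ 1 ∷ 0 ∷ []) , (6 ∷ 0 ∷ 6 ∷ 0 ∷ 6 ∷ []))) n k (n % 6) s n≡6k+s eq
  ... | s , inj₂ eq = ⊥-elim (even≢odd N (3 * k + s)
    ((linear 5 (λ n k r s N → (n :≡ 6 :* k :+ r) ∷ (r :≡ 2 :* s :+ con 1) ∷ (n :≡ 2 :* N) ∷ [] ⊢ 2 :* N :≡ 2 :* (3 :* k :+ s) :+ con 1) ((2 ∷ 2 ∷ 0 ∷ 2 ∷ 0 ∷ 0 ∷ 2 ∷ []) , (6 ∷ 0 ∷ 6 ∷ 0 ∷ 6 ∷ 6 ∷ 0 ∷ []))) n k (n % 6) s N n≡6k+s eq n≡2N))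

  s : ℕ
  s = proj₁ split
  s≤2 : s ≤ 2
  s≤2 = proj₁ (proj₂ split)
  n≡ : n ≡ 6 * k + 2 * s
  n≡ = proj₂ (proj₂ split)

  1≤k : 1 ≤ k
  1≤k = (linear 3 (λ n k s → (n :≡ 6 :* k :+ 2 :* s) ∷ (s :≤ con 2) ∷ (con 5 :≤ n) ∷ [] ⊢ con 1 :≤ k) ((6 ∷ 1 ∷ 0 ∷ 2 ∷ 1 ∷ []) , [])) n k s n≡ s≤2 5≤n

  -- The graph θ_{2k,2k,2k+2s} has 6k + 2s - 1 vertices, and the leaf completes the order n.
  -- Lengthening one strand by an even amount keeps the girth 4k.
  G : Graph n
  G = proj₁ (theta-graph n (2 * k) s ((linear 1 (λ k → (con 1 :≤ k) ∷ [] ⊢ con 2 :≤ 2 :* k) ((1 ∷ 2 ∷ []) , [])) k 1≤k) ((linear 3 (λ n k s → (n :≡ 6 :* k :+ 2 :* s) ∷ [] ⊢ n :≡ 3 :* 2 :* k :+ 2 :* s) ((1 ∷ 1 ∷ 0 ∷ []) , (6 ∷ 0 ∷ 6 ∷ []))) n k s n≡))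

  lower : AlmostSelfCentered G × IsGirth G (2 * (2 * k))
  lower = theta-extremal {G = G} (2 * k) s ((linear 1 (λ k → (con 1 :≤ k) ∷ [] ⊢ con 2 :≤ 2 :* k) ((1 ∷ 2 ∷ []) , [])) k 1≤k) 3≤n
    (proj₂ (theta-graph n (2 * k) s ((linear 1 (λ k → (con 1 :≤ k) ∷ [] ⊢ con 2 :≤ 2 :* k) ((1 ∷ 2 ∷ []) , [])) k 1≤k) ((linear 3 (λ n k s → (n :≡ 6 :* k :+ 2 :* s) ∷ [] ⊢ n :≡ 3 :* 2 :* k :+ 2 :* s) ((1 ∷ 1 ∷ 0 ∷ []) , (6 ∷ 0 ∷ 6 ∷ []))) n k s n≡)))

  upper : ∀ (G : Graph n) → AlmostSelfCentered G → ∀ h → IsGirth G h → n + 2 ≤ 2 * h → h ≤ 4 * k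
  upper G asc h isGirth n≤ = ≮⇒≥ λ 4k<h → even-impossible 3≤n asc isGirth n≤
    ((linear 2 (λ k h → (con 1 :≤ k) ∷ (4 :* k :< h) ∷ [] ⊢ con 5 :≤ h) ((1 ∷ 4 ∷ 1 ∷ []) , [])) k h 1≤k 4k<h) N k n≡2N
    ((linear 3 (λ n k s → (n :≡ 6 :* k :+ 2 :* s) ∷ (s :≤ con 2) ∷ [] ⊢ n :≤ 6 :* k :+ con 4) ((1 ∷ 1 ∷ 0 ∷ 2 ∷ []) , [])) n k s n≡ s≤2) 4k<h

even-case : ∀ n → 5 ≤ n → 2 ∣ n → n ≢ 10 → IsMaxASCGirth n (4 * (n / 6))
even-case n 5≤n 2∣n n≢10 = (G , proj₁ lower , subst (IsGirth G) ((linear 1 (λ k → [] ⊢ 2 :* 2 :* k :≡ 4 :* k) ((1 ∷ []) , (1 ∷ []))) k) (proj₂ lower)) , upper′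
  where
  open EvenOrder n 5≤n 2∣n
  -- Either alternative gives s ≤ k, which is what turns h > 4k into n + 2 ≤ 2h.
  not-10 : s ≤ 1 ⊎ 2 ≤ k
  not-10 with s ≤? 1 | 2 ≤? k
  ... | yes p | _ = inj₁ p
  ... | _ | yes q = inj₂ q
  ... | no s≰1 | no 2≰k = ⊥-elim (n≢10 ((linear 3 (λ n k s → (n :≡ 6 :* k :+ 2 :* s) ∷ (s :≤ con 2) ∷ (con 1 :< s) ∷ (k :< con 2) ∷ (con 1 :≤ k) ∷ [] ⊢ n :≡ con 10) ((1 ∷ 1 ∷ 0 ∷ 2 ∷ 0 ∷ 6 ∷ 0 ∷ []) , (1 ∷ 0 ∷ 1 ∷ 0 ∷ 2 ∷ 0 ∷ 6 ∷ []))) n k s n≡ s≤2 (≰⇒> s≰1) (≰⇒> 2≰k) 1≤k))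
  upper′ : ∀ (G : Graph n) → AlmostSelfCentered G → ∀ h → IsGirth G h → h ≤ 4 * k
  upper′ G asc h isGirth with n + 2 ≤? 2 * h
  ... | yes n≤ = upper G asc h isGirth n≤
  ... | no n≰ = ≮⇒≥ λ 4k<h → case not-10 of λ
    { (inj₁ s≤1) → (linear 4 (λ n k s h → (n :≡ 6 :* k :+ 2 :* s) ∷ (s :≤ con 1) ∷ (con 1 :≤ k) ∷ (4 :* k :< h) ∷ (2 :* h :< n :+ con 2) ∷ [] ⊢ absurd) ((4 ∷ 0 ∷ 8 ∷ 8 ∷ 8 ∷ 4 ∷ []) , [])) n k s h n≡ s≤1 1≤k 4k<h (≰⇒> n≰)
    ; (inj₂ 2≤k) → (linear 4 (λ n k s h → (n :≡ 6 :* k :+ 2 :* s) ∷ (s :≤ con 2) ∷ (con 2 :≤ k) ∷ (4 :* k :< h) ∷ (2 :* h :< n :+ con 2) ∷ [] ⊢ absurd) ((4 ∷ 0 ∷ 8 ∷ 8 ∷ 8 ∷ 4 ∷ []) , [])) n k s h n≡ s≤2 2≤k 4k<h (≰⇒> n≰) }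

order-10-case : IsMaxASCGirth 10 5
order-10-case = (G₁₀ , Metric.Poles⇒AlmostSelfCentered G₁₀ Order10.S.walk-connected (s≤s (s≤s (s≤s z≤n))) Order10.poles₁₀ , Order10.girth₁₀) , upper
  where
  -- Already h > 5 gives 2h ≥ 12 = n + 2, so the general exclusion applies with k = 1.
  upper : ∀ (G : Graph 10) → AlmostSelfCentered G → ∀ h → IsGirth G h → h ≤ 5
  upper G asc h isGirth = ≮⇒≥ λ 5<h → even-impossible (s≤s (s≤s (s≤s z≤n))) asc isGirth
    ((linear 1 (λ h → (con 5 :< h) ∷ [] ⊢ con 12 :≤ 2 :* h) ((1 ∷ 2 ∷ []) , [])) h 5<h) (<⇒≤ 5<h) 5 1 refl ≤-refl (<⇒≤ 5<h)

extremal-case : ∀ n → 12 ≤ n → 6 ∣ n →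
  (AlmostSelfCentered (ThetaPendant n) × IsGirth (ThetaPendant n) (4 * (n / 6))) ×
  (∀ (G : Graph n) → AlmostSelfCentered G → IsGirth G (4 * (n / 6)) → Isomorphic G (ThetaPendant n))
extremal-case n 12≤n (divides k n≡k*6) =
    (proj₁ Θ-extremal , subst (IsGirth (ThetaPendant n)) (trans ((linear 1 (λ k → [] ⊢ 2 :* 2 :* k :≡ 4 :* k) ((1 ∷ []) , (1 ∷ []))) k) (cong (4 *_) (sym n/6≡k))) (proj₂ Θ-extremal))
  , λ G asc isGirth → let 𝒢 , len = extremal-pendant {G = G} 3≤n asc isGirth n≤ 5≤g (3 * k) k 2≤k n≡2N n≡6k (cong (4 *_) n/6≡k) in
      pendant-isomorphic 𝒢 (proj₁ Θ) λ σ → trans (len σ) (sym (proj₂ Θ σ))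
  where
  n≡6k : n ≡ 6 * k
  n≡6k = trans n≡k*6 (lemma k)
    where
    lemma : ∀ k → k * 6 ≡ 6 * k
    lemma = solve-∀
  n≡2N : n ≡ 2 * (3 * k)
  n≡2N = (linear 2 (λ n k → (n :≡ 6 :* k) ∷ [] ⊢ n :≡ 2 :* 3 :* k) ((1 ∷ 1 ∷ 0 ∷ []) , (6 ∷ 0 ∷ 6 ∷ []))) n k n≡6k
  n/6≡k : n / 6 ≡ k
  n/6≡k = trans (cong (_/ 6) n≡k*6) (m*n/n≡m k 6)
  2≤k : 2 ≤ k
  2≤k = (linear 2 (λ n k → (n :≡ 6 :* k) ∷ (con 12 :≤ n) ∷ [] ⊢ con 2 :≤ k) ((6 ∷ 1 ∷ 0 ∷ 1 ∷ []) , [])) n k n≡6k 12≤n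
  3≤n : 3 ≤ n
  3≤n = ≤-trans (s≤s (s≤s (s≤s z≤n))) 12≤n
  n≤ : n + 2 ≤ 2 * (4 * (n / 6))
  n≤ = (linear 3 (λ n k q → (n :≡ 6 :* k) ∷ (q :≡ k) ∷ (con 2 :≤ k) ∷ [] ⊢ n :+ con 2 :≤ 2 :* 4 :* q) ((1 ∷ 1 ∷ 0 ∷ 0 ∷ 8 ∷ 2 ∷ []) , [])) n k (n / 6) n≡6k n/6≡k 2≤k
  5≤g : 5 ≤ 4 * (n / 6)
  5≤g = (linear 2 (λ k q → (q :≡ k) ∷ (con 2 :≤ k) ∷ [] ⊢ con 5 :≤ 4 :* q) ((1 ∷ 0 ∷ 4 ∷ 4 ∷ []) , [])) k (n / 6) n/6≡k 2≤k
  Θ : PendantWith (ThetaPendant n) 3 (λ _ → 2 * k)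
  Θ = ThetaPendant-pendant n k 2≤k n≡6k
  Θ-extremal : AlmostSelfCentered (ThetaPendant n) × IsGirth (ThetaPendant n) (2 * (2 * k))
  Θ-extremal = theta-extremal {G = ThetaPendant n} (2 * k) 0 ((linear 1 (λ k → (con 2 :≤ k) ∷ [] ⊢ con 2 :≤ 2 :* k) ((1 ∷ 2 ∷ []) , [])) k 2≤k) 3≤n
    (proj₁ Θ , λ { 𝟎 → proj₂ Θ 𝟎 ; 𝟏 → proj₂ Θ 𝟏 ; 𝟐 → trans (proj₂ Θ 𝟐) (sym (+-identityʳ (2 * k))) })

theorem5 : (∀ n → 5 ≤ n → ¬ (2 ∣ n) → IsMaxASCGirth n (n ∸ 1)) ×
    (∀ n → 5 ≤ n → 2 ∣ n → n ≢ 10 → IsMaxASCGirth n (4 * (n / 6))) ×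
    IsMaxASCGirth 10 5 ×
    (∀ n → 12 ≤ n → 6 ∣ n →
    (AlmostSelfCentered (ThetaPendant n) × IsGirth (ThetaPendant n) (4 * (n / 6))) ×
    (∀ (G : Graph n) → AlmostSelfCentered G → IsGirth G (4 * (n / 6)) →
    Isomorphic G (ThetaPendant n)))
theorem5 = odd-case , even-case , order-10-case , extremal-case
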